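{- Let $C_i$ be a sequence of self-dual codes over $\mathbb{Z}_4$ with length $n(C_i)\to\infty$. Then \[ \limsup_{i\to\infty}\frac{d_E(C_i)}{n(C_i)}\le 2-2x\;(\approx .3332625492), \] where $x$ is the positive real root of \[ 11x^{16}+2112x^{14}-8525x^{12}+15048x^{10}-15218x^8+9552x^6-3718x^4+828x^2-81. \]
   Context: Self-duality over $\mathbb{Z}_4$ is with respect to the inner product $\sum x_iy_i\bmod 4$. The Euclidean weights of $0,1,2,3\in\mathbb{Z}_4$ are $0,1,4,1$, summed over coordinates; $d_E(C)$ is the minimum Euclidean weight of a nonzero codeword of $C$. -}

module Defs where

open import Data.Nat using (ℕ; zero; suc; _%_)
import Data.Nat as ℕ
open import Data.Fin using (Fin; toℕ)
open import Data.Vec using (Vec; []; _∷_; replicate)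
open import Data.Product using (_×_)
open import Data.Integer using (+_; -[1+_])
open import Data.Rational using (ℚ; _/_; _+_; _*_; _-_)
open import Relation.Binary.PropositionalEquality using (_≡_)

Z4 : Set
Z4 = Fin 4

inner : ∀ {n} → Vec Z4 n → Vec Z4 n → ℕ
inner [] [] = 0
inner (x ∷ xs) (y ∷ ys) = toℕ x ℕ.* toℕ y ℕ.+ inner xs ys

Code : ℕ → Set₁
Code n = Vec Z4 n → Set

Dual : ∀ {n} → Code n → Code n
Dual C v = ∀ w → C w → inner v w % 4 ≡ 0

SelfDual : ∀ {n} → Code n → Set
SelfDual C = ∀ v → (C v → Dual C v) × (Dual C v → C v)

ewt : Z4 → ℕ
ewt Fin.zero = 0
ewt (Fin.suc Fin.zero) = 1
ewt (Fin.suc (Fin.suc Fin.zero)) = 4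
ewt (Fin.suc (Fin.suc (Fin.suc Fin.zero))) = 1

wtE : ∀ {n} → Vec Z4 n → ℕ
wtE [] = 0
wtE (x ∷ xs) = ewt x ℕ.+ wtE xs

IsMinEuclideanDistance : ∀ {n} → Code n → ℕ → Set
IsMinEuclideanDistance {n} C d =
  (Data.Product.∃ λ v → C v × (¬' (v ≡ replicate n Fin.zero)) × wtE v ≡ d)
  × (∀ v → C v → ¬' (v ≡ replicate n Fin.zero) → d ℕ.≤ wtE v)
  where
    open import Relation.Nullary using () renaming (¬_ to ¬')
    import Data.Product

ℕtoℚ : ℕ → ℚ
ℕtoℚ m = + m / 1

zq : Data.Integer.ℤ → ℚ
zq z = z / 1
  where import Data.Integer

pw : ℚ → ℕ → ℚ
pw y zero = + 1 / 1
pw y (suc k) = y * pw y k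

poly : ℚ → ℚ
poly x =
  zq (+ 11) * pw x 16 + zq (+ 2112) * pw x 14 - zq (+ 8525) * pw x 12
  + zq (+ 15048) * pw x 10 - zq (+ 15218) * pw x 8 + zq (+ 9552) * pw x 6
  - zq (+ 3718) * pw x 4 + zq (+ 828) * pw x 2 - zq (+ 81)

{-# OPTIONS --safe #-}
module Submission where

-- Substitute T = 1 + t, V = 1 - t, U⁴ = T⁴ - V⁴ = 8t(1 + t²) for the letters in the symmetrized weight enumerator
-- (0 ↦ T + V, ±1 ↦ U, 2 ↦ T - V): a word of Euclidean weight 4k becomes a nonnegative combination of powers t^i with i ≥ k.
-- By MacWilliams the enumerator of a self-dual code is a combination Σ c_j h_j of fixed polynomials, and positivity of
-- the shadow gives c_J ≥ 0 ≥ c_{J+1} for even J. Both coefficients are residues, so for r ≥ 0 the functional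
-- J c_J - r (J+1) c_{J+1} is nonnegative on the enumerator, while its value at t^k is
--   - [t^(J+1-k)] (1+t)^A R^(J+1) (k(1+t) - nt) f,   R = 1/((1+t²)(1-t²)⁴),   f = r (1+t)¹² - t (1+t²)(1-t²)⁴,
-- with 12 J = n + A + 1 and A bounded. Its sign is governed by that of f at the saddle point: at k = 0 this is
-- the root t₀ of 11t⁴ + 6t² = 1, and for J - k ≈ uJ it is the root τ of 6τ² + 10τ⁴ = (1 - τ⁴)u. Choosing r so that f
-- vanishes just beyond τ makes the value ≤ 0 for every k beyond the claimed bound, and f(t₀) < 0, which makes it negative at
-- the zero word, is exactly the condition poly y < 0 for u = 6y - 5.

-- The numbers `t₀`, `τ` and the bound itself are irrational, while everything here lives in ℚ. The
-- strict inequality `poly y < 0` supplies the room: `τ` is bracketed by points of a rational grid,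
-- `t₀` gives way to a rational point just above it, and the slack pays for the errors. The saddle
-- point heuristic must hold for every `k` beyond the bound at once, so no asymptotics is used
-- there: an exact derivative, with vanishing coefficient, is added until one factor is
-- coefficientwise nonnegative, and the other, `(τ₂ - t)(1 + t)^B R^(J+1)`, is settled by counting
-- sign changes. At `k = 0` the ratios of consecutive coefficients of `R^(J+1)` are shown to
-- converge. The degree 16 comes from elimination. With λ = U⁴/T⁴ at `τ` and μ = V⁴/T⁴ at `t₀`, f
-- vanishes at both points once λ = μ; μ is a zero of a quartic m, and `poly`, rewritten in `τ`, is
-- up to positive factors the product of m(λ), its conjugate under `τ ↦ -τ`, and a factor that is
-- negative near 0. Membership in a code is not assumed decidable; the final inequality is, so it
-- may be proved under double negation.

open import Defs
open import Data.Nat as ℕ using (ℕ; zero; suc; z≤n; s≤s)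
import Data.Nat.Properties as ℕₚ
open import Data.Nat.Divisibility using (_∣_; divides; _∣?_)
import Data.Nat.Divisibility as ∣
open import Data.Integer as ℤ using (-[1+_]) renaming (+_ to pos)
open import Data.Rational using (ℚ; mkℚ; _/_; _+_; _*_; _-_; -_; _≤_; _<_; _≤?_; _<?_; 0ℚ; 1ℚ; 1/_; nonNegative; positive)
open import Data.Rational.Properties as ℚₚ using (_≟_; +-*-commutativeRing)
open import Data.Product using (∃; _×_; _,_; proj₁; proj₂)
open import Data.Sum using (_⊎_; inj₁; inj₂)
open import Data.Empty using (⊥; ⊥-elim)
open import Data.Fin using (Fin; zero; suc; toℕ)
open import Data.Vec using (Vec; []; _∷_; replicate; lookup; allFin)
open import Data.Vec.N-ary using (N-ary; Eq; curryⁿ; curryⁿ-cong; _$ⁿ_)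
open import Relation.Nullary using (¬_; Dec; yes; no)
open import Relation.Nullary.Decidable using (True; toWitness; ¬¬-excluded-middle; _×-dec_)
open import Relation.Binary.PropositionalEquality hiding (J)
open import Level using (0ℓ)
import Data.Nat.Tactic.RingSolver as ℕR
import Data.Fin.Properties as Finₚ
import Data.Nat.DivMod as DivMod
import Data.Vec.Properties as Vecₚ
import Relation.Binary.Reasoning.Setoid as SetoidReasoning
import Data.Integer.Properties as ℤₚ
import Data.Nat.Coprimality as Coprimality
open import Data.List using (List; []; _∷_)
open import Data.Unit using (tt)
open import Data.List.Relation.Unary.All as All using (All; []; _∷_)
open import Algebra.Bundles using (CommutativeRing)

-- A decision procedure for polynomial identities with rational coefficients, by nested coefficient lists

infixl 6 _:+_ _:-_
infixl 7 _:*_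
infix 8 :-_
infix 4 _:=_

data Poly (n : ℕ) : Set where
  con : ℚ → Poly n
  ‵_ : Fin n → Poly n
  _:+_ _:*_ : Poly n → Poly n → Poly n
  :-_ : Poly n → Poly n

_:-_ : ∀ {n} → Poly n → Poly n → Poly n
p :- q = p :+ (:- q)

_:=_ : ∀ {n} → Poly n → Poly n → Poly n × Poly n
_:=_ = _,_

-- Dense nested lists, never trimmed of trailing zeros: the only test made on them is whether all
-- coefficients of a difference vanish.
MP : ℕ → Set
MP zero = ℚ
MP (suc n) = List (MP n)

addMP mulMP : ∀ {n} → MP n → MP n → MP n
scaleMP : ∀ {n} → MP n → List (MP n) → List (MP n)

addMP {zero} p q = p + q
addMP {suc n} [] m = m
addMP {suc n} (p ∷ l) [] = p ∷ l
addMP {suc n} (p ∷ l) (q ∷ m) = addMP {n} p q ∷ addMP {suc n} l m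

constMP : ∀ {n} → ℚ → MP n
constMP {zero} q = q
constMP {suc n} q = constMP {n} q ∷ []

mulMP {zero} p q = p * q
mulMP {suc n} [] m = []
mulMP {suc n} (p ∷ l) m = addMP {suc n} (scaleMP p m) (constMP 0ℚ ∷ mulMP {suc n} l m)

scaleMP p [] = []
scaleMP p (q ∷ m) = mulMP p q ∷ scaleMP p m

varMP : ∀ {n} → Fin n → MP n
varMP {suc n} zero = constMP 0ℚ ∷ constMP 1ℚ ∷ []
varMP {suc n} (suc i) = varMP i ∷ []

normMP : ∀ {n} → Poly n → MP n
normMP (con c) = constMP c
normMP (‵ i) = varMP i
normMP (p :+ q) = addMP (normMP p) (normMP q)
normMP (p :* q) = mulMP (normMP p) (normMP q)
normMP (:- p) = mulMP (constMP (- 1ℚ)) (normMP p)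

ZeroMP : ∀ {n} → MP n → Set
ZeroMP {zero} q = q ≡ 0ℚ
ZeroMP {suc n} l = All (ZeroMP {n}) l

zeroMP? : ∀ {n} (p : MP n) → Dec (ZeroMP p)
zeroMP? {zero} q = q ≟ 0ℚ
zeroMP? {suc n} l = All.all? (zeroMP? {n}) l

close : ∀ n → N-ary n (Poly n) (Poly n × Poly n) → Poly n × Poly n
close n f = f $ⁿ Data.Vec.map ‵_ (allFin n)

Decided : ∀ n → N-ary n (Poly n) (Poly n × Poly n) → Set
Decided n f = True (zeroMP? (normMP (proj₁ (close n f) :- proj₂ (close n f))))

-- One solver serves both ℚ and the ring of power series: coefficients stay in ℚ, where equality is
-- decidable, and reach the target ring through the homomorphism `h`.
record Coefficients : Set₁ where
  field
    target : CommutativeRing 0ℓ 0ℓ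
  open CommutativeRing target public renaming (_+_ to _+′_; _*_ to _*′_; -_ to -′_; 0# to 0′; 1# to 1′)
  field
    h : ℚ → Carrier
    h-+ : ∀ a b → h (a + b) ≈ h a +′ h b
    h-* : ∀ a b → h (a * b) ≈ h a *′ h b
    h-neg : ∀ a → h (- a) ≈ -′ h a
    h-0 : h 0ℚ ≈ 0′
    h-1 : h 1ℚ ≈ 1′

module RingIdentity (𝓗 : Coefficients) where
  private
    module 𝓡 = Coefficients 𝓗
  open 𝓡 using (_≈_; _+′_; _*′_; -′_; 0′; 1′; h; h-+; h-*; h-neg; h-0; h-1)

  private
    open import Algebra.Properties.Ring 𝓡.ring using (-1*x≈-x)
    open import Algebra.Properties.CommutativeSemigroup 𝓡.+-commutativeSemigroup using (interchange)
    open import Algebra.Properties.CommutativeSemigroup 𝓡.*-commutativeSemigroup using () renaming (x∙yz≈y∙xz to *-swap)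

    evalMP : ∀ {n} → MP n → Vec 𝓡.Carrier n → 𝓡.Carrier
    evalMP {zero} q [] = h q
    evalMP {suc n} [] ρ = 0′
    evalMP {suc n} (p ∷ l) (x ∷ ρ) = evalMP {n} p ρ +′ x *′ evalMP {suc n} l (x ∷ ρ)

  ⟦_⟧ : ∀ {n} → Poly n → Vec 𝓡.Carrier n → 𝓡.Carrier
  ⟦ con c ⟧ ρ = h c
  ⟦ ‵ i ⟧ ρ = lookup ρ i
  ⟦ p :+ q ⟧ ρ = ⟦ p ⟧ ρ +′ ⟦ q ⟧ ρ
  ⟦ p :* q ⟧ ρ = ⟦ p ⟧ ρ *′ ⟦ q ⟧ ρ
  ⟦ :- p ⟧ ρ = -′ ⟦ p ⟧ ρ

  private
    eval-addMP : ∀ {n} (p q : MP n) ρ → evalMP (addMP p q) ρ ≈ evalMP p ρ +′ evalMP q ρ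
    eval-addMP {zero} p q [] = h-+ p q
    eval-addMP {suc n} [] m ρ = 𝓡.sym (𝓡.+-identityˡ (evalMP m ρ))
    eval-addMP {suc n} (p ∷ l) [] (x ∷ ρ) = 𝓡.sym (𝓡.+-identityʳ (evalMP (p ∷ l) (x ∷ ρ)))
    eval-addMP {suc n} (p ∷ l) (q ∷ m) (x ∷ ρ) = 𝓡.trans
      (𝓡.+-cong (eval-addMP p q ρ) (𝓡.trans (𝓡.*-congˡ (eval-addMP {suc n} l m (x ∷ ρ))) (𝓡.distribˡ x (evalMP {suc n} l (x ∷ ρ)) (evalMP {suc n} m (x ∷ ρ)))))
      (interchange (evalMP p ρ) (evalMP q ρ) (x *′ evalMP {suc n} l (x ∷ ρ)) (x *′ evalMP {suc n} m (x ∷ ρ)))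

    eval-constMP : ∀ {n} c ρ → evalMP (constMP {n} c) ρ ≈ h c
    eval-constMP {zero} c [] = 𝓡.refl
    eval-constMP {suc n} c (x ∷ ρ) = 𝓡.trans (𝓡.+-cong (eval-constMP {n} c ρ) (𝓡.zeroʳ x)) (𝓡.+-identityʳ (h c))

    eval-mulMP : ∀ {n} (p q : MP n) ρ → evalMP (mulMP p q) ρ ≈ evalMP p ρ *′ evalMP q ρ
    eval-scaleMP : ∀ {n} (p : MP n) m x ρ → evalMP {suc n} (scaleMP p m) (x ∷ ρ) ≈ evalMP p ρ *′ evalMP {suc n} m (x ∷ ρ)

    eval-mulMP {zero} p q [] = h-* p q
    eval-mulMP {suc n} [] m ρ = 𝓡.sym (𝓡.zeroˡ (evalMP m ρ))
    eval-mulMP {suc n} (p ∷ l) m (x ∷ ρ) = 𝓡.trans (eval-addMP {suc n} (scaleMP p m) (constMP 0ℚ ∷ mulMP {suc n} l m) (x ∷ ρ))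
      (𝓡.trans (𝓡.+-cong (eval-scaleMP p m x ρ)
          (𝓡.trans (𝓡.+-cong (𝓡.trans (eval-constMP {n} 0ℚ ρ) h-0) (𝓡.trans (𝓡.*-congˡ (eval-mulMP {suc n} l m (x ∷ ρ))) (𝓡.sym (𝓡.*-assoc x L M)))) (𝓡.+-identityˡ (x *′ L *′ M))))
        (𝓡.sym (𝓡.distribʳ M (evalMP p ρ) (x *′ L))))
      where
      L M : 𝓡.Carrier
      L = evalMP {suc n} l (x ∷ ρ)
      M = evalMP {suc n} m (x ∷ ρ)

    eval-scaleMP p [] x ρ = 𝓡.sym (𝓡.zeroʳ (evalMP p ρ))
    eval-scaleMP {n} p (q ∷ m) x ρ = 𝓡.trans
      (𝓡.+-cong (eval-mulMP p q ρ) (𝓡.trans (𝓡.*-congˡ (eval-scaleMP p m x ρ)) (*-swap x (evalMP p ρ) (evalMP {suc n} m (x ∷ ρ)))))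
      (𝓡.sym (𝓡.distribˡ (evalMP p ρ) (evalMP q ρ) (x *′ evalMP {suc n} m (x ∷ ρ))))

    eval-varMP : ∀ {n} (i : Fin n) ρ → evalMP (varMP i) ρ ≈ lookup ρ i
    eval-varMP {suc n} zero (x ∷ ρ) = 𝓡.trans
      (𝓡.+-cong (𝓡.trans (eval-constMP {n} 0ℚ ρ) h-0) (𝓡.*-congˡ (𝓡.trans (𝓡.+-cong (𝓡.trans (eval-constMP {n} 1ℚ ρ) h-1) (𝓡.zeroʳ x)) (𝓡.+-identityʳ 1′))))
      (𝓡.trans (𝓡.+-identityˡ (x *′ 1′)) (𝓡.*-identityʳ x))
    eval-varMP {suc n} (suc i) (x ∷ ρ) = 𝓡.trans (𝓡.+-cong (eval-varMP i ρ) (𝓡.zeroʳ x)) (𝓡.+-identityʳ (lookup ρ i))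

    eval-normMP : ∀ {n} (p : Poly n) ρ → evalMP (normMP p) ρ ≈ ⟦ p ⟧ ρ
    eval-normMP {n} (con c) ρ = eval-constMP {n} c ρ
    eval-normMP (‵ i) ρ = eval-varMP i ρ
    eval-normMP (p :+ q) ρ = 𝓡.trans (eval-addMP (normMP p) (normMP q) ρ) (𝓡.+-cong (eval-normMP p ρ) (eval-normMP q ρ))
    eval-normMP (p :* q) ρ = 𝓡.trans (eval-mulMP (normMP p) (normMP q) ρ) (𝓡.*-cong (eval-normMP p ρ) (eval-normMP q ρ))
    eval-normMP {n} (:- p) ρ = 𝓡.trans (eval-mulMP (constMP (- 1ℚ)) (normMP p) ρ)
      (𝓡.trans (𝓡.*-cong (𝓡.trans (eval-constMP {n} (- 1ℚ) ρ) (𝓡.trans (h-neg 1ℚ) (𝓡.-‿cong h-1))) (eval-normMP p ρ)) (-1*x≈-x (⟦ p ⟧ ρ)))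

    eval-zeroMP : ∀ {n} {p : MP n} → ZeroMP p → ∀ ρ → evalMP p ρ ≈ 0′
    eval-zeroMP {zero} refl [] = h-0
    eval-zeroMP {suc n} [] ρ = 𝓡.refl
    eval-zeroMP {suc n} (z ∷ zs) (x ∷ ρ) = 𝓡.trans (𝓡.+-cong (eval-zeroMP {n} z ρ) (𝓡.trans (𝓡.*-congˡ (eval-zeroMP {suc n} zs (x ∷ ρ))) (𝓡.zeroʳ x))) (𝓡.+-identityˡ 0′)

  solve : ∀ n f {_ : Decided n f} → Eq n _≈_ (curryⁿ ⟦ proj₁ (close n f) ⟧) (curryⁿ ⟦ proj₂ (close n f) ⟧)
  solve n f {w} = curryⁿ-cong _≈_ ⟦ a ⟧ ⟦ b ⟧ λ ρ → 𝓡.trans (𝓡.sym (𝓡.+-identityʳ (⟦ a ⟧ ρ)))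
      (𝓡.trans (𝓡.+-congˡ (𝓡.sym (𝓡.-‿inverseˡ (⟦ b ⟧ ρ)))) (𝓡.trans (𝓡.sym (𝓡.+-assoc (⟦ a ⟧ ρ) (-′ ⟦ b ⟧ ρ) (⟦ b ⟧ ρ)))
        (𝓡.trans (𝓡.+-congʳ (𝓡.trans (𝓡.sym (eval-normMP (a :- b) ρ)) (eval-zeroMP {n} (toWitness w) ρ))) (𝓡.+-identityˡ (⟦ b ⟧ ρ)))))
    where
    a b : Poly n
    a = proj₁ (close n f)
    b = proj₂ (close n f)

rationals : Coefficients
rationals = record
  { target = +-*-commutativeRing ; h = λ q → q ; h-+ = λ _ _ → refl ; h-* = λ _ _ → refl ; h-neg = λ _ → refl ; h-0 = refl ; h-1 = refl }

open RingIdentity rationals using () renaming (solve to solveᵠ)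

ι : ℕ → ℚ
ι = ℕtoℚ

-- Ordered field arithmetic

≤-trans : ∀ {a b c} → a ≤ b → b ≤ c → a ≤ c
≤-trans = ℚₚ.≤-trans

≤-refl : ∀ {a} → a ≤ a
≤-refl = ℚₚ.≤-refl

≤-reflexive : ∀ {a b} → a ≡ b → a ≤ b
≤-reflexive = ℚₚ.≤-reflexive

<⇒≤ : ∀ {a b} → a < b → a ≤ b
<⇒≤ = ℚₚ.<⇒≤

+-mono-≤ : ∀ {a b c d} → a ≤ b → c ≤ d → a + c ≤ b + d
+-mono-≤ = ℚₚ.+-mono-≤

0≤+ : ∀ {a b} → 0ℚ ≤ a → 0ℚ ≤ b → 0ℚ ≤ a + b
0≤+ p q = +-mono-≤ p q

0<+ : ∀ {a b} → 0ℚ < a → 0ℚ ≤ b → 0ℚ < a + b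
0<+ p q = ℚₚ.+-mono-<-≤ p q

0≤* : ∀ {a b} → 0ℚ ≤ a → 0ℚ ≤ b → 0ℚ ≤ a * b
0≤* {a} {b} p q = ℚₚ.nonNegative⁻¹ (a * b) {{ℚₚ.nonNeg*nonNeg⇒nonNeg a {{nonNegative p}} b {{nonNegative q}}}}

0<* : ∀ {a b} → 0ℚ < a → 0ℚ < b → 0ℚ < a * b
0<* {a} {b} p q = ℚₚ.positive⁻¹ (a * b) {{ℚₚ.pos*pos⇒pos a {{positive p}} b {{positive q}}}}

≤⇒0≤- : ∀ {a b} → a ≤ b → 0ℚ ≤ b - a
≤⇒0≤- {a} {b} p = subst (_≤ b - a) (ℚₚ.+-inverseʳ a) (ℚₚ.+-monoˡ-≤ (- a) p)

<⇒0<- : ∀ {a b} → a < b → 0ℚ < b - a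
<⇒0<- {a} {b} p = subst (_< b - a) (ℚₚ.+-inverseʳ a) (ℚₚ.+-monoˡ-< (- a) p)

private
  b-a+a : ∀ a b → b - a + a ≡ b
  b-a+a = solveᵠ 2 λ a b → b :- a :+ a := b

0≤-⇒≤ : ∀ {a b} → 0ℚ ≤ b - a → a ≤ b
0≤-⇒≤ {a} {b} p = subst₂ _≤_ (ℚₚ.+-identityˡ a) (b-a+a a b) (ℚₚ.+-monoˡ-≤ a p)

0<-⇒< : ∀ {a b} → 0ℚ < b - a → a < b
0<-⇒< {a} {b} p = subst₂ _<_ (ℚₚ.+-identityˡ a) (b-a+a a b) (ℚₚ.+-monoˡ-< a p)

-- The working pattern for inequalities: a ring identity rewrites the difference as an expression
-- whose summands and factors are visibly nonnegative.
by≤ : ∀ {a b c} → b - a ≡ c → 0ℚ ≤ c → a ≤ b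
by≤ e p = 0≤-⇒≤ (subst (0ℚ ≤_) (sym e) p)

by< : ∀ {a b c} → b - a ≡ c → 0ℚ < c → a < b
by< e p = 0<-⇒< (subst (0ℚ <_) (sym e) p)

by0≤ : ∀ {a c} → a ≡ c → 0ℚ ≤ c → 0ℚ ≤ a
by0≤ e p = subst (0ℚ ≤_) (sym e) p

by0< : ∀ {a c} → a ≡ c → 0ℚ < c → 0ℚ < a
by0< e p = subst (0ℚ <_) (sym e) p

*-monoˡ : ∀ {a b c} → 0ℚ ≤ c → a ≤ b → c * a ≤ c * b
*-monoˡ {a} {b} {c} p q = ℚₚ.*-monoˡ-≤-nonNeg c {{nonNegative p}} q

*-monoʳ : ∀ {a b c} → 0ℚ ≤ c → a ≤ b → a * c ≤ b * c
*-monoʳ {a} {b} {c} p q = ℚₚ.*-monoʳ-≤-nonNeg c {{nonNegative p}} q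

*-mono : ∀ {a b c d} → 0ℚ ≤ a → a ≤ b → 0ℚ ≤ c → c ≤ d → a * c ≤ b * d
*-mono p q r s = ≤-trans (*-monoʳ r q) (*-monoˡ (≤-trans p q) s)

*-cancelˡ : ∀ {a b c} → 0ℚ < c → c * a ≤ c * b → a ≤ b
*-cancelˡ {c = c} p q = ℚₚ.*-cancelˡ-≤-pos c {{positive p}} q

*-cancelˡ-0≤ : ∀ {a c} → 0ℚ < c → 0ℚ ≤ c * a → 0ℚ ≤ a
*-cancelˡ-0≤ {a} {c} p q = *-cancelˡ p (subst (_≤ c * a) (sym (ℚₚ.*-zeroʳ c)) q)

*-cancelˡ-0< : ∀ {a c} → 0ℚ ≤ c → 0ℚ < c * a → 0ℚ < a
*-cancelˡ-0< {a} {c} p q = ℚₚ.*-cancelˡ-<-nonNeg c {{nonNegative p}} (subst (_< c * a) (sym (ℚₚ.*-zeroʳ c)) q)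

*-cancelˡ-≡0 : ∀ {a c} → 0ℚ < c → c * a ≡ 0ℚ → a ≡ 0ℚ
*-cancelˡ-≡0 {a} {c} p q = ℚₚ.≤-antisym
  (*-cancelˡ p (≤-reflexive (trans q (sym (ℚₚ.*-zeroʳ c)))))
  (*-cancelˡ-0≤ p (≤-reflexive (sym q)))

lit≤ : ∀ {a b} {p : True (a ≤? b)} → a ≤ b
lit≤ {p = p} = toWitness p

lit< : ∀ {a b} {p : True (a <? b)} → a < b
lit< {p = p} = toWitness p

0≤1 : 0ℚ ≤ 1ℚ
0≤1 = lit≤

0<1 : 0ℚ < 1ℚ
0<1 = lit<

recip : ∀ a → 0ℚ < a → ∃ λ b → (a * b ≡ 1ℚ) × 0ℚ < b
recip a p = (1/ a) , ℚₚ.*-inverseʳ a , *-cancelˡ-0< (<⇒≤ p) (subst (0ℚ <_) (sym (ℚₚ.*-inverseʳ a)) lit<)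
  where instance _ = ℚₚ.pos⇒nonZero a {{positive p}}

-- The embedding of ℕ

private
  ι-mk : ∀ n → ι n ≡ mkℚ (pos n) 0 (Coprimality.sym (Coprimality.1-coprimeTo n))
  ι-mk n = ℚₚ.normalize-coprime (Coprimality.sym (Coprimality.1-coprimeTo n))

ι-+ : ∀ m n → ι (m ℕ.+ n) ≡ ι m + ι n
ι-+ m n rewrite ι-mk m | ι-mk n = cong (_/ 1) (trans (ℤₚ.pos-+ m n) (sym (cong₂ ℤ._+_ (ℤₚ.*-identityʳ (pos m)) (ℤₚ.*-identityʳ (pos n)))))

ι-* : ∀ m n → ι (m ℕ.* n) ≡ ι m * ι n
ι-* m n rewrite ι-mk m | ι-mk n = cong (_/ 1) (ℤₚ.pos-* m n)

ι-suc : ∀ n → ι (suc n) ≡ 1ℚ + ι n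
ι-suc n = ι-+ 1 n

ι-nonneg : ∀ n → 0ℚ ≤ ι n
ι-nonneg zero = ≤-refl
ι-nonneg (suc n) = subst (0ℚ ≤_) (sym (ι-suc n)) (0≤+ 0≤1 (ι-nonneg n))

ι-pos : ∀ n → 0ℚ < ι (suc n)
ι-pos n = subst (0ℚ <_) (sym (ι-suc n)) (0<+ 0<1 (ι-nonneg n))

ι-mono : ∀ {m n} → m ℕ.≤ n → ι m ≤ ι n
ι-mono {m} {n} p with k , e ← ℕₚ.m≤n⇒∃[o]m+o≡n p =
  subst₂ _≤_ (ℚₚ.+-identityʳ (ι m)) (trans (sym (ι-+ m k)) (cong ι e)) (+-mono-≤ (≤-refl {ι m}) (ι-nonneg k))

ringᵠ₁ : ∀ a → 1ℚ + a - a ≡ 1ℚ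
ringᵠ₁ = solveᵠ 1 λ a → con 1ℚ :+ a :- a := con 1ℚ

ι-cancel : ∀ {m n} → ι m ≤ ι n → m ℕ.≤ n
ι-cancel {m} {n} p with m ℕ.≤? n
... | yes q = q
... | no q with ℕₚ.m≤n⇒∃[o]m+o≡n (ℕₚ.≰⇒> q)
...   | k , e = ⊥-elim (ℚₚ.<-irrefl refl (ℚₚ.<-≤-trans lt p))
  where
  lt : ι n < ι m
  lt = subst (ι n <_) (cong ι e) (ℚₚ.<-≤-trans
    (0<-⇒< (subst (0ℚ <_) (sym (trans (cong (_- ι n) (ι-suc n)) (ringᵠ₁ (ι n)))) lit<)) (ι-mono (ℕₚ.m≤m+n (suc n) k)))

archimedes : ∀ a → ∃ λ N → a ≤ ι N
archimedes (mkℚ (pos n) d c) = n , subst (mkℚ (pos n) d c ≤_) (sym (ι-mk n))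
  (Data.Rational.*≤* (subst₂ ℤ._≤_ (ℤₚ.pos-* n 1) (ℤₚ.pos-* n (suc d)) (ℤ.+≤+ (ℕₚ.*-monoʳ-≤ n (s≤s z≤n)))))
  where import Data.Rational
archimedes (mkℚ -[1+ n ] d c) = 0 , <⇒≤ (ℚₚ.negative⁻¹ (mkℚ -[1+ n ] d c))

-- Powers

infixr 8 _^_
_^_ : ℚ → ℕ → ℚ
a ^ zero = 1ℚ
a ^ suc n = a * a ^ n

^-+ : ∀ a m n → a ^ (m ℕ.+ n) ≡ a ^ m * a ^ n
^-+ a zero n = sym (ℚₚ.*-identityˡ (a ^ n))
^-+ a (suc m) n = trans (cong (a *_) (^-+ a m n)) (sym (ℚₚ.*-assoc a (a ^ m) (a ^ n)))

^-nonneg : ∀ {a} n → 0ℚ ≤ a → 0ℚ ≤ a ^ n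
^-nonneg zero p = lit≤
^-nonneg (suc n) p = 0≤* p (^-nonneg n p)

^-pos : ∀ {a} n → 0ℚ < a → 0ℚ < a ^ n
^-pos zero p = lit<
^-pos (suc n) p = 0<* p (^-pos n p)

^-mono : ∀ {a b} n → 0ℚ ≤ a → a ≤ b → a ^ n ≤ b ^ n
^-mono zero p q = ≤-refl
^-mono (suc n) p q = *-mono p q (^-nonneg n p) (^-mono n p q)

ringᵠ₂ : ∀ a b c d → a * b * (c * d) ≡ a * c * (b * d)
ringᵠ₂ = solveᵠ 4 λ a b c d → a :* b :* (c :* d) := a :* c :* (b :* d)

^-*-distrib : ∀ a b n → (a * b) ^ n ≡ a ^ n * b ^ n
^-*-distrib a b zero = refl
^-*-distrib a b (suc n) = trans (cong (a * b *_) (^-*-distrib a b n)) (ringᵠ₂ a b (a ^ n) (b ^ n))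

1^ : ∀ n → 1ℚ ^ n ≡ 1ℚ
1^ zero = refl
1^ (suc n) = trans (ℚₚ.*-identityˡ (1ℚ ^ n)) (1^ n)

ringᵠ₃ : ∀ a → 1ℚ + 0ℚ * a ≡ 1ℚ
ringᵠ₃ = solveᵠ 1 λ a → con 1ℚ :+ con 0ℚ :* a := con 1ℚ

ringᵠ₄ : ∀ a b → (1ℚ + a) * (1ℚ + b * a) - (1ℚ + (1ℚ + b) * a) ≡ b * (a * a)
ringᵠ₄ = solveᵠ 2 λ a b → (con 1ℚ :+ a) :* (con 1ℚ :+ b :* a) :- (con 1ℚ :+ (con 1ℚ :+ b) :* a) := b :* (a :* a)

bernoulli : ∀ a n → 0ℚ ≤ a → 1ℚ + ι n * a ≤ (1ℚ + a) ^ n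
bernoulli a zero p = ≤-reflexive (ringᵠ₃ a)
bernoulli a (suc n) p = ≤-trans
  (by≤ (trans (cong (λ z → (1ℚ + a) * (1ℚ + ι n * a) - (1ℚ + z * a)) (ι-suc n)) (ringᵠ₄ a (ι n))) (0≤* (ι-nonneg n) (0≤* p p)))
  (*-monoˡ (0≤+ 0≤1 p) (bernoulli a n p))

-- Formal power series

PS : Set
PS = ℕ → ℚ

infix 4 _≈_
-- Wrapped in a record so that both series can be inferred from a proof of equality.
record _≈_ (f g : PS) : Set where
  constructor mk≈
  field at : ∀ n → f n ≡ g n
open _≈_ public

infixl 6 _⊕_ _⊖_
infixl 7 _⊛_
infix 8 ⊝_

_⊕_ : PS → PS → PS
(f ⊕ g) n = f n + g n

⊝_ : PS → PS
(⊝ f) n = - f n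

_⊖_ : PS → PS → PS
f ⊖ g = f ⊕ (⊝ g)

tail : PS → PS
tail f n = f (suc n)

_⊛_ : PS → PS → PS
(f ⊛ g) zero = f 0 * g 0
(f ⊛ g) (suc n) = f 0 * g (suc n) + (tail f ⊛ g) n

κ : ℚ → PS
κ c zero = c
κ c (suc n) = 0ℚ

X : PS
X zero = 0ℚ
X (suc zero) = 1ℚ
X (suc (suc n)) = 0ℚ

≈-refl : ∀ {f} → f ≈ f
≈-refl = mk≈ λ n → refl

≈-sym : ∀ {f g} → f ≈ g → g ≈ f
≈-sym p = mk≈ λ n → sym (at p n)

≈-trans : ∀ {f g h} → f ≈ g → g ≈ h → f ≈ h
≈-trans p q = mk≈ λ n → trans (at p n) (at q n)

⊛-cong′ : ∀ {f f' g g' : PS} → (∀ n → f n ≡ f' n) → (∀ n → g n ≡ g' n) → ∀ n → (f ⊛ g) n ≡ (f' ⊛ g') n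
⊛-cong′ p q zero = cong₂ _*_ (p 0) (q 0)
⊛-cong′ p q (suc n) = cong₂ _+_ (cong₂ _*_ (p 0) (q (suc n))) (⊛-cong′ (λ i → p (suc i)) q n)

⊛-cong : ∀ {f f' g g'} → f ≈ f' → g ≈ g' → f ⊛ g ≈ f' ⊛ g'
⊛-cong p q = mk≈ (⊛-cong′ (at p) (at q))

ringᵠ₅ : ∀ a b c → (a + b) * c ≡ a * c + b * c
ringᵠ₅ = solveᵠ 3 λ a b c → (a :+ b) :* c := a :* c :+ b :* c

ringᵠ₆ : ∀ a b c d e → (a + b) * c + (d + e) ≡ a * c + d + (b * c + e)
ringᵠ₆ = solveᵠ 5 λ a b c d e → (a :+ b) :* c :+ (d :+ e) := a :* c :+ d :+ (b :* c :+ e)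

⊛-distribʳ : ∀ f g h n → ((f ⊕ g) ⊛ h) n ≡ (f ⊛ h ⊕ g ⊛ h) n
⊛-distribʳ f g h zero = ringᵠ₅ (f 0) (g 0) (h 0)
⊛-distribʳ f g h (suc n) = trans (cong ((f 0 + g 0) * h (suc n) +_) (⊛-distribʳ (tail f) (tail g) h n)) (ringᵠ₆ (f 0) (g 0) (h (suc n)) ((tail f ⊛ h) n) ((tail g ⊛ h) n))

ringᵠ₇ : ∀ a b c d → a * b * c + a * d ≡ a * (b * c + d)
ringᵠ₇ = solveᵠ 4 λ a b c d → a :* b :* c :+ a :* d := a :* (b :* c :+ d)

⊛-scaleˡ : ∀ c f g n → ((λ i → c * f i) ⊛ g) n ≡ c * (f ⊛ g) n
⊛-scaleˡ c f g zero = ℚₚ.*-assoc c (f 0) (g 0)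
⊛-scaleˡ c f g (suc n) = trans (cong (c * f 0 * g (suc n) +_) (⊛-scaleˡ c (tail f) g n)) (ringᵠ₇ c (f 0) (g (suc n)) ((tail f ⊛ g) n))

⊛-sucʳ : ∀ f g n → (f ⊛ g) (suc n) ≡ (f ⊛ tail g) n + f (suc n) * g 0
⊛-sucʳ f g zero = refl
⊛-sucʳ f g (suc n) = trans (cong (f 0 * g (suc (suc n)) +_) (⊛-sucʳ (tail f) g n)) (sym (ℚₚ.+-assoc (f 0 * g (suc (suc n))) ((tail f ⊛ tail g) n) (f (suc (suc n)) * g 0)))

⊛-comm : ∀ f g n → (f ⊛ g) n ≡ (g ⊛ f) n
⊛-comm f g zero = ℚₚ.*-comm (f 0) (g 0)
⊛-comm f g (suc n) = trans (⊛-sucʳ f g n) (trans (cong₂ _+_ (⊛-comm f (tail g) n) (ℚₚ.*-comm (f (suc n)) (g 0))) (ℚₚ.+-comm ((tail g ⊛ f) n) (g 0 * f (suc n))))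

ringᵠ₈ : ∀ a b c d e → a * b * c + (a * d + e) ≡ a * (b * c + d) + e
ringᵠ₈ = solveᵠ 5 λ a b c d e → a :* b :* c :+ (a :* d :+ e) := a :* (b :* c :+ d) :+ e

⊛-assoc : ∀ f g h n → ((f ⊛ g) ⊛ h) n ≡ (f ⊛ (g ⊛ h)) n
⊛-assoc f g h zero = ℚₚ.*-assoc (f 0) (g 0) (h 0)
⊛-assoc f g h (suc n) = begin
  f 0 * g 0 * h (suc n) + (tail (f ⊛ g) ⊛ h) n
    ≡⟨ cong (f 0 * g 0 * h (suc n) +_) (⊛-distribʳ (λ i → f 0 * tail g i) (tail f ⊛ g) h n) ⟩
  f 0 * g 0 * h (suc n) + (((λ i → f 0 * tail g i) ⊛ h) n + ((tail f ⊛ g) ⊛ h) n)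
    ≡⟨ cong₂ (λ a b → f 0 * g 0 * h (suc n) + (a + b)) (⊛-scaleˡ (f 0) (tail g) h n) (⊛-assoc (tail f) g h n) ⟩
  f 0 * g 0 * h (suc n) + (f 0 * (tail g ⊛ h) n + (tail f ⊛ (g ⊛ h)) n)
    ≡⟨ ringᵠ₈ (f 0) (g 0) (h (suc n)) ((tail g ⊛ h) n) ((tail f ⊛ (g ⊛ h)) n) ⟩
  f 0 * (g ⊛ h) (suc n) + (tail f ⊛ (g ⊛ h)) n ∎
  where
  open ≡-Reasoning

0⊛ : ∀ (f : PS) {z : PS} → (∀ n → z n ≡ 0ℚ) → ∀ n → (z ⊛ f) n ≡ 0ℚ
0⊛ f p zero = trans (cong (_* f 0) (p 0)) (ℚₚ.*-zeroˡ (f 0))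
0⊛ f p (suc n) = trans (cong₂ _+_ (trans (cong (_* f (suc n)) (p 0)) (ℚₚ.*-zeroˡ (f (suc n)))) (0⊛ f (λ i → p (suc i)) n)) refl

κ⊛ : ∀ c f n → (κ c ⊛ f) n ≡ c * f n
κ⊛ c f zero = refl
κ⊛ c f (suc n) = trans (cong (c * f (suc n) +_) (0⊛ f (λ _ → refl) n)) (ℚₚ.+-identityʳ (c * f (suc n)))

PS-commutativeRing : CommutativeRing 0ℓ 0ℓ
PS-commutativeRing = record
  { Carrier = PS ; _≈_ = _≈_ ; _+_ = _⊕_ ; _*_ = _⊛_ ; -_ = ⊝_ ; 0# = κ 0ℚ ; 1# = κ 1ℚ
  ; isCommutativeRing = record
    { isRing = record
      { +-isAbelianGroup = record
        { isGroup = record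
          { isMonoid = record
            { isSemigroup = record
              { isMagma = record
                { isEquivalence = record { refl = ≈-refl ; sym = ≈-sym ; trans = ≈-trans }
                ; ∙-cong = λ p q → mk≈ λ n → cong₂ _+_ (at p n) (at q n) }
              ; assoc = λ f g h → mk≈ λ n → ℚₚ.+-assoc (f n) (g n) (h n) }
            ; identity = (λ f → mk≈ λ { zero → ℚₚ.+-identityˡ (f 0) ; (suc n) → ℚₚ.+-identityˡ (f (suc n)) })
                       , (λ f → mk≈ λ { zero → ℚₚ.+-identityʳ (f 0) ; (suc n) → ℚₚ.+-identityʳ (f (suc n)) }) }
          ; inverse = (λ f → mk≈ λ { zero → ℚₚ.+-inverseˡ (f 0) ; (suc n) → ℚₚ.+-inverseˡ (f (suc n)) })
                    , (λ f → mk≈ λ { zero → ℚₚ.+-inverseʳ (f 0) ; (suc n) → ℚₚ.+-inverseʳ (f (suc n)) })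
          ; ⁻¹-cong = λ p → mk≈ λ n → cong -_ (at p n) }
        ; comm = λ f g → mk≈ λ n → ℚₚ.+-comm (f n) (g n) }
      ; *-cong = ⊛-cong
      ; *-assoc = λ f g h → mk≈ (⊛-assoc f g h)
      ; *-identity = (λ f → mk≈ λ n → trans (κ⊛ 1ℚ f n) (ℚₚ.*-identityˡ (f n)))
                   , (λ f → mk≈ λ n → trans (⊛-comm f (κ 1ℚ) n) (trans (κ⊛ 1ℚ f n) (ℚₚ.*-identityˡ (f n))))
      ; distrib = (λ f g h → mk≈ λ n → trans (⊛-comm f (g ⊕ h) n) (trans (⊛-distribʳ g h f n) (cong₂ _+_ (⊛-comm g f n) (⊛-comm h f n))))
                , (λ f g h → mk≈ (⊛-distribʳ g h f)) }
    ; *-comm = λ f g → mk≈ (⊛-comm f g) } }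

module PSR = CommutativeRing PS-commutativeRing

series : Coefficients
series = record
  { target = PS-commutativeRing ; h = κ
  ; h-+ = λ a b → mk≈ λ { zero → refl ; (suc n) → refl }
  ; h-* = λ a b → mk≈ λ { zero → refl ; (suc n) → sym (trans (κ⊛ a (κ b) (suc n)) (ℚₚ.*-zeroʳ a)) }
  ; h-neg = λ a → mk≈ λ { zero → refl ; (suc n) → refl }
  ; h-0 = ≈-refl ; h-1 = ≈-refl }

open RingIdentity series using () renaming (solve to solveˢ)

-- The derivation t d/dt

θ : PS → PS
θ f n = ι n * f n

ringᵠ₉ : ∀ a b → 0ℚ * (a * b) ≡ 0ℚ * a * b + a * (0ℚ * b)
ringᵠ₉ = solveᵠ 2 λ a b → con 0ℚ :* (a :* b) := con 0ℚ :* a :* b :+ a :* (con 0ℚ :* b)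

ringᵠ₁₀ : ∀ i a b c → (1ℚ + i) * (a * b + c) ≡ a * ((1ℚ + i) * b) + (c + i * c)
ringᵠ₁₀ = solveᵠ 4 λ i a b c → (con 1ℚ :+ i) :* (a :* b :+ c) := a :* ((con 1ℚ :+ i) :* b) :+ (c :+ i :* c)

ringᵠ₁₁ : ∀ f g a b c d → a + (b + (c + d)) ≡ (0ℚ * f * g + (b + c)) + (a + d)
ringᵠ₁₁ = solveᵠ 6 λ f g a b c d → a :+ (b :+ (c :+ d)) := con 0ℚ :* f :* g :+ (b :+ c) :+ (a :+ d)

ringᵠ₁₂ : ∀ i a → a + i * a ≡ (1ℚ + i) * a
ringᵠ₁₂ = solveᵠ 2 λ i a → a :+ i :* a := (con 1ℚ :+ i) :* a

-- Leibniz rule. Taking a tail shifts indices by one, so `tail (θ f)` is `tail f ⊕ θ (tail f)`; the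
-- extra summand is matched by the 1 in the factor `1 + n`.
θ-⊛′ : ∀ f g n → θ (f ⊛ g) n ≡ (θ f ⊛ g ⊕ f ⊛ θ g) n
θ-⊛′ f g zero = ringᵠ₉ (f 0) (g 0)
θ-⊛′ f g (suc n) = begin
  ι (suc n) * (f 0 * g (suc n) + (tail f ⊛ g) n)
    ≡⟨ trans (cong (_* (f 0 * g (suc n) + (tail f ⊛ g) n)) (ι-suc n)) (ringᵠ₁₀ (ι n) (f 0) (g (suc n)) ((tail f ⊛ g) n)) ⟩
  f 0 * ((1ℚ + ι n) * g (suc n)) + ((tail f ⊛ g) n + ι n * (tail f ⊛ g) n)
    ≡⟨ cong₂ (λ a b → f 0 * (a * g (suc n)) + ((tail f ⊛ g) n + b)) (sym (ι-suc n)) (θ-⊛′ (tail f) g n) ⟩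
  f 0 * θ g (suc n) + ((tail f ⊛ g) n + ((θ (tail f) ⊛ g) n + (tail f ⊛ θ g) n))
    ≡⟨ ringᵠ₁₁ (f 0) (g (suc n)) (f 0 * θ g (suc n)) ((tail f ⊛ g) n) ((θ (tail f) ⊛ g) n) ((tail f ⊛ θ g) n) ⟩
  (0ℚ * f 0 * g (suc n) + ((tail f ⊛ g) n + (θ (tail f) ⊛ g) n)) + (f 0 * θ g (suc n) + (tail f ⊛ θ g) n)
    ≡⟨ cong (λ z → (0ℚ * f 0 * g (suc n) + z) + (f 0 * θ g (suc n) + (tail f ⊛ θ g) n))
         (trans (sym (⊛-distribʳ (tail f) (θ (tail f)) g n)) (⊛-cong′ {g = g} (λ i → trans (ringᵠ₁₂ (ι i) (f (suc i))) (cong (_* f (suc i)) (sym (ι-suc i)))) (λ _ → refl) n)) ⟩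
  (θ f ⊛ g ⊕ f ⊛ θ g) (suc n) ∎
  where
  open ≡-Reasoning

θ-⊛ : ∀ f g → θ (f ⊛ g) ≈ θ f ⊛ g ⊕ f ⊛ θ g
θ-⊛ f g = mk≈ (θ-⊛′ f g)

-- Sums over Z4^n

pattern z0 = zero
pattern z1 = suc zero
pattern z2 = suc (suc zero)
pattern z3 = suc (suc (suc zero))

sum4 : (Z4 → ℚ) → ℚ
sum4 g = g z0 + g z1 + g z2 + g z3

sumV : ∀ n → (Vec Z4 n → ℚ) → ℚ
sumV zero g = g []
sumV (suc n) g = sum4 λ x → sumV n (λ v → g (x ∷ v))

sum4-cong : ∀ {g h : Z4 → ℚ} → (∀ x → g x ≡ h x) → sum4 g ≡ sum4 h
sum4-cong p = cong₂ _+_ (cong₂ _+_ (cong₂ _+_ (p z0) (p z1)) (p z2)) (p z3)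

sumV-cong : ∀ n {g h : Vec Z4 n → ℚ} → (∀ v → g v ≡ h v) → sumV n g ≡ sumV n h
sumV-cong zero p = p []
sumV-cong (suc n) p = sum4-cong λ x → sumV-cong n (λ v → p (x ∷ v))

ringᵠ₁₃ : ∀ a b c d a' b' c' d' → a + a' + (b + b') + (c + c') + (d + d') ≡ a + b + c + d + (a' + b' + c' + d')
ringᵠ₁₃ = solveᵠ 8 λ a b c d a' b' c' d' → a :+ a' :+ (b :+ b') :+ (c :+ c') :+ (d :+ d') := a :+ b :+ c :+ d :+ (a' :+ b' :+ c' :+ d')

sumV-+ : ∀ n (g h : Vec Z4 n → ℚ) → sumV n (λ v → g v + h v) ≡ sumV n g + sumV n h
sumV-+ zero g h = refl
sumV-+ (suc n) g h = trans
  (sum4-cong λ x → sumV-+ n (λ v → g (x ∷ v)) (λ v → h (x ∷ v)))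
  (ringᵠ₁₃ (sumV n (λ v → g (z0 ∷ v))) (sumV n (λ v → g (z1 ∷ v))) (sumV n (λ v → g (z2 ∷ v))) (sumV n (λ v → g (z3 ∷ v)))
     (sumV n (λ v → h (z0 ∷ v))) (sumV n (λ v → h (z1 ∷ v))) (sumV n (λ v → h (z2 ∷ v))) (sumV n (λ v → h (z3 ∷ v))))

ringᵠ₁₄ : ∀ c a b d e → c * a + c * b + c * d + c * e ≡ c * (a + b + d + e)
ringᵠ₁₄ = solveᵠ 5 λ c a b d e → c :* a :+ c :* b :+ c :* d :+ c :* e := c :* (a :+ b :+ d :+ e)

sumV-* : ∀ n c (g : Vec Z4 n → ℚ) → sumV n (λ v → c * g v) ≡ c * sumV n g
sumV-* zero c g = refl
sumV-* (suc n) c g = trans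
  (sum4-cong λ x → sumV-* n c (λ v → g (x ∷ v)))
  (ringᵠ₁₄ c (sumV n (λ v → g (z0 ∷ v))) (sumV n (λ v → g (z1 ∷ v))) (sumV n (λ v → g (z2 ∷ v))) (sumV n (λ v → g (z3 ∷ v))))

sumV-sum4 : ∀ n (g : Z4 → Vec Z4 n → ℚ) → sumV n (λ v → sum4 (λ x → g x v)) ≡ sum4 (λ x → sumV n (g x))
sumV-sum4 n g = trans (sumV-+ n (λ v → g z0 v + g z1 v + g z2 v) (g z3)) (cong (_+ sumV n (g z3))
  (trans (sumV-+ n (λ v → g z0 v + g z1 v) (g z2)) (cong (_+ sumV n (g z2)) (sumV-+ n (g z0) (g z1)))))

sumV-swap : ∀ m n (g : Vec Z4 m → Vec Z4 n → ℚ) →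
  sumV m (λ u → sumV n (g u)) ≡ sumV n (λ v → sumV m (λ u → g u v))
sumV-swap zero n g = refl
sumV-swap (suc m) n g = trans
  (sum4-cong λ x → sumV-swap m n (λ u → g (x ∷ u)))
  (sym (sumV-sum4 n (λ x v → sumV m (λ u → g (x ∷ u) v))))

sumV-nonneg : ∀ n (g : Vec Z4 n → ℚ) → (∀ v → 0ℚ ≤ g v) → 0ℚ ≤ sumV n g
sumV-nonneg zero g p = p []
sumV-nonneg (suc n) g p = 0≤+ (0≤+ (0≤+ (s z0) (s z1)) (s z2)) (s z3)
  where
  s : ∀ x → 0ℚ ≤ sumV n (λ v → g (x ∷ v))
  s x = sumV-nonneg n (λ v → g (x ∷ v)) (λ v → p (x ∷ v))

ringᵠ₁₅ : ∀ a b c d → a + b + c + d - a ≡ b + c + d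
ringᵠ₁₅ = solveᵠ 4 λ a b c d → a :+ b :+ c :+ d :- a := b :+ c :+ d

ringᵠ₁₆ : ∀ a b c d → a + b + c + d - b ≡ a + c + d
ringᵠ₁₆ = solveᵠ 4 λ a b c d → a :+ b :+ c :+ d :- b := a :+ c :+ d

ringᵠ₁₇ : ∀ a b c d → a + b + c + d - c ≡ a + b + d
ringᵠ₁₇ = solveᵠ 4 λ a b c d → a :+ b :+ c :+ d :- c := a :+ b :+ d

ringᵠ₁₈ : ∀ a b c d → a + b + c + d - d ≡ a + b + c
ringᵠ₁₈ = solveᵠ 4 λ a b c d → a :+ b :+ c :+ d :- d := a :+ b :+ c

sumV-≥-term : ∀ n (g : Vec Z4 n → ℚ) → (∀ v → 0ℚ ≤ g v) → ∀ u → g u ≤ sumV n g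
sumV-≥-term zero g p [] = ≤-refl
sumV-≥-term (suc n) g p (x ∷ u) = ≤-trans (sumV-≥-term n (λ v → g (x ∷ v)) (λ v → p (x ∷ v)) u) (part x)
  where
  s : ∀ x → 0ℚ ≤ sumV n (λ v → g (x ∷ v))
  s x = sumV-nonneg n (λ v → g (x ∷ v)) (λ v → p (x ∷ v))
  S : Z4 → ℚ
  S x = sumV n (λ v → g (x ∷ v))
  part : ∀ x → S x ≤ sum4 S
  part z0 = by≤ (ringᵠ₁₅ (S z0) (S z1) (S z2) (S z3)) (0≤+ (0≤+ (s z1) (s z2)) (s z3))
  part z1 = by≤ (ringᵠ₁₆ (S z0) (S z1) (S z2) (S z3)) (0≤+ (0≤+ (s z0) (s z2)) (s z3))
  part z2 = by≤ (ringᵠ₁₇ (S z0) (S z1) (S z2) (S z3)) (0≤+ (0≤+ (s z0) (s z1)) (s z3))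
  part z3 = by≤ (ringᵠ₁₈ (S z0) (S z1) (S z2) (S z3)) (0≤+ (0≤+ (s z0) (s z1)) (s z2))

-- Addition in Z4^n

succ₄ : Z4 → Z4
succ₄ z0 = z1
succ₄ z1 = z2
succ₄ z2 = z3
succ₄ z3 = z0

_⊞_ : Z4 → Z4 → Z4
x ⊞ z0 = x
x ⊞ z1 = succ₄ x
x ⊞ z2 = succ₄ (succ₄ x)
x ⊞ z3 = succ₄ (succ₄ (succ₄ x))

_⊞ᵛ_ : ∀ {n} → Vec Z4 n → Vec Z4 n → Vec Z4 n
[] ⊞ᵛ [] = []
(x ∷ v) ⊞ᵛ (y ∷ w) = (x ⊞ y) ∷ (v ⊞ᵛ w)

ringᵠ₁₉ : ∀ a b c d → b + c + d + a ≡ a + b + c + d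
ringᵠ₁₉ = solveᵠ 4 λ a b c d → b :+ c :+ d :+ a := a :+ b :+ c :+ d

ringᵠ₂₀ : ∀ a b c d → c + d + a + b ≡ a + b + c + d
ringᵠ₂₀ = solveᵠ 4 λ a b c d → c :+ d :+ a :+ b := a :+ b :+ c :+ d

ringᵠ₂₁ : ∀ a b c d → d + a + b + c ≡ a + b + c + d
ringᵠ₂₁ = solveᵠ 4 λ a b c d → d :+ a :+ b :+ c := a :+ b :+ c :+ d

sum4-shift : ∀ y (g : Z4 → ℚ) → sum4 (λ x → g (x ⊞ y)) ≡ sum4 g
sum4-shift z0 g = refl
sum4-shift z1 g = ringᵠ₁₉ (g z0) (g z1) (g z2) (g z3)
sum4-shift z2 g = ringᵠ₂₀ (g z0) (g z1) (g z2) (g z3)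
sum4-shift z3 g = ringᵠ₂₁ (g z0) (g z1) (g z2) (g z3)

sumV-shift : ∀ n w (g : Vec Z4 n → ℚ) → sumV n (λ v → g (v ⊞ᵛ w)) ≡ sumV n g
sumV-shift zero [] g = refl
sumV-shift (suc n) (y ∷ w) g = trans
  (sum4-cong λ x → sumV-shift n w (λ v → g ((x ⊞ y) ∷ v)))
  (sum4-shift y (λ x → sumV n (λ v → g (x ∷ v))))

inner-comm : ∀ {n} (v w : Vec Z4 n) → inner v w ≡ inner w v
inner-comm [] [] = refl
inner-comm (x ∷ v) (y ∷ w) = cong₂ ℕ._+_ (ℕₚ.*-comm (toℕ x) (toℕ y)) (inner-comm v w)

⊞-carry : ∀ x y → ∃ λ k → toℕ (x ⊞ y) ℕ.+ 4 ℕ.* k ≡ toℕ x ℕ.+ toℕ y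
⊞-carry z0 z0 = 0 , refl
⊞-carry z0 z1 = 0 , refl
⊞-carry z0 z2 = 0 , refl
⊞-carry z0 z3 = 0 , refl
⊞-carry z1 z0 = 0 , refl
⊞-carry z1 z1 = 0 , refl
⊞-carry z1 z2 = 0 , refl
⊞-carry z1 z3 = 1 , refl
⊞-carry z2 z0 = 0 , refl
⊞-carry z2 z1 = 0 , refl
⊞-carry z2 z2 = 1 , refl
⊞-carry z2 z3 = 1 , refl
⊞-carry z3 z0 = 0 , refl
⊞-carry z3 z1 = 1 , refl
⊞-carry z3 z2 = 1 , refl
⊞-carry z3 z3 = 1 , refl

ringⁿ₁ : ∀ x a b k k' → x ℕ.* a ℕ.+ b ℕ.+ 4 ℕ.* (x ℕ.* k ℕ.+ k') ≡ x ℕ.* (a ℕ.+ 4 ℕ.* k) ℕ.+ (b ℕ.+ 4 ℕ.* k')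
ringⁿ₁ = ℕR.solve-∀

ringⁿ₂ : ∀ x y z a b → x ℕ.* (y ℕ.+ z) ℕ.+ (a ℕ.+ b) ≡ x ℕ.* y ℕ.+ a ℕ.+ (x ℕ.* z ℕ.+ b)
ringⁿ₂ = ℕR.solve-∀

inner-⊞ : ∀ {n} (u v w : Vec Z4 n) → ∃ λ k → inner u (v ⊞ᵛ w) ℕ.+ 4 ℕ.* k ≡ inner u v ℕ.+ inner u w
inner-⊞ [] [] [] = 0 , refl
inner-⊞ (x ∷ u) (y ∷ v) (z ∷ w) with k , e ← ⊞-carry y z | k' , e' ← inner-⊞ u v w =
  toℕ x ℕ.* k ℕ.+ k' , (begin
    toℕ x ℕ.* toℕ (y ⊞ z) ℕ.+ inner u (v ⊞ᵛ w) ℕ.+ 4 ℕ.* (toℕ x ℕ.* k ℕ.+ k')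
      ≡⟨ ringⁿ₁ (toℕ x) (toℕ (y ⊞ z)) (inner u (v ⊞ᵛ w)) k k' ⟩
    toℕ x ℕ.* (toℕ (y ⊞ z) ℕ.+ 4 ℕ.* k) ℕ.+ (inner u (v ⊞ᵛ w) ℕ.+ 4 ℕ.* k')
      ≡⟨ cong₂ (λ a b → toℕ x ℕ.* a ℕ.+ b) e e' ⟩
    toℕ x ℕ.* (toℕ y ℕ.+ toℕ z) ℕ.+ (inner u v ℕ.+ inner u w)
      ≡⟨ ringⁿ₂ (toℕ x) (toℕ y) (toℕ z) (inner u v) (inner u w) ⟩
    toℕ x ℕ.* toℕ y ℕ.+ inner u v ℕ.+ (toℕ x ℕ.* toℕ z ℕ.+ inner u w) ∎)
  where
  open ≡-Reasoning

-- Modulo 8 the Euclidean weight of a letter is its square, which is well defined on residues modulo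
-- 4; hence it is a quadratic form modulo 8 with polar form twice the product.
ewt-⊞ : ∀ x y → ∃ λ k → ewt (x ⊞ y) ℕ.+ 8 ℕ.* k ≡ ewt x ℕ.+ ewt y ℕ.+ 2 ℕ.* (toℕ x ℕ.* toℕ y)
ewt-⊞ z0 z0 = 0 , refl
ewt-⊞ z0 z1 = 0 , refl
ewt-⊞ z0 z2 = 0 , refl
ewt-⊞ z0 z3 = 0 , refl
ewt-⊞ z1 z0 = 0 , refl
ewt-⊞ z1 z1 = 0 , refl
ewt-⊞ z1 z2 = 1 , refl
ewt-⊞ z1 z3 = 1 , refl
ewt-⊞ z2 z0 = 0 , refl
ewt-⊞ z2 z1 = 1 , refl
ewt-⊞ z2 z2 = 2 , refl
ewt-⊞ z2 z3 = 2 , refl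
ewt-⊞ z3 z0 = 0 , refl
ewt-⊞ z3 z1 = 1 , refl
ewt-⊞ z3 z2 = 2 , refl
ewt-⊞ z3 z3 = 2 , refl

ringⁿ₃ : ∀ a b k k' → a ℕ.+ b ℕ.+ 8 ℕ.* (k ℕ.+ k') ≡ (a ℕ.+ 8 ℕ.* k) ℕ.+ (b ℕ.+ 8 ℕ.* k')
ringⁿ₃ = ℕR.solve-∀

ringⁿ₄ : ∀ a b c d e f → (a ℕ.+ b ℕ.+ 2 ℕ.* c) ℕ.+ (d ℕ.+ e ℕ.+ 2 ℕ.* f) ≡ a ℕ.+ d ℕ.+ (b ℕ.+ e) ℕ.+ 2 ℕ.* (c ℕ.+ f)
ringⁿ₄ = ℕR.solve-∀

wtE-⊞ : ∀ {n} (v w : Vec Z4 n) → ∃ λ k → wtE (v ⊞ᵛ w) ℕ.+ 8 ℕ.* k ≡ wtE v ℕ.+ wtE w ℕ.+ 2 ℕ.* inner v w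
wtE-⊞ [] [] = 0 , refl
wtE-⊞ (x ∷ v) (y ∷ w) with k , e ← ewt-⊞ x y | k' , e' ← wtE-⊞ v w =
  k ℕ.+ k' , (begin
    ewt (x ⊞ y) ℕ.+ wtE (v ⊞ᵛ w) ℕ.+ 8 ℕ.* (k ℕ.+ k')
      ≡⟨ ringⁿ₃ (ewt (x ⊞ y)) (wtE (v ⊞ᵛ w)) k k' ⟩
    (ewt (x ⊞ y) ℕ.+ 8 ℕ.* k) ℕ.+ (wtE (v ⊞ᵛ w) ℕ.+ 8 ℕ.* k')
      ≡⟨ cong₂ ℕ._+_ e e' ⟩
    (ewt x ℕ.+ ewt y ℕ.+ 2 ℕ.* (toℕ x ℕ.* toℕ y)) ℕ.+ (wtE v ℕ.+ wtE w ℕ.+ 2 ℕ.* inner v w)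
      ≡⟨ ringⁿ₄ (ewt x) (ewt y) (toℕ x ℕ.* toℕ y) (wtE v) (wtE w) (inner v w) ⟩
    ewt x ℕ.+ wtE v ℕ.+ (ewt y ℕ.+ wtE w) ℕ.+ 2 ℕ.* (toℕ x ℕ.* toℕ y ℕ.+ inner v w) ∎)
  where
  open ≡-Reasoning

private
  self : ∀ x → ∃ λ k → ewt x ℕ.+ 8 ℕ.* k ≡ toℕ x ℕ.* toℕ x
  self z0 = 0 , refl
  self z1 = 0 , refl
  self z2 = 0 , refl
  self z3 = 1 , refl

inner-self : ∀ {n} (v : Vec Z4 n) → ∃ λ k → wtE v ℕ.+ 8 ℕ.* k ≡ inner v v
inner-self [] = 0 , refl
inner-self (x ∷ v) with k , e ← self x | k' , e' ← inner-self v =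
  k ℕ.+ k' , trans (ringⁿ₃ (ewt x) (wtE v) k k') (cong₂ ℕ._+_ e e')

-- The real and imaginary parts of iⁿ, and the sign (-1)^⌊n/4⌋

c4 s4 : ℕ → ℚ
c4 zero = 1ℚ
c4 (suc n) = - s4 n
s4 zero = 0ℚ
s4 (suc n) = c4 n

c4-+ : ∀ a b → c4 (a ℕ.+ b) ≡ c4 a * c4 b - s4 a * s4 b
ringᵠ₂₂ : ∀ c s → c ≡ 1ℚ * c - 0ℚ * s
ringᵠ₂₂ = solveᵠ 2 λ c s → c := con 1ℚ :* c :- con 0ℚ :* s

ringᵠ₂₃ : ∀ c s c' s' → - (s * c' + c * s') ≡ (- s) * c' - c * s'
ringᵠ₂₃ = solveᵠ 4 λ c s c' s' → (:- (s :* c' :+ c :* s')) := (:- s) :* c' :- c :* s'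

ringᵠ₂₄ : ∀ c s → s ≡ 0ℚ * c + 1ℚ * s
ringᵠ₂₄ = solveᵠ 2 λ c s → s := con 0ℚ :* c :+ con 1ℚ :* s

ringᵠ₂₅ : ∀ c s c' s' → c * c' - s * s' ≡ c * c' + (- s) * s'
ringᵠ₂₅ = solveᵠ 4 λ c s c' s' → c :* c' :- s :* s' := c :* c' :+ (:- s) :* s'

s4-+ : ∀ a b → s4 (a ℕ.+ b) ≡ s4 a * c4 b + c4 a * s4 b
c4-+ zero b = ringᵠ₂₂ (c4 b) (s4 b)
c4-+ (suc a) b = trans (cong -_ (s4-+ a b)) (ringᵠ₂₃ (c4 a) (s4 a) (c4 b) (s4 b))
s4-+ zero b = ringᵠ₂₄ (c4 b) (s4 b)
s4-+ (suc a) b = trans (c4-+ a b) (ringᵠ₂₅ (c4 a) (s4 a) (c4 b) (s4 b))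

neg-neg : ∀ a → - (- a) ≡ a
neg-neg = solveᵠ 1 λ a → (:- (:- a)) := a

c4-4k : ∀ k → c4 (4 ℕ.* k) ≡ 1ℚ
s4-4k : ∀ k → s4 (4 ℕ.* k) ≡ 0ℚ
c4-4k zero = refl
c4-4k (suc k) = trans (cong c4 (ℕₚ.*-suc 4 k)) (trans (neg-neg (c4 (4 ℕ.* k))) (c4-4k k))
s4-4k zero = refl
s4-4k (suc k) = trans (cong s4 (ℕₚ.*-suc 4 k)) (trans (neg-neg (s4 (4 ℕ.* k))) (s4-4k k))

ringᵠ₂₆ : ∀ c s → (- s) * (- s) + c * c ≡ c * c + s * s
ringᵠ₂₆ = solveᵠ 2 λ c s → (:- s) :* (:- s) :+ c :* c := c :* c :+ s :* s

c4²+s4² : ∀ a → c4 a * c4 a + s4 a * s4 a ≡ 1ℚ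
c4²+s4² zero = refl
c4²+s4² (suc a) = trans (ringᵠ₂₆ (c4 a) (s4 a)) (c4²+s4² a)

ringᵠ₂₇ : ∀ c s → c * 1ℚ - s * 0ℚ ≡ c
ringᵠ₂₇ = solveᵠ 2 λ c s → c :* con 1ℚ :- s :* con 0ℚ := c

c4-mod : ∀ a k b → a ℕ.+ 4 ℕ.* k ≡ b → c4 a ≡ c4 b
c4-mod a k b refl = sym (trans (c4-+ a (4 ℕ.* k)) (trans (cong₂ (λ x y → c4 a * x - s4 a * y) (c4-4k k) (s4-4k k)) (ringᵠ₂₇ (c4 a) (s4 a))))

ringᵠ₂₈ : ∀ c s → s * 1ℚ + c * 0ℚ ≡ s
ringᵠ₂₈ = solveᵠ 2 λ c s → s :* con 1ℚ :+ c :* con 0ℚ := s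

s4-mod : ∀ a k b → a ℕ.+ 4 ℕ.* k ≡ b → s4 a ≡ s4 b
s4-mod a k b refl = sym (trans (s4-+ a (4 ℕ.* k)) (trans (cong₂ (λ x y → s4 a * x + c4 a * y) (c4-4k k) (s4-4k k)) (ringᵠ₂₈ (c4 a) (s4 a))))

c4≡1⇒4∣ : ∀ a → c4 a ≡ 1ℚ → 4 ∣ a
c4≡1⇒4∣ 0 p = divides 0 refl
c4≡1⇒4∣ 1 ()
c4≡1⇒4∣ 2 ()
c4≡1⇒4∣ 3 ()
c4≡1⇒4∣ (suc (suc (suc (suc a)))) p = ∣.∣m∣n⇒∣m+n (divides 1 refl) (c4≡1⇒4∣ a (trans (sym (neg-neg (c4 a))) p))

sg : ℕ → ℚ
sg (suc (suc (suc (suc n)))) = - sg n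
sg _ = 1ℚ

ringᵠ₂₉ : ∀ a b → - (a * b) ≡ - a * b
ringᵠ₂₉ = solveᵠ 2 λ a b → (:- (a :* b)) := (:- a) :* b

sg-4k : ∀ k b → sg (4 ℕ.* k ℕ.+ b) ≡ sg (4 ℕ.* k) * sg b
sg-4k zero b = sym (ℚₚ.*-identityˡ (sg b))
sg-4k (suc k) b = begin
  sg (4 ℕ.* suc k ℕ.+ b) ≡⟨ cong (λ z → sg (z ℕ.+ b)) (ℕₚ.*-suc 4 k) ⟩
  - sg (4 ℕ.* k ℕ.+ b) ≡⟨ cong -_ (sg-4k k b) ⟩
  - (sg (4 ℕ.* k) * sg b) ≡⟨ ringᵠ₂₉ (sg (4 ℕ.* k)) (sg b) ⟩
  - sg (4 ℕ.* k) * sg b ≡⟨ cong (λ z → sg z * sg b) (sym (ℕₚ.*-suc 4 k)) ⟩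
  sg (4 ℕ.* suc k) * sg b ∎
  where
  open ≡-Reasoning

ringᵠ₃₀ : ∀ a → - a * - a ≡ a * a
ringᵠ₃₀ = solveᵠ 1 λ a → (:- a) :* (:- a) := a :* a

sg-sq : ∀ a → sg a * sg a ≡ 1ℚ
sg-sq 0 = refl
sg-sq 1 = refl
sg-sq 2 = refl
sg-sq 3 = refl
sg-sq (suc (suc (suc (suc a)))) = trans (ringᵠ₃₀ (sg a)) (sg-sq a)

sg-8k : ∀ k b → sg (8 ℕ.* k ℕ.+ b) ≡ sg b
sg-8k zero b = refl
sg-8k (suc k) b = trans (cong (λ z → sg (z ℕ.+ b)) (ℕₚ.*-suc 8 k)) (trans (neg-neg (sg (8 ℕ.* k ℕ.+ b))) (sg-8k k b))

-- Evaluation of the formal product of the letters 0 ↦ T + V, ±1 ↦ U, 2 ↦ T - V under the linear map U^p V^r T^o ↦ M p r o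

Mono : Set
Mono = ℕ → ℕ → ℕ → ℚ

U⁺ V⁺ T⁺ swap : Mono → Mono
U⁺ M p r o = M (suc p) r o
V⁺ M p r o = M p (suc r) o
T⁺ M p r o = M p r (suc o)
swap M p r o = M r p o

ringᵠ₃₁ : ∀ c s c' s' e → (c * c' - s * s') * e ≡ c * (c' * e) + (- s) * (s' * e)
ringᵠ₃₁ = solveᵠ 5 λ c s c' s' e → (c :* c' :- s :* s') :* e := c :* (c' :* e) :+ (:- s) :* (s' :* e)

ringᵠ₃₂ : ∀ c s a b → c * a + (- s) * b ≡ c * a - s * b
ringᵠ₃₂ = solveᵠ 4 λ c s a b → c :* a :+ (:- s) :* b := c :* a :- s :* b

ringᵠ₃₃ : ∀ c s c' s' e → (s * c' + c * s') * e ≡ s * (c' * e) + c * (s' * e)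
ringᵠ₃₃ = solveᵠ 5 λ c s c' s' e → (s :* c' :+ c :* s') :* e := s :* (c' :* e) :+ c :* (s' :* e)

ringᵠ₃₄ : ∀ a b c → a * (b + c) ≡ a * b + a * c
ringᵠ₃₄ = solveᵠ 3 λ a b c → a :* (b :+ c) := a :* b :+ a :* c

ringᵠ₃₅ : ∀ a b c → a * (b - c) ≡ a * b + (- 1ℚ) * (a * c)
ringᵠ₃₅ = solveᵠ 3 λ a b c → a :* (b :- c) := a :* b :+ (:- con 1ℚ) :* (a :* c)

ringᵠ₃₆ : ∀ a b → a + (- 1ℚ) * b ≡ a - b
ringᵠ₃₆ = solveᵠ 2 λ a b → a :+ (:- con 1ℚ) :* b := a :- b

-- The product is never expanded into a polynomial: each letter acts on the functional `M` by
-- shifting exponents. A relation such as U⁴ = T⁴ - V⁴ is then imposed through the choice of `M`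
-- alone.
ev : ∀ {n} → Vec Z4 n → Mono → ℚ
ev [] M = M 0 0 0
ev (z0 ∷ v) M = ev v (T⁺ M) + ev v (V⁺ M)
ev (z1 ∷ v) M = ev v (U⁺ M)
ev (z2 ∷ v) M = ev v (T⁺ M) - ev v (V⁺ M)
ev (z3 ∷ v) M = ev v (U⁺ M)

private
  Cs-part : ∀ {n} (v : Vec Z4 n) a (e : Vec Z4 n → ℚ) →
    sumV n (λ u → c4 (a ℕ.+ inner u v) * e u) ≡
    c4 a * sumV n (λ u → c4 (inner u v) * e u) - s4 a * sumV n (λ u → s4 (inner u v) * e u)
  Cs-part {n} v a e = begin
    sumV n (λ u → c4 (a ℕ.+ inner u v) * e u)
      ≡⟨ sumV-cong n (λ u → trans (cong (_* e u) (c4-+ a (inner u v))) (ringᵠ₃₁ (c4 a) (s4 a) (c4 (inner u v)) (s4 (inner u v)) (e u))) ⟩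
    sumV n (λ u → c4 a * (c4 (inner u v) * e u) + (- s4 a) * (s4 (inner u v) * e u))
      ≡⟨ sumV-+ n (λ u → c4 a * (c4 (inner u v) * e u)) (λ u → (- s4 a) * (s4 (inner u v) * e u)) ⟩
    sumV n (λ u → c4 a * (c4 (inner u v) * e u)) + sumV n (λ u → (- s4 a) * (s4 (inner u v) * e u))
      ≡⟨ cong₂ _+_ (sumV-* n (c4 a) (λ u → c4 (inner u v) * e u)) (sumV-* n (- s4 a) (λ u → s4 (inner u v) * e u)) ⟩
    c4 a * sumV n (λ u → c4 (inner u v) * e u) + (- s4 a) * sumV n (λ u → s4 (inner u v) * e u)
      ≡⟨ ringᵠ₃₂ (c4 a) (s4 a) (sumV n (λ u → c4 (inner u v) * e u)) (sumV n (λ u → s4 (inner u v) * e u)) ⟩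
    c4 a * sumV n (λ u → c4 (inner u v) * e u) - s4 a * sumV n (λ u → s4 (inner u v) * e u) ∎
    where
    open ≡-Reasoning

  Ss-part : ∀ {n} (v : Vec Z4 n) a (e : Vec Z4 n → ℚ) →
    sumV n (λ u → s4 (a ℕ.+ inner u v) * e u) ≡
    s4 a * sumV n (λ u → c4 (inner u v) * e u) + c4 a * sumV n (λ u → s4 (inner u v) * e u)
  Ss-part {n} v a e = begin
    sumV n (λ u → s4 (a ℕ.+ inner u v) * e u)
      ≡⟨ sumV-cong n (λ u → trans (cong (_* e u) (s4-+ a (inner u v))) (ringᵠ₃₃ (c4 a) (s4 a) (c4 (inner u v)) (s4 (inner u v)) (e u))) ⟩
    sumV n (λ u → s4 a * (c4 (inner u v) * e u) + c4 a * (s4 (inner u v) * e u))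
      ≡⟨ sumV-+ n (λ u → s4 a * (c4 (inner u v) * e u)) (λ u → c4 a * (s4 (inner u v) * e u)) ⟩
    sumV n (λ u → s4 a * (c4 (inner u v) * e u)) + sumV n (λ u → c4 a * (s4 (inner u v) * e u))
      ≡⟨ cong₂ _+_ (sumV-* n (s4 a) (λ u → c4 (inner u v) * e u)) (sumV-* n (c4 a) (λ u → s4 (inner u v) * e u)) ⟩
    s4 a * sumV n (λ u → c4 (inner u v) * e u) + c4 a * sumV n (λ u → s4 (inner u v) * e u) ∎
    where
    open ≡-Reasoning

  sumV-*+ : ∀ n (b f g : Vec Z4 n → ℚ) → sumV n (λ u → b u * (f u + g u)) ≡ sumV n (λ u → b u * f u) + sumV n (λ u → b u * g u)
  sumV-*+ n b f g = trans (sumV-cong n (λ u → ringᵠ₃₄ (b u) (f u) (g u))) (sumV-+ n (λ u → b u * f u) (λ u → b u * g u))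

  sumV-*- : ∀ n (b f g : Vec Z4 n → ℚ) → sumV n (λ u → b u * (f u - g u)) ≡ sumV n (λ u → b u * f u) - sumV n (λ u → b u * g u)
  sumV-*- n b f g = begin
    sumV n (λ u → b u * (f u - g u)) ≡⟨ sumV-cong n (λ u → ringᵠ₃₅ (b u) (f u) (g u)) ⟩
    sumV n (λ u → b u * f u + (- 1ℚ) * (b u * g u)) ≡⟨ sumV-+ n (λ u → b u * f u) (λ u → (- 1ℚ) * (b u * g u)) ⟩
    sumV n (λ u → b u * f u) + sumV n (λ u → (- 1ℚ) * (b u * g u)) ≡⟨ cong (sumV n (λ u → b u * f u) +_) (sumV-* n (- 1ℚ) (λ u → b u * g u)) ⟩
    sumV n (λ u → b u * f u) + (- 1ℚ) * sumV n (λ u → b u * g u) ≡⟨ ringᵠ₃₆ (sumV n (λ u → b u * f u)) (sumV n (λ u → b u * g u)) ⟩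
    sumV n (λ u → b u * f u) - sumV n (λ u → b u * g u) ∎
    where
    open ≡-Reasoning

ringᵠ₃₇ : ∀ t v u s1 s2 s3 c1 c2 c3 → (0ℚ * (t + v) + 1ℚ * (0ℚ + 0ℚ)) + (s1 * u + c1 * 0ℚ) + (s2 * (t - v) + c2 * (0ℚ - 0ℚ)) + (s3 * u + c3 * 0ℚ) ≡ s1 * u + s2 * (t - v) + s3 * u
ringᵠ₃₇ = solveᵠ 9 λ t v u s1 s2 s3 c1 c2 c3 → con 0ℚ :* (t :+ v) :+ con 1ℚ :* (con 0ℚ :+ con 0ℚ) :+ (s1 :* u :+ c1 :* con 0ℚ) :+ (s2 :* (t :- v) :+ c2 :* (con 0ℚ :- con 0ℚ)) :+ (s3 :* u :+ c3 :* con 0ℚ) := s1 :* u :+ s2 :* (t :- v) :+ s3 :* u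

ringᵠ₃₈ : ∀ t v u s1 s2 s3 c1 c2 c3 → (1ℚ * (t + v) - 0ℚ * (0ℚ + 0ℚ)) + (c1 * u - s1 * 0ℚ) + (c2 * (t - v) - s2 * (0ℚ - 0ℚ)) + (c3 * u - s3 * 0ℚ) ≡ (t + v) + c1 * u + c2 * (t - v) + c3 * u
ringᵠ₃₈ = solveᵠ 9 λ t v u s1 s2 s3 c1 c2 c3 → con 1ℚ :* (t :+ v) :- con 0ℚ :* (con 0ℚ :+ con 0ℚ) :+ (c1 :* u :- s1 :* con 0ℚ) :+ (c2 :* (t :- v) :- s2 :* (con 0ℚ :- con 0ℚ)) :+ (c3 :* u :- s3 :* con 0ℚ) := t :+ v :+ c1 :* u :+ c2 :* (t :- v) :+ c3 :* u

Cs Ss : ∀ {n} → Vec Z4 n → Mono → ℚ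
Cs {n} v M = sumV n (λ u → c4 (inner u v) * ev u M)
Ss {n} v M = sumV n (λ u → s4 (inner u v) * ev u M)

private
  Ss-zero-step : ∀ {n} y (v : Vec Z4 n) M → (∀ M → Ss v M ≡ 0ℚ) → Ss (y ∷ v) M ≡
    s4 (toℕ y) * Cs v (U⁺ M) + s4 (2 ℕ.* toℕ y) * (Cs v (T⁺ M) - Cs v (V⁺ M)) + s4 (3 ℕ.* toℕ y) * Cs v (U⁺ M)
  Ss-zero-step {n} y v M S0 = begin
    Ss (y ∷ v) M
      ≡⟨ cong₂ _+_ (cong₂ _+_ (cong₂ _+_ p0 p1) p2) p3 ⟩
    (0ℚ * (Cs v (T⁺ M) + Cs v (V⁺ M)) + 1ℚ * (0ℚ + 0ℚ)) + (s4 (1 ℕ.* toℕ y) * Cs v (U⁺ M) + c4 (1 ℕ.* toℕ y) * 0ℚ)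
      + (s4 (2 ℕ.* toℕ y) * (Cs v (T⁺ M) - Cs v (V⁺ M)) + c4 (2 ℕ.* toℕ y) * (0ℚ - 0ℚ)) + (s4 (3 ℕ.* toℕ y) * Cs v (U⁺ M) + c4 (3 ℕ.* toℕ y) * 0ℚ)
      ≡⟨ ringᵠ₃₇ (Cs v (T⁺ M)) (Cs v (V⁺ M)) (Cs v (U⁺ M)) (s4 (1 ℕ.* toℕ y)) (s4 (2 ℕ.* toℕ y)) (s4 (3 ℕ.* toℕ y)) (c4 (1 ℕ.* toℕ y)) (c4 (2 ℕ.* toℕ y)) (c4 (3 ℕ.* toℕ y)) ⟩
    s4 (1 ℕ.* toℕ y) * Cs v (U⁺ M) + s4 (2 ℕ.* toℕ y) * (Cs v (T⁺ M) - Cs v (V⁺ M)) + s4 (3 ℕ.* toℕ y) * Cs v (U⁺ M)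
      ≡⟨ cong (λ z → s4 z * Cs v (U⁺ M) + s4 (2 ℕ.* toℕ y) * (Cs v (T⁺ M) - Cs v (V⁺ M)) + s4 (3 ℕ.* toℕ y) * Cs v (U⁺ M)) (ℕₚ.*-identityˡ (toℕ y)) ⟩
    s4 (toℕ y) * Cs v (U⁺ M) + s4 (2 ℕ.* toℕ y) * (Cs v (T⁺ M) - Cs v (V⁺ M)) + s4 (3 ℕ.* toℕ y) * Cs v (U⁺ M) ∎
    where
    open ≡-Reasoning
    C S : Vec Z4 n → ℚ
    C u = c4 (inner u v)
    S u = s4 (inner u v)
    p0 = trans (Ss-part v 0 (λ u → ev u (T⁺ M) + ev u (V⁺ M))) (cong₂ (λ a b → 0ℚ * a + 1ℚ * b)
      (sumV-*+ n C (λ u → ev u (T⁺ M)) (λ u → ev u (V⁺ M)))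
      (trans (sumV-*+ n S (λ u → ev u (T⁺ M)) (λ u → ev u (V⁺ M))) (cong₂ _+_ (S0 (T⁺ M)) (S0 (V⁺ M)))))
    p1 = trans (Ss-part v (1 ℕ.* toℕ y) (λ u → ev u (U⁺ M))) (cong (λ a → s4 (1 ℕ.* toℕ y) * Cs v (U⁺ M) + c4 (1 ℕ.* toℕ y) * a) (S0 (U⁺ M)))
    p2 = trans (Ss-part v (2 ℕ.* toℕ y) (λ u → ev u (T⁺ M) - ev u (V⁺ M))) (cong₂ (λ a b → s4 (2 ℕ.* toℕ y) * a + c4 (2 ℕ.* toℕ y) * b)
      (sumV-*- n C (λ u → ev u (T⁺ M)) (λ u → ev u (V⁺ M)))
      (trans (sumV-*- n S (λ u → ev u (T⁺ M)) (λ u → ev u (V⁺ M))) (cong₂ _-_ (S0 (T⁺ M)) (S0 (V⁺ M)))))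
    p3 = trans (Ss-part v (3 ℕ.* toℕ y) (λ u → ev u (U⁺ M))) (cong (λ a → s4 (3 ℕ.* toℕ y) * Cs v (U⁺ M) + c4 (3 ℕ.* toℕ y) * a) (S0 (U⁺ M)))

  Cs-step : ∀ {n} y (v : Vec Z4 n) M → (∀ M → Ss v M ≡ 0ℚ) → Cs (y ∷ v) M ≡
    (Cs v (T⁺ M) + Cs v (V⁺ M)) + c4 (toℕ y) * Cs v (U⁺ M) + c4 (2 ℕ.* toℕ y) * (Cs v (T⁺ M) - Cs v (V⁺ M)) + c4 (3 ℕ.* toℕ y) * Cs v (U⁺ M)
  Cs-step {n} y v M S0 = begin
    Cs (y ∷ v) M
      ≡⟨ cong₂ _+_ (cong₂ _+_ (cong₂ _+_ p0 p1) p2) p3 ⟩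
    (1ℚ * (Cs v (T⁺ M) + Cs v (V⁺ M)) - 0ℚ * (0ℚ + 0ℚ)) + (c4 (1 ℕ.* toℕ y) * Cs v (U⁺ M) - s4 (1 ℕ.* toℕ y) * 0ℚ)
      + (c4 (2 ℕ.* toℕ y) * (Cs v (T⁺ M) - Cs v (V⁺ M)) - s4 (2 ℕ.* toℕ y) * (0ℚ - 0ℚ)) + (c4 (3 ℕ.* toℕ y) * Cs v (U⁺ M) - s4 (3 ℕ.* toℕ y) * 0ℚ)
      ≡⟨ ringᵠ₃₈ (Cs v (T⁺ M)) (Cs v (V⁺ M)) (Cs v (U⁺ M)) (s4 (1 ℕ.* toℕ y)) (s4 (2 ℕ.* toℕ y)) (s4 (3 ℕ.* toℕ y)) (c4 (1 ℕ.* toℕ y)) (c4 (2 ℕ.* toℕ y)) (c4 (3 ℕ.* toℕ y)) ⟩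
    (Cs v (T⁺ M) + Cs v (V⁺ M)) + c4 (1 ℕ.* toℕ y) * Cs v (U⁺ M) + c4 (2 ℕ.* toℕ y) * (Cs v (T⁺ M) - Cs v (V⁺ M)) + c4 (3 ℕ.* toℕ y) * Cs v (U⁺ M)
      ≡⟨ cong (λ z → (Cs v (T⁺ M) + Cs v (V⁺ M)) + c4 z * Cs v (U⁺ M) + c4 (2 ℕ.* toℕ y) * (Cs v (T⁺ M) - Cs v (V⁺ M)) + c4 (3 ℕ.* toℕ y) * Cs v (U⁺ M)) (ℕₚ.*-identityˡ (toℕ y)) ⟩
    (Cs v (T⁺ M) + Cs v (V⁺ M)) + c4 (toℕ y) * Cs v (U⁺ M) + c4 (2 ℕ.* toℕ y) * (Cs v (T⁺ M) - Cs v (V⁺ M)) + c4 (3 ℕ.* toℕ y) * Cs v (U⁺ M) ∎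
    where
    open ≡-Reasoning
    C S : Vec Z4 n → ℚ
    C u = c4 (inner u v)
    S u = s4 (inner u v)
    p0 = trans (Cs-part v 0 (λ u → ev u (T⁺ M) + ev u (V⁺ M))) (cong₂ (λ a b → 1ℚ * a - 0ℚ * b)
      (sumV-*+ n C (λ u → ev u (T⁺ M)) (λ u → ev u (V⁺ M)))
      (trans (sumV-*+ n S (λ u → ev u (T⁺ M)) (λ u → ev u (V⁺ M))) (cong₂ _+_ (S0 (T⁺ M)) (S0 (V⁺ M)))))
    p1 = trans (Cs-part v (1 ℕ.* toℕ y) (λ u → ev u (U⁺ M))) (cong (λ a → c4 (1 ℕ.* toℕ y) * Cs v (U⁺ M) - s4 (1 ℕ.* toℕ y) * a) (S0 (U⁺ M)))
    p2 = trans (Cs-part v (2 ℕ.* toℕ y) (λ u → ev u (T⁺ M) - ev u (V⁺ M))) (cong₂ (λ a b → c4 (2 ℕ.* toℕ y) * a - s4 (2 ℕ.* toℕ y) * b)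
      (sumV-*- n C (λ u → ev u (T⁺ M)) (λ u → ev u (V⁺ M)))
      (trans (sumV-*- n S (λ u → ev u (T⁺ M)) (λ u → ev u (V⁺ M))) (cong₂ _-_ (S0 (T⁺ M)) (S0 (V⁺ M)))))
    p3 = trans (Cs-part v (3 ℕ.* toℕ y) (λ u → ev u (U⁺ M))) (cong (λ a → c4 (3 ℕ.* toℕ y) * Cs v (U⁺ M) - s4 (3 ℕ.* toℕ y) * a) (S0 (U⁺ M)))

2ℚ : ℚ
2ℚ = pos 2 / 1

ringᵠ₃₉ : ∀ t v u → 0ℚ * u + 0ℚ * (t - v) + 0ℚ * u ≡ 0ℚ
ringᵠ₃₉ = solveᵠ 3 λ t v u → con 0ℚ :* u :+ con 0ℚ :* (t :- v) :+ con 0ℚ :* u := con 0ℚ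

ringᵠ₄₀ : ∀ t v u → 1ℚ * u + 0ℚ * (t - v) + (- 1ℚ) * u ≡ 0ℚ
ringᵠ₄₀ = solveᵠ 3 λ t v u → con 1ℚ :* u :+ con 0ℚ :* (t :- v) :+ (:- con 1ℚ) :* u := con 0ℚ

ringᵠ₄₁ : ∀ t v u → (- 1ℚ) * u + 0ℚ * (t - v) + 1ℚ * u ≡ 0ℚ
ringᵠ₄₁ = solveᵠ 3 λ t v u → (:- con 1ℚ) :* u :+ con 0ℚ :* (t :- v) :+ con 1ℚ :* u := con 0ℚ

-- The letters 1 and 3 have the same image `U`, so the imaginary parts cancel in every coordinate
-- and the transform is real.
Ss-zero : ∀ {n} (v : Vec Z4 n) M → Ss v M ≡ 0ℚ
Ss-zero [] M = ℚₚ.*-zeroˡ (M 0 0 0)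
Ss-zero (z0 ∷ v) M = trans (Ss-zero-step z0 v M (Ss-zero v)) (ringᵠ₃₉ (Cs v (T⁺ M)) (Cs v (V⁺ M)) (Cs v (U⁺ M)))
Ss-zero (z1 ∷ v) M = trans (Ss-zero-step z1 v M (Ss-zero v)) (ringᵠ₄₀ (Cs v (T⁺ M)) (Cs v (V⁺ M)) (Cs v (U⁺ M)))
Ss-zero (z2 ∷ v) M = trans (Ss-zero-step z2 v M (Ss-zero v)) (ringᵠ₃₉ (Cs v (T⁺ M)) (Cs v (V⁺ M)) (Cs v (U⁺ M)))
Ss-zero (z3 ∷ v) M = trans (Ss-zero-step z3 v M (Ss-zero v)) (ringᵠ₄₁ (Cs v (T⁺ M)) (Cs v (V⁺ M)) (Cs v (U⁺ M)))

ringᵠ₄₂ : ∀ t v u → (t + v) + 1ℚ * u + 1ℚ * (t - v) + 1ℚ * u ≡ 2ℚ * (t + u)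
ringᵠ₄₂ = solveᵠ 3 λ t v u → t :+ v :+ con 1ℚ :* u :+ con 1ℚ :* (t :- v) :+ con 1ℚ :* u := con 2ℚ :* (t :+ u)

ringᵠ₄₃ : ∀ p a b → 2ℚ * (p * a + p * b) ≡ 2ℚ * p * (a + b)
ringᵠ₄₃ = solveᵠ 3 λ p a b → con 2ℚ :* (p :* a :+ p :* b) := con 2ℚ :* p :* (a :+ b)

ringᵠ₄₄ : ∀ t v u → (t + v) + 0ℚ * u + (- 1ℚ) * (t - v) + 0ℚ * u ≡ 2ℚ * v
ringᵠ₄₄ = solveᵠ 3 λ t v u → t :+ v :+ con 0ℚ :* u :+ (:- con 1ℚ) :* (t :- v) :+ con 0ℚ :* u := con 2ℚ :* v

ringᵠ₄₅ : ∀ t v u → (t + v) + (- 1ℚ) * u + 1ℚ * (t - v) + (- 1ℚ) * u ≡ 2ℚ * (t - u)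
ringᵠ₄₅ = solveᵠ 3 λ t v u → t :+ v :+ (:- con 1ℚ) :* u :+ con 1ℚ :* (t :- v) :+ (:- con 1ℚ) :* u := con 2ℚ :* (t :- u)

ringᵠ₄₆ : ∀ p a b → 2ℚ * (p * a - p * b) ≡ 2ℚ * p * (a - b)
ringᵠ₄₆ = solveᵠ 3 λ p a b → con 2ℚ :* (p :* a :- p :* b) := con 2ℚ :* p :* (a :- b)

-- This is why the letters are chosen as they are: in one coordinate the Fourier transform of (T +
-- V, U, T - V, U) is 2 (T + U, V, T - U, V), so it merely exchanges U and V and fixes T.
fourier-ev : ∀ {n} (v : Vec Z4 n) M → Cs v M ≡ 2ℚ ^ n * ev v (swap M)
fourier-ev [] M = refl
fourier-ev {suc n} (z0 ∷ v) M = begin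
  Cs (z0 ∷ v) M ≡⟨ Cs-step z0 v M (Ss-zero v) ⟩
  (Cs v (T⁺ M) + Cs v (V⁺ M)) + 1ℚ * Cs v (U⁺ M) + 1ℚ * (Cs v (T⁺ M) - Cs v (V⁺ M)) + 1ℚ * Cs v (U⁺ M)
    ≡⟨ ringᵠ₄₂ (Cs v (T⁺ M)) (Cs v (V⁺ M)) (Cs v (U⁺ M)) ⟩
  2ℚ * (Cs v (T⁺ M) + Cs v (U⁺ M)) ≡⟨ cong₂ (λ a b → 2ℚ * (a + b)) (fourier-ev v (T⁺ M)) (fourier-ev v (U⁺ M)) ⟩
  2ℚ * (2ℚ ^ n * ev v (T⁺ (swap M)) + 2ℚ ^ n * ev v (V⁺ (swap M))) ≡⟨ ringᵠ₄₃ (2ℚ ^ n) (ev v (T⁺ (swap M))) (ev v (V⁺ (swap M))) ⟩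
  2ℚ * 2ℚ ^ n * (ev v (T⁺ (swap M)) + ev v (V⁺ (swap M))) ∎
  where
  open ≡-Reasoning
fourier-ev {suc n} (z1 ∷ v) M = begin
  Cs (z1 ∷ v) M ≡⟨ Cs-step z1 v M (Ss-zero v) ⟩
  (Cs v (T⁺ M) + Cs v (V⁺ M)) + 0ℚ * Cs v (U⁺ M) + (- 1ℚ) * (Cs v (T⁺ M) - Cs v (V⁺ M)) + 0ℚ * Cs v (U⁺ M)
    ≡⟨ ringᵠ₄₄ (Cs v (T⁺ M)) (Cs v (V⁺ M)) (Cs v (U⁺ M)) ⟩
  2ℚ * Cs v (V⁺ M) ≡⟨ cong (2ℚ *_) (fourier-ev v (V⁺ M)) ⟩
  2ℚ * (2ℚ ^ n * ev v (U⁺ (swap M))) ≡⟨ sym (ℚₚ.*-assoc 2ℚ (2ℚ ^ n) (ev v (U⁺ (swap M)))) ⟩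
  2ℚ * 2ℚ ^ n * ev v (U⁺ (swap M)) ∎
  where
  open ≡-Reasoning
fourier-ev {suc n} (z2 ∷ v) M = begin
  Cs (z2 ∷ v) M ≡⟨ Cs-step z2 v M (Ss-zero v) ⟩
  (Cs v (T⁺ M) + Cs v (V⁺ M)) + (- 1ℚ) * Cs v (U⁺ M) + 1ℚ * (Cs v (T⁺ M) - Cs v (V⁺ M)) + (- 1ℚ) * Cs v (U⁺ M)
    ≡⟨ ringᵠ₄₅ (Cs v (T⁺ M)) (Cs v (V⁺ M)) (Cs v (U⁺ M)) ⟩
  2ℚ * (Cs v (T⁺ M) - Cs v (U⁺ M)) ≡⟨ cong₂ (λ a b → 2ℚ * (a - b)) (fourier-ev v (T⁺ M)) (fourier-ev v (U⁺ M)) ⟩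
  2ℚ * (2ℚ ^ n * ev v (T⁺ (swap M)) - 2ℚ ^ n * ev v (V⁺ (swap M))) ≡⟨ ringᵠ₄₆ (2ℚ ^ n) (ev v (T⁺ (swap M))) (ev v (V⁺ (swap M))) ⟩
  2ℚ * 2ℚ ^ n * (ev v (T⁺ (swap M)) - ev v (V⁺ (swap M))) ∎
  where
  open ≡-Reasoning
fourier-ev {suc n} (z3 ∷ v) M = begin
  Cs (z3 ∷ v) M ≡⟨ Cs-step z3 v M (Ss-zero v) ⟩
  (Cs v (T⁺ M) + Cs v (V⁺ M)) + 0ℚ * Cs v (U⁺ M) + (- 1ℚ) * (Cs v (T⁺ M) - Cs v (V⁺ M)) + 0ℚ * Cs v (U⁺ M)
    ≡⟨ ringᵠ₄₄ (Cs v (T⁺ M)) (Cs v (V⁺ M)) (Cs v (U⁺ M)) ⟩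
  2ℚ * Cs v (V⁺ M) ≡⟨ cong (2ℚ *_) (fourier-ev v (V⁺ M)) ⟩
  2ℚ * (2ℚ ^ n * ev v (U⁺ (swap M))) ≡⟨ sym (ℚₚ.*-assoc 2ℚ (2ℚ ^ n) (ev v (U⁺ (swap M)))) ⟩
  2ℚ * 2ℚ ^ n * ev v (U⁺ (swap M)) ∎
  where
  open ≡-Reasoning

n₁ n₂ : ∀ {n} → Vec Z4 n → ℕ
n₁ [] = 0
n₁ (z0 ∷ v) = n₁ v
n₁ (z1 ∷ v) = suc (n₁ v)
n₁ (z2 ∷ v) = n₁ v
n₁ (z3 ∷ v) = suc (n₁ v)
n₂ [] = 0
n₂ (z0 ∷ v) = n₂ v
n₂ (z1 ∷ v) = n₂ v
n₂ (z2 ∷ v) = suc (n₂ v)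
n₂ (z3 ∷ v) = n₂ v

ringⁿ₅ : ∀ a b → 4 ℕ.+ (a ℕ.+ 4 ℕ.* b) ≡ a ℕ.+ 4 ℕ.* suc b
ringⁿ₅ = ℕR.solve-∀

wtE-count : ∀ {n} (v : Vec Z4 n) → wtE v ≡ n₁ v ℕ.+ 4 ℕ.* n₂ v
wtE-count [] = refl
wtE-count (z0 ∷ v) = wtE-count v
wtE-count (z1 ∷ v) = cong suc (wtE-count v)
wtE-count (z2 ∷ v) = trans (cong (4 ℕ.+_) (wtE-count v)) (ringⁿ₅ (n₁ v) (n₂ v))
wtE-count (z3 ∷ v) = cong suc (wtE-count v)

-- Only these monomials can occur in the product of a word: U arises from the letters ±1 and from
-- nothing else, and every letter is linear.
Agree : ∀ {n} → Vec Z4 n → Mono → Mono → Set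
Agree {n} v M M' = ∀ p r o → p ≡ n₁ v → p ℕ.+ r ℕ.+ o ≡ n → M p r o ≡ M' p r o

private
  sucʳ : ∀ p r o n → p ℕ.+ r ℕ.+ o ≡ n → p ℕ.+ r ℕ.+ suc o ≡ suc n
  sucʳ p r o n e = trans (ℕₚ.+-suc (p ℕ.+ r) o) (cong suc e)
  sucᵐ : ∀ p r o n → p ℕ.+ r ℕ.+ o ≡ n → p ℕ.+ suc r ℕ.+ o ≡ suc n
  sucᵐ p r o n e = trans (cong (ℕ._+ o) (ℕₚ.+-suc p r)) (cong suc e)

ev-cong : ∀ {n} (v : Vec Z4 n) M M' → Agree v M M' → ev v M ≡ ev v M'
ev-cong [] M M' h = h 0 0 0 refl refl
ev-cong {suc n} (z0 ∷ v) M M' h = cong₂ _+_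
  (ev-cong v (T⁺ M) (T⁺ M') (λ p r o e e' → h p r (suc o) e (sucʳ p r o n e')))
  (ev-cong v (V⁺ M) (V⁺ M') (λ p r o e e' → h p (suc r) o e (sucᵐ p r o n e')))
ev-cong {suc n} (z1 ∷ v) M M' h = ev-cong v (U⁺ M) (U⁺ M') (λ p r o e e' → h (suc p) r o (cong suc e) (cong suc e'))
ev-cong {suc n} (z2 ∷ v) M M' h = cong₂ _-_
  (ev-cong v (T⁺ M) (T⁺ M') (λ p r o e e' → h p r (suc o) e (sucʳ p r o n e')))
  (ev-cong v (V⁺ M) (V⁺ M') (λ p r o e e' → h p (suc r) o e (sucᵐ p r o n e')))
ev-cong {suc n} (z3 ∷ v) M M' h = ev-cong v (U⁺ M) (U⁺ M') (λ p r o e e' → h (suc p) r o (cong suc e) (cong suc e'))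

ringᵠ₄₇ : ∀ a b c d → a + b + (c + d) ≡ a + c + (b + d)
ringᵠ₄₇ = solveᵠ 4 λ a b c d → a :+ b :+ (c :+ d) := a :+ c :+ (b :+ d)

ringᵠ₄₈ : ∀ a b c d → a + b - (c + d) ≡ a - c + (b - d)
ringᵠ₄₈ = solveᵠ 4 λ a b c d → a :+ b :- (c :+ d) := a :- c :+ (b :- d)

ev-+ : ∀ {n} (v : Vec Z4 n) M M' → ev v (λ p r o → M p r o + M' p r o) ≡ ev v M + ev v M'
ev-+ [] M M' = refl
ev-+ (z0 ∷ v) M M' = trans (cong₂ _+_ (ev-+ v (T⁺ M) (T⁺ M')) (ev-+ v (V⁺ M) (V⁺ M'))) (ringᵠ₄₇ (ev v (T⁺ M)) (ev v (T⁺ M')) (ev v (V⁺ M)) (ev v (V⁺ M')))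
ev-+ (z1 ∷ v) M M' = ev-+ v (U⁺ M) (U⁺ M')
ev-+ (z2 ∷ v) M M' = trans (cong₂ _-_ (ev-+ v (T⁺ M) (T⁺ M')) (ev-+ v (V⁺ M) (V⁺ M'))) (ringᵠ₄₈ (ev v (T⁺ M)) (ev v (T⁺ M')) (ev v (V⁺ M)) (ev v (V⁺ M')))
ev-+ (z3 ∷ v) M M' = ev-+ v (U⁺ M) (U⁺ M')

ringᵠ₄₉ : ∀ a b c → a * b + a * c ≡ a * (b + c)
ringᵠ₄₉ = solveᵠ 3 λ a b c → a :* b :+ a :* c := a :* (b :+ c)

ringᵠ₅₀ : ∀ a b c → a * b - a * c ≡ a * (b - c)
ringᵠ₅₀ = solveᵠ 3 λ a b c → a :* b :- a :* c := a :* (b :- c)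

ev-*U : ∀ {n} (v : Vec Z4 n) (a : ℕ → ℚ) M → ev v (λ p r o → a p * M p r o) ≡ a (n₁ v) * ev v M
ev-*U [] a M = refl
ev-*U (z0 ∷ v) a M = trans (cong₂ _+_ (ev-*U v a (T⁺ M)) (ev-*U v a (V⁺ M))) (ringᵠ₄₉ (a (n₁ v)) (ev v (T⁺ M)) (ev v (V⁺ M)))
ev-*U (z1 ∷ v) a M = ev-*U v (λ p → a (suc p)) (U⁺ M)
ev-*U (z2 ∷ v) a M = trans (cong₂ _-_ (ev-*U v a (T⁺ M)) (ev-*U v a (V⁺ M))) (ringᵠ₅₀ (a (n₁ v)) (ev v (T⁺ M)) (ev v (V⁺ M)))
ev-*U (z3 ∷ v) a M = ev-*U v (λ p → a (suc p)) (U⁺ M)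

swapVT : Mono → Mono
swapVT M p r o = M p o r

ringᵠ₅₁ : ∀ a b c → a * b + a * c ≡ a * (c + b)
ringᵠ₅₁ = solveᵠ 3 λ a b c → a :* b :+ a :* c := a :* (c :+ b)

ringᵠ₅₂ : ∀ a b c → a * b - a * c ≡ - a * (c - b)
ringᵠ₅₂ = solveᵠ 3 λ a b c → a :* b :- a :* c := (:- a) :* (c :- b)

-- Exchanging V and T fixes T + V and U and negates T - V, so the sign is (-1)^n₂.
ev-swapVT : ∀ {n} (v : Vec Z4 n) M → ev v (swapVT M) ≡ sg (4 ℕ.* n₂ v) * ev v M
ev-swapVT [] M = sym (ℚₚ.*-identityˡ (M 0 0 0))
ev-swapVT (z0 ∷ v) M = trans (cong₂ _+_ (ev-swapVT v (V⁺ M)) (ev-swapVT v (T⁺ M))) (ringᵠ₅₁ (sg (4 ℕ.* n₂ v)) (ev v (V⁺ M)) (ev v (T⁺ M)))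
ev-swapVT (z1 ∷ v) M = ev-swapVT v (U⁺ M)
ev-swapVT (z2 ∷ v) M = trans (cong₂ _-_ (ev-swapVT v (V⁺ M)) (ev-swapVT v (T⁺ M)))
  (trans (ringᵠ₅₂ (sg (4 ℕ.* n₂ v)) (ev v (V⁺ M)) (ev v (T⁺ M))) (cong (λ z → sg z * (ev v (T⁺ M) - ev v (V⁺ M))) (sym (ℕₚ.*-suc 4 (n₂ v)))))
ev-swapVT (z3 ∷ v) M = ev-swapVT v (U⁺ M)

any-Vec? : ∀ n (P : Vec Z4 n → Set) → (∀ v → Dec (P v)) → Dec (∃ P)
any-Vec? zero P d with d []
... | yes p = yes ([] , p)
... | no q = no λ { ([] , p) → q p }
any-Vec? (suc n) P d with Finₚ.any? (λ x → any-Vec? n (λ v → P (x ∷ v)) (λ v → d (x ∷ v)))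
... | yes (x , v , p) = yes (x ∷ v , p)
... | no q = no λ { (x ∷ v , p) → q (x , v , p) }

indicator : ∀ {A : Set} → Dec A → ℚ
indicator (yes _) = 1ℚ
indicator (no _) = 0ℚ

4∣-split : ∀ a k b → a ℕ.+ 4 ℕ.* k ≡ b → 4 ∣ b → 4 ∣ a
4∣-split a k b refl d = ∣.∣m+n∣m⇒∣n (subst (4 ∣_) (ℕₚ.+-comm a (4 ℕ.* k)) d) (divides k (ℕₚ.*-comm 4 k))

-- Linear conditions on the symmetrized weight enumerator: x^m y^l + x^l y^m in terms of the (xy)^j (x+y)^i

powE : ℕ → (ℕ → ℕ → ℚ) → ℚ
powE zero H = H 0 0 + H 0 0
powE (suc zero) H = H 0 1
-- Newton's recurrence p_l = (x + y) p_(l-1) - xy p_(l-2), with `H j i` standing for the value of a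
-- linear functional at (xy)^j (x + y)^i.
powE (suc (suc l)) H = powE (suc l) (λ j i → H j (suc i)) - powE l (λ j i → H (suc j) i)

symE : ℕ → ℕ → (ℕ → ℕ → ℚ) → ℚ
symE zero l H = powE l H
symE (suc m) zero H = powE (suc m) H
symE (suc m) (suc l) H = symE m l (λ j i → H (suc j) i)

powE-cong : ∀ l {H H'} → (∀ j i → 2 ℕ.* j ℕ.+ i ≡ l → H j i ≡ H' j i) → powE l H ≡ powE l H'
powE-cong zero h = cong₂ _+_ (h 0 0 refl) (h 0 0 refl)
powE-cong (suc zero) h = h 0 1 refl
powE-cong (suc (suc l)) h = cong₂ _-_
  (powE-cong (suc l) (λ j i e → h j (suc i) (trans (ℕₚ.+-suc (2 ℕ.* j) i) (cong suc e))))
  (powE-cong l (λ j i e → h (suc j) i (trans (cong (ℕ._+ i) (ℕₚ.*-suc 2 j)) (cong (2 ℕ.+_) e))))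

symE-cong : ∀ m l {H H'} → (∀ j i → 2 ℕ.* j ℕ.+ i ≡ m ℕ.+ l → H j i ≡ H' j i) → symE m l H ≡ symE m l H'
symE-cong zero l h = powE-cong l h
symE-cong (suc m) zero h = powE-cong (suc m) (λ j i e → h j i (trans e (sym (ℕₚ.+-identityʳ (suc m)))))
symE-cong (suc m) (suc l) h = symE-cong m l (λ j i e → h (suc j) i
  (trans (cong (ℕ._+ i) (ℕₚ.*-suc 2 j)) (trans (cong (2 ℕ.+_) e) (cong suc (sym (ℕₚ.+-suc m l))))))

ringᵠ₅₃ : ∀ c a b → c * a - c * b ≡ c * (a - b)
ringᵠ₅₃ = solveᵠ 3 λ c a b → c :* a :- c :* b := c :* (a :- b)

powE-* : ∀ l c H → powE l (λ j i → c * H j i) ≡ c * powE l H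
powE-* zero c H = sym (ℚₚ.*-distribˡ-+ c (H 0 0) (H 0 0))
powE-* (suc zero) c H = refl
powE-* (suc (suc l)) c H = trans (cong₂ _-_ (powE-* (suc l) c (λ j i → H j (suc i))) (powE-* l c (λ j i → H (suc j) i)))
  (ringᵠ₅₃ c (powE (suc l) (λ j i → H j (suc i))) (powE l (λ j i → H (suc j) i)))

symE-* : ∀ m l c H → symE m l (λ j i → c * H j i) ≡ c * symE m l H
symE-* zero l c H = powE-* l c H
symE-* (suc m) zero c H = powE-* (suc m) c H
symE-* (suc m) (suc l) c H = symE-* m l c (λ j i → H (suc j) i)

δ : ℕ → ℕ → ℚ
δ J j = indicator (J ℕ.≟ j)

ringⁿ₆ : ∀ k → 4 ℕ.* (2 ℕ.* k) ≡ 8 ℕ.* k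
ringⁿ₆ = ℕR.solve-∀

ringᵠ₅₄ : ∀ χ w w' c s c' s' → χ * (w * w' * (c * c' - s * s')) ≡ w' * c' * (χ * (w * c)) + - (w' * s') * (χ * (w * s))
ringᵠ₅₄ = solveᵠ 7 λ χ w w' c s c' s' → χ :* (w :* w' :* (c :* c' :- s :* s')) := w' :* c' :* (χ :* (w :* c)) :+ (:- (w' :* s')) :* (χ :* (w :* s))

ringᵠ₅₅ : ∀ χ w w' c s c' s' → χ * (w * w' * (s * c' + c * s')) ≡ w' * s' * (χ * (w * c)) + w' * c' * (χ * (w * s))
ringᵠ₅₅ = solveᵠ 7 λ χ w w' c s c' s' → χ :* (w :* w' :* (s :* c' :+ c :* s')) := w' :* s' :* (χ :* (w :* c)) :+ w' :* c' :* (χ :* (w :* s))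

ringᵠ₅₆ : ∀ w c s → w * c * (w * c) + w * s * (w * s) ≡ w * w * (c * c + s * s)
ringᵠ₅₆ = solveᵠ 3 λ w c s → w :* c :* (w :* c) :+ w :* s :* (w :* s) := w :* w :* (c :* c :+ s :* s)

ringᵠ₅₇ : ∀ a → a ≡ 1ℚ - (1ℚ - a)
ringᵠ₅₇ = solveᵠ 1 λ a → a := con 1ℚ :- (con 1ℚ :- a)

ringᵠ₅₈ : ∀ a → a ≡ pos 1 / 2 * (a + a)
ringᵠ₅₈ = solveᵠ 1 λ a → a := con (pos 1 / 2) :* (a :+ a)

ringᵠ₅₉ : ∀ b → pos 1 / 2 * 0ℚ * b ≡ 0ℚ
ringᵠ₅₉ = solveᵠ 1 λ b → con (pos 1 / 2) :* con 0ℚ :* b := con 0ℚ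

ringᵠ₆₀ : ∀ a b N S → (1ℚ - a) * N + (1ℚ - a) * N ≡ (1ℚ - a) * (N - (a * N + - b * S)) - b * (S - (b * N + a * S)) + (1ℚ - (a * a + b * b)) * N
ringᵠ₆₀ = solveᵠ 4 λ a b N S → (con 1ℚ :- a) :* N :+ (con 1ℚ :- a) :* N := (con 1ℚ :- a) :* (N :- (a :* N :+ (:- b) :* S)) :- b :* (S :- (b :* N :+ a :* S)) :+ (con 1ℚ :- (a :* a :+ b :* b)) :* N

ringᵠ₆₁ : ∀ a b N → (1ℚ - a) * 0ℚ - b * 0ℚ + (1ℚ - 1ℚ) * N ≡ 0ℚ
ringᵠ₆₁ = solveᵠ 3 λ a b N → (con 1ℚ :- a) :* con 0ℚ :- b :* con 0ℚ :+ (con 1ℚ :- con 1ℚ) :* N := con 0ℚ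

ringᵠ₆₂ : ∀ e χ w c → e * (χ * (w * c)) ≡ χ * w * (c * e)
ringᵠ₆₂ = solveᵠ 4 λ e χ w c → e :* (χ :* (w :* c)) := χ :* w :* (c :* e)

ringᵠ₆₃ : ∀ χ w p e → χ * w * (p * e) ≡ p * (χ * (w * e))
ringᵠ₆₃ = solveᵠ 4 λ χ w p e → χ :* w :* (p :* e) := p :* (χ :* (w :* e))

-- Character sums over a self-dual code.

module SelfDualCode {n : ℕ} (C : Code n) (sd : SelfDual C) (C? : ∀ v → Dec (C v)) where

  χ : Vec Z4 n → ℚ
  χ v = indicator (C? v)

  χ-nonneg : ∀ v → 0ℚ ≤ χ v
  χ-nonneg v with C? v
  ... | yes _ = 0≤1
  ... | no _ = ≤-refl

  χ* : ∀ v {a b : ℚ} → (C v → a ≡ b) → χ v * a ≡ χ v * b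
  χ* v {a} {b} h with C? v
  ... | yes c = cong (1ℚ *_) (h c)
  ... | no _ = trans (ℚₚ.*-zeroˡ a) (sym (ℚₚ.*-zeroˡ b))

  χ-iff : ∀ v w → (C v → C w) → (C w → C v) → χ v ≡ χ w
  χ-iff v w f g with C? v | C? w
  ... | yes _ | yes _ = refl
  ... | no _ | no _ = refl
  ... | yes a | no b = ⊥-elim (b (f a))
  ... | no a | yes b = ⊥-elim (a (g b))

  4∣inner : ∀ {v w} → C v → C w → 4 ∣ inner v w
  4∣inner {v} {w} a b = ∣.m%n≡0⇒n∣m (inner v w) 4 (proj₁ (sd v) a w b)

  dual⇒C : ∀ v → (∀ w → C w → 4 ∣ inner w v) → C v
  dual⇒C v h = proj₂ (sd v) (λ w c → ∣.n∣m⇒m%n≡0 (inner v w) 4 (subst (4 ∣_) (inner-comm w v) (h w c)))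

  C-⊞ : ∀ {v w} → C v → C w → C (v ⊞ᵛ w)
  C-⊞ {v} {w} a b = dual⇒C (v ⊞ᵛ w) λ x c → let k , e = inner-⊞ x v w in
    4∣-split (inner x (v ⊞ᵛ w)) k (inner x v ℕ.+ inner x w) e (∣.∣m∣n⇒∣m+n (4∣inner c a) (4∣inner c b))

  -- Closure under subtraction without introducing negatives: `v` is orthogonal to every codeword
  -- because `v ⊞ᵛ w` and `w` are.
  C-⊞⁻ : ∀ {v w} → C (v ⊞ᵛ w) → C w → C v
  C-⊞⁻ {v} {w} a b = dual⇒C v λ x c → let k , e = inner-⊞ x v w in
    ∣.∣m+n∣m⇒∣n (subst (4 ∣_) (trans e (ℕₚ.+-comm (inner x v) (inner x w))) (∣.∣m∣n⇒∣m+n (4∣inner c a) (divides k (ℕₚ.*-comm 4 k)))) (4∣inner c b)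

  χ-shift : ∀ v {w} → C w → χ (v ⊞ᵛ w) ≡ χ v
  χ-shift v {w} c = χ-iff (v ⊞ᵛ w) v (λ a → C-⊞⁻ a c) (λ a → C-⊞ a c)

  inner-0 : ∀ {m} (v : Vec Z4 m) → inner v (replicate m zero) ≡ 0
  inner-0 [] = refl
  inner-0 (x ∷ v) = cong₂ ℕ._+_ (ℕₚ.*-zeroʳ (toℕ x)) (inner-0 v)

  C-0 : C (replicate n zero)
  C-0 = dual⇒C (replicate n zero) λ w _ → subst (4 ∣_) (sym (inner-0 w)) (divides 0 refl)

  card : ℚ
  card = sumV n χ

  card-pos : 0ℚ < card
  card-pos = ℚₚ.<-≤-trans 0<1 (≤-trans (one) (sumV-≥-term n χ χ-nonneg (replicate n zero)))
    where
    one : 1ℚ ≤ χ (replicate n zero)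
    one with C? (replicate n zero)
    ... | yes _ = ≤-refl
    ... | no q = ⊥-elim (q C-0)

  4∣wtE : ∀ {v} → C v → 4 ∣ wtE v
  4∣wtE {v} c = let k , e = inner-self v in
    4∣-split (wtE v) (2 ℕ.* k) (inner v v) (trans (cong (wtE v ℕ.+_) (ringⁿ₆ k)) e) (4∣inner c c)

  4∣n₁ : ∀ {v} → C v → 4 ∣ n₁ v
  4∣n₁ {v} c = 4∣-split (n₁ v) (n₂ v) (wtE v) (sym (wtE-count v)) (4∣wtE c)

  -- Orthogonality for the characters v ↦ w v · i^⟨u,v⟩ of C, where w takes the values ±1

  module _ (w : Vec Z4 n → ℚ) (w-⊞ : ∀ {v v'} → C v → C v' → w (v ⊞ᵛ v') ≡ w v * w v') (w-sq : ∀ {v} → C v → w v * w v ≡ 1ℚ) where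

    Nc Ns : Vec Z4 n → ℚ
    Nc u = sumV n (λ v → χ v * (w v * c4 (inner u v)))
    Ns u = sumV n (λ v → χ v * (w v * s4 (inner u v)))

    private
      combine : ∀ (u : Vec Z4 n) a b (g h : Vec Z4 n → ℚ) →
        sumV n (λ v → a * (χ v * g v) + b * (χ v * h v)) ≡ a * sumV n (λ v → χ v * g v) + b * sumV n (λ v → χ v * h v)
      combine u a b g h = trans (sumV-+ n (λ v → a * (χ v * g v)) (λ v → b * (χ v * h v)))
        (cong₂ _+_ (sumV-* n a (λ v → χ v * g v)) (sumV-* n b (λ v → χ v * h v)))

    Nc-shift : ∀ u {x} → C x → Nc u ≡ w x * c4 (inner u x) * Nc u + - (w x * s4 (inner u x)) * Ns u
    Nc-shift u {x} c = begin
      Nc u ≡⟨ sumV-shift n x (λ v → χ v * (w v * c4 (inner u v))) ⟨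
      sumV n (λ v → χ (v ⊞ᵛ x) * (w (v ⊞ᵛ x) * c4 (inner u (v ⊞ᵛ x)))) ≡⟨ sumV-cong n term ⟩
      sumV n (λ v → w x * c4 (inner u x) * (χ v * (w v * c4 (inner u v))) + - (w x * s4 (inner u x)) * (χ v * (w v * s4 (inner u v))))
        ≡⟨ combine u (w x * c4 (inner u x)) (- (w x * s4 (inner u x))) (λ v → w v * c4 (inner u v)) (λ v → w v * s4 (inner u v)) ⟩
      w x * c4 (inner u x) * Nc u + - (w x * s4 (inner u x)) * Ns u ∎
      where
      open ≡-Reasoning
      term : ∀ v → χ (v ⊞ᵛ x) * (w (v ⊞ᵛ x) * c4 (inner u (v ⊞ᵛ x))) ≡
        w x * c4 (inner u x) * (χ v * (w v * c4 (inner u v))) + - (w x * s4 (inner u x)) * (χ v * (w v * s4 (inner u v)))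
      term v = trans (cong (_* (w (v ⊞ᵛ x) * c4 (inner u (v ⊞ᵛ x)))) (χ-shift v c)) (trans
        (χ* v (λ cv → cong₂ _*_ (w-⊞ cv c) (let k , e = inner-⊞ u v x in trans (c4-mod (inner u (v ⊞ᵛ x)) k (inner u v ℕ.+ inner u x) e) (c4-+ (inner u v) (inner u x)))))
        (ringᵠ₅₄ (χ v) (w v) (w x) (c4 (inner u v)) (s4 (inner u v)) (c4 (inner u x)) (s4 (inner u x))))

    Ns-shift : ∀ u {x} → C x → Ns u ≡ w x * s4 (inner u x) * Nc u + w x * c4 (inner u x) * Ns u
    Ns-shift u {x} c = begin
      Ns u ≡⟨ sumV-shift n x (λ v → χ v * (w v * s4 (inner u v))) ⟨
      sumV n (λ v → χ (v ⊞ᵛ x) * (w (v ⊞ᵛ x) * s4 (inner u (v ⊞ᵛ x)))) ≡⟨ sumV-cong n term ⟩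
      sumV n (λ v → w x * s4 (inner u x) * (χ v * (w v * c4 (inner u v))) + w x * c4 (inner u x) * (χ v * (w v * s4 (inner u v))))
        ≡⟨ combine u (w x * s4 (inner u x)) (w x * c4 (inner u x)) (λ v → w v * c4 (inner u v)) (λ v → w v * s4 (inner u v)) ⟩
      w x * s4 (inner u x) * Nc u + w x * c4 (inner u x) * Ns u ∎
      where
      open ≡-Reasoning
      term : ∀ v → χ (v ⊞ᵛ x) * (w (v ⊞ᵛ x) * s4 (inner u (v ⊞ᵛ x))) ≡
        w x * s4 (inner u x) * (χ v * (w v * c4 (inner u v))) + w x * c4 (inner u x) * (χ v * (w v * s4 (inner u v)))
      term v = trans (cong (_* (w (v ⊞ᵛ x) * s4 (inner u (v ⊞ᵛ x)))) (χ-shift v c)) (trans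
        (χ* v (λ cv → cong₂ _*_ (w-⊞ cv c) (let k , e = inner-⊞ u v x in trans (s4-mod (inner u (v ⊞ᵛ x)) k (inner u v ℕ.+ inner u x) e) (s4-+ (inner u v) (inner u x)))))
        (ringᵠ₅₅ (χ v) (w v) (w x) (c4 (inner u v)) (s4 (inner u v)) (c4 (inner u x)) (s4 (inner u x))))

    -- Writing ω = w x · i^⟨u,x⟩, invariance under the shift by x gives |1 - ω|² N = 0.
    Nc-zero : ∀ u {x} → C x → ¬ (w x * c4 (inner u x) ≡ 1ℚ) → Nc u ≡ 0ℚ
    Nc-zero u {x} c ne = cancel (1ℚ - a) (Nc u) (λ e → ne (a≡1 e)) final
      where
      a b : ℚ
      a = w x * c4 (inner u x)
      b = w x * s4 (inner u x)
      a²+b² : a * a + b * b ≡ 1ℚ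
      a²+b² = trans (ringᵠ₅₆ (w x) (c4 (inner u x)) (s4 (inner u x))) (trans (cong₂ _*_ (w-sq c) (c4²+s4² (inner u x))) refl)
      a≡1 : 1ℚ - a ≡ 0ℚ → a ≡ 1ℚ
      a≡1 e = trans (ringᵠ₅₇ a) (trans (cong (λ z → 1ℚ - z) e) refl)
      cancel : ∀ d N → ¬ (d ≡ 0ℚ) → d * N + d * N ≡ 0ℚ → N ≡ 0ℚ
      cancel d N nz e with N ≟ 0ℚ
      ... | yes p = p
      ... | no q = ⊥-elim (nz (trans (sym (ℚₚ.*-identityʳ d)) (trans (cong (d *_) (sym (ℚₚ.*-inverseʳ N))) (trans (sym (ℚₚ.*-assoc d N (1/ N)))
              (trans (cong (_* (1/ N)) (trans (ringᵠ₅₈ (d * N)) (cong (pos 1 / 2 *_) e))) (ringᵠ₅₉ (1/ N)))))))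
        where
        instance _ = Data.Rational.≢-nonZero q
      open ≡-Reasoning
      final : (1ℚ - a) * Nc u + (1ℚ - a) * Nc u ≡ 0ℚ
      final = begin
        (1ℚ - a) * Nc u + (1ℚ - a) * Nc u
          ≡⟨ ringᵠ₆₀ a b (Nc u) (Ns u) ⟩
        (1ℚ - a) * (Nc u - (a * Nc u + - b * Ns u)) - b * (Ns u - (b * Nc u + a * Ns u)) + (1ℚ - (a * a + b * b)) * Nc u
          ≡⟨ cong₂ _+_ (cong₂ (λ y z → (1ℚ - a) * y - b * z) (diff (Nc-shift u c)) (diff (Ns-shift u c))) (cong (λ z → (1ℚ - z) * Nc u) a²+b²) ⟩
        (1ℚ - a) * 0ℚ - b * 0ℚ + (1ℚ - 1ℚ) * Nc u ≡⟨ ringᵠ₆₁ a b (Nc u) ⟩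
        0ℚ ∎
        where
        diff : ∀ {y z} → y ≡ z → y - z ≡ 0ℚ
        diff {y} refl = ℚₚ.+-inverseʳ y

    -- Testing real parts suffices, since a complex number of modulus 1 with real part 1 is 1. The
    -- alternatives are separated by an exhaustive search over the finitely many words.
    Nc-dichotomy : ∀ u → (∀ v → C v → w v * c4 (inner u v) ≡ 1ℚ) ⊎ Nc u ≡ 0ℚ
    Nc-dichotomy u with any-Vec? n (λ v → C v × ¬ (w v * c4 (inner u v) ≡ 1ℚ)) dec
      where
      dec : ∀ v → Dec (C v × ¬ (w v * c4 (inner u v) ≡ 1ℚ))
      dec v with C? v | w v * c4 (inner u v) ≟ 1ℚ
      ... | yes c | no q = yes (c , q)
      ... | yes c | yes p = no λ z → proj₂ z p
      ... | no c | _ = no λ z → c (proj₁ z)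
    ... | yes (x , c , q) = inj₂ (Nc-zero u c q)
    ... | no q = inj₁ all
      where
      all : ∀ v → C v → w v * c4 (inner u v) ≡ 1ℚ
      all v c with w v * c4 (inner u v) ≟ 1ℚ
      ... | yes p = p
      ... | no r = ⊥-elim (q (v , c , r))

    Nc-card : ∀ u → (∀ v → C v → w v * c4 (inner u v) ≡ 1ℚ) → Nc u ≡ card
    Nc-card u h = sumV-cong n (λ v → trans (χ* v (h v)) (ℚₚ.*-identityʳ (χ v)))

    Nc-nonneg : ∀ u → 0ℚ ≤ Nc u
    Nc-nonneg u with Nc-dichotomy u
    ... | inj₁ h = subst (0ℚ ≤_) (sym (Nc-card u h)) (<⇒≤ card-pos)
    ... | inj₂ e = ≤-reflexive (sym e)

    -- Poisson summation: after exchanging the two sums the inner one is a Fourier transform of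
    -- `ev`. The weight `w` is 1 for MacWilliams and the sign (-1)^(weight/4) for the shadow.
    poisson : ∀ M → sumV n (λ u → Nc u * ev u M) ≡ 2ℚ ^ n * sumV n (λ v → χ v * (w v * ev v (swap M)))
    poisson M = begin
      sumV n (λ u → Nc u * ev u M)
        ≡⟨ sumV-cong n (λ u → trans (ℚₚ.*-comm (Nc u) (ev u M)) (sym (sumV-* n (ev u M) (λ v → χ v * (w v * c4 (inner u v)))))) ⟩
      sumV n (λ u → sumV n (λ v → ev u M * (χ v * (w v * c4 (inner u v)))))
        ≡⟨ sumV-swap n n (λ u v → ev u M * (χ v * (w v * c4 (inner u v)))) ⟩
      sumV n (λ v → sumV n (λ u → ev u M * (χ v * (w v * c4 (inner u v)))))
        ≡⟨ sumV-cong n (λ v → trans (sumV-cong n (λ u → ringᵠ₆₂ (ev u M) (χ v) (w v) (c4 (inner u v)))) (trans (sumV-* n (χ v * w v) (λ u → c4 (inner u v) * ev u M))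
             (trans (cong (χ v * w v *_) (fourier-ev v M)) (ringᵠ₆₃ (χ v) (w v) (2ℚ ^ n) (ev v (swap M)))))) ⟩
      sumV n (λ v → 2ℚ ^ n * (χ v * (w v * ev v (swap M))))
        ≡⟨ sumV-* n (2ℚ ^ n) (λ v → χ v * (w v * ev v (swap M))) ⟩
      2ℚ ^ n * sumV n (λ v → χ v * (w v * ev v (swap M))) ∎
      where
      open ≡-Reasoning

ringᵠ₆₄ : ∀ χ c e → χ * (c * e) ≡ c * (χ * e)
ringᵠ₆₄ = solveᵠ 3 λ χ c e → χ :* (c :* e) := c :* (χ :* e)

ringᵠ₆₅ : ∀ p a b → p * a + p * b ≡ p * (b + a)
ringᵠ₆₅ = solveᵠ 3 λ p a b → p :* a :+ p :* b := p :* (b :+ a)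

ringⁿ₇ : ∀ a j → a ℕ.+ 2 ℕ.* (j ℕ.* 4) ≡ 8 ℕ.* j ℕ.+ a
ringⁿ₇ = ℕR.solve-∀

-- MacWilliams identity, reduction to symmetric functions, and the shadow.

module Enumerator {n : ℕ} (C : Code n) (sd : SelfDual C) (C? : ∀ v → Dec (C v)) where
  open SelfDualCode C sd C?

  enum : Mono → ℚ
  enum M = sumV n (λ v → χ v * ev v M)

  N₁ : Vec Z4 n → ℚ
  N₁ = Nc (λ _ → 1ℚ) (λ _ _ → refl) (λ _ → refl)

  N₁-χ : ∀ u → N₁ u ≡ card * χ u
  N₁-χ u = go (C? u) refl
    where
    inC : C u → ∀ v → C v → 1ℚ * c4 (inner u v) ≡ 1ℚ
    inC c v c' with 4∣inner c c'
    ... | divides k e = trans (ℚₚ.*-identityˡ (c4 (inner u v))) (trans (cong c4 (trans e (ℕₚ.*-comm k 4))) (c4-4k k))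
    go : ∀ d → C? u ≡ d → N₁ u ≡ card * χ u
    go (yes c) eq = trans (Nc-card (λ _ → 1ℚ) (λ _ _ → refl) (λ _ → refl) u (inC c))
      (sym (trans (cong (λ d → card * indicator d) eq) (ℚₚ.*-identityʳ card)))
    go (no q) eq with Nc-dichotomy (λ _ → 1ℚ) (λ _ _ → refl) (λ _ → refl) u
    ... | inj₂ e = trans e (sym (trans (cong (λ d → card * indicator d) eq) (ℚₚ.*-zeroʳ card)))
    ... | inj₁ h = ⊥-elim (q (dual⇒C u λ w c → subst (4 ∣_) (inner-comm u w)
            (c4≡1⇒4∣ (inner u w) (trans (sym (ℚₚ.*-identityˡ (c4 (inner u w)))) (h w c)))))

  macwilliams : ∀ M → card * enum M ≡ 2ℚ ^ n * enum (swap M)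
  macwilliams M = begin
    card * enum M ≡⟨ sumV-* n card (λ v → χ v * ev v M) ⟨
    sumV n (λ v → card * (χ v * ev v M)) ≡⟨ sumV-cong n (λ v → trans (sym (ℚₚ.*-assoc card (χ v) (ev v M))) (cong (_* ev v M) (sym (N₁-χ v)))) ⟩
    sumV n (λ u → N₁ u * ev u M) ≡⟨ poisson (λ _ → 1ℚ) (λ _ _ → refl) (λ _ → refl) M ⟩
    2ℚ ^ n * sumV n (λ v → χ v * (1ℚ * ev v (swap M))) ≡⟨ cong (2ℚ ^ n *_) (sumV-cong n (λ v → cong (χ v *_) (ℚₚ.*-identityˡ (ev v (swap M))))) ⟩
    2ℚ ^ n * enum (swap M) ∎
    where open ≡-Reasoning

  enum-agree : ∀ M M' → (∀ p r o → 4 ∣ p → p ℕ.+ r ℕ.+ o ≡ n → M p r o ≡ M' p r o) → enum M ≡ enum M'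
  enum-agree M M' h = sumV-cong n (λ v → χ* v (λ c → ev-cong v M M' (λ p r o e e' → h p r o (subst (4 ∣_) (sym e) (4∣n₁ c)) e')))

  -- Divisibility of the U-exponent is a fact about codewords; for the V-exponent it follows by
  -- duality. The hybrid `M₁` follows `M` where 4 divides the first exponent and `M'` elsewhere.
  -- After the MacWilliams exchange `M₁` and `M'` differ only at U-exponents not divisible by 4,
  -- which no codeword produces.
  enum-agree² : ∀ M M' → (∀ p r o → 4 ∣ p → 4 ∣ r → p ℕ.+ r ℕ.+ o ≡ n → M p r o ≡ M' p r o) → enum M ≡ enum M'
  enum-agree² M M' h = trans (enum-agree M M₁ agree₁) (cancel (begin
    card * enum M₁ ≡⟨ macwilliams M₁ ⟩
    2ℚ ^ n * enum (swap M₁) ≡⟨ cong (2ℚ ^ n *_) (enum-agree (swap M₁) (swap M') agree₂) ⟩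
    2ℚ ^ n * enum (swap M') ≡⟨ macwilliams M' ⟨
    card * enum M' ∎))
    where
    open ≡-Reasoning
    choose : ∀ {A : Set} → Dec A → ℚ → ℚ → ℚ
    choose (yes _) a b = a
    choose (no _) a b = b
    M₁ : Mono
    M₁ p r o = choose (4 ∣? p) (M p r o) (M' p r o)
    agree₁ : ∀ p r o → 4 ∣ p → p ℕ.+ r ℕ.+ o ≡ n → M p r o ≡ M₁ p r o
    agree₁ p r o d e with 4 ∣? p
    ... | yes _ = refl
    ... | no q = ⊥-elim (q d)
    agree₂ : ∀ p r o → 4 ∣ p → p ℕ.+ r ℕ.+ o ≡ n → swap M₁ p r o ≡ swap M' p r o
    agree₂ p r o d e with 4 ∣? r
    ... | yes d' = h r p o d' d (trans (cong (ℕ._+ o) (ℕₚ.+-comm r p)) e)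
    ... | no q = refl
    cancel : card * enum M₁ ≡ card * enum M' → enum M₁ ≡ enum M'
    cancel e = ℚₚ.≤-antisym (*-cancelˡ card-pos (≤-reflexive e)) (*-cancelˡ card-pos (≤-reflexive (sym e)))

  enum-+ : ∀ M M' → enum (λ p r o → M p r o + M' p r o) ≡ enum M + enum M'
  enum-+ M M' = trans (sumV-cong n (λ v → trans (cong (χ v *_) (ev-+ v M M')) (ℚₚ.*-distribˡ-+ (χ v) (ev v M) (ev v M'))))
    (sumV-+ n (λ v → χ v * ev v M) (λ v → χ v * ev v M'))

  enum-* : ∀ c M → enum (λ p r o → c * M p r o) ≡ c * enum M
  enum-* c M = trans (sumV-cong n (λ v → trans (cong (χ v *_) (ev-*U v (λ _ → c) M)) (ringᵠ₆₄ (χ v) c (ev v M))))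
    (sumV-* n c (λ v → χ v * ev v M))

  -- The factor produced by symmetrising: `card * enum M` turns into `2ℚ ^ n * enum (swap M)`, and
  -- `2ℚ ^ n * enum M` is added to it.
  total : ℚ
  total = card + 2ℚ ^ n

  total-pos : 0ℚ < total
  total-pos = 0<+ card-pos (^-nonneg n lit≤)

  -- G J is the coefficient of (x y)^J in the enumerator restricted to the curve T⁴ = U⁴ + V⁴, up to a factor.
  G : ℕ → ℚ
  G J = enum (λ p r o → symE (p ℕ./ 4) (r ℕ./ 4) (λ j i → δ J j))

  -- Adding the MacWilliams transform makes the functional symmetric in x = U⁴ and y = V⁴, hence a
  -- function of xy and x + y. A functional that reads off the coefficient of (xy)^J sees the
  -- enumerator only through `G J`.
  gleason : ∀ M c J →
    (∀ m l o → 4 ℕ.* m ℕ.+ 4 ℕ.* l ℕ.+ o ≡ n → M (4 ℕ.* m) (4 ℕ.* l) o + M (4 ℕ.* l) (4 ℕ.* m) o ≡ c * symE m l (λ j i → δ J j)) →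
    total * enum M ≡ 2ℚ ^ n * (c * G J)
  gleason M c J h = begin
    (card + 2ℚ ^ n) * enum M ≡⟨ ℚₚ.*-distribʳ-+ (enum M) card (2ℚ ^ n) ⟩
    card * enum M + 2ℚ ^ n * enum M ≡⟨ cong (_+ 2ℚ ^ n * enum M) (macwilliams M) ⟩
    2ℚ ^ n * enum (swap M) + 2ℚ ^ n * enum M ≡⟨ ringᵠ₆₅ (2ℚ ^ n) (enum (swap M)) (enum M) ⟩
    2ℚ ^ n * (enum M + enum (swap M)) ≡⟨ cong (2ℚ ^ n *_) (enum-+ M (swap M)) ⟨
    2ℚ ^ n * enum (λ p r o → M p r o + M r p o) ≡⟨ cong (2ℚ ^ n *_) (enum-agree² (λ p r o → M p r o + M r p o) (λ p r o → c * S p r o) agree) ⟩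
    2ℚ ^ n * enum (λ p r o → c * S p r o) ≡⟨ cong (2ℚ ^ n *_) (enum-* c S) ⟩
    2ℚ ^ n * (c * G J) ∎
    where
    open ≡-Reasoning
    S : Mono
    S p r o = symE (p ℕ./ 4) (r ℕ./ 4) (λ j i → δ J j)
    agree : ∀ p r o → 4 ∣ p → 4 ∣ r → p ℕ.+ r ℕ.+ o ≡ n → M p r o + M r p o ≡ c * S p r o
    agree p r o (divides m refl) (divides l' refl) e = begin
      M (m ℕ.* 4) (l' ℕ.* 4) o + M (l' ℕ.* 4) (m ℕ.* 4) o ≡⟨ cong₂ (λ a b → M a b o + M b a o) (ℕₚ.*-comm m 4) (ℕₚ.*-comm l' 4) ⟩
      M (4 ℕ.* m) (4 ℕ.* l') o + M (4 ℕ.* l') (4 ℕ.* m) o ≡⟨ h m l' o (trans (cong₂ (λ a b → a ℕ.+ b ℕ.+ o) (ℕₚ.*-comm 4 m) (ℕₚ.*-comm 4 l')) e) ⟩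
      c * symE m l' (λ j i → δ J j) ≡⟨ cong₂ (λ a b → c * symE a b (λ j i → δ J j)) (DivMod.m*n/n≡m m 4) (DivMod.m*n/n≡m l' 4) ⟨
      c * symE (m ℕ.* 4 ℕ./ 4) (l' ℕ.* 4 ℕ./ 4) (λ j i → δ J j) ∎

  sgn : Vec Z4 n → ℚ
  sgn v = sg (wtE v)

  -- The cross term 2⟨v,v'⟩ of the weight is a multiple of 8 on a self-dual code, and `sg` has
  -- period 8.
  sgn-⊞ : ∀ {v v'} → C v → C v' → sgn (v ⊞ᵛ v') ≡ sgn v * sgn v'
  sgn-⊞ {v} {v'} c c' with wtE-⊞ v v' | 4∣inner c c' | 4∣wtE c
  ... | k , e | divides j e' | divides a e'' = begin
    sg (wtE (v ⊞ᵛ v')) ≡⟨ sg-8k k (wtE (v ⊞ᵛ v')) ⟨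
    sg (8 ℕ.* k ℕ.+ wtE (v ⊞ᵛ v')) ≡⟨ cong sg (trans (ℕₚ.+-comm (8 ℕ.* k) (wtE (v ⊞ᵛ v'))) e) ⟩
    sg (wtE v ℕ.+ wtE v' ℕ.+ 2 ℕ.* inner v v') ≡⟨ cong (λ z → sg (wtE v ℕ.+ wtE v' ℕ.+ 2 ℕ.* z)) e' ⟩
    sg (wtE v ℕ.+ wtE v' ℕ.+ 2 ℕ.* (j ℕ.* 4)) ≡⟨ cong sg (ringⁿ₇ (wtE v ℕ.+ wtE v') j) ⟩
    sg (8 ℕ.* j ℕ.+ (wtE v ℕ.+ wtE v')) ≡⟨ sg-8k j (wtE v ℕ.+ wtE v') ⟩
    sg (wtE v ℕ.+ wtE v') ≡⟨ cong (λ z → sg (z ℕ.+ wtE v')) (trans e'' (ℕₚ.*-comm a 4)) ⟩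
    sg (4 ℕ.* a ℕ.+ wtE v') ≡⟨ sg-4k a (wtE v') ⟩
    sg (4 ℕ.* a) * sg (wtE v') ≡⟨ cong (λ z → sg z * sg (wtE v')) (trans e'' (ℕₚ.*-comm a 4)) ⟨
    sg (wtE v) * sg (wtE v') ∎
    where
    open ≡-Reasoning

  -- `card` times the indicator of the shadow, the set of u such that i^⟨u,v⟩ equals `sgn v`
  -- throughout the code.
  shadowWeight : Vec Z4 n → ℚ
  shadowWeight = Nc sgn sgn-⊞ (λ {v} _ → sg-sq (wtE v))

  shadowWeight-nonneg : ∀ u → 0ℚ ≤ shadowWeight u
  shadowWeight-nonneg = Nc-nonneg sgn sgn-⊞ (λ {v} _ → sg-sq (wtE v))

  -- On a codeword the sign is (-1)^(n₁/4) (-1)^n₂. The first factor is `sg p`; the second exchanges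
  -- V and T, and together with the Fourier exchange of U and V it permutes the three symbols
  -- cyclically.
  shadow : ∀ M → sumV n (λ u → shadowWeight u * ev u M) ≡ 2ℚ ^ n * enum (λ p r o → sg p * M o p r)
  shadow M = trans (poisson sgn sgn-⊞ (λ {v} _ → sg-sq (wtE v)) M) (cong (2ℚ ^ n *_) (sumV-cong n (λ v → χ* v (term v))))
    where
    open ≡-Reasoning
    term : ∀ v → C v → sgn v * ev v (swap M) ≡ ev v (λ p r o → sg p * M o p r)
    term v c with 4∣n₁ c
    ... | divides m e = begin
      sg (wtE v) * ev v (swap M) ≡⟨ cong (λ z → sg z * ev v (swap M)) (wtE-count v) ⟩
      sg (n₁ v ℕ.+ 4 ℕ.* n₂ v) * ev v (swap M) ≡⟨ cong (λ z → sg (z ℕ.+ 4 ℕ.* n₂ v) * ev v (swap M)) (trans e (ℕₚ.*-comm m 4)) ⟩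
      sg (4 ℕ.* m ℕ.+ 4 ℕ.* n₂ v) * ev v (swap M) ≡⟨ cong (_* ev v (swap M)) (sg-4k m (4 ℕ.* n₂ v)) ⟩
      sg (4 ℕ.* m) * sg (4 ℕ.* n₂ v) * ev v (swap M) ≡⟨ ℚₚ.*-assoc (sg (4 ℕ.* m)) (sg (4 ℕ.* n₂ v)) (ev v (swap M)) ⟩
      sg (4 ℕ.* m) * (sg (4 ℕ.* n₂ v) * ev v (swap M)) ≡⟨ cong₂ (λ a b → sg a * b) (sym (trans e (ℕₚ.*-comm m 4))) (sym (ev-swapVT v (swap M))) ⟩
      sg (n₁ v) * ev v (swapVT (swap M)) ≡⟨ ev-*U v sg (swapVT (swap M)) ⟨
      ev v (λ p r o → sg p * M o p r) ∎

-- The series of the substitution, and logarithmic derivatives.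

one s T V I2 I4 Ti L R : PS
one = κ 1ℚ
s = X ⊛ X
T = one ⊕ X
V = one ⊖ X

I2 zero = 1ℚ
I2 (suc zero) = 0ℚ
I2 (suc (suc n)) = I2 n

I4 zero = 1ℚ
I4 (suc zero) = 0ℚ
I4 (suc (suc zero)) = 0ℚ
I4 (suc (suc (suc zero))) = 0ℚ
I4 (suc (suc (suc (suc n)))) = I4 n

-- `I2`, `I4` and `Ti` are the inverses of 1 - t², 1 - t⁴ and 1 + t, and `L` is t R'/R.
Ti = (one ⊖ X) ⊛ (one ⊕ s) ⊛ I4
L = (κ (pos 6 / 1) ⊛ s ⊕ κ (pos 10 / 1) ⊛ (s ⊛ s)) ⊛ I4
R = I4 ⊛ (I2 ⊛ I2 ⊛ I2)

infixr 8 _^ˢ_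
_^ˢ_ : PS → ℕ → PS
f ^ˢ zero = one
f ^ˢ suc n = f ⊛ f ^ˢ n

module ≈-Reasoning = SetoidReasoning PSR.setoid

open PSR using () renaming (*-cong to *-congˢ; +-cong to +-congˢ; *-identityˡ to idˡ; *-identityʳ to idʳ; *-assoc to assocˢ; *-comm to commˢ) public

congˡ : ∀ f {g h} → g ≈ h → f ⊛ g ≈ f ⊛ h
congˡ f p = ⊛-cong (≈-refl {f}) p

congʳ : ∀ f {g h} → g ≈ h → g ⊛ f ≈ h ⊛ f
congʳ f p = ⊛-cong p (≈-refl {f})

⊕-congˡ : ∀ f {g h} → g ≈ h → f ⊕ g ≈ f ⊕ h
⊕-congˡ f p = +-congˢ (≈-refl {f}) p

⊕-congʳ : ∀ f {g h} → g ≈ h → g ⊕ f ≈ h ⊕ f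
⊕-congʳ f p = +-congˢ p (≈-refl {f})

^ˢ-cong : ∀ {f g} n → f ≈ g → f ^ˢ n ≈ g ^ˢ n
^ˢ-cong zero p = ≈-refl
^ˢ-cong (suc n) p = ⊛-cong p (^ˢ-cong n p)

^ˢ-+ : ∀ f m n → f ^ˢ (m ℕ.+ n) ≈ f ^ˢ m ⊛ f ^ˢ n
^ˢ-+ f zero n = ≈-sym (idˡ (f ^ˢ n))
^ˢ-+ f (suc m) n = ≈-trans (congˡ f (^ˢ-+ f m n)) (≈-sym (assocˢ f (f ^ˢ m) (f ^ˢ n)))

⊛-shuffle : ∀ a b c d → a ⊛ b ⊛ (c ⊛ d) ≈ a ⊛ c ⊛ (b ⊛ d)
⊛-shuffle = solveˢ 4 (λ a b c d → a :* b :* (c :* d) := a :* c :* (b :* d))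

^ˢ-distrib : ∀ f g n → (f ⊛ g) ^ˢ n ≈ f ^ˢ n ⊛ g ^ˢ n
^ˢ-distrib f g zero = ≈-sym (idˡ one)
^ˢ-distrib f g (suc n) = ≈-trans (congˡ (f ⊛ g) (^ˢ-distrib f g n)) (⊛-shuffle f g (f ^ˢ n) (g ^ˢ n))

one^ : ∀ n → one ^ˢ n ≈ one
one^ zero = ≈-refl
one^ (suc n) = ≈-trans (idˡ (one ^ˢ n)) (one^ n)

^ˢ-* : ∀ f m n → f ^ˢ (m ℕ.* n) ≈ (f ^ˢ n) ^ˢ m
^ˢ-* f zero n = ≈-refl
^ˢ-* f (suc m) n = ≈-trans (^ˢ-+ f n (m ℕ.* n)) (congˡ (f ^ˢ n) (^ˢ-* f m n))

inv^ : ∀ f g n → f ⊛ g ≈ one → f ^ˢ n ⊛ g ^ˢ n ≈ one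
inv^ f g n p = ≈-trans (≈-sym (^ˢ-distrib f g n)) (≈-trans (^ˢ-cong n p) (one^ n))

X⊛-zero : ∀ f → (X ⊛ f) 0 ≡ 0ℚ
X⊛-zero f = ℚₚ.*-zeroˡ (f 0)

X⊛-suc : ∀ f n → (X ⊛ f) (suc n) ≡ f n
X⊛-suc f n = begin
  0ℚ * f (suc n) + (tail X ⊛ f) n ≡⟨ cong₂ _+_ (ℚₚ.*-zeroˡ (f (suc n))) (⊛-cong′ {tail X} {one} {f} {f} (λ { zero → refl ; (suc _) → refl }) (λ _ → refl) n) ⟩
  0ℚ + (one ⊛ f) n ≡⟨ ℚₚ.+-identityˡ ((one ⊛ f) n) ⟩
  (one ⊛ f) n ≡⟨ at (idˡ f) n ⟩
  f n ∎
  where open ≡-Reasoning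

X^⊛-+ : ∀ k f n → (X ^ˢ k ⊛ f) (k ℕ.+ n) ≡ f n
X^⊛-+ zero f n = at (idˡ f) n
X^⊛-+ (suc k) f n = trans (at (assocˢ X (X ^ˢ k) f) (suc (k ℕ.+ n))) (trans (X⊛-suc (X ^ˢ k ⊛ f) (k ℕ.+ n)) (X^⊛-+ k f n))

X^⊛-< : ∀ k f n → n ℕ.< k → (X ^ˢ k ⊛ f) n ≡ 0ℚ
X^⊛-< (suc k) f zero p = trans (at (assocˢ X (X ^ˢ k) f) 0) (X⊛-zero (X ^ˢ k ⊛ f))
X^⊛-< (suc k) f (suc n) (s≤s p) = trans (at (assocˢ X (X ^ˢ k) f) (suc n)) (trans (X⊛-suc (X ^ˢ k ⊛ f) n) (X^⊛-< k f n p))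

s⊛-+ : ∀ f n → (s ⊛ f) (2 ℕ.+ n) ≡ f n
s⊛-+ f n = trans (at (assocˢ X X f) (2 ℕ.+ n)) (trans (X⊛-suc (X ⊛ f) (suc n)) (X⊛-suc f n))

s⊛-0 : ∀ f → (s ⊛ f) 0 ≡ 0ℚ
s⊛-0 f = trans (at (assocˢ X X f) 0) (X⊛-zero (X ⊛ f))

s⊛-1 : ∀ f → (s ⊛ f) 1 ≡ 0ℚ
s⊛-1 f = trans (at (assocˢ X X f) 1) (trans (X⊛-suc (X ⊛ f) 0) (X⊛-zero f))

ringˢ₁ : ∀ s i → (one ⊖ s) ⊛ i ≈ i ⊖ s ⊛ i
ringˢ₁ = solveˢ 2 (λ s i → (con 1ℚ :- s) :* i := i :- s :* i)

I2-eq : (one ⊖ s) ⊛ I2 ≈ one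
I2-eq = ≈-trans (ringˢ₁ s I2) (mk≈ coeff)
  where
  a-a : ∀ a → a - a ≡ 0ℚ
  a-a = ℚₚ.+-inverseʳ
  coeff : ∀ n → (I2 ⊖ s ⊛ I2) n ≡ one n
  coeff zero = cong (λ z → 1ℚ - z) (s⊛-0 I2)
  coeff (suc zero) = cong (λ z → 0ℚ - z) (s⊛-1 I2)
  coeff (suc (suc n)) = trans (cong (λ z → I2 n - z) (s⊛-+ I2 n)) (a-a (I2 n))

ringˢ₂ : ∀ s i → (one ⊖ s ⊛ s) ⊛ i ≈ i ⊖ s ⊛ (s ⊛ i)
ringˢ₂ = solveˢ 2 (λ s i → (con 1ℚ :- s :* s) :* i := i :- s :* (s :* i))

I4-eq : (one ⊖ s ⊛ s) ⊛ I4 ≈ one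
I4-eq = ≈-trans (ringˢ₂ s I4) (mk≈ coeff)
  where
  a-a : ∀ a → a - a ≡ 0ℚ
  a-a = ℚₚ.+-inverseʳ
  coeff : ∀ n → (I4 ⊖ s ⊛ (s ⊛ I4)) n ≡ one n
  coeff zero = cong (λ z → 1ℚ - z) (s⊛-0 (s ⊛ I4))
  coeff (suc zero) = cong (λ z → 0ℚ - z) (s⊛-1 (s ⊛ I4))
  coeff (suc (suc zero)) = cong (λ z → 0ℚ - z) (trans (s⊛-+ (s ⊛ I4) 0) (s⊛-0 I4))
  coeff (suc (suc (suc zero))) = cong (λ z → 0ℚ - z) (trans (s⊛-+ (s ⊛ I4) 1) (s⊛-1 I4))
  coeff (suc (suc (suc (suc n)))) = trans (cong (λ z → I4 n - z) (trans (s⊛-+ (s ⊛ I4) (2 ℕ.+ n)) (s⊛-+ I4 n))) (a-a (I4 n))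

ringˢ₅ : ∀ s i j → i ⊛ ((one ⊖ s ⊛ s) ⊛ j) ≈ (one ⊖ s) ⊛ i ⊛ ((one ⊕ s) ⊛ j)
ringˢ₅ = solveˢ 3 (λ s i j → i :* ((con 1ℚ :- s :* s) :* j) := (con 1ℚ :- s) :* i :* ((con 1ℚ :+ s) :* j))

I2≈ : I2 ≈ (one ⊕ s) ⊛ I4
I2≈ = begin
  I2 ≈⟨ idʳ I2 ⟨
  I2 ⊛ one ≈⟨ congˡ I2 I4-eq ⟨
  I2 ⊛ ((one ⊖ s ⊛ s) ⊛ I4) ≈⟨ ringˢ₅ s I2 I4 ⟩
  (one ⊖ s) ⊛ I2 ⊛ ((one ⊕ s) ⊛ I4) ≈⟨ congʳ ((one ⊕ s) ⊛ I4) I2-eq ⟩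
  one ⊛ ((one ⊕ s) ⊛ I4) ≈⟨ idˡ ((one ⊕ s) ⊛ I4) ⟩
  (one ⊕ s) ⊛ I4 ∎
  where
  open ≈-Reasoning

ringˢ₆ : ∀ x i → (one ⊕ x) ⊛ ((one ⊖ x) ⊛ (one ⊕ x ⊛ x) ⊛ i) ≈ (one ⊖ x ⊛ x ⊛ (x ⊛ x)) ⊛ i
ringˢ₆ = solveˢ 2 (λ x i → (con 1ℚ :+ x) :* ((con 1ℚ :- x) :* (con 1ℚ :+ x :* x) :* i) := (con 1ℚ :- x :* x :* (x :* x)) :* i)

T⊛Ti : T ⊛ Ti ≈ one
T⊛Ti = ≈-trans (ringˢ₆ X I4) I4-eq

qˢ : PS
qˢ = (one ⊕ s) ⊛ ((one ⊖ s) ⊛ (one ⊖ s) ⊛ (one ⊖ s) ⊛ (one ⊖ s))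

q⊛R : qˢ ⊛ R ≈ one
q⊛R = begin
  qˢ ⊛ R ≈⟨ l s I4 I2 ⟩
  ((one ⊖ s ⊛ s) ⊛ I4) ⊛ (((one ⊖ s) ⊛ I2) ⊛ ((one ⊖ s) ⊛ I2) ⊛ ((one ⊖ s) ⊛ I2)) ≈⟨ ⊛-cong I4-eq (⊛-cong (⊛-cong I2-eq I2-eq) I2-eq) ⟩
  one ⊛ (one ⊛ one ⊛ one) ≈⟨ ≈-trans (idˡ _) (≈-trans (idʳ _) (idˡ one)) ⟩
  one ∎
  where
  open ≈-Reasoning
  l : ∀ s i j → (one ⊕ s) ⊛ ((one ⊖ s) ⊛ (one ⊖ s) ⊛ (one ⊖ s) ⊛ (one ⊖ s)) ⊛ (i ⊛ (j ⊛ j ⊛ j)) ≈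
    ((one ⊖ s ⊛ s) ⊛ i) ⊛ (((one ⊖ s) ⊛ j) ⊛ ((one ⊖ s) ⊛ j) ⊛ ((one ⊖ s) ⊛ j))
  l = solveˢ 3 (λ s i j → let o = con 1ℚ in (o :+ s) :* ((o :- s) :* (o :- s) :* (o :- s) :* (o :- s)) :* (i :* (j :* j :* j)) :=
    ((o :- s :* s) :* i) :* (((o :- s) :* j) :* ((o :- s) :* j) :* ((o :- s) :* j)))

-- Logarithmic derivatives: LD f e means t f' = f e

LD : PS → PS → Set
LD f e = θ f ≈ f ⊛ e

θ-cong : ∀ {f g} → f ≈ g → θ f ≈ θ g
θ-cong p = mk≈ λ n → cong (ι n *_) (at p n)

θ-κ : ∀ c → θ (κ c) ≈ κ 0ℚ
θ-κ c = mk≈ λ { zero → ℚₚ.*-zeroˡ c ; (suc n) → ℚₚ.*-zeroʳ (ι (suc n)) }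

θ-X : θ X ≈ X
θ-X = mk≈ λ { zero → refl ; (suc zero) → refl ; (suc (suc n)) → ℚₚ.*-zeroʳ (ι (suc (suc n))) }

θ-⊕ : ∀ f g → θ (f ⊕ g) ≈ θ f ⊕ θ g
θ-⊕ f g = mk≈ λ n → ℚₚ.*-distribˡ-+ (ι n) (f n) (g n)

ringᵠ₆₆ : ∀ a b → a * - b ≡ - (a * b)
ringᵠ₆₆ = solveᵠ 2 λ a b → a :* (:- b) := (:- (a :* b))

θ-⊝ : ∀ f → θ (⊝ f) ≈ ⊝ θ f
θ-⊝ f = mk≈ λ n → ringᵠ₆₆ (ι n) (f n)

ringˢ₇ : ∀ f g e e' → f ⊛ e ⊛ g ⊕ f ⊛ (g ⊛ e') ≈ f ⊛ g ⊛ (e ⊕ e')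
ringˢ₇ = solveˢ 4 (λ f g e e' → f :* e :* g :+ f :* (g :* e') := f :* g :* (e :+ e'))

LD-⊛ : ∀ {f g e e'} → LD f e → LD g e' → LD (f ⊛ g) (e ⊕ e')
LD-⊛ {f} {g} {e} {e'} p q = ≈-trans (θ-⊛ f g) (≈-trans (+-congˢ (congʳ g p) (congˡ f q)) (ringˢ₇ f g e e'))

LD-one : LD one (κ 0ℚ)
LD-one = ≈-trans (θ-κ 1ℚ) (≈-sym (idˡ (κ 0ℚ)))

LD-cong : ∀ {f e e'} → LD f e → e ≈ e' → LD f e'
LD-cong {f} p q = ≈-trans p (congˡ f q)

κ-+ : ∀ a b → κ (a + b) ≈ κ a ⊕ κ b
κ-+ a b = mk≈ λ { zero → refl ; (suc n) → refl }

κ-* : ∀ a b → κ (a * b) ≈ κ a ⊛ κ b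
κ-* a b = mk≈ λ { zero → refl ; (suc n) → sym (trans (κ⊛ a (κ b) (suc n)) (ℚₚ.*-zeroʳ a)) }

κ-cong : ∀ {a b} → a ≡ b → κ a ≈ κ b
κ-cong refl = ≈-refl

ringˢ₈ : ∀ e → κ 0ℚ ≈ κ 0ℚ ⊛ e
ringˢ₈ = solveˢ 1 (λ e → con 0ℚ := con 0ℚ :* e)

ringˢ₉ : ∀ e k → e ⊕ k ⊛ e ≈ (one ⊕ k) ⊛ e
ringˢ₉ = solveˢ 2 (λ e k → e :+ k :* e := (con 1ℚ :+ k) :* e)

LD-^ : ∀ {f e} n → LD f e → LD (f ^ˢ n) (κ (ι n) ⊛ e)
LD-^ {f} {e} zero p = LD-cong LD-one (ringˢ₈ e)
LD-^ {f} {e} (suc n) p = LD-cong (LD-⊛ p (LD-^ n p)) (≈-trans (ringˢ₉ e (κ (ι n)))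
  (congʳ e (≈-trans (≈-sym (κ-+ 1ℚ (ι n))) (κ-cong (sym (ι-suc n))))))

LD-X : LD X one
LD-X = ≈-trans θ-X (≈-sym (idʳ X))

ringˢ₁₀ : ∀ x → κ 0ℚ ⊕ x ≈ one ⊛ x
ringˢ₁₀ = solveˢ 1 (λ x → con 0ℚ :+ x := con 1ℚ :* x)

ringˢ₁₁ : ∀ t i x → t ⊛ i ⊛ x ≈ t ⊛ (x ⊛ i)
ringˢ₁₁ = solveˢ 3 (λ t i x → t :* i :* x := t :* (x :* i))

LD-T : LD T (X ⊛ Ti)
LD-T = begin
  θ T ≈⟨ θ-⊕ one X ⟩
  θ one ⊕ θ X ≈⟨ +-congˢ (θ-κ 1ℚ) θ-X ⟩
  κ 0ℚ ⊕ X ≈⟨ ringˢ₁₀ X ⟩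
  one ⊛ X ≈⟨ congʳ X T⊛Ti ⟨
  T ⊛ Ti ⊛ X ≈⟨ ringˢ₁₁ T Ti X ⟩
  T ⊛ (X ⊛ Ti) ∎
  where
  open ≈-Reasoning

ringˢ₁₂ : ∀ f g h k → f ⊛ g ⊛ h ≈ g ⊛ ((k ⊛ g ⊕ f ⊛ h) ⊖ k ⊛ g)
ringˢ₁₂ = solveˢ 4 (λ f g h k → f :* g :* h := g :* ((k :* g :+ f :* h) :- k :* g))

ringˢ₁₃ : ∀ f g e → g ⊛ (κ 0ℚ ⊖ f ⊛ e ⊛ g) ≈ g ⊛ (⊝ e) ⊛ (f ⊛ g)
ringˢ₁₃ = solveˢ 3 (λ f g e → g :* (con 0ℚ :- f :* e :* g) := g :* (:- e) :* (f :* g))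

LD-inv : ∀ {f g e} → f ⊛ g ≈ one → LD f e → LD g (⊝ e)
LD-inv {f} {g} {e} p q = begin
  θ g ≈⟨ idˡ (θ g) ⟨
  one ⊛ θ g ≈⟨ congʳ (θ g) p ⟨
  f ⊛ g ⊛ θ g ≈⟨ ringˢ₁₂ f g (θ g) (f ⊛ e) ⟩
  g ⊛ ((f ⊛ e ⊛ g ⊕ f ⊛ θ g) ⊖ f ⊛ e ⊛ g) ≈⟨ congˡ g (+-congˢ (≈-trans (≈-sym (≈-trans (θ-⊛ f g) (+-congˢ (congʳ g q) ≈-refl))) (≈-trans (θ-cong p) (θ-κ 1ℚ))) ≈-refl) ⟩
  g ⊛ (κ 0ℚ ⊖ f ⊛ e ⊛ g) ≈⟨ ringˢ₁₃ f g e ⟩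
  g ⊛ (⊝ e) ⊛ (f ⊛ g) ≈⟨ congˡ (g ⊛ (⊝ e)) p ⟩
  g ⊛ (⊝ e) ⊛ one ≈⟨ idʳ (g ⊛ (⊝ e)) ⟩
  g ⊛ (⊝ e) ∎
  where
  open ≈-Reasoning

ringˢ₁₄ : ∀ x → x ⊛ x ⊕ x ⊛ x ≈ κ 2ℚ ⊛ (x ⊛ x)
ringˢ₁₄ = solveˢ 1 (λ x → x :* x :+ x :* x := con 2ℚ :* (x :* x))

θ-s : θ s ≈ κ 2ℚ ⊛ s
θ-s = ≈-trans (θ-⊛ X X) (≈-trans (+-congˢ (congʳ X θ-X) (congˡ X θ-X)) (ringˢ₁₄ X))

ringˢ₁₅ : ∀ k s → κ 0ℚ ⊕ (⊝ (k ⊛ s)) ≈ (⊝ (k ⊛ s)) ⊛ one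
ringˢ₁₅ = solveˢ 2 (λ k s → con 0ℚ :+ (:- (k :* s)) := (:- (k :* s)) :* con 1ℚ)

ringˢ₁₆ : ∀ k s i → (⊝ (k ⊛ s)) ⊛ ((one ⊖ s) ⊛ i) ≈ (one ⊖ s) ⊛ (⊝ (k ⊛ s ⊛ i))
ringˢ₁₆ = solveˢ 3 (λ k s i → (:- (k :* s)) :* ((con 1ℚ :- s) :* i) := (con 1ℚ :- s) :* (:- (k :* s :* i)))

LD-1-s : LD (one ⊖ s) (⊝ (κ 2ℚ ⊛ s ⊛ I2))
LD-1-s = begin
  θ (one ⊖ s) ≈⟨ ≈-trans (θ-⊕ one (⊝ s)) (+-congˢ (θ-κ 1ℚ) (≈-trans (θ-⊝ s) (PSR.-‿cong θ-s))) ⟩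
  κ 0ℚ ⊕ (⊝ (κ 2ℚ ⊛ s)) ≈⟨ ringˢ₁₅ (κ 2ℚ) s ⟩
  (⊝ (κ 2ℚ ⊛ s)) ⊛ one ≈⟨ congˡ (⊝ (κ 2ℚ ⊛ s)) I2-eq ⟨
  (⊝ (κ 2ℚ ⊛ s)) ⊛ ((one ⊖ s) ⊛ I2) ≈⟨ ringˢ₁₆ (κ 2ℚ) s I2 ⟩
  (one ⊖ s) ⊛ (⊝ (κ 2ℚ ⊛ s ⊛ I2)) ∎
  where
  open ≈-Reasoning

ringˢ₁₇ : ∀ s → κ 0ℚ ⊕ (⊝ (κ 2ℚ ⊛ s ⊛ s ⊕ s ⊛ (κ 2ℚ ⊛ s))) ≈ (⊝ (κ (pos 4 / 1) ⊛ (s ⊛ s))) ⊛ one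
ringˢ₁₇ = solveˢ 1 (λ s → con 0ℚ :+ (:- (con 2ℚ :* s :* s :+ s :* (con 2ℚ :* s))) := (:- (con (pos 4 / 1) :* (s :* s))) :* con 1ℚ)

ringˢ₁₈ : ∀ k s i → (⊝ (k ⊛ (s ⊛ s))) ⊛ ((one ⊖ s ⊛ s) ⊛ i) ≈ (one ⊖ s ⊛ s) ⊛ (⊝ (k ⊛ (s ⊛ s) ⊛ i))
ringˢ₁₈ = solveˢ 3 (λ k s i → (:- (k :* (s :* s))) :* ((con 1ℚ :- s :* s) :* i) := (con 1ℚ :- s :* s) :* (:- (k :* (s :* s) :* i)))

LD-1-s² : LD (one ⊖ s ⊛ s) (⊝ (κ (pos 4 / 1) ⊛ (s ⊛ s) ⊛ I4))
LD-1-s² = begin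
  θ (one ⊖ s ⊛ s) ≈⟨ ≈-trans (θ-⊕ one (⊝ (s ⊛ s))) (+-congˢ (θ-κ 1ℚ) (≈-trans (θ-⊝ (s ⊛ s)) (PSR.-‿cong (≈-trans (θ-⊛ s s) (+-congˢ (congʳ s θ-s) (congˡ s θ-s)))))) ⟩
  κ 0ℚ ⊕ (⊝ (κ 2ℚ ⊛ s ⊛ s ⊕ s ⊛ (κ 2ℚ ⊛ s))) ≈⟨ ringˢ₁₇ s ⟩
  (⊝ (κ (pos 4 / 1) ⊛ (s ⊛ s))) ⊛ one ≈⟨ congˡ (⊝ (κ (pos 4 / 1) ⊛ (s ⊛ s))) I4-eq ⟨
  (⊝ (κ (pos 4 / 1) ⊛ (s ⊛ s))) ⊛ ((one ⊖ s ⊛ s) ⊛ I4) ≈⟨ ringˢ₁₈ (κ (pos 4 / 1)) s I4 ⟩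
  (one ⊖ s ⊛ s) ⊛ (⊝ (κ (pos 4 / 1) ⊛ (s ⊛ s) ⊛ I4)) ∎
  where
  open ≈-Reasoning

ringˢ₁₉ : ∀ s i j → (⊝ (⊝ (κ (pos 4 / 1) ⊛ (s ⊛ s) ⊛ i))) ⊕ ((⊝ (⊝ (κ 2ℚ ⊛ s ⊛ j))) ⊕ (⊝ (⊝ (κ 2ℚ ⊛ s ⊛ j))) ⊕ (⊝ (⊝ (κ 2ℚ ⊛ s ⊛ j)))) ≈ κ (pos 4 / 1) ⊛ (s ⊛ s) ⊛ i ⊕ κ (pos 6 / 1) ⊛ s ⊛ j
ringˢ₁₉ = solveˢ 3 (λ s i j → let k = :- (:- (con 2ℚ :* s :* j)) in (:- (:- (con (pos 4 / 1) :* (s :* s) :* i))) :+ (k :+ k :+ k) := con (pos 4 / 1) :* (s :* s) :* i :+ con (pos 6 / 1) :* s :* j)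

ringˢ₂₀ : ∀ s i → κ (pos 4 / 1) ⊛ (s ⊛ s) ⊛ i ⊕ κ (pos 6 / 1) ⊛ s ⊛ ((one ⊕ s) ⊛ i) ≈ (κ (pos 6 / 1) ⊛ s ⊕ κ (pos 10 / 1) ⊛ (s ⊛ s)) ⊛ i
ringˢ₂₀ = solveˢ 2 (λ s i → con (pos 4 / 1) :* (s :* s) :* i :+ con (pos 6 / 1) :* s :* ((con 1ℚ :+ s) :* i) := (con (pos 6 / 1) :* s :+ con (pos 10 / 1) :* (s :* s)) :* i)

LD-R : LD R L
LD-R = LD-cong (LD-⊛ (LD-inv I4-eq LD-1-s²) (LD-⊛ (LD-⊛ (LD-inv I2-eq LD-1-s) (LD-inv I2-eq LD-1-s)) (LD-inv I2-eq LD-1-s)))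
  (begin
    (⊝ (⊝ (κ (pos 4 / 1) ⊛ (s ⊛ s) ⊛ I4))) ⊕ ((⊝ (⊝ (κ 2ℚ ⊛ s ⊛ I2))) ⊕ (⊝ (⊝ (κ 2ℚ ⊛ s ⊛ I2))) ⊕ (⊝ (⊝ (κ 2ℚ ⊛ s ⊛ I2)))) ≈⟨ ringˢ₁₉ s I4 I2 ⟩
    κ (pos 4 / 1) ⊛ (s ⊛ s) ⊛ I4 ⊕ κ (pos 6 / 1) ⊛ s ⊛ I2 ≈⟨ ⊕-congˡ (κ (pos 4 / 1) ⊛ (s ⊛ s) ⊛ I4) (congˡ (κ (pos 6 / 1) ⊛ s) I2≈) ⟩
    κ (pos 4 / 1) ⊛ (s ⊛ s) ⊛ I4 ⊕ κ (pos 6 / 1) ⊛ s ⊛ ((one ⊕ s) ⊛ I4) ≈⟨ ringˢ₂₀ s I4 ⟩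
    L ∎)
  where
  open ≈-Reasoning

ringˢ₂₁ : ∀ f e k → f ⊛ (k ⊖ e) ≈ k ⊛ f ⊖ f ⊛ e
ringˢ₂₁ = solveˢ 3 (λ f e k → f :* (k :- e) := k :* f :- f :* e)

-- The residue of an exact differential: the coefficient of t^N in N f - t f' vanishes.
residue : ∀ {f e} N → LD f e → (f ⊛ (κ (ι N) ⊖ e)) N ≡ 0ℚ
residue {f} {e} N p = begin
  (f ⊛ (κ (ι N) ⊖ e)) N ≡⟨ at (ringˢ₂₁ f e (κ (ι N))) N ⟩
  (κ (ι N) ⊛ f) N - (f ⊛ e) N ≡⟨ cong₂ _-_ (κ⊛ (ι N) f N) (sym (at p N)) ⟩
  ι N * f N - ι N * f N ≡⟨ ℚₚ.+-inverseʳ (ι N * f N) ⟩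
  0ℚ ∎
  where
  open ≡-Reasoning

-- Nonnegative coefficients

NN : PS → Set
NN f = ∀ n → 0ℚ ≤ f n

NN-⊕ : ∀ {f g} → NN f → NN g → NN (f ⊕ g)
NN-⊕ p q n = 0≤+ (p n) (q n)

NN-⊛ : ∀ {f g} → NN f → NN g → NN (f ⊛ g)
NN-⊛ p q zero = 0≤* (p 0) (q 0)
NN-⊛ {f} {g} p q (suc n) = 0≤+ (0≤* (p 0) (q (suc n))) (NN-⊛ {tail f} {g} (λ i → p (suc i)) q n)

NN-κ : ∀ {c} → 0ℚ ≤ c → NN (κ c)
NN-κ p zero = p
NN-κ p (suc n) = ≤-refl

NN-X : NN X
NN-X zero = ≤-refl
NN-X (suc zero) = 0≤1
NN-X (suc (suc n)) = ≤-refl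

NN-^ : ∀ {f} n → NN f → NN (f ^ˢ n)
NN-^ zero p = NN-κ 0≤1
NN-^ {f} (suc n) p = NN-⊛ p (NN-^ n p)

NN-I2 : NN I2
NN-I2 zero = 0≤1
NN-I2 (suc zero) = ≤-refl
NN-I2 (suc (suc n)) = NN-I2 n

NN-I4 : NN I4
NN-I4 zero = 0≤1
NN-I4 (suc zero) = ≤-refl
NN-I4 (suc (suc zero)) = ≤-refl
NN-I4 (suc (suc (suc zero))) = ≤-refl
NN-I4 (suc (suc (suc (suc n)))) = NN-I4 n

NN-s : NN s
NN-s = NN-⊛ NN-X NN-X

NN-T : NN T
NN-T = NN-⊕ (NN-κ 0≤1) NN-X

NN-R : NN R
NN-R = NN-⊛ NN-I4 (NN-⊛ (NN-⊛ NN-I2 NN-I2) NN-I2)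

NN-≈ : ∀ {f g} → f ≈ g → NN f → NN g
NN-≈ p q n = subst (0ℚ ≤_) (at p n) (q n)

-- Words and symmetric functions evaluated at power series.

even# : ∀ {n} → Vec Z4 n → ℕ
even# [] = 0
even# (z0 ∷ v) = suc (even# v)
even# (z1 ∷ v) = even# v
even# (z2 ∷ v) = suc (even# v)
even# (z3 ∷ v) = even# v

κ^ : ∀ a n → κ a ^ˢ n ≈ κ (a ^ n)
κ^ a zero = ≈-refl
κ^ a (suc n) = ≈-trans (congˡ (κ a) (κ^ a n)) (≈-sym (κ-* a (a ^ n)))

ringˢ₂₂ : ∀ a r t o w → (a ⊛ r ⊛ (t ⊛ o)) ⊛ w ≈ (a ⊛ r ⊛ o) ⊛ (t ⊛ w)
ringˢ₂₂ = solveˢ 5 (λ a r t o w → (a :* r :* (t :* o)) :* w := (a :* r :* o) :* (t :* w))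

ringˢ₂₃ : ∀ a r t o w → (a ⊛ (t ⊛ r) ⊛ o) ⊛ w ≈ (a ⊛ r ⊛ o) ⊛ (t ⊛ w)
ringˢ₂₃ = solveˢ 5 (λ a r t o w → (a :* (t :* r) :* o) :* w := (a :* r :* o) :* (t :* w))

ringᵠ₆₇ : ∀ a b → a * (2ℚ * b) ≡ 2ℚ * a * b
ringᵠ₆₇ = solveᵠ 2 λ a b → a :* (con 2ℚ :* b) := con 2ℚ :* a :* b

ringˢ₂₄ : ∀ b x w → b ⊛ ((one ⊕ x) ⊛ w) ⊕ b ⊛ ((one ⊖ x) ⊛ w) ≈ κ 2ℚ ⊛ (b ⊛ w)
ringˢ₂₄ = solveˢ 3 (λ b x w → b :* ((con 1ℚ :+ x) :* w) :+ b :* ((con 1ℚ :- x) :* w) := con 2ℚ :* (b :* w))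

ringˢ₂₅ : ∀ a b x w → (a ⊛ b) ⊛ ((one ⊕ x) ⊛ w) ⊖ (a ⊛ b) ⊛ ((one ⊖ x) ⊛ w) ≈ κ 2ℚ ⊛ ((a ⊛ (x ⊛ b)) ⊛ w)
ringˢ₂₅ = solveˢ 4 (λ a b x w → (a :* b) :* ((con 1ℚ :+ x) :* w) :- (a :* b) :* ((con 1ℚ :- x) :* w) := con 2ℚ :* ((a :* (x :* b)) :* w))

-- T + V = 2 and T - V = 2t, so a word contributes 2^(#even) U^n₁ t^n₂
ev-word : ∀ {n} (v : Vec Z4 n) (a : ℕ → PS) (W : PS) N →
  ev v (λ p r o → ((a p ⊛ V ^ˢ r ⊛ T ^ˢ o) ⊛ W) N) ≡ 2ℚ ^ even# v * ((a (n₁ v) ⊛ X ^ˢ n₂ v) ⊛ W) N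
ev-word [] a W N = trans (at (congʳ W (idʳ (a 0 ⊛ one))) N) (sym (ℚₚ.*-identityˡ (((a 0 ⊛ one) ⊛ W) N)))
ev-word (z0 ∷ v) a W N = begin
  ev v (λ p r o → ((a p ⊛ V ^ˢ r ⊛ (T ⊛ T ^ˢ o)) ⊛ W) N) + ev v (λ p r o → ((a p ⊛ (V ⊛ V ^ˢ r) ⊛ T ^ˢ o) ⊛ W) N)
    ≡⟨ cong₂ _+_ (ev-cong v _ _ (λ p r o _ _ → at (ringˢ₂₂ (a p) (V ^ˢ r) T (T ^ˢ o) W) N)) (ev-cong v _ _ (λ p r o _ _ → at (ringˢ₂₃ (a p) (V ^ˢ r) V (T ^ˢ o) W) N)) ⟩
  ev v (λ p r o → ((a p ⊛ V ^ˢ r ⊛ T ^ˢ o) ⊛ (T ⊛ W)) N) + ev v (λ p r o → ((a p ⊛ V ^ˢ r ⊛ T ^ˢ o) ⊛ (V ⊛ W)) N)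
    ≡⟨ cong₂ _+_ (ev-word v a (T ⊛ W) N) (ev-word v a (V ⊛ W) N) ⟩
  2ℚ ^ even# v * (B ⊛ (T ⊛ W)) N + 2ℚ ^ even# v * (B ⊛ (V ⊛ W)) N
    ≡⟨ ringᵠ₄₉ (2ℚ ^ even# v) ((B ⊛ (T ⊛ W)) N) ((B ⊛ (V ⊛ W)) N) ⟩
  2ℚ ^ even# v * (B ⊛ (T ⊛ W) ⊕ B ⊛ (V ⊛ W)) N
    ≡⟨ cong (2ℚ ^ even# v *_) (trans (at (ringˢ₂₄ B X W) N) (κ⊛ 2ℚ (B ⊛ W) N)) ⟩
  2ℚ ^ even# v * (2ℚ * (B ⊛ W) N) ≡⟨ ringᵠ₆₇ (2ℚ ^ even# v) ((B ⊛ W) N) ⟩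
  2ℚ * 2ℚ ^ even# v * (B ⊛ W) N ∎
  where
  open ≡-Reasoning
  B : PS
  B = a (n₁ v) ⊛ X ^ˢ n₂ v
ev-word (z1 ∷ v) a W N = ev-word v (λ p → a (suc p)) W N
ev-word (z2 ∷ v) a W N = begin
  ev v (λ p r o → ((a p ⊛ V ^ˢ r ⊛ (T ⊛ T ^ˢ o)) ⊛ W) N) - ev v (λ p r o → ((a p ⊛ (V ⊛ V ^ˢ r) ⊛ T ^ˢ o) ⊛ W) N)
    ≡⟨ cong₂ _-_ (ev-cong v _ _ (λ p r o _ _ → at (ringˢ₂₂ (a p) (V ^ˢ r) T (T ^ˢ o) W) N)) (ev-cong v _ _ (λ p r o _ _ → at (ringˢ₂₃ (a p) (V ^ˢ r) V (T ^ˢ o) W) N)) ⟩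
  ev v (λ p r o → ((a p ⊛ V ^ˢ r ⊛ T ^ˢ o) ⊛ (T ⊛ W)) N) - ev v (λ p r o → ((a p ⊛ V ^ˢ r ⊛ T ^ˢ o) ⊛ (V ⊛ W)) N)
    ≡⟨ cong₂ _-_ (ev-word v a (T ⊛ W) N) (ev-word v a (V ⊛ W) N) ⟩
  2ℚ ^ even# v * (B ⊛ (T ⊛ W)) N - 2ℚ ^ even# v * (B ⊛ (V ⊛ W)) N
    ≡⟨ ringᵠ₅₀ (2ℚ ^ even# v) ((B ⊛ (T ⊛ W)) N) ((B ⊛ (V ⊛ W)) N) ⟩
  2ℚ ^ even# v * (B ⊛ (T ⊛ W) ⊖ B ⊛ (V ⊛ W)) N
    ≡⟨ cong (2ℚ ^ even# v *_) (trans (at (ringˢ₂₅ (a (n₁ v)) (X ^ˢ n₂ v) X W) N) (κ⊛ 2ℚ (B' ⊛ W) N)) ⟩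
  2ℚ ^ even# v * (2ℚ * (B' ⊛ W) N) ≡⟨ ringᵠ₆₇ (2ℚ ^ even# v) ((B' ⊛ W) N) ⟩
  2ℚ * 2ℚ ^ even# v * (B' ⊛ W) N ∎
  where
  open ≡-Reasoning
  B B' : PS
  B = a (n₁ v) ⊛ X ^ˢ n₂ v
  B' = a (n₁ v) ⊛ (X ⊛ X ^ˢ n₂ v)
ev-word (z3 ∷ v) a W N = ev-word v (λ p → a (suc p)) W N

ringˢ₂₆ : ∀ z → (one ⊛ one) ⊛ z ⊕ (one ⊛ one) ⊛ z ≈ (one ⊕ one) ⊛ z
ringˢ₂₆ = solveˢ 1 (λ z → let o = con 1ℚ in (o :* o) :* z :+ (o :* o) :* z := (o :+ o) :* z)

ringˢ₂₇ : ∀ x y z → (one ⊛ ((x ⊕ y) ⊛ one)) ⊛ z ≈ (x ⊛ one ⊕ y ⊛ one) ⊛ z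
ringˢ₂₇ = solveˢ 3 (λ x y z → let o = con 1ℚ in (o :* ((x :+ y) :* o)) :* z := (x :* o :+ y :* o) :* z)

ringˢ₂₈ : ∀ a e b z → (a ⊛ (e ⊛ b)) ⊛ z ≈ (a ⊛ b) ⊛ (e ⊛ z)
ringˢ₂₈ = solveˢ 4 (λ a e b z → (a :* (e :* b)) :* z := (a :* b) :* (e :* z))

ringˢ₂₉ : ∀ a e b z → (e ⊛ a ⊛ b) ⊛ z ≈ (a ⊛ b) ⊛ (e ⊛ z)
ringˢ₂₉ = solveˢ 4 (λ a e b z → (e :* a :* b) :* z := (a :* b) :* (e :* z))

ringˢ₃₀ : ∀ x y a b z → (x ⊛ a ⊕ y ⊛ b) ⊛ ((x ⊕ y) ⊛ z) ⊖ (a ⊕ b) ⊛ ((x ⊛ y) ⊛ z) ≈ (x ⊛ (x ⊛ a) ⊕ y ⊛ (y ⊛ b)) ⊛ z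
ringˢ₃₀ = solveˢ 5 (λ x y a b z → (x :* a :+ y :* b) :* ((x :+ y) :* z) :- (a :+ b) :* ((x :* y) :* z) := (x :* (x :* a) :+ y :* (y :* b)) :* z)

powE-PS : ∀ l x y Z N → powE l (λ j i → (((x ⊛ y) ^ˢ j ⊛ (x ⊕ y) ^ˢ i) ⊛ Z) N) ≡ ((x ^ˢ l ⊕ y ^ˢ l) ⊛ Z) N
powE-PS zero x y Z N = at (ringˢ₂₆ Z) N
powE-PS (suc zero) x y Z N = at (ringˢ₂₇ x y Z) N
powE-PS (suc (suc l)) x y Z N = begin
  powE (suc l) (λ j i → (((x ⊛ y) ^ˢ j ⊛ ((x ⊕ y) ⊛ (x ⊕ y) ^ˢ i)) ⊛ Z) N) - powE l (λ j i → (((x ⊛ y) ⊛ (x ⊛ y) ^ˢ j ⊛ (x ⊕ y) ^ˢ i) ⊛ Z) N)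
    ≡⟨ cong₂ _-_ (powE-cong (suc l) (λ j i _ → at (ringˢ₂₈ ((x ⊛ y) ^ˢ j) (x ⊕ y) ((x ⊕ y) ^ˢ i) Z) N)) (powE-cong l (λ j i _ → at (ringˢ₂₉ ((x ⊛ y) ^ˢ j) (x ⊛ y) ((x ⊕ y) ^ˢ i) Z) N)) ⟩
  powE (suc l) (λ j i → (((x ⊛ y) ^ˢ j ⊛ (x ⊕ y) ^ˢ i) ⊛ ((x ⊕ y) ⊛ Z)) N) - powE l (λ j i → (((x ⊛ y) ^ˢ j ⊛ (x ⊕ y) ^ˢ i) ⊛ ((x ⊛ y) ⊛ Z)) N)
    ≡⟨ cong₂ _-_ (powE-PS (suc l) x y ((x ⊕ y) ⊛ Z) N) (powE-PS l x y ((x ⊛ y) ⊛ Z) N) ⟩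
  ((x ^ˢ suc l ⊕ y ^ˢ suc l) ⊛ ((x ⊕ y) ⊛ Z) ⊖ (x ^ˢ l ⊕ y ^ˢ l) ⊛ ((x ⊛ y) ⊛ Z)) N
    ≡⟨ at (ringˢ₃₀ x y (x ^ˢ l) (y ^ˢ l) Z) N ⟩
  ((x ^ˢ suc (suc l) ⊕ y ^ˢ suc (suc l)) ⊛ Z) N ∎
  where
  open ≡-Reasoning

ringˢ₃₁ : ∀ a b z → (a ⊕ b) ⊛ z ≈ (one ⊛ b ⊕ a ⊛ one) ⊛ z
ringˢ₃₁ = solveˢ 3 (λ a b z → (a :+ b) :* z := (con 1ℚ :* b :+ a :* con 1ℚ) :* z)

ringˢ₃₂ : ∀ a b z → (a ⊕ b) ⊛ z ≈ (a ⊛ one ⊕ one ⊛ b) ⊛ z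
ringˢ₃₂ = solveˢ 3 (λ a b z → (a :+ b) :* z := (a :* con 1ℚ :+ con 1ℚ :* b) :* z)

ringˢ₃₃ : ∀ x y a b c d z → (a ⊛ b ⊕ c ⊛ d) ⊛ ((x ⊛ y) ⊛ z) ≈ (x ⊛ a ⊛ (y ⊛ b) ⊕ x ⊛ c ⊛ (y ⊛ d)) ⊛ z
ringˢ₃₃ = solveˢ 7 (λ x y a b c d z → (a :* b :+ c :* d) :* ((x :* y) :* z) := (x :* a :* (y :* b) :+ x :* c :* (y :* d)) :* z)

symE-PS : ∀ m l x y Z N → symE m l (λ j i → (((x ⊛ y) ^ˢ j ⊛ (x ⊕ y) ^ˢ i) ⊛ Z) N) ≡ ((x ^ˢ m ⊛ y ^ˢ l ⊕ x ^ˢ l ⊛ y ^ˢ m) ⊛ Z) N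
symE-PS zero l x y Z N = trans (powE-PS l x y Z N) (at (ringˢ₃₁ (x ^ˢ l) (y ^ˢ l) Z) N)
symE-PS (suc m) zero x y Z N = trans (powE-PS (suc m) x y Z N) (at (ringˢ₃₂ (x ^ˢ suc m) (y ^ˢ suc m) Z) N)
symE-PS (suc m) (suc l) x y Z N = begin
  symE m l (λ j i → (((x ⊛ y) ⊛ (x ⊛ y) ^ˢ j ⊛ (x ⊕ y) ^ˢ i) ⊛ Z) N)
    ≡⟨ symE-cong m l (λ j i _ → at (ringˢ₂₉ ((x ⊛ y) ^ˢ j) (x ⊛ y) ((x ⊕ y) ^ˢ i) Z) N) ⟩
  symE m l (λ j i → (((x ⊛ y) ^ˢ j ⊛ (x ⊕ y) ^ˢ i) ⊛ ((x ⊛ y) ⊛ Z)) N) ≡⟨ symE-PS m l x y ((x ⊛ y) ⊛ Z) N ⟩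
  ((x ^ˢ m ⊛ y ^ˢ l ⊕ x ^ˢ l ⊛ y ^ˢ m) ⊛ ((x ⊛ y) ⊛ Z)) N ≡⟨ at (ringˢ₃₃ x y (x ^ˢ m) (y ^ˢ l) (x ^ˢ l) (y ^ˢ m) Z) N ⟩
  ((x ^ˢ suc m ⊛ y ^ˢ suc l ⊕ x ^ˢ suc l ⊛ y ^ˢ suc m) ⊛ Z) N ∎
  where
  open ≡-Reasoning

8ℚ : ℚ
8ℚ = pos 8 / 1

u4 v4 t4 : PS
u4 = κ 8ℚ ⊛ (X ⊛ (one ⊕ s))
v4 = V ^ˢ 4
t4 = T ^ˢ 4

ringˢ₃₄ : ∀ x → κ 8ℚ ⊛ (x ⊛ (one ⊕ x ⊛ x)) ⊕ (one ⊖ x) ⊛ ((one ⊖ x) ⊛ ((one ⊖ x) ⊛ ((one ⊖ x) ⊛ one))) ≈ (one ⊕ x) ⊛ ((one ⊕ x) ⊛ ((one ⊕ x) ⊛ ((one ⊕ x) ⊛ one)))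
ringˢ₃₄ = solveˢ 1 (λ x → let o = con 1ℚ in con 8ℚ :* (x :* (o :+ x :* x)) :+ (o :- x) :* ((o :- x) :* ((o :- x) :* ((o :- x) :* o))) := (o :+ x) :* ((o :+ x) :* ((o :+ x) :* ((o :+ x) :* o))))

u4+v4 : u4 ⊕ v4 ≈ t4
u4+v4 = ringˢ₃₄ X

ringˢ₃₅ : ∀ k r e → k ⊛ (r ⊛ (one ⊖ e)) ≈ r ⊛ (k ⊖ k ⊛ e)
ringˢ₃₅ = solveˢ 3 (λ k r e → k :* (r :* (con 1ℚ :- e)) := r :* (k :- k :* e))

-- The orthogonality behind Lagrange inversion for the variable t/ρ: k times the series is k ρ^k
-- minus the t-derivative of ρ^k.
residue-^ : ∀ {ρ e} k → LD ρ e → 0 ℕ.< k → (ρ ^ˢ k ⊛ (one ⊖ e)) k ≡ 0ℚ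
residue-^ {ρ} {e} (suc k) p _ = *-cancelˡ-≡0 (ι-pos k) (begin
  ι (suc k) * (ρ ^ˢ suc k ⊛ (one ⊖ e)) (suc k) ≡⟨ κ⊛ (ι (suc k)) (ρ ^ˢ suc k ⊛ (one ⊖ e)) (suc k) ⟨
  (κ (ι (suc k)) ⊛ (ρ ^ˢ suc k ⊛ (one ⊖ e))) (suc k) ≡⟨ at (ringˢ₃₅ (κ (ι (suc k))) (ρ ^ˢ suc k) e) (suc k) ⟩
  (ρ ^ˢ suc k ⊛ (κ (ι (suc k)) ⊖ κ (ι (suc k)) ⊛ e)) (suc k) ≡⟨ residue (suc k) (LD-^ (suc k) p) ⟩
  0ℚ ∎)
  where
  open ≡-Reasoning

δ-refl : ∀ J → δ J J ≡ 1ℚ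
δ-refl J with J ℕ.≟ J
... | yes _ = refl
... | no q = ⊥-elim (q refl)

δ-≢ : ∀ J j → ¬ (J ≡ j) → δ J j ≡ 0ℚ
δ-≢ J j q with J ℕ.≟ j
... | yes p = ⊥-elim (q p)
... | no _ = refl

-- The functional extracting the coefficient of (u4 v4)^J

e₁ D₁ ρ₁ : PS
e₁ = κ (ι 12) ⊛ (X ⊛ Ti) ⊕ L
D₁ = one ⊖ e₁
ρ₁ = T ^ˢ 12 ⊛ R

LD-ρ₁ : LD ρ₁ e₁
LD-ρ₁ = LD-⊛ (LD-^ 12 LD-T) LD-R

-- Kernel for the expansion in φ = u4 v4 / T⁸ = 8t/ρ₁, in which the restricted enumerator divided by
-- T^n is a polynomial; `D₁` is the Jacobian factor t φ'/φ.
W₁ : ℕ → ℕ → PS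
W₁ J A = (T ^ˢ A ⊛ R ^ˢ J) ⊛ D₁

private
  cvtR : ((one ⊕ s) ⊛ v4) ⊛ t4 ⊛ R ≈ one
  cvtR = ≈-trans (congʳ R (l X)) q⊛R
    where
    l : ∀ x → ((one ⊕ x ⊛ x) ⊛ ((one ⊖ x) ⊛ ((one ⊖ x) ⊛ ((one ⊖ x) ⊛ ((one ⊖ x) ⊛ one))))) ⊛ ((one ⊕ x) ⊛ ((one ⊕ x) ⊛ ((one ⊕ x) ⊛ ((one ⊕ x) ⊛ one))))
      ≈ (one ⊕ x ⊛ x) ⊛ ((one ⊖ x ⊛ x) ⊛ (one ⊖ x ⊛ x) ⊛ (one ⊖ x ⊛ x) ⊛ (one ⊖ x ⊛ x))
    l = solveˢ 1 (λ x → let o = con 1ℚ in ((o :+ x :* x) :* ((o :- x) :* ((o :- x) :* ((o :- x) :* ((o :- x) :* o))))) :* ((o :+ x) :* ((o :+ x) :* ((o :+ x) :* ((o :+ x) :* o))))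
      := (o :+ x :* x) :* ((o :- x :* x) :* (o :- x :* x) :* (o :- x :* x) :* (o :- x :* x)))

ringˢ₃₆ : ∀ a b c d → (a ⊛ (b ⊛ c)) ⊛ d ≈ a ⊛ (b ⊛ (c ⊛ d))
ringˢ₃₆ = solveˢ 4 (λ a b c d → (a :* (b :* c)) :* d := a :* (b :* (c :* d)))

u4v4^ : ∀ j → (u4 ⊛ v4) ^ˢ j ≈ κ (8ℚ ^ j) ⊛ (X ^ˢ j ⊛ ((one ⊕ s) ⊛ v4) ^ˢ j)
u4v4^ j = begin
  (u4 ⊛ v4) ^ˢ j ≈⟨ ^ˢ-cong j (ringˢ₃₆ (κ 8ℚ) X (one ⊕ s) v4) ⟩
  (κ 8ℚ ⊛ (X ⊛ ((one ⊕ s) ⊛ v4))) ^ˢ j ≈⟨ ^ˢ-distrib (κ 8ℚ) (X ⊛ ((one ⊕ s) ⊛ v4)) j ⟩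
  κ 8ℚ ^ˢ j ⊛ (X ⊛ ((one ⊕ s) ⊛ v4)) ^ˢ j ≈⟨ ⊛-cong (κ^ 8ℚ j) (^ˢ-distrib X ((one ⊕ s) ⊛ v4) j) ⟩
  κ (8ℚ ^ j) ⊛ (X ^ˢ j ⊛ ((one ⊕ s) ⊛ v4) ^ˢ j) ∎
  where
  open ≈-Reasoning

ringˢ₃₇ : ∀ a b c d w → ((a ⊛ (b ⊛ c)) ⊛ d) ⊛ w ≈ b ⊛ (a ⊛ (c ⊛ d ⊛ w))
ringˢ₃₇ = solveˢ 5 (λ a b c d w → ((a :* (b :* c)) :* d) :* w := b :* (a :* (c :* d :* w)))

ringⁿ₈ : ∀ j i o A → 8 ℕ.* j ℕ.+ (i ℕ.* 4 ℕ.+ (o ℕ.+ A)) ≡ 8 ℕ.* j ℕ.+ 4 ℕ.* i ℕ.+ o ℕ.+ A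
ringⁿ₈ = ℕR.solve-∀

ringⁿ₉ : ∀ j k → 12 ℕ.* (j ℕ.+ k) ≡ 8 ℕ.* j ℕ.+ (k ℕ.* 12 ℕ.+ j ℕ.* 4)
ringⁿ₉ = ℕR.solve-∀

ringˢ₃₈ : ∀ a b c d r w → (a ⊛ b) ⊛ (c ⊛ ((d ⊛ r) ⊛ w)) ≈ (a ⊛ (b ⊛ (c ⊛ d))) ⊛ (r ⊛ w)
ringˢ₃₈ = solveˢ 6 (λ a b c d r w → (a :* b) :* (c :* ((d :* r) :* w)) := (a :* (b :* (c :* d))) :* (r :* w))

ringˢ₃₉ : ∀ k x c t u r r' d → ((k ⊛ (x ⊛ c)) ⊛ (t ⊛ u)) ⊛ ((r ⊛ r') ⊛ d) ≈ (c ⊛ u ⊛ r) ⊛ (k ⊛ (x ⊛ ((t ⊛ r') ⊛ d)))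
ringˢ₃₉ = solveˢ 8 (λ k x c t u r r' d → ((k :* (x :* c)) :* (t :* u)) :* ((r :* r') :* d) := (c :* u :* r) :* (k :* (x :* ((t :* r') :* d))))

-- Because (1 + t²) v4 t4 R = 1 and u4 + v4 = T⁴, the kernel turns the monomial into 8^j t^j
-- ρ₁^(J-j) `D₁`. Lagrange orthogonality removes j < J, and the order in t removes j > J.
residue₁ : ∀ n J A → n ℕ.+ A ≡ 12 ℕ.* J → ∀ j i o → 8 ℕ.* j ℕ.+ 4 ℕ.* i ℕ.+ o ≡ n →
  (((u4 ⊛ v4) ^ˢ j ⊛ (u4 ⊕ v4) ^ˢ i) ⊛ (T ^ˢ o ⊛ W₁ J A)) J ≡ 8ℚ ^ J * δ J j
residue₁ n J A eA j i o e with ℕₚ.≤-<-connex j J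
... | inj₂ J<j = begin
  (((u4 ⊛ v4) ^ˢ j ⊛ (u4 ⊕ v4) ^ˢ i) ⊛ (T ^ˢ o ⊛ W₁ J A)) J ≡⟨ at (congʳ (T ^ˢ o ⊛ W₁ J A) (congʳ ((u4 ⊕ v4) ^ˢ i) (u4v4^ j))) J ⟩
  (((κ (8ℚ ^ j) ⊛ (X ^ˢ j ⊛ ((one ⊕ s) ⊛ v4) ^ˢ j)) ⊛ (u4 ⊕ v4) ^ˢ i) ⊛ (T ^ˢ o ⊛ W₁ J A)) J
    ≡⟨ at (ringˢ₃₇ (κ (8ℚ ^ j)) (X ^ˢ j) (((one ⊕ s) ⊛ v4) ^ˢ j) ((u4 ⊕ v4) ^ˢ i) (T ^ˢ o ⊛ W₁ J A)) J ⟩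
  (X ^ˢ j ⊛ (κ (8ℚ ^ j) ⊛ (((one ⊕ s) ⊛ v4) ^ˢ j ⊛ (u4 ⊕ v4) ^ˢ i ⊛ (T ^ˢ o ⊛ W₁ J A)))) J
    ≡⟨ X^⊛-< j (κ (8ℚ ^ j) ⊛ (((one ⊕ s) ⊛ v4) ^ˢ j ⊛ (u4 ⊕ v4) ^ˢ i ⊛ (T ^ˢ o ⊛ W₁ J A))) J J<j ⟩
  0ℚ ≡⟨ trans (cong (8ℚ ^ J *_) (δ-≢ J j (λ { refl → ℕₚ.<-irrefl refl J<j }))) (ℚₚ.*-zeroʳ (8ℚ ^ J)) ⟨
  8ℚ ^ J * δ J j ∎
  where
  open ≡-Reasoning
... | inj₁ j≤J with ℕₚ.m≤n⇒∃[o]m+o≡n j≤J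
...   | k , refl = begin
  (((u4 ⊛ v4) ^ˢ j ⊛ (u4 ⊕ v4) ^ˢ i) ⊛ (T ^ˢ o ⊛ W₁ (j ℕ.+ k) A)) (j ℕ.+ k) ≡⟨ at main (j ℕ.+ k) ⟩
  (κ (8ℚ ^ j) ⊛ (X ^ˢ j ⊛ (ρ₁ ^ˢ k ⊛ D₁))) (j ℕ.+ k) ≡⟨ κ⊛ (8ℚ ^ j) (X ^ˢ j ⊛ (ρ₁ ^ˢ k ⊛ D₁)) (j ℕ.+ k) ⟩
  8ℚ ^ j * (X ^ˢ j ⊛ (ρ₁ ^ˢ k ⊛ D₁)) (j ℕ.+ k) ≡⟨ cong (8ℚ ^ j *_) (X^⊛-+ j (ρ₁ ^ˢ k ⊛ D₁) k) ⟩
  8ℚ ^ j * (ρ₁ ^ˢ k ⊛ D₁) k ≡⟨ fin k ⟩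
  8ℚ ^ (j ℕ.+ k) * δ (j ℕ.+ k) j ∎
  where
  open ≡-Reasoning
  fin : ∀ k → 8ℚ ^ j * (ρ₁ ^ˢ k ⊛ D₁) k ≡ 8ℚ ^ (j ℕ.+ k) * δ (j ℕ.+ k) j
  fin zero = trans (cong (8ℚ ^ j *_) refl) (sym (trans (cong (λ z → 8ℚ ^ z * δ z j) (ℕₚ.+-identityʳ j)) (cong (8ℚ ^ j *_) (δ-refl j))))
  fin (suc k) = trans (cong (8ℚ ^ j *_) (residue-^ {ρ₁} {e₁} (suc k) LD-ρ₁ (s≤s z≤n))) (trans (ℚₚ.*-zeroʳ (8ℚ ^ j))
    (sym (trans (cong (8ℚ ^ (j ℕ.+ suc k) *_) (δ-≢ (j ℕ.+ suc k) j (λ q → ℕₚ.m≢1+m+n j (trans (sym q) (ℕₚ.+-suc j k))))) (ℚₚ.*-zeroʳ (8ℚ ^ (j ℕ.+ suc k))))))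
  expo : i ℕ.* 4 ℕ.+ (o ℕ.+ A) ≡ k ℕ.* 12 ℕ.+ j ℕ.* 4
  expo = ℕₚ.+-cancelˡ-≡ (8 ℕ.* j) (i ℕ.* 4 ℕ.+ (o ℕ.+ A)) (k ℕ.* 12 ℕ.+ j ℕ.* 4)
    (trans (ringⁿ₈ j i o A) (trans (cong (ℕ._+ A) e) (trans eA (ringⁿ₉ j k))))
  Texp : (u4 ⊕ v4) ^ˢ i ⊛ (T ^ˢ o ⊛ T ^ˢ A) ≈ (T ^ˢ 12) ^ˢ k ⊛ t4 ^ˢ j
  Texp = ≈-trans (⊛-cong (≈-trans (^ˢ-cong i u4+v4) (≈-sym (^ˢ-* T i 4))) (≈-sym (^ˢ-+ T o A)))
    (≈-trans (≈-sym (^ˢ-+ T (i ℕ.* 4) (o ℕ.+ A))) (≈-trans (subst (λ z → T ^ˢ (i ℕ.* 4 ℕ.+ (o ℕ.+ A)) ≈ T ^ˢ z) expo ≈-refl)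
    (≈-trans (^ˢ-+ T (k ℕ.* 12) (j ℕ.* 4)) (⊛-cong (^ˢ-* T k 12) (^ˢ-* T j 4)))))
  c : PS
  c = (one ⊕ s) ⊛ v4
  main : ((u4 ⊛ v4) ^ˢ j ⊛ (u4 ⊕ v4) ^ˢ i) ⊛ (T ^ˢ o ⊛ W₁ (j ℕ.+ k) A) ≈ κ (8ℚ ^ j) ⊛ (X ^ˢ j ⊛ (ρ₁ ^ˢ k ⊛ D₁))
  main = S.begin
    ((u4 ⊛ v4) ^ˢ j ⊛ (u4 ⊕ v4) ^ˢ i) ⊛ (T ^ˢ o ⊛ ((T ^ˢ A ⊛ R ^ˢ (j ℕ.+ k)) ⊛ D₁))
      S.≈⟨ ringˢ₃₈ ((u4 ⊛ v4) ^ˢ j) ((u4 ⊕ v4) ^ˢ i) (T ^ˢ o) (T ^ˢ A) (R ^ˢ (j ℕ.+ k)) D₁ ⟩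
    ((u4 ⊛ v4) ^ˢ j ⊛ ((u4 ⊕ v4) ^ˢ i ⊛ (T ^ˢ o ⊛ T ^ˢ A))) ⊛ (R ^ˢ (j ℕ.+ k) ⊛ D₁)
      S.≈⟨ ⊛-cong (⊛-cong (u4v4^ j) Texp) (congʳ D₁ (^ˢ-+ R j k)) ⟩
    ((κ (8ℚ ^ j) ⊛ (X ^ˢ j ⊛ c ^ˢ j)) ⊛ ((T ^ˢ 12) ^ˢ k ⊛ t4 ^ˢ j)) ⊛ ((R ^ˢ j ⊛ R ^ˢ k) ⊛ D₁)
      S.≈⟨ ringˢ₃₉ (κ (8ℚ ^ j)) (X ^ˢ j) (c ^ˢ j) ((T ^ˢ 12) ^ˢ k) (t4 ^ˢ j) (R ^ˢ j) (R ^ˢ k) D₁ ⟩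
    (c ^ˢ j ⊛ t4 ^ˢ j ⊛ R ^ˢ j) ⊛ (κ (8ℚ ^ j) ⊛ (X ^ˢ j ⊛ (((T ^ˢ 12) ^ˢ k ⊛ R ^ˢ k) ⊛ D₁)))
      S.≈⟨ ⊛-cong (≈-trans (congʳ (R ^ˢ j) (≈-sym (^ˢ-distrib c t4 j))) (inv^ (c ⊛ t4) R j cvtR)) (congˡ (κ (8ℚ ^ j)) (congˡ (X ^ˢ j) (congʳ D₁ (≈-sym (^ˢ-distrib (T ^ˢ 12) R k))))) ⟩
    one ⊛ (κ (8ℚ ^ j) ⊛ (X ^ˢ j ⊛ (ρ₁ ^ˢ k ⊛ D₁))) S.≈⟨ idˡ (κ (8ℚ ^ j) ⊛ (X ^ˢ j ⊛ (ρ₁ ^ˢ k ⊛ D₁))) ⟩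
    κ (8ℚ ^ j) ⊛ (X ^ˢ j ⊛ (ρ₁ ^ˢ k ⊛ D₁)) S.∎
    where
    module S = ≈-Reasoning

ringˢ₄₀ : ∀ j f h t y l → j ⊛ (f ⊛ (h ⊛ (one ⊖ (t ⊛ y ⊕ l)))) ≈ (f ⊛ h) ⊛ (j ⊖ j ⊛ l) ⊖ (t ⊛ j) ⊛ ((f ⊛ h) ⊛ y)
ringˢ₄₀ = solveˢ 6 (λ j f h t y l → j :* (f :* (h :* (con 1ℚ :- (t :* y :+ l)))) := (f :* h) :* (j :- j :* l) :- (t :* j) :* ((f :* h) :* y))

ringˢ₄₁ : ∀ j f n a y l k → f ⊛ (j ⊖ j ⊛ l) ⊖ (n ⊕ a) ⊛ (f ⊛ y) ≈ f ⊛ (j ⊖ (k ⊛ one ⊕ (a ⊛ y ⊕ j ⊛ l))) ⊕ f ⊛ (k ⊖ n ⊛ y)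
ringˢ₄₁ = solveˢ 7 (λ j f n a y l k → f :* (j :- j :* l) :- (n :+ a) :* (f :* y) := f :* (j :- (k :* con 1ℚ :+ (a :* y :+ j :* l))) :+ f :* (k :- n :* y))

ringˢ₄₂ : ∀ f t a r k n x i → (f ⊛ ((t ⊛ a) ⊛ r)) ⊛ (k ⊖ n ⊛ (x ⊛ i)) ≈ f ⊛ ((a ⊛ r) ⊛ (k ⊛ t ⊖ (n ⊛ x) ⊛ (t ⊛ i)))
ringˢ₄₂ = solveˢ 8 (λ f t a r k n x i → (f :* ((t :* a) :* r)) :* (k :- n :* (x :* i)) := f :* ((a :* r) :* (k :* t :- (n :* x) :* (t :* i))))

-- The derivative of t^k T^(A+1) R^J is subtracted. This removes `L` altogether; of the 12 J = n +
-- (A + 1) copies of tT'/T in J `e₁` it uses up A + 1, so that k - n t/T remains.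
residue-by-parts : ∀ n J A k → n ℕ.+ suc A ≡ 12 ℕ.* J →
  ι J * (X ^ˢ k ⊛ W₁ J (suc A)) J ≡ (X ^ˢ k ⊛ ((T ^ˢ A ⊛ R ^ˢ J) ⊛ (κ (ι k) ⊛ T ⊖ κ (ι n) ⊛ X))) J
residue-by-parts n J A k eA = begin
  ι J * (F ⊛ W₁ J (suc A)) J ≡⟨ κ⊛ (ι J) (F ⊛ W₁ J (suc A)) J ⟨
  (κ (ι J) ⊛ (F ⊛ (H ⊛ D₁))) J ≡⟨ at split J ⟩
  ((F ⊛ H) ⊛ (κ (ι J) ⊖ E) ⊕ (F ⊛ H) ⊛ (κ (ι k) ⊖ κ (ι n) ⊛ (X ⊛ Ti))) J
    ≡⟨ cong (_+ ((F ⊛ H) ⊛ (κ (ι k) ⊖ κ (ι n) ⊛ (X ⊛ Ti))) J) (residue J (LD-⊛ (LD-^ k LD-X) (LD-⊛ (LD-^ (suc A) LD-T) (LD-^ J LD-R)))) ⟩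
  0ℚ + ((F ⊛ H) ⊛ (κ (ι k) ⊖ κ (ι n) ⊛ (X ⊛ Ti))) J ≡⟨ ℚₚ.+-identityˡ (((F ⊛ H) ⊛ (κ (ι k) ⊖ κ (ι n) ⊛ (X ⊛ Ti))) J) ⟩
  ((F ⊛ H) ⊛ (κ (ι k) ⊖ κ (ι n) ⊛ (X ⊛ Ti))) J ≡⟨ at drop J ⟩
  (F ⊛ ((T ^ˢ A ⊛ R ^ˢ J) ⊛ (κ (ι k) ⊛ T ⊖ κ (ι n) ⊛ X))) J ∎
  where
  open ≡-Reasoning
  F H E : PS
  F = X ^ˢ k
  H = T ^ˢ suc A ⊛ R ^ˢ J
  E = κ (ι k) ⊛ one ⊕ (κ (ι (suc A)) ⊛ (X ⊛ Ti) ⊕ κ (ι J) ⊛ L)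
  12J : κ (ι 12) ⊛ κ (ι J) ≈ κ (ι n) ⊕ κ (ι (suc A))
  12J = ≈-trans (≈-sym (κ-* (ι 12) (ι J))) (≈-trans (κ-cong (trans (sym (ι-* 12 J)) (trans (cong ι (sym eA)) (ι-+ n (suc A))))) (κ-+ (ι n) (ι (suc A))))
  split : κ (ι J) ⊛ (F ⊛ (H ⊛ D₁)) ≈ (F ⊛ H) ⊛ (κ (ι J) ⊖ E) ⊕ (F ⊛ H) ⊛ (κ (ι k) ⊖ κ (ι n) ⊛ (X ⊛ Ti))
  split = S.begin
    κ (ι J) ⊛ (F ⊛ (H ⊛ (one ⊖ (κ (ι 12) ⊛ (X ⊛ Ti) ⊕ L)))) S.≈⟨ ringˢ₄₀ (κ (ι J)) F H (κ (ι 12)) (X ⊛ Ti) L ⟩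
    (F ⊛ H) ⊛ (κ (ι J) ⊖ κ (ι J) ⊛ L) ⊖ (κ (ι 12) ⊛ κ (ι J)) ⊛ ((F ⊛ H) ⊛ (X ⊛ Ti))
      S.≈⟨ ⊕-congˡ ((F ⊛ H) ⊛ (κ (ι J) ⊖ κ (ι J) ⊛ L)) (PSR.-‿cong (congʳ ((F ⊛ H) ⊛ (X ⊛ Ti)) 12J)) ⟩
    (F ⊛ H) ⊛ (κ (ι J) ⊖ κ (ι J) ⊛ L) ⊖ (κ (ι n) ⊕ κ (ι (suc A))) ⊛ ((F ⊛ H) ⊛ (X ⊛ Ti))
      S.≈⟨ ringˢ₄₁ (κ (ι J)) (F ⊛ H) (κ (ι n)) (κ (ι (suc A))) (X ⊛ Ti) L (κ (ι k)) ⟩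
    (F ⊛ H) ⊛ (κ (ι J) ⊖ E) ⊕ (F ⊛ H) ⊛ (κ (ι k) ⊖ κ (ι n) ⊛ (X ⊛ Ti)) S.∎
    where
    module S = ≈-Reasoning
  drop : (F ⊛ H) ⊛ (κ (ι k) ⊖ κ (ι n) ⊛ (X ⊛ Ti)) ≈ F ⊛ ((T ^ˢ A ⊛ R ^ˢ J) ⊛ (κ (ι k) ⊛ T ⊖ κ (ι n) ⊛ X))
  drop = ≈-trans (ringˢ₄₂ F T (T ^ˢ A) (R ^ˢ J) (κ (ι k)) (κ (ι n)) X Ti)
    (congˡ F (congˡ (T ^ˢ A ⊛ R ^ˢ J) (⊕-congˡ (κ (ι k) ⊛ T) (PSR.-‿cong (≈-trans (congˡ (κ (ι n) ⊛ X) T⊛Ti) (idʳ (κ (ι n) ⊛ X)))))))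

-- The shadow functional

e₂ D₂ ρ₂ : PS
ρ₂ = ((one ⊖ s) ⊛ (one ⊖ s) ⊛ (one ⊖ s)) ⊛ I4
e₂ = ((⊝ (κ 2ℚ ⊛ s ⊛ I2)) ⊕ (⊝ (κ 2ℚ ⊛ s ⊛ I2)) ⊕ (⊝ (κ 2ℚ ⊛ s ⊛ I2))) ⊕ (⊝ (⊝ (κ (pos 4 / 1) ⊛ (s ⊛ s) ⊛ I4)))
D₂ = one ⊖ e₂

LD-ρ₂ : LD ρ₂ e₂
LD-ρ₂ = LD-⊛ (LD-⊛ (LD-⊛ LD-1-s LD-1-s) LD-1-s) (LD-inv I4-eq LD-1-s²)

ringˢ₄₃ : ∀ s i j → one ⊖ (((⊝ (κ 2ℚ ⊛ s ⊛ i)) ⊕ (⊝ (κ 2ℚ ⊛ s ⊛ i)) ⊕ (⊝ (κ 2ℚ ⊛ s ⊛ i))) ⊕ (⊝ (⊝ (κ (pos 4 / 1) ⊛ (s ⊛ s) ⊛ j)))) ≈ (one ⊖ κ (pos 4 / 1) ⊛ (s ⊛ s) ⊛ j) ⊕ κ (pos 6 / 1) ⊛ s ⊛ i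
ringˢ₄₃ = solveˢ 3 (λ s i j → let k = :- (con 2ℚ :* s :* i) in con 1ℚ :- ((k :+ k :+ k) :+ (:- (:- (con (pos 4 / 1) :* (s :* s) :* j)))) := (con 1ℚ :- con (pos 4 / 1) :* (s :* s) :* j) :+ con (pos 6 / 1) :* s :* i)

ringˢ₄₄ : ∀ s j → (one ⊖ κ (pos 4 / 1) ⊛ (s ⊛ s) ⊛ j) ⊕ κ (pos 6 / 1) ⊛ s ⊛ ((one ⊕ s) ⊛ j) ≈ one ⊕ (κ (pos 6 / 1) ⊛ s ⊕ κ (pos 2 / 1) ⊛ (s ⊛ s)) ⊛ j
ringˢ₄₄ = solveˢ 2 (λ s j → (con 1ℚ :- con (pos 4 / 1) :* (s :* s) :* j) :+ con (pos 6 / 1) :* s :* ((con 1ℚ :+ s) :* j) := con 1ℚ :+ (con (pos 6 / 1) :* s :+ con (pos 2 / 1) :* (s :* s)) :* j)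

-- `D₂` is 1 + (6t² + 2t⁴)/(1 - t⁴). This positivity carries the nonnegativity of the shadow over to
-- the coefficients.
NN-D₂ : NN D₂
NN-D₂ = NN-≈ (≈-sym (≈-trans (ringˢ₄₃ s I2 I4) (≈-trans (⊕-congˡ (one ⊖ κ (pos 4 / 1) ⊛ (s ⊛ s) ⊛ I4) (congˡ (κ (pos 6 / 1) ⊛ s) I2≈)) (ringˢ₄₄ s I4))))
  (NN-⊕ (NN-κ 0≤1) (NN-⊛ (NN-⊕ (NN-⊛ (NN-κ lit≤) NN-s) (NN-⊛ (NN-κ lit≤) (NN-⊛ NN-s NN-s))) NN-I4))

W₂ : ℕ → ℕ → PS
W₂ E M = (I2 ^ˢ E ⊛ I4 ^ˢ M) ⊛ D₂

NN-W₂ : ∀ E M → NN (W₂ E M)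
NN-W₂ E M = NN-⊛ (NN-⊛ (NN-^ E NN-I2) (NN-^ M NN-I4)) NN-D₂

u4^ : ∀ w → u4 ^ˢ w ≈ κ (8ℚ ^ w) ⊛ (X ^ˢ w ⊛ (one ⊕ s) ^ˢ w)
u4^ w = ≈-trans (^ˢ-distrib (κ 8ℚ) (X ⊛ (one ⊕ s)) w) (⊛-cong (κ^ 8ℚ w) (^ˢ-distrib X (one ⊕ s) w))

ringˢ₄₅ : ∀ f k g → (⊝ f) ⊛ (k ⊛ g) ≈ (⊝ k) ⊛ (f ⊛ g)
ringˢ₄₅ = solveˢ 3 (λ f k g → (:- f) :* (k :* g) := (:- k) :* (f :* g))

⊝^ : ∀ f j → (⊝ f) ^ˢ j ≈ κ (sg (4 ℕ.* j)) ⊛ f ^ˢ j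
⊝^ f zero = ≈-sym (idˡ one)
⊝^ f (suc j) = ≈-trans (congˡ (⊝ f) (⊝^ f j)) (≈-trans (ringˢ₄₅ f (κ (sg (4 ℕ.* j))) (f ^ˢ j))
  (congʳ (f ⊛ f ^ˢ j) (mk≈ λ { zero → cong sg (sym (ℕₚ.*-suc 4 j)) ; (suc n) → refl })))

private
  v4t4 : v4 ⊛ t4 ≈ (one ⊖ s) ^ˢ 4
  v4t4 = l X
    where
    l : ∀ x → ((one ⊖ x) ⊛ ((one ⊖ x) ⊛ ((one ⊖ x) ⊛ ((one ⊖ x) ⊛ one)))) ⊛ ((one ⊕ x) ⊛ ((one ⊕ x) ⊛ ((one ⊕ x) ⊛ ((one ⊕ x) ⊛ one))))
      ≈ (one ⊖ x ⊛ x) ⊛ ((one ⊖ x ⊛ x) ⊛ ((one ⊖ x ⊛ x) ⊛ ((one ⊖ x ⊛ x) ⊛ one)))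
    l = solveˢ 1 (λ x → let o = con 1ℚ in ((o :- x) :* ((o :- x) :* ((o :- x) :* ((o :- x) :* o)))) :* ((o :+ x) :* ((o :+ x) :* ((o :+ x) :* ((o :+ x) :* o))))
      := (o :- x :* x) :* ((o :- x :* x) :* ((o :- x :* x) :* ((o :- x :* x) :* o))))

ringˢ₄₆ : ∀ a b → (⊝ a) ⊛ b ≈ ⊝ (a ⊛ b)
ringˢ₄₆ = solveˢ 2 (λ a b → (:- a) :* b := :- (a :* b))

-v4t4^ : ∀ j → ((⊝ v4) ⊛ t4) ^ˢ j ≈ κ (sg (4 ℕ.* j)) ⊛ (one ⊖ s) ^ˢ (j ℕ.* 4)
-v4t4^ j = ≈-trans (^ˢ-cong j (≈-trans (ringˢ₄₆ v4 t4) (PSR.-‿cong v4t4))) (≈-trans (⊝^ ((one ⊖ s) ^ˢ 4) j) (congˡ (κ (sg (4 ℕ.* j))) (≈-sym (^ˢ-* (one ⊖ s) j 4))))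

ringˢ₄₇ : ∀ a b c d w → (a ⊛ (b ⊛ (c ⊛ d))) ⊛ w ≈ c ⊛ (a ⊛ b ⊛ d ⊛ w)
ringˢ₄₇ = solveˢ 5 (λ a b c d w → (a :* (b :* (c :* d))) :* w := c :* (a :* b :* d :* w))

ringⁿ₁₀ : ∀ w J d → w ℕ.+ 2 ℕ.* (J ℕ.+ d) ≡ w ℕ.+ 2 ℕ.* d ℕ.+ 2 ℕ.* J
ringⁿ₁₀ = ℕR.solve-∀

ringⁿ₁₁ : ∀ J d → (J ℕ.+ d) ℕ.* 4 ≡ 4 ℕ.* J ℕ.+ 2 ℕ.* (2 ℕ.* d)
ringⁿ₁₁ = ℕR.solve-∀

ringⁿ₁₂ : ∀ E w k → E ℕ.+ (w ℕ.+ k) ℕ.+ 2 ℕ.* k ≡ E ℕ.+ (w ℕ.+ k ℕ.* 3)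
ringⁿ₁₂ = ℕR.solve-∀

ringˢ₄₈ : ∀ a → a ⊛ (a ⊛ (a ⊛ one)) ≈ a ⊛ a ⊛ a
ringˢ₄₈ = solveˢ 1 (λ a → a :* (a :* (a :* con 1ℚ)) := a :* a :* a)

ringˢ₄₉ : ∀ s → (one ⊖ s) ⊛ (one ⊕ s) ≈ one ⊖ s ⊛ s
ringˢ₄₉ = solveˢ 1 (λ s → (con 1ℚ :- s) :* (con 1ℚ :+ s) := con 1ℚ :- s :* s)

ringˢ₅₀ : ∀ σ a b c k x p i j m d → ((σ ⊛ (a ⊛ (b ⊛ c))) ⊛ (k ⊛ (x ⊛ p))) ⊛ ((i ⊛ (j ⊛ m)) ⊛ d) ≈ ((a ⊛ i) ⊛ (b ⊛ p ⊛ j)) ⊛ ((σ ⊛ k) ⊛ (x ⊛ ((c ⊛ m) ⊛ d)))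
ringˢ₅₀ = solveˢ 11 (λ σ a b c k x p i j m d → ((σ :* (a :* (b :* c))) :* (k :* (x :* p))) :* ((i :* (j :* m)) :* d) := ((a :* i) :* (b :* p :* j)) :* ((σ :* k) :* (x :* ((c :* m) :* d))))

-- In the shadow the symmetric variables are x = -V⁴ and y = T⁴, with x + y = u4 and xy = -(1 -
-- t²)⁴, so it is now x + y that is small and t/ρ₂ = u4 / 8(1 - t²)² is the Lagrange variable. Terms
-- with j < J have order above M; those with j > J are residues of ρ₂^(2(j-J)).
residue₂ : ∀ J E M → 4 ℕ.* J ≡ E ℕ.+ M → ∀ j w → w ℕ.+ 2 ℕ.* j ≡ M ℕ.+ 2 ℕ.* J →
  ((((⊝ v4) ⊛ t4) ^ˢ j ⊛ u4 ^ˢ w) ⊛ W₂ E M) M ≡ sg (4 ℕ.* J) * 8ℚ ^ M * δ J j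
residue₂ J E M eE j w e with ℕₚ.≤-<-connex J j
... | inj₂ j<J = begin
  ((((⊝ v4) ⊛ t4) ^ˢ j ⊛ u4 ^ˢ w) ⊛ W₂ E M) M ≡⟨ at (≈-trans (congʳ (W₂ E M) (congˡ (((⊝ v4) ⊛ t4) ^ˢ j) (u4^ w))) (ringˢ₄₇ (((⊝ v4) ⊛ t4) ^ˢ j) (κ (8ℚ ^ w)) (X ^ˢ w) ((one ⊕ s) ^ˢ w) (W₂ E M))) M ⟩
  (X ^ˢ w ⊛ (((⊝ v4) ⊛ t4) ^ˢ j ⊛ κ (8ℚ ^ w) ⊛ (one ⊕ s) ^ˢ w ⊛ W₂ E M)) M ≡⟨ X^⊛-< w (((⊝ v4) ⊛ t4) ^ˢ j ⊛ κ (8ℚ ^ w) ⊛ (one ⊕ s) ^ˢ w ⊛ W₂ E M) M M<w ⟩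
  0ℚ ≡⟨ trans (cong (sg (4 ℕ.* J) * 8ℚ ^ M *_) (δ-≢ J j (λ { refl → ℕₚ.<-irrefl refl j<J }))) (ℚₚ.*-zeroʳ (sg (4 ℕ.* J) * 8ℚ ^ M)) ⟨
  sg (4 ℕ.* J) * 8ℚ ^ M * δ J j ∎
  where
  open ≡-Reasoning
  M<w : M ℕ.< w
  M<w = ℕₚ.+-cancelʳ-< (2 ℕ.* j) M w (subst (M ℕ.+ 2 ℕ.* j ℕ.<_) (sym e) (ℕₚ.+-monoʳ-< M (ℕₚ.*-monoʳ-< 2 j<J)))
... | inj₁ J≤j with ℕₚ.m≤n⇒∃[o]m+o≡n J≤j
...   | d , refl = begin
  ((((⊝ v4) ⊛ t4) ^ˢ (J ℕ.+ d) ⊛ u4 ^ˢ w) ⊛ W₂ E M) M ≡⟨ at main M ⟩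
  (κ (sg (4 ℕ.* (J ℕ.+ d)) * 8ℚ ^ w) ⊛ (X ^ˢ w ⊛ (ρ₂ ^ˢ k ⊛ D₂))) M ≡⟨ κ⊛ (sg (4 ℕ.* (J ℕ.+ d)) * 8ℚ ^ w) (X ^ˢ w ⊛ (ρ₂ ^ˢ k ⊛ D₂)) M ⟩
  sg (4 ℕ.* (J ℕ.+ d)) * 8ℚ ^ w * (X ^ˢ w ⊛ (ρ₂ ^ˢ k ⊛ D₂)) M
    ≡⟨ cong (λ z → sg (4 ℕ.* (J ℕ.+ d)) * 8ℚ ^ w * (X ^ˢ w ⊛ (ρ₂ ^ˢ k ⊛ D₂)) z) eM ⟩
  sg (4 ℕ.* (J ℕ.+ d)) * 8ℚ ^ w * (X ^ˢ w ⊛ (ρ₂ ^ˢ k ⊛ D₂)) (w ℕ.+ k) ≡⟨ cong (sg (4 ℕ.* (J ℕ.+ d)) * 8ℚ ^ w *_) (X^⊛-+ w (ρ₂ ^ˢ k ⊛ D₂) k) ⟩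
  sg (4 ℕ.* (J ℕ.+ d)) * 8ℚ ^ w * (ρ₂ ^ˢ k ⊛ D₂) k ≡⟨ fin d eM ⟩
  sg (4 ℕ.* J) * 8ℚ ^ M * δ J (J ℕ.+ d) ∎
  where
  open ≡-Reasoning
  k : ℕ
  k = 2 ℕ.* d
  eM : M ≡ w ℕ.+ k
  eM = ℕₚ.+-cancelʳ-≡ (2 ℕ.* J) M (w ℕ.+ k) (trans (sym e) (ringⁿ₁₀ w J d))
  fin : ∀ d → M ≡ w ℕ.+ 2 ℕ.* d → sg (4 ℕ.* (J ℕ.+ d)) * 8ℚ ^ w * (ρ₂ ^ˢ (2 ℕ.* d) ⊛ D₂) (2 ℕ.* d) ≡ sg (4 ℕ.* J) * 8ℚ ^ M * δ J (J ℕ.+ d)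
  fin zero q = cong₂ _*_ (cong₂ (λ a b → sg (4 ℕ.* a) * 8ℚ ^ b) (ℕₚ.+-identityʳ J) (sym (trans q (ℕₚ.+-identityʳ w))))
    (sym (trans (cong (δ J) (ℕₚ.+-identityʳ J)) (δ-refl J)))
  fin (suc d) q = trans (cong (sg (4 ℕ.* (J ℕ.+ suc d)) * 8ℚ ^ w *_) (residue-^ {ρ₂} {e₂} (2 ℕ.* suc d) LD-ρ₂ (s≤s z≤n)))
    (trans (ℚₚ.*-zeroʳ (sg (4 ℕ.* (J ℕ.+ suc d)) * 8ℚ ^ w)) (sym (trans (cong (sg (4 ℕ.* J) * 8ℚ ^ M *_) (δ-≢ J (J ℕ.+ suc d) (λ q → ℕₚ.m≢1+m+n J (trans q (ℕₚ.+-suc J d))))) (ℚₚ.*-zeroʳ (sg (4 ℕ.* J) * 8ℚ ^ M)))))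
  expo : (J ℕ.+ d) ℕ.* 4 ≡ E ℕ.+ (w ℕ.+ k ℕ.* 3)
  expo = trans (ringⁿ₁₁ J d) (trans (cong (ℕ._+ 2 ℕ.* k) (trans eE (cong (E ℕ.+_) eM))) (ringⁿ₁₂ E w k))
  a : PS
  a = one ⊖ s
  a^ : a ^ˢ ((J ℕ.+ d) ℕ.* 4) ≈ a ^ˢ E ⊛ (a ^ˢ w ⊛ (a ⊛ a ⊛ a) ^ˢ k)
  a^ = ≈-trans (subst (λ z → a ^ˢ ((J ℕ.+ d) ℕ.* 4) ≈ a ^ˢ z) expo ≈-refl) (≈-trans (^ˢ-+ a E (w ℕ.+ k ℕ.* 3)) (congˡ (a ^ˢ E)
    (≈-trans (^ˢ-+ a w (k ℕ.* 3)) (congˡ (a ^ˢ w) (≈-trans (^ˢ-* a k 3) (^ˢ-cong k (ringˢ₄₈ a)))))))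
  I4^ : I4 ^ˢ M ≈ I4 ^ˢ w ⊛ I4 ^ˢ k
  I4^ = ≈-trans (subst (λ z → I4 ^ˢ M ≈ I4 ^ˢ z) eM ≈-refl) (^ˢ-+ I4 w k)
  main : (((⊝ v4) ⊛ t4) ^ˢ (J ℕ.+ d) ⊛ u4 ^ˢ w) ⊛ W₂ E M ≈ κ (sg (4 ℕ.* (J ℕ.+ d)) * 8ℚ ^ w) ⊛ (X ^ˢ w ⊛ (ρ₂ ^ˢ k ⊛ D₂))
  main = S.begin
    (((⊝ v4) ⊛ t4) ^ˢ (J ℕ.+ d) ⊛ u4 ^ˢ w) ⊛ ((I2 ^ˢ E ⊛ I4 ^ˢ M) ⊛ D₂)
      S.≈⟨ ⊛-cong (⊛-cong (≈-trans (-v4t4^ (J ℕ.+ d)) (congˡ σ a^)) (u4^ w)) (congʳ D₂ (congˡ (I2 ^ˢ E) I4^)) ⟩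
    ((σ ⊛ (a ^ˢ E ⊛ (a ^ˢ w ⊛ (a ⊛ a ⊛ a) ^ˢ k))) ⊛ (κ (8ℚ ^ w) ⊛ (X ^ˢ w ⊛ (one ⊕ s) ^ˢ w))) ⊛ ((I2 ^ˢ E ⊛ (I4 ^ˢ w ⊛ I4 ^ˢ k)) ⊛ D₂)
      S.≈⟨ ringˢ₅₀ σ (a ^ˢ E) (a ^ˢ w) ((a ⊛ a ⊛ a) ^ˢ k) (κ (8ℚ ^ w)) (X ^ˢ w) ((one ⊕ s) ^ˢ w) (I2 ^ˢ E) (I4 ^ˢ w) (I4 ^ˢ k) D₂ ⟩
    ((a ^ˢ E ⊛ I2 ^ˢ E) ⊛ (a ^ˢ w ⊛ (one ⊕ s) ^ˢ w ⊛ I4 ^ˢ w)) ⊛ ((σ ⊛ κ (8ℚ ^ w)) ⊛ (X ^ˢ w ⊛ (((a ⊛ a ⊛ a) ^ˢ k ⊛ I4 ^ˢ k) ⊛ D₂)))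
      S.≈⟨ ⊛-cong (≈-trans (⊛-cong (inv^ a I2 E I2-eq) (≈-trans (congʳ (I4 ^ˢ w) (≈-sym (^ˢ-distrib a (one ⊕ s) w))) (inv^ (a ⊛ (one ⊕ s)) I4 w (≈-trans (congʳ I4 (ringˢ₄₉ s)) I4-eq)))) (idˡ one))
           (⊛-cong (≈-sym (κ-* (sg (4 ℕ.* (J ℕ.+ d))) (8ℚ ^ w))) (congˡ (X ^ˢ w) (congʳ D₂ (≈-sym (^ˢ-distrib (a ⊛ a ⊛ a) I4 k))))) ⟩
    one ⊛ (κ (sg (4 ℕ.* (J ℕ.+ d)) * 8ℚ ^ w) ⊛ (X ^ˢ w ⊛ (ρ₂ ^ˢ k ⊛ D₂))) S.≈⟨ idˡ _ ⟩
    κ (sg (4 ℕ.* (J ℕ.+ d)) * 8ℚ ^ w) ⊛ (X ^ˢ w ⊛ (ρ₂ ^ˢ k ⊛ D₂)) S.∎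
    where
    module S = ≈-Reasoning
    σ : PS
    σ = κ (sg (4 ℕ.* (J ℕ.+ d)))

4*/4 : ∀ m → 4 ℕ.* m ℕ./ 4 ≡ m
4*/4 m = trans (cong (ℕ._/ 4) (ℕₚ.*-comm 4 m)) (DivMod.m*n/n≡m m 4)

^ˢ4* : ∀ f m → f ^ˢ (4 ℕ.* m) ≈ (f ^ˢ 4) ^ˢ m
^ˢ4* f m = ≈-trans (subst (λ z → f ^ˢ (4 ℕ.* m) ≈ f ^ˢ z) (ℕₚ.*-comm 4 m) ≈-refl) (^ˢ-* f m 4)

ringˢ₅₁ : ∀ a b → (⊝ b) ⊕ (a ⊕ b) ≈ a
ringˢ₅₁ = solveˢ 2 (λ a b → (:- b) :+ (a :+ b) := a)

-u4 : (⊝ v4) ⊕ t4 ≈ u4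
-u4 = ≈-trans (⊕-congˡ (⊝ v4) (≈-sym u4+v4)) (ringˢ₅₁ u4 v4)

ringⁿ₁₃ : ∀ j i o → 8 ℕ.* j ℕ.+ 4 ℕ.* i ℕ.+ o ≡ 4 ℕ.* (2 ℕ.* j ℕ.+ i) ℕ.+ o
ringⁿ₁₃ = ℕR.solve-∀

ringⁿ₁₄ : ∀ m l o → o ℕ.+ (m ℕ.+ l) ℕ.* 4 ≡ 4 ℕ.* m ℕ.+ 4 ℕ.* l ℕ.+ o
ringⁿ₁₄ = ℕR.solve-∀

ringˢ₅₂ : ∀ k u v t w → k ⊛ ((u ⊛ v ⊛ t) ⊛ w) ≈ ((k ⊛ v) ⊛ t) ⊛ (u ⊛ w)
ringˢ₅₂ = solveˢ 5 (λ k u v t w → k :* ((u :* v :* t) :* w) := ((k :* v) :* t) :* (u :* w))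

ringˢ₅₃ : ∀ a b c w → (a ⊛ b) ⊛ (c ⊛ w) ≈ (a ⊛ (b ⊛ c)) ⊛ w
ringˢ₅₃ = solveˢ 4 (λ a b c w → (a :* b) :* (c :* w) := (a :* (b :* c)) :* w)

ringⁿ₁₅ : ∀ i w j → i ℕ.+ w ℕ.+ 2 ℕ.* j ≡ w ℕ.+ (2 ℕ.* j ℕ.+ i)
ringⁿ₁₅ = ℕR.solve-∀

ringᵠ₆₈ : ∀ a b c d → a * b * (c * d) ≡ a * (c * b * d)
ringᵠ₆₈ = solveᵠ 4 λ a b c d → a :* b :* (c :* d) := a :* (c :* b :* d)

ringᵠ₆₉ : ∀ a b c → a * (b * c) ≡ b * (a * c)
ringᵠ₆₉ = solveᵠ 3 λ a b c → a :* (b :* c) := b :* (a :* c)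

ringᵠ₇₀ : ∀ a b c d → c * (a * (b * d)) ≡ a * b * (c * d)
ringᵠ₇₀ = solveᵠ 4 λ a b c d → c :* (a :* (b :* d)) := a :* b :* (c :* d)

-- Signs of the coefficients of the enumerator.

module Signs {n : ℕ} (C : Code n) (sd : SelfDual C) (C? : ∀ v → Dec (C v)) where
  open SelfDualCode C sd C?
  open Enumerator C sd C?

  M₁ : ℕ → ℕ → Mono
  M₁ J A p r o = ((u4 ^ˢ (p ℕ./ 4) ⊛ V ^ˢ r ⊛ T ^ˢ o) ⊛ W₁ J A) J

  enum₁ : ∀ J A → n ℕ.+ A ≡ 12 ℕ.* J → total * enum (M₁ J A) ≡ 2ℚ ^ n * (8ℚ ^ J * G J)
  enum₁ J A eA = gleason (M₁ J A) (8ℚ ^ J) J cond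
    where
    open ≡-Reasoning
    mono : ∀ m l o → M₁ J A (4 ℕ.* m) (4 ℕ.* l) o ≡ ((u4 ^ˢ m ⊛ v4 ^ˢ l) ⊛ (T ^ˢ o ⊛ W₁ J A)) J
    mono m l o = trans (cong (λ z → ((u4 ^ˢ z ⊛ V ^ˢ (4 ℕ.* l) ⊛ T ^ˢ o) ⊛ W₁ J A) J) (4*/4 m))
      (at (≈-trans (congʳ (W₁ J A) (congʳ (T ^ˢ o) (congˡ (u4 ^ˢ m) (^ˢ4* V l)))) (assocˢ (u4 ^ˢ m ⊛ v4 ^ˢ l) (T ^ˢ o) (W₁ J A))) J)
    deg : ∀ m l j i o → 4 ℕ.* m ℕ.+ 4 ℕ.* l ℕ.+ o ≡ n → 2 ℕ.* j ℕ.+ i ≡ m ℕ.+ l → 8 ℕ.* j ℕ.+ 4 ℕ.* i ℕ.+ o ≡ n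
    deg m l j i o e e' = trans (ringⁿ₁₃ j i o) (trans (cong (λ z → 4 ℕ.* z ℕ.+ o) e') (trans (cong (ℕ._+ o) (ℕₚ.*-distribˡ-+ 4 m l)) e))
    cond : ∀ m l o → 4 ℕ.* m ℕ.+ 4 ℕ.* l ℕ.+ o ≡ n → M₁ J A (4 ℕ.* m) (4 ℕ.* l) o + M₁ J A (4 ℕ.* l) (4 ℕ.* m) o ≡ 8ℚ ^ J * symE m l (λ j i → δ J j)
    cond m l o e = begin
      M₁ J A (4 ℕ.* m) (4 ℕ.* l) o + M₁ J A (4 ℕ.* l) (4 ℕ.* m) o ≡⟨ cong₂ _+_ (mono m l o) (mono l m o) ⟩
      ((u4 ^ˢ m ⊛ v4 ^ˢ l) ⊛ Z ⊕ (u4 ^ˢ l ⊛ v4 ^ˢ m) ⊛ Z) J ≡⟨ at (PSR.distribʳ Z (u4 ^ˢ m ⊛ v4 ^ˢ l) (u4 ^ˢ l ⊛ v4 ^ˢ m)) J ⟨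
      ((u4 ^ˢ m ⊛ v4 ^ˢ l ⊕ u4 ^ˢ l ⊛ v4 ^ˢ m) ⊛ Z) J ≡⟨ symE-PS m l u4 v4 Z J ⟨
      symE m l (λ j i → (((u4 ⊛ v4) ^ˢ j ⊛ (u4 ⊕ v4) ^ˢ i) ⊛ Z) J) ≡⟨ symE-cong m l (λ j i e' → residue₁ n J A eA j i o (deg m l j i o e e')) ⟩
      symE m l (λ j i → 8ℚ ^ J * δ J j) ≡⟨ symE-* m l (8ℚ ^ J) (λ j i → δ J j) ⟩
      8ℚ ^ J * symE m l (λ j i → δ J j) ∎
      where
      Z : PS
      Z = T ^ˢ o ⊛ W₁ J A

  -- Only letters ±1 in number ≡ n (mod 4) occur in the shadow; a root of U⁴ = u4 is thereby avoided.
  a₂ : ℕ → PS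
  a₂ p with p ℕ.% 4 ℕ.≟ n ℕ.% 4
  ... | yes _ = u4 ^ˢ (p ℕ./ 4)
  ... | no _ = κ 0ℚ

  M₂ : ℕ → ℕ → Mono
  M₂ E M p r o = ((a₂ p ⊛ V ^ˢ r ⊛ T ^ˢ o) ⊛ W₂ E M) M

  NN-u4 : NN u4
  NN-u4 = NN-⊛ (NN-κ lit≤) (NN-⊛ NN-X (NN-⊕ (NN-κ 0≤1) NN-s))

  NN-a₂ : ∀ p → NN (a₂ p)
  NN-a₂ p with p ℕ.% 4 ℕ.≟ n ℕ.% 4
  ... | yes _ = NN-^ (p ℕ./ 4) NN-u4
  ... | no _ = NN-κ ≤-refl

  -- Positivity is termwise: each word of the shadow becomes a power of 2 times a product of series
  -- with nonnegative coefficients.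
  shadow-nonneg : ∀ E M → 0ℚ ≤ sumV n (λ u → shadowWeight u * ev u (M₂ E M))
  shadow-nonneg E M = sumV-nonneg n (λ u → shadowWeight u * ev u (M₂ E M)) λ u → 0≤* (shadowWeight-nonneg u)
    (subst (0ℚ ≤_) (sym (ev-word u a₂ (W₂ E M) M)) (0≤* (^-nonneg (even# u) lit≤) (NN-⊛ (NN-⊛ (NN-a₂ (n₁ u)) (NN-^ (n₂ u) NN-X)) (NN-W₂ E M) M)))

  enum₂ : ∀ J E M → 4 ℕ.* J ≡ E ℕ.+ M → n ℕ./ 4 ≡ M ℕ.+ 2 ℕ.* J →
    total * enum (λ p r o → sg p * M₂ E M o p r) ≡ 2ℚ ^ n * (sg (4 ℕ.* J) * 8ℚ ^ M * G J)
  enum₂ J E M eE eM = gleason M° c J cond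
    where
    open ≡-Reasoning
    M° : Mono
    M° p r o = sg p * M₂ E M o p r
    c : ℚ
    c = sg (4 ℕ.* J) * 8ℚ ^ M
    module _ (m l o : ℕ) (e : 4 ℕ.* m ℕ.+ 4 ℕ.* l ℕ.+ o ≡ n) where
      w : ℕ
      w = o ℕ./ 4
      o+ : o ℕ.+ (m ℕ.+ l) ℕ.* 4 ≡ n
      o+ = trans (ringⁿ₁₄ m l o) e
      w+ : w ℕ.+ (m ℕ.+ l) ≡ n ℕ./ 4
      w+ = trans (cong (w ℕ.+_) (sym (DivMod.m*n/n≡m (m ℕ.+ l) 4))) (trans (sym (DivMod.+-distrib-/-∣ʳ o (divides (m ℕ.+ l) refl))) (cong (ℕ._/ 4) o+))
      -- The other two exponents are multiples of 4, so `o` is congruent to n modulo 4 and the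
      -- nonzero branch of `a₂` is taken.
      a₂-o : a₂ o ≡ u4 ^ˢ w
      a₂-o with o ℕ.% 4 ℕ.≟ n ℕ.% 4
      ... | yes _ = refl
      ... | no q = ⊥-elim (q (trans (sym (DivMod.[m+kn]%n≡m%n o (m ℕ.+ l) 4)) (cong (ℕ._% 4) o+)))
      Z : PS
      Z = u4 ^ˢ w ⊛ W₂ E M
      mono : ∀ m l → M° (4 ℕ.* m) (4 ℕ.* l) o ≡ (((⊝ v4) ^ˢ m ⊛ t4 ^ˢ l) ⊛ Z) M
      mono m l = begin
        sg (4 ℕ.* m) * ((a₂ o ⊛ V ^ˢ (4 ℕ.* m) ⊛ T ^ˢ (4 ℕ.* l)) ⊛ W₂ E M) M
          ≡⟨ cong (λ z → sg (4 ℕ.* m) * ((z ⊛ V ^ˢ (4 ℕ.* m) ⊛ T ^ˢ (4 ℕ.* l)) ⊛ W₂ E M) M) a₂-o ⟩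
        sg (4 ℕ.* m) * ((u4 ^ˢ w ⊛ V ^ˢ (4 ℕ.* m) ⊛ T ^ˢ (4 ℕ.* l)) ⊛ W₂ E M) M
          ≡⟨ κ⊛ (sg (4 ℕ.* m)) ((u4 ^ˢ w ⊛ V ^ˢ (4 ℕ.* m) ⊛ T ^ˢ (4 ℕ.* l)) ⊛ W₂ E M) M ⟨
        (κ (sg (4 ℕ.* m)) ⊛ ((u4 ^ˢ w ⊛ V ^ˢ (4 ℕ.* m) ⊛ T ^ˢ (4 ℕ.* l)) ⊛ W₂ E M)) M
          ≡⟨ at (≈-trans (congˡ (κ (sg (4 ℕ.* m))) (congʳ (W₂ E M) (⊛-cong (congˡ (u4 ^ˢ w) (^ˢ4* V m)) (^ˢ4* T l)))) (ringˢ₅₂ (κ (sg (4 ℕ.* m))) (u4 ^ˢ w) (v4 ^ˢ m) (t4 ^ˢ l) (W₂ E M))) M ⟩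
        (((κ (sg (4 ℕ.* m)) ⊛ v4 ^ˢ m) ⊛ t4 ^ˢ l) ⊛ Z) M ≡⟨ at (congʳ Z (congʳ (t4 ^ˢ l) (⊝^ v4 m))) M ⟨
        (((⊝ v4) ^ˢ m ⊛ t4 ^ˢ l) ⊛ Z) M ∎
      term : ∀ j i → 2 ℕ.* j ℕ.+ i ≡ m ℕ.+ l → ((((⊝ v4) ⊛ t4) ^ˢ j ⊛ ((⊝ v4) ⊕ t4) ^ˢ i) ⊛ Z) M ≡ c * δ J j
      term j i e' = trans (at (≈-trans (congʳ Z (congˡ (((⊝ v4) ⊛ t4) ^ˢ j) (^ˢ-cong i -u4)))
        (≈-trans (ringˢ₅₃ (((⊝ v4) ⊛ t4) ^ˢ j) (u4 ^ˢ i) (u4 ^ˢ w) (W₂ E M)) (congʳ (W₂ E M) (congˡ (((⊝ v4) ⊛ t4) ^ˢ j) (≈-sym (^ˢ-+ u4 i w)))))) M)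
        (residue₂ J E M eE j (i ℕ.+ w) (trans (ringⁿ₁₅ i w j) (trans (cong (w ℕ.+_) e') (trans w+ eM))))
      cond : M° (4 ℕ.* m) (4 ℕ.* l) o + M° (4 ℕ.* l) (4 ℕ.* m) o ≡ c * symE m l (λ j i → δ J j)
      cond = begin
        M° (4 ℕ.* m) (4 ℕ.* l) o + M° (4 ℕ.* l) (4 ℕ.* m) o ≡⟨ cong₂ _+_ (mono m l) (mono l m) ⟩
        (((⊝ v4) ^ˢ m ⊛ t4 ^ˢ l) ⊛ Z ⊕ ((⊝ v4) ^ˢ l ⊛ t4 ^ˢ m) ⊛ Z) M ≡⟨ at (PSR.distribʳ Z ((⊝ v4) ^ˢ m ⊛ t4 ^ˢ l) ((⊝ v4) ^ˢ l ⊛ t4 ^ˢ m)) M ⟨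
        (((⊝ v4) ^ˢ m ⊛ t4 ^ˢ l ⊕ (⊝ v4) ^ˢ l ⊛ t4 ^ˢ m) ⊛ Z) M ≡⟨ symE-PS m l (⊝ v4) t4 Z M ⟨
        symE m l (λ j i → ((((⊝ v4) ⊛ t4) ^ˢ j ⊛ ((⊝ v4) ⊕ t4) ^ˢ i) ⊛ Z) M) ≡⟨ symE-cong m l term ⟩
        symE m l (λ j i → c * δ J j) ≡⟨ symE-* m l c (λ j i → δ J j) ⟩
        c * symE m l (λ j i → δ J j) ∎

  sign-G : ∀ J E M → 4 ℕ.* J ≡ E ℕ.+ M → n ℕ./ 4 ≡ M ℕ.+ 2 ℕ.* J → 0ℚ ≤ sg (4 ℕ.* J) * G J
  sign-G J E M eE eM = *-cancelˡ-0≤ (0<* (^-pos n lit<) (^-pos M lit<)) (by0≤ (trans (ringᵠ₆₈ (2ℚ ^ n) (8ℚ ^ M) (sg (4 ℕ.* J)) (G J)) (sym (enum₂ J E M eE eM)))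
    (0≤* (<⇒≤ total-pos) (*-cancelˡ-0≤ (^-pos n lit<) (subst (0ℚ ≤_) (shadow (M₂ E M)) (shadow-nonneg E M)))))

  sign-enum₁ : ∀ J A E M → n ℕ.+ A ≡ 12 ℕ.* J → 4 ℕ.* J ≡ E ℕ.+ M → n ℕ./ 4 ≡ M ℕ.+ 2 ℕ.* J → 0ℚ ≤ sg (4 ℕ.* J) * enum (M₁ J A)
  sign-enum₁ J A E M eA eE eM = *-cancelˡ-0≤ total-pos (by0≤ (trans (ringᵠ₆₉ total (sg (4 ℕ.* J)) (enum (M₁ J A))) (trans (cong (sg (4 ℕ.* J) *_) (enum₁ J A eA)) (ringᵠ₇₀ (2ℚ ^ n) (8ℚ ^ J) (sg (4 ℕ.* J)) (G J))))
    (0≤* (0≤* (^-nonneg n lit≤) (^-nonneg J lit≤)) (sign-G J E M eE eM)))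

-- The combined functional and the reduction to signs of `Φ`.

fˢ : ℚ → PS
fˢ r = κ r ⊛ T ^ˢ 12 ⊖ X ⊛ qˢ

-- Φ k is minus the value of the functional on the word polynomial t^k
Φ : ℕ → ℕ → ℕ → ℚ → ℕ → ℚ
Φ n J A r k = (X ^ˢ k ⊛ ((T ^ˢ A ⊛ R ^ˢ suc J) ⊛ ((κ (ι k) ⊛ T ⊖ κ (ι n) ⊛ X) ⊛ fˢ r))) (suc J)

-- Raising `J` by one must raise the exponent of T by 12, so that n plus this exponent stays 12
-- times the index.
λˢ : ℕ → ℕ → ℚ → PS → ℚ
λˢ J A r h = ι J * (h ⊛ W₁ J (suc A)) J - r * (ι (suc J) * (h ⊛ W₁ (suc J) (suc A ℕ.+ 12)) (suc J))

λˢ-cong : ∀ J A r {f g} → f ≈ g → λˢ J A r f ≡ λˢ J A r g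
λˢ-cong J A r p = cong₂ (λ a b → ι J * a - r * (ι (suc J) * b)) (at (congʳ (W₁ J (suc A)) p) J) (at (congʳ (W₁ (suc J) (suc A ℕ.+ 12)) p) (suc J))

ringᵠ₇₁ : ∀ j r j' a b c d → j * (a + b) - r * (j' * (c + d)) ≡ j * a - r * (j' * c) + (j * b - r * (j' * d))
ringᵠ₇₁ = solveᵠ 7 λ j r j' a b c d → j :* (a :+ b) :- r :* (j' :* (c :+ d)) := j :* a :- r :* (j' :* c) :+ (j :* b :- r :* (j' :* d))

λˢ-⊕ : ∀ J A r f g → λˢ J A r (f ⊕ g) ≡ λˢ J A r f + λˢ J A r g
λˢ-⊕ J A r f g = trans (cong₂ (λ a b → ι J * a - r * (ι (suc J) * b)) (⊛-distribʳ f g (W₁ J (suc A)) J) (⊛-distribʳ f g (W₁ (suc J) (suc A ℕ.+ 12)) (suc J)))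
  (ringᵠ₇₁ (ι J) r (ι (suc J)) ((f ⊛ W₁ J (suc A)) J) ((g ⊛ W₁ J (suc A)) J) ((f ⊛ W₁ (suc J) (suc A ℕ.+ 12)) (suc J)) ((g ⊛ W₁ (suc J) (suc A ℕ.+ 12)) (suc J)))

ringᵠ₇₂ : ∀ j r j' c a b → j * (c * a) - r * (j' * (c * b)) ≡ c * (j * a - r * (j' * b))
ringᵠ₇₂ = solveᵠ 6 λ j r j' c a b → j :* (c :* a) :- r :* (j' :* (c :* b)) := c :* (j :* a :- r :* (j' :* b))

λˢ-κ : ∀ J A r c f → λˢ J A r (κ c ⊛ f) ≡ c * λˢ J A r f
λˢ-κ J A r c f = trans (cong₂ (λ a b → ι J * a - r * (ι (suc J) * b)) (lem (W₁ J (suc A)) J) (lem (W₁ (suc J) (suc A ℕ.+ 12)) (suc J)))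
  (ringᵠ₇₂ (ι J) r (ι (suc J)) c ((f ⊛ W₁ J (suc A)) J) ((f ⊛ W₁ (suc J) (suc A ℕ.+ 12)) (suc J)))
  where
  lem : ∀ W N → ((κ c ⊛ f) ⊛ W) N ≡ c * (f ⊛ W) N
  lem W N = trans (at (assocˢ (κ c) f W) N) (κ⊛ c (f ⊛ W) N)

ringⁿ₁₆ : ∀ n A → n ℕ.+ suc (A ℕ.+ 12) ≡ n ℕ.+ suc A ℕ.+ 12
ringⁿ₁₆ = ℕR.solve-∀

ringⁿ₁₇ : ∀ J → 12 ℕ.* J ℕ.+ 12 ≡ 12 ℕ.* suc J
ringⁿ₁₇ = ℕR.solve-∀

ringˢ₅₄ : ∀ x q r k a b c d t → (q ⊛ r) ⊛ (x ⊛ (k ⊛ ((a ⊛ b) ⊛ c))) ⊖ d ⊛ (k ⊛ (((a ⊛ t) ⊛ (r ⊛ b)) ⊛ c)) ≈ ⊝ (k ⊛ ((a ⊛ (r ⊛ b)) ⊛ (c ⊛ (d ⊛ t ⊖ x ⊛ q))))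
ringˢ₅₄ = solveˢ 9 (λ x q r k a b c d t → (q :* r) :* (x :* (k :* ((a :* b) :* c))) :- d :* (k :* (((a :* t) :* (r :* b)) :* c)) := :- (k :* ((a :* (r :* b)) :* (c :* (d :* t :- x :* q)))))

-- After integration by parts both terms are read at index J + 1, the first one through the factor t
-- = t q R with q = `qˢ`; factoring out T^A R^(J+1) leaves t q - r T¹², which is -f.
λˢ-X^ : ∀ n J A r k → n ℕ.+ suc A ≡ 12 ℕ.* J → λˢ J A r (X ^ˢ k) ≡ - Φ n J A r k
λˢ-X^ n J A r k eA = begin
  ι J * (X ^ˢ k ⊛ W₁ J (suc A)) J - r * (ι (suc J) * (X ^ˢ k ⊛ W₁ (suc J) (suc A ℕ.+ 12)) (suc J))
    ≡⟨ cong₂ (λ a b → a - r * b) (residue-by-parts n J A k eA) (residue-by-parts n (suc J) (A ℕ.+ 12) k eA') ⟩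
  (X ^ˢ k ⊛ ((T ^ˢ A ⊛ R ^ˢ J) ⊛ Q)) J - r * (X ^ˢ k ⊛ ((T ^ˢ (A ℕ.+ 12) ⊛ R ^ˢ suc J) ⊛ Q)) (suc J)
    ≡⟨ cong₂ _-_ (sym (X⊛-suc (X ^ˢ k ⊛ ((T ^ˢ A ⊛ R ^ˢ J) ⊛ Q)) J)) (sym (κ⊛ r (X ^ˢ k ⊛ ((T ^ˢ (A ℕ.+ 12) ⊛ R ^ˢ suc J) ⊛ Q)) (suc J))) ⟩
  (X ⊛ (X ^ˢ k ⊛ ((T ^ˢ A ⊛ R ^ˢ J) ⊛ Q)) ⊖ κ r ⊛ (X ^ˢ k ⊛ ((T ^ˢ (A ℕ.+ 12) ⊛ R ^ˢ suc J) ⊛ Q))) (suc J)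
    ≡⟨ at main (suc J) ⟩
  - Φ n J A r k ∎
  where
  open ≡-Reasoning
  Q : PS
  Q = κ (ι k) ⊛ T ⊖ κ (ι n) ⊛ X
  eA' : n ℕ.+ suc (A ℕ.+ 12) ≡ 12 ℕ.* suc J
  eA' = trans (ringⁿ₁₆ n A) (trans (cong (ℕ._+ 12) eA) (ringⁿ₁₇ J))
  main : X ⊛ (X ^ˢ k ⊛ ((T ^ˢ A ⊛ R ^ˢ J) ⊛ Q)) ⊖ κ r ⊛ (X ^ˢ k ⊛ ((T ^ˢ (A ℕ.+ 12) ⊛ R ^ˢ suc J) ⊛ Q)) ≈
    ⊝ (X ^ˢ k ⊛ ((T ^ˢ A ⊛ R ^ˢ suc J) ⊛ (Q ⊛ fˢ r)))
  main = S.begin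
    X ⊛ (X ^ˢ k ⊛ ((T ^ˢ A ⊛ R ^ˢ J) ⊛ Q)) ⊖ κ r ⊛ (X ^ˢ k ⊛ ((T ^ˢ (A ℕ.+ 12) ⊛ R ^ˢ suc J) ⊛ Q))
      S.≈⟨ +-congˢ (≈-sym (idˡ (X ⊛ (X ^ˢ k ⊛ ((T ^ˢ A ⊛ R ^ˢ J) ⊛ Q))))) (PSR.-‿cong (congˡ (κ r) (congˡ (X ^ˢ k) (congʳ Q (congʳ (R ^ˢ suc J) (^ˢ-+ T A 12)))))) ⟩
    one ⊛ (X ⊛ (X ^ˢ k ⊛ ((T ^ˢ A ⊛ R ^ˢ J) ⊛ Q))) ⊖ κ r ⊛ (X ^ˢ k ⊛ (((T ^ˢ A ⊛ T ^ˢ 12) ⊛ R ^ˢ suc J) ⊛ Q))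
      S.≈⟨ ⊕-congʳ (⊝ (κ r ⊛ (X ^ˢ k ⊛ (((T ^ˢ A ⊛ T ^ˢ 12) ⊛ R ^ˢ suc J) ⊛ Q)))) (congʳ (X ⊛ (X ^ˢ k ⊛ ((T ^ˢ A ⊛ R ^ˢ J) ⊛ Q))) (≈-sym q⊛R)) ⟩
    (qˢ ⊛ R) ⊛ (X ⊛ (X ^ˢ k ⊛ ((T ^ˢ A ⊛ R ^ˢ J) ⊛ Q))) ⊖ κ r ⊛ (X ^ˢ k ⊛ (((T ^ˢ A ⊛ T ^ˢ 12) ⊛ (R ⊛ R ^ˢ J)) ⊛ Q))
      S.≈⟨ ringˢ₅₄ X qˢ R (X ^ˢ k) (T ^ˢ A) (R ^ˢ J) Q (κ r) (T ^ˢ 12) ⟩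
    ⊝ (X ^ˢ k ⊛ ((T ^ˢ A ⊛ R ^ˢ suc J) ⊛ (Q ⊛ fˢ r))) S.∎
    where
    module S = ≈-Reasoning

ringˢ₅₅ : ∀ x c k → ((one ⊕ x ⊛ x) ⊛ c) ⊛ k ≈ c ⊛ k ⊕ c ⊛ (x ⊛ (x ⊛ k))
ringˢ₅₅ = solveˢ 3 (λ x c k → ((con 1ℚ :+ x :* x) :* c) :* k := c :* k :+ c :* (x :* (x :* k)))

-- Each factor 1 + t² only adds higher powers, so the sign is inherited from the pure powers at or
-- beyond the weight.
λˢ-word : ∀ n J A r k₀ → n ℕ.+ suc A ≡ 12 ℕ.* J → (∀ k → k₀ ℕ.≤ k → 0ℚ ≤ Φ n J A r k) →
  ∀ m k → k₀ ℕ.≤ k → λˢ J A r ((one ⊕ s) ^ˢ m ⊛ X ^ˢ k) ≤ 0ℚ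
λˢ-word n J A r k₀ eA h zero k p = ≤-trans (≤-reflexive (trans (λˢ-cong J A r (idˡ (X ^ˢ k))) (λˢ-X^ n J A r k eA))) (ℚₚ.neg-antimono-≤ (h k p))
λˢ-word n J A r k₀ eA h (suc m) k p = ≤-trans
  (≤-reflexive (trans (λˢ-cong J A r (ringˢ₅₅ X ((one ⊕ s) ^ˢ m) (X ^ˢ k))) (λˢ-⊕ J A r ((one ⊕ s) ^ˢ m ⊛ X ^ˢ k) ((one ⊕ s) ^ˢ m ⊛ X ^ˢ suc (suc k)))))
  (+-mono-≤ (λˢ-word n J A r k₀ eA h m k p) (λˢ-word n J A r k₀ eA h m (suc (suc k)) (ℕₚ.≤-trans p (ℕₚ.m≤n+m k 2))))

ringⁿ₁₈ : ∀ J → 6 ℕ.* J ≡ 2 ℕ.* J ℕ.+ 4 ℕ.* J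
ringⁿ₁₈ = ℕR.solve-∀

-- The two bounds say exactly that M = ⌊n/4⌋ - 2J and E = 6J - ⌊n/4⌋ are natural numbers.
shadow-exponents : ∀ n J → 2 ℕ.* J ℕ.≤ n ℕ./ 4 → n ℕ./ 4 ℕ.≤ 6 ℕ.* J → ∃ λ E → ∃ λ M → (4 ℕ.* J ≡ E ℕ.+ M) × (n ℕ./ 4 ≡ M ℕ.+ 2 ℕ.* J)
shadow-exponents n J p q with ℕₚ.m≤n⇒∃[o]m+o≡n p
... | M , e with ℕₚ.m≤n⇒∃[o]m+o≡n (ℕₚ.+-cancelˡ-≤ (2 ℕ.* J) M (4 ℕ.* J) (subst₂ ℕ._≤_ (sym e) (ringⁿ₁₈ J) q))
...   | E , e' = E , M , trans (sym e') (ℕₚ.+-comm M E) , trans (sym e) (ℕₚ.+-comm (2 ℕ.* J) M)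

ringⁿ₁₉ : ∀ j → 4 ℕ.* (2 ℕ.* j) ≡ 8 ℕ.* j ℕ.+ 0
ringⁿ₁₉ = ℕR.solve-∀

ringᵠ₇₃ : ∀ a → 0ℚ - a ≡ (- 1ℚ) * a
ringᵠ₇₃ = solveᵠ 1 λ a → con 0ℚ :- a := (:- con 1ℚ) :* a

ringᵠ₇₄ : ∀ c p j a r j' b → c * (p * (j * a - r * (j' * b))) ≡ j * (c * (p * a)) + (- (r * j')) * (c * (p * b))
ringᵠ₇₄ = solveᵠ 7 λ c p j a r j' b → c :* (p :* (j :* a :- r :* (j' :* b))) := j :* (c :* (p :* a)) :+ (:- (r :* j')) :* (c :* (p :* b))

ringᵠ₇₅ : ∀ j r j' a b → j * a + (- (r * j')) * b ≡ j * a - r * (j' * b)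
ringᵠ₇₅ = solveᵠ 5 λ j r j' a b → j :* a :+ (:- (r :* j')) :* b := j :* a :- r :* (j' :* b)

ringˢ₅₆ : ∀ k x c y → (k ⊛ (x ⊛ c)) ⊛ y ≈ k ⊛ (c ⊛ (x ⊛ y))
ringˢ₅₆ = solveˢ 4 (λ k x c y → (k :* (x :* c)) :* y := k :* (c :* (x :* y)))

ringᵠ₇₆ : ∀ a b c → (- 1ℚ) * (a * (b * c)) ≡ a * (b * (- c))
ringᵠ₇₆ = solveᵠ 3 λ a b c → (:- con 1ℚ) :* (a :* (b :* c)) := a :* (b :* (:- c))

ringᵠ₇₇ : ∀ j r j' a b → (0ℚ - (- 1ℚ) * (j * a - r * (j' * b))) ≡ j * a + r * (j' * (0ℚ - b))
ringᵠ₇₇ = solveᵠ 5 λ j r j' a b → con 0ℚ :- (:- con 1ℚ) :* (j :* a :- r :* (j' :* b)) := j :* a :+ r :* (j' :* (con 0ℚ :- b))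

module Reduction {n : ℕ} (C : Code n) (sd : SelfDual C) (C? : ∀ v → Dec (C v))
  (j A : ℕ) (r : ℚ) (k₀ : ℕ) (r≥0 : 0ℚ ≤ r)
  (eA : n ℕ.+ suc A ≡ 12 ℕ.* (2 ℕ.* j))
  (lo : 2 ℕ.* suc (2 ℕ.* j) ℕ.≤ n ℕ./ 4) (hi : n ℕ./ 4 ℕ.≤ 6 ℕ.* (2 ℕ.* j))
  (Φ₀ : 0ℚ < Φ n (2 ℕ.* j) A r 0) (Φₖ : ∀ k → k₀ ℕ.≤ k → 0ℚ ≤ Φ n (2 ℕ.* j) A r k)
  (min : ∀ v → C v → ¬ (v ≡ replicate n zero) → 4 ℕ.* k₀ ℕ.≤ wtE v)
  where
  open SelfDualCode C sd C?
  open Enumerator C sd C?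
  open Signs C sd C?

  private
    J : ℕ
    J = 2 ℕ.* j

    sgJ : sg (4 ℕ.* J) ≡ 1ℚ
    sgJ = trans (cong sg (ringⁿ₁₉ j)) (sg-8k j 0)

    enumJ≥0 : 0ℚ ≤ enum (M₁ J (suc A))
    enumJ≥0 = let E , M , eE , eM = shadow-exponents n J (ℕₚ.≤-trans (ℕₚ.*-monoʳ-≤ 2 (ℕₚ.n≤1+n J)) lo) hi in
      subst (0ℚ ≤_) (trans (cong (_* enum (M₁ J (suc A))) sgJ) (ℚₚ.*-identityˡ (enum (M₁ J (suc A))))) (sign-enum₁ J (suc A) E M eA eE eM)

    enumJ+1≤0 : enum (M₁ (suc J) (suc A ℕ.+ 12)) ≤ 0ℚ
    enumJ+1≤0 = let E , M , eE , eM = shadow-exponents n (suc J) lo (ℕₚ.≤-trans hi (ℕₚ.*-monoʳ-≤ 6 (ℕₚ.n≤1+n J))) in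
      by≤ (trans (ringᵠ₇₃ (enum (M₁ (suc J) (suc A ℕ.+ 12)))) (cong (_* enum (M₁ (suc J) (suc A ℕ.+ 12))) (sym sgJ+1))) (sign-enum₁ (suc J) (suc A ℕ.+ 12) E M eA' eE eM)
      where
      sgJ+1 : sg (4 ℕ.* suc J) ≡ - 1ℚ
      sgJ+1 = trans (cong sg (ℕₚ.*-suc 4 J)) (cong -_ sgJ)
      eA' : n ℕ.+ (suc A ℕ.+ 12) ≡ 12 ℕ.* suc J
      eA' = trans (sym (ℕₚ.+-assoc n (suc A) 12)) (trans (cong (ℕ._+ 12) eA) (ringⁿ₁₇ J))

    word : Vec Z4 n → PS
    word v = u4 ^ˢ (n₁ v ℕ./ 4) ⊛ X ^ˢ n₂ v

    Λtotal : sumV n (λ v → χ v * (2ℚ ^ even# v * λˢ J A r (word v))) ≡ ι J * enum (M₁ J (suc A)) - r * (ι (suc J) * enum (M₁ (suc J) (suc A ℕ.+ 12)))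
    Λtotal = begin
      sumV n (λ v → χ v * (2ℚ ^ even# v * λˢ J A r (word v))) ≡⟨ sumV-cong n term ⟩
      sumV n (λ v → ι J * (χ v * ev v M') + (- (r * ι (suc J))) * (χ v * ev v M'')) ≡⟨ sumV-+ n (λ v → ι J * (χ v * ev v M')) (λ v → (- (r * ι (suc J))) * (χ v * ev v M'')) ⟩
      sumV n (λ v → ι J * (χ v * ev v M')) + sumV n (λ v → (- (r * ι (suc J))) * (χ v * ev v M''))
        ≡⟨ cong₂ _+_ (sumV-* n (ι J) (λ v → χ v * ev v M')) (sumV-* n (- (r * ι (suc J))) (λ v → χ v * ev v M'')) ⟩
      ι J * enum M' + (- (r * ι (suc J))) * enum M'' ≡⟨ ringᵠ₇₅ (ι J) r (ι (suc J)) (enum M') (enum M'') ⟩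
      ι J * enum M' - r * (ι (suc J) * enum M'') ∎
      where
      open ≡-Reasoning
      M' M'' : Mono
      M' = M₁ J (suc A)
      M'' = M₁ (suc J) (suc A ℕ.+ 12)
      term : ∀ v → χ v * (2ℚ ^ even# v * λˢ J A r (word v)) ≡ ι J * (χ v * ev v M') + (- (r * ι (suc J))) * (χ v * ev v M'')
      term v = trans (ringᵠ₇₄ (χ v) (2ℚ ^ even# v) (ι J) ((word v ⊛ W₁ J (suc A)) J) r (ι (suc J)) ((word v ⊛ W₁ (suc J) (suc A ℕ.+ 12)) (suc J)))
        (cong₂ (λ a b → ι J * (χ v * a) + (- (r * ι (suc J))) * (χ v * b))
          (sym (ev-word v (λ p → u4 ^ˢ (p ℕ./ 4)) (W₁ J (suc A)) J)) (sym (ev-word v (λ p → u4 ^ˢ (p ℕ./ 4)) (W₁ (suc J) (suc A ℕ.+ 12)) (suc J))))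

    λ0 : λˢ J A r (X ^ˢ 0) < 0ℚ
    λ0 = subst (_< 0ℚ) (sym (λˢ-X^ n J A r 0 eA)) (ℚₚ.neg-antimono-< Φ₀)

    n₁0 : ∀ n → n₁ (replicate n zero) ≡ 0
    n₁0 zero = refl
    n₁0 (suc n) = n₁0 n

    n₂0 : ∀ n → n₂ (replicate n zero) ≡ 0
    n₂0 zero = refl
    n₂0 (suc n) = n₂0 n

    0v : Vec Z4 n
    0v = replicate n zero

    word-0 : λˢ J A r (word 0v) ≡ λˢ J A r (X ^ˢ 0)
    word-0 = trans (cong₂ (λ a b → λˢ J A r (u4 ^ˢ (a ℕ./ 4) ⊛ X ^ˢ b)) (n₁0 n) (n₂0 n)) (λˢ-cong J A r (idˡ one))

    word-C′ : ∀ v → C v → Dec (v ≡ 0v) → λˢ J A r (word v) ≤ 0ℚ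
    word-C′ v c (yes e) = ≤-trans (≤-reflexive (trans (cong (λ z → λˢ J A r (word z)) e) word-0)) (<⇒≤ λ0)
    word-C′ v c (no ne) = ≤-trans (≤-reflexive (trans (λˢ-cong J A r w≈) (λˢ-κ J A r (8ℚ ^ m) ((one ⊕ s) ^ˢ m ⊛ X ^ˢ (m ℕ.+ n₂ v)))))
        (≤-trans (*-monoˡ (^-nonneg m lit≤) (λˢ-word n J A r k₀ eA Φₖ m (m ℕ.+ n₂ v) (ℕₚ.*-cancelˡ-≤ 4 (subst (4 ℕ.* k₀ ℕ.≤_) wt (min v c ne))))) (≤-reflexive (ℚₚ.*-zeroʳ (8ℚ ^ m))))
      where
      m : ℕ
      m = n₁ v ℕ./ 4
      wt : wtE v ≡ 4 ℕ.* (m ℕ.+ n₂ v)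
      wt = trans (wtE-count v) (trans (cong (ℕ._+ 4 ℕ.* n₂ v) (sym (trans (ℕₚ.*-comm 4 m) (DivMod.m/n*n≡m (4∣n₁ c))))) (sym (ℕₚ.*-distribˡ-+ 4 m (n₂ v))))
      w≈ : word v ≈ κ (8ℚ ^ m) ⊛ ((one ⊕ s) ^ˢ m ⊛ X ^ˢ (m ℕ.+ n₂ v))
      w≈ = ≈-trans (congʳ (X ^ˢ n₂ v) (u4^ m)) (≈-trans (ringˢ₅₆ (κ (8ℚ ^ m)) (X ^ˢ m) ((one ⊕ s) ^ˢ m) (X ^ˢ n₂ v))
        (congˡ (κ (8ℚ ^ m)) (congˡ ((one ⊕ s) ^ˢ m) (≈-sym (^ˢ-+ X m (n₂ v))))))

    word-C : ∀ v → C v → λˢ J A r (word v) ≤ 0ℚ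
    word-C v c = word-C′ v c (Vecₚ.≡-dec Finₚ._≟_ v 0v)

    neg-term : Vec Z4 n → ℚ
    neg-term v = (- 1ℚ) * (χ v * (2ℚ ^ even# v * λˢ J A r (word v)))

    neg-term≥0 : ∀ v → 0ℚ ≤ neg-term v
    neg-term≥0 v = by0≤ (ringᵠ₇₆ (χ v) (2ℚ ^ even# v) (λˢ J A r (word v)))
      (subst (0ℚ ≤_) (sym (case v (C? v) refl)) (nn v (C? v)))
      where
      case : ∀ v (d : Dec (C v)) → C? v ≡ d → χ v * (2ℚ ^ even# v * (- λˢ J A r (word v))) ≡ indicator d * (2ℚ ^ even# v * (- λˢ J A r (word v)))
      case v d e = cong (λ d → indicator d * (2ℚ ^ even# v * (- λˢ J A r (word v)))) e
      nn : ∀ v (d : Dec (C v)) → 0ℚ ≤ indicator d * (2ℚ ^ even# v * (- λˢ J A r (word v)))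
      nn v (yes c) = 0≤* 0≤1 (0≤* (^-nonneg (even# v) lit≤) (ℚₚ.neg-antimono-≤ (word-C v c)))
      nn v (no _) = ≤-reflexive (sym (ℚₚ.*-zeroˡ (2ℚ ^ even# v * (- λˢ J A r (word v)))))

    neg-term-0 : 0ℚ < neg-term 0v
    neg-term-0 = by0< (trans (ringᵠ₇₆ (χ 0v) (2ℚ ^ even# 0v) (λˢ J A r (word 0v))) (cong₂ (λ a b → a * (2ℚ ^ even# 0v * (- b))) χ0 word-0))
      (0<* 0<1 (0<* (^-pos (even# 0v) lit<) (ℚₚ.neg-antimono-< λ0)))
      where
      χ0 : χ 0v ≡ 1ℚ
      χ0 with C? 0v
      ... | yes _ = refl
      ... | no q = ⊥-elim (q C-0)

  contradiction-Φ : ⊥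
  -- The negated contributions are all nonnegative and positive at the zero word, while the signs of
  -- the two coefficients make their sum nonpositive.
  contradiction-Φ = ℚₚ.<-irrefl refl (ℚₚ.<-≤-trans neg-term-0 (≤-trans (sumV-≥-term n neg-term neg-term≥0 0v) total≤0))
    where
    total≤0 : sumV n neg-term ≤ 0ℚ
    total≤0 = by≤ (trans (cong (λ z → 0ℚ - z) (trans (sumV-* n (- 1ℚ) (λ v → χ v * (2ℚ ^ even# v * λˢ J A r (word v)))) (cong ((- 1ℚ) *_) Λtotal)))
        (ringᵠ₇₇ (ι J) r (ι (suc J)) (enum (M₁ J (suc A))) (enum (M₁ (suc J) (suc A ℕ.+ 12)))))
      (0≤+ (0≤* (ι-nonneg J) enumJ≥0) (0≤* r≥0 (0≤* (ι-nonneg (suc J)) (≤⇒0≤- enumJ+1≤0))))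

-- Reflection for univariate polynomials with integer coefficients

infixl 6 _⊹_
infixl 7 _✶_
infixr 8 _↑_
data Expr : Set where
  var : Expr
  lit : ℤ.ℤ → Expr
  _⊹_ _✶_ : Expr → Expr → Expr
  _↑_ : Expr → ℕ → Expr

addL : List ℤ.ℤ → List ℤ.ℤ → List ℤ.ℤ
addL [] m = m
addL (a ∷ l) [] = a ∷ l
addL (a ∷ l) (b ∷ m) = a ℤ.+ b ∷ addL l m

scaleL : ℤ.ℤ → List ℤ.ℤ → List ℤ.ℤ
scaleL c [] = []
scaleL c (a ∷ l) = c ℤ.* a ∷ scaleL c l

mulL : List ℤ.ℤ → List ℤ.ℤ → List ℤ.ℤ
mulL [] m = []
mulL (a ∷ l) m = addL (scaleL a m) (pos 0 ∷ mulL l m)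

powL : List ℤ.ℤ → ℕ → List ℤ.ℤ
powL l zero = pos 1 ∷ []
powL l (suc n) = mulL l (powL l n)

coeffs : Expr → List ℤ.ℤ
coeffs var = pos 0 ∷ pos 1 ∷ []
coeffs (lit c) = c ∷ []
coeffs (a ⊹ b) = addL (coeffs a) (coeffs b)
coeffs (a ✶ b) = mulL (coeffs a) (coeffs b)
coeffs (a ↑ n) = powL (coeffs a) n

zq-mk : ∀ i → zq i ≡ mkℚ i 0 (Coprimality.sym (Coprimality.1-coprimeTo ℤ.∣ i ∣))
zq-mk i = ℚₚ.↥p/↧p≡p (mkℚ i 0 (Coprimality.sym (Coprimality.1-coprimeTo ℤ.∣ i ∣)))

zq-+ : ∀ a b → zq (a ℤ.+ b) ≡ zq a + zq b
zq-+ a b rewrite zq-mk a | zq-mk b = cong (_/ 1) (sym (cong₂ ℤ._+_ (ℤₚ.*-identityʳ a) (ℤₚ.*-identityʳ b)))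

zq-* : ∀ a b → zq (a ℤ.* b) ≡ zq a * zq b
zq-* a b rewrite zq-mk a | zq-mk b = refl

zq-nonneg : ∀ {i} → pos 0 ℤ.≤ i → 0ℚ ≤ zq i
zq-nonneg {pos n} _ = ι-nonneg n

evalE : Expr → ℚ → ℚ
evalE var x = x
evalE (lit c) x = zq c
evalE (a ⊹ b) x = evalE a x + evalE b x
evalE (a ✶ b) x = evalE a x * evalE b x
evalE (a ↑ n) x = evalE a x ^ n

evalL : List ℤ.ℤ → ℚ → ℚ
evalL [] x = 0ℚ
evalL (a ∷ l) x = zq a + x * evalL l x

ringᵠ₇₈ : ∀ a b x l m → a + b + x * (l + m) ≡ a + x * l + (b + x * m)
ringᵠ₇₈ = solveᵠ 5 λ a b x l m → a :+ b :+ x :* (l :+ m) := a :+ x :* l :+ (b :+ x :* m)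

evalL-add : ∀ l m x → evalL (addL l m) x ≡ evalL l x + evalL m x
evalL-add [] m x = sym (ℚₚ.+-identityˡ (evalL m x))
evalL-add (a ∷ l) [] x = sym (ℚₚ.+-identityʳ (zq a + x * evalL l x))
evalL-add (a ∷ l) (b ∷ m) x = trans (cong₂ (λ u v → u + x * v) (zq-+ a b) (evalL-add l m x)) (ringᵠ₇₈ (zq a) (zq b) x (evalL l x) (evalL m x))

ringᵠ₇₉ : ∀ c a x l → c * a + x * (c * l) ≡ c * (a + x * l)
ringᵠ₇₉ = solveᵠ 4 λ c a x l → c :* a :+ x :* (c :* l) := c :* (a :+ x :* l)

evalL-scale : ∀ c l x → evalL (scaleL c l) x ≡ zq c * evalL l x
evalL-scale c [] x = sym (ℚₚ.*-zeroʳ (zq c))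
evalL-scale c (a ∷ l) x = trans (cong₂ (λ u v → u + x * v) (zq-* c a) (evalL-scale c l x)) (ringᵠ₇₉ (zq c) (zq a) x (evalL l x))

ringᵠ₈₀ : ∀ a m x l → a * m + (0ℚ + x * (l * m)) ≡ (a + x * l) * m
ringᵠ₈₀ = solveᵠ 4 λ a m x l → a :* m :+ (con 0ℚ :+ x :* (l :* m)) := (a :+ x :* l) :* m

evalL-mul : ∀ l m x → evalL (mulL l m) x ≡ evalL l x * evalL m x
evalL-mul [] m x = sym (ℚₚ.*-zeroˡ (evalL m x))
evalL-mul (a ∷ l) m x = trans (evalL-add (scaleL a m) (pos 0 ∷ mulL l m) x) (trans (cong₂ (λ u v → u + (0ℚ + x * v)) (evalL-scale a m x) (evalL-mul l m x)) (ringᵠ₈₀ (zq a) (evalL m x) x (evalL l x)))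

evalL-pow : ∀ l n x → evalL (powL l n) x ≡ evalL l x ^ n
evalL-pow l zero x = trans (cong (1ℚ +_) (ℚₚ.*-zeroʳ x)) refl
evalL-pow l (suc n) x = trans (evalL-mul l (powL l n) x) (cong (evalL l x *_) (evalL-pow l n x))

ringᵠ₈₁ : ∀ x → x ≡ 0ℚ + x * (1ℚ + x * 0ℚ)
ringᵠ₈₁ = solveᵠ 1 λ x → x := con 0ℚ :+ x :* (con 1ℚ :+ x :* con 0ℚ)

evalE-coeffs : ∀ e x → evalE e x ≡ evalL (coeffs e) x
evalE-coeffs var x = ringᵠ₈₁ x
evalE-coeffs (lit c) x = sym (trans (cong (zq c +_) (ℚₚ.*-zeroʳ x)) (ℚₚ.+-identityʳ (zq c)))
evalE-coeffs (a ⊹ b) x = trans (cong₂ _+_ (evalE-coeffs a x) (evalE-coeffs b x)) (sym (evalL-add (coeffs a) (coeffs b) x))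
evalE-coeffs (a ✶ b) x = trans (cong₂ _*_ (evalE-coeffs a x) (evalE-coeffs b x)) (sym (evalL-mul (coeffs a) (coeffs b) x))
evalE-coeffs (a ↑ n) x = trans (cong (_^ n) (evalE-coeffs a x)) (sym (evalL-pow (coeffs a) n x))

neg : Expr → Expr
neg e = lit -[1+ 0 ] ✶ e

zero-coeffs? : (l : List ℤ.ℤ) → Dec (All (_≡ pos 0) l)
zero-coeffs? = All.all? (ℤ._≟ pos 0)

evalL-zero : ∀ {l} → All (_≡ pos 0) l → ∀ x → evalL l x ≡ 0ℚ
evalL-zero [] x = refl
evalL-zero (a ∷ as) x = trans (cong₂ (λ u v → zq u + x * v) a (evalL-zero as x)) (trans (cong (0ℚ +_) (ℚₚ.*-zeroʳ x)) refl)

ringᵠ₈₂ : ∀ a b → a ≡ a + (- 1ℚ) * b + b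
ringᵠ₈₂ = solveᵠ 2 λ a b → a := a :+ (:- con 1ℚ) :* b :+ b

poly-identity : ∀ a b {_ : True (zero-coeffs? (coeffs (a ⊹ neg b)))} x → evalE a x ≡ evalE b x
poly-identity a b {w} x = trans (ringᵠ₈₂ (evalE a x) (evalE b x))
  (trans (cong (_+ evalE b x) (trans (evalE-coeffs (a ⊹ neg b) x) (evalL-zero (toWitness w) x))) (ℚₚ.+-identityˡ (evalE b x)))

nonneg-coeffs? : (l : List ℤ.ℤ) → Dec (All (pos 0 ℤ.≤_) l)
nonneg-coeffs? = All.all? (pos 0 ℤₚ.≤?_)

evalL-nonneg : ∀ {l} → All (pos 0 ℤ.≤_) l → ∀ {x} → 0ℚ ≤ x → 0ℚ ≤ evalL l x
evalL-nonneg [] p = ≤-refl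
evalL-nonneg (a ∷ as) p = 0≤+ (zq-nonneg a) (0≤* p (evalL-nonneg as p))

-- A sufficient test only: the expansion is computed over ℤ during type checking and inspected
-- coefficient by coefficient.
poly-nonneg : ∀ e {_ : True (nonneg-coeffs? (coeffs e))} {x} → 0ℚ ≤ x → 0ℚ ≤ evalE e x
poly-nonneg e {w} {x} p = subst (0ℚ ≤_) (sym (evalE-coeffs e x)) (evalL-nonneg (toWitness w) p)

evalˢ : Expr → PS
evalˢ var = X
evalˢ (lit c) = κ (zq c)
evalˢ (a ⊹ b) = evalˢ a ⊕ evalˢ b
evalˢ (a ✶ b) = evalˢ a ⊛ evalˢ b
evalˢ (a ↑ n) = evalˢ a ^ˢ n

seriesL : List ℤ.ℤ → PS
seriesL [] = κ 0ℚ
seriesL (a ∷ l) = κ (zq a) ⊕ X ⊛ seriesL l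

ringˢ₅₇ : ∀ a → a ≈ κ 0ℚ ⊕ a
ringˢ₅₇ = solveˢ 1 (λ a → a := con 0ℚ :+ a)

ringˢ₅₈ : ∀ a → a ≈ a ⊕ κ 0ℚ
ringˢ₅₈ = solveˢ 1 (λ a → a := a :+ con 0ℚ)

ringˢ₅₉ : ∀ a b x l m → a ⊕ b ⊕ x ⊛ (l ⊕ m) ≈ a ⊕ x ⊛ l ⊕ (b ⊕ x ⊛ m)
ringˢ₅₉ = solveˢ 5 (λ a b x l m → a :+ b :+ x :* (l :+ m) := a :+ x :* l :+ (b :+ x :* m))

seriesL-add : ∀ l m → seriesL (addL l m) ≈ seriesL l ⊕ seriesL m
seriesL-add [] m = ringˢ₅₇ (seriesL m)
seriesL-add (a ∷ l) [] = ringˢ₅₈ (seriesL (a ∷ l))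
seriesL-add (a ∷ l) (b ∷ m) = ≈-trans (+-congˢ (≈-trans (κ-cong (zq-+ a b)) (κ-+ (zq a) (zq b))) (congˡ X (seriesL-add l m))) (ringˢ₅₉ (κ (zq a)) (κ (zq b)) X (seriesL l) (seriesL m))

ringˢ₆₀ : ∀ a → κ 0ℚ ≈ a ⊛ κ 0ℚ
ringˢ₆₀ = solveˢ 1 (λ a → con 0ℚ := a :* con 0ℚ)

ringˢ₆₁ : ∀ c a x l → c ⊛ a ⊕ x ⊛ (c ⊛ l) ≈ c ⊛ (a ⊕ x ⊛ l)
ringˢ₆₁ = solveˢ 4 (λ c a x l → c :* a :+ x :* (c :* l) := c :* (a :+ x :* l))

seriesL-scale : ∀ c l → seriesL (scaleL c l) ≈ κ (zq c) ⊛ seriesL l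
seriesL-scale c [] = ringˢ₆₀ (κ (zq c))
seriesL-scale c (a ∷ l) = ≈-trans (+-congˢ (≈-trans (κ-cong (zq-* c a)) (κ-* (zq c) (zq a))) (congˡ X (seriesL-scale c l))) (ringˢ₆₁ (κ (zq c)) (κ (zq a)) X (seriesL l))

ringˢ₆₂ : ∀ a → κ 0ℚ ≈ κ 0ℚ ⊛ a
ringˢ₆₂ = solveˢ 1 (λ a → con 0ℚ := con 0ℚ :* a)

ringˢ₆₃ : ∀ a m x l → a ⊛ m ⊕ (κ 0ℚ ⊕ x ⊛ (l ⊛ m)) ≈ (a ⊕ x ⊛ l) ⊛ m
ringˢ₆₃ = solveˢ 4 (λ a m x l → a :* m :+ (con 0ℚ :+ x :* (l :* m)) := (a :+ x :* l) :* m)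

seriesL-mul : ∀ l m → seriesL (mulL l m) ≈ seriesL l ⊛ seriesL m
seriesL-mul [] m = ringˢ₆₂ (seriesL m)
seriesL-mul (a ∷ l) m = ≈-trans (seriesL-add (scaleL a m) (pos 0 ∷ mulL l m)) (≈-trans (+-congˢ (seriesL-scale a m) (⊕-congˡ (κ 0ℚ) (congˡ X (seriesL-mul l m)))) (ringˢ₆₃ (κ (zq a)) (seriesL m) X (seriesL l)))

ringˢ₆₄ : ∀ x → one ⊕ x ⊛ κ 0ℚ ≈ one
ringˢ₆₄ = solveˢ 1 (λ x → con 1ℚ :+ x :* con 0ℚ := con 1ℚ)

seriesL-pow : ∀ l n → seriesL (powL l n) ≈ seriesL l ^ˢ n
seriesL-pow l zero = ringˢ₆₄ X
seriesL-pow l (suc n) = ≈-trans (seriesL-mul l (powL l n)) (congˡ (seriesL l) (seriesL-pow l n))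

ringˢ₆₅ : ∀ x → x ≈ κ 0ℚ ⊕ x ⊛ (one ⊕ x ⊛ κ 0ℚ)
ringˢ₆₅ = solveˢ 1 (λ x → x := con 0ℚ :+ x :* (con 1ℚ :+ x :* con 0ℚ))

ringˢ₆₆ : ∀ c x → c ≈ c ⊕ x ⊛ κ 0ℚ
ringˢ₆₆ = solveˢ 2 (λ c x → c := c :+ x :* con 0ℚ)

evalˢ-coeffs : ∀ e → evalˢ e ≈ seriesL (coeffs e)
evalˢ-coeffs var = ringˢ₆₅ X
evalˢ-coeffs (lit c) = ringˢ₆₆ (κ (zq c)) X
evalˢ-coeffs (a ⊹ b) = ≈-trans (+-congˢ (evalˢ-coeffs a) (evalˢ-coeffs b)) (≈-sym (seriesL-add (coeffs a) (coeffs b)))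
evalˢ-coeffs (a ✶ b) = ≈-trans (⊛-cong (evalˢ-coeffs a) (evalˢ-coeffs b)) (≈-sym (seriesL-mul (coeffs a) (coeffs b)))
evalˢ-coeffs (a ↑ n) = ≈-trans (^ˢ-cong n (evalˢ-coeffs a)) (≈-sym (seriesL-pow (coeffs a) n))

NN-seriesL : ∀ {l} → All (pos 0 ℤ.≤_) l → NN (seriesL l)
NN-seriesL [] = NN-κ ≤-refl
NN-seriesL (a ∷ as) = NN-⊕ (NN-κ (zq-nonneg a)) (NN-⊛ NN-X (NN-seriesL as))

NN-evalˢ : ∀ e {_ : True (nonneg-coeffs? (coeffs e))} → NN (evalˢ e)
NN-evalˢ e {w} = NN-≈ (≈-sym (evalˢ-coeffs e)) (NN-seriesL (toWitness w))

-- `Uₑ` is t + ... + t¹¹; 8 times it majorises the nonconstant part of f/(τ - t). `CminE` is the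
-- worst case met in `Tail`: its constants are 5000 times 4/5, 8, 12 · 11/10 and 12 · 8, and 5000
-- times the coefficients 6 and 10 of `ℓ`. The exponents 31, 42 and the factor 80 are such that all
-- its coefficients are nonnegative.
Uₑ Tₑ CminE : Expr
Uₑ = var ✶ (lit (pos 1) ⊹ var ✶ (lit (pos 1) ⊹ var ✶ (lit (pos 1) ⊹ var ✶ (lit (pos 1) ⊹ var ✶ (lit (pos 1) ⊹ var ✶ (lit (pos 1) ⊹ var ✶ (lit (pos 1) ⊹ var ✶ (lit (pos 1) ⊹ var ✶ (lit (pos 1) ⊹ var ✶ (lit (pos 1) ⊹ var))))))))))
Tₑ = lit (pos 1) ⊹ var
CminE = Tₑ ↑ 31 ✶ (lit (pos 4000) ⊹ neg (lit (pos 40000) ✶ Uₑ) ⊹ neg (lit (pos 66000) ✶ var) ⊹ neg (lit (pos 480000) ✶ (var ✶ Uₑ)))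
  ⊹ (Tₑ ✶ (lit (pos 30000) ✶ (var ✶ var) ⊹ lit (pos 50000) ✶ (var ✶ var ✶ (var ✶ var)))
     ⊹ neg (lit (pos 5) ✶ (var ✶ (var ✶ var ✶ (var ✶ var)) ⊹ Tₑ ⊹ (lit (pos 4) ✶ Tₑ ⊹ lit (pos 42) ✶ var) ✶ (var ✶ var ✶ (var ✶ var)) ⊹ Tₑ ✶ var)))
    ✶ (lit (pos 80) ✶ Tₑ ↑ 42)

NN-Cmin : NN (evalˢ CminE)
NN-Cmin = NN-evalˢ CminE

-- Even and odd parts of series

Ev Od : PS → PS
Ev f i = f (i ℕ.+ i)
Od f i = f (suc (i ℕ.+ i))

Even : PS → Set
Even f = ∀ i → Od f i ≡ 0ℚ

private
  dbl : ∀ i → suc i ℕ.+ suc i ≡ suc (suc (i ℕ.+ i))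
  dbl i = cong suc (ℕₚ.+-suc i i)

ringᵠ₈₃ : ∀ a b c d → a * b + (c * 0ℚ + d) ≡ a * b + d
ringᵠ₈₃ = solveᵠ 4 λ a b c d → a :* b :+ (c :* con 0ℚ :+ d) := a :* b :+ d

⊛-Ev : ∀ p Y → Even Y → ∀ i → (p ⊛ Y) (i ℕ.+ i) ≡ (Ev p ⊛ Ev Y) i
⊛-Ev p Y h zero = refl
⊛-Ev p Y h (suc i) = begin
  (p ⊛ Y) (suc i ℕ.+ suc i) ≡⟨ cong (p ⊛ Y) (dbl i) ⟩
  p 0 * Y (suc (suc (i ℕ.+ i))) + (p 1 * Y (suc (i ℕ.+ i)) + (tail (tail p) ⊛ Y) (i ℕ.+ i))
    ≡⟨ cong₂ (λ a b → p 0 * Y (suc (suc (i ℕ.+ i))) + (p 1 * a + b)) (h i) (⊛-Ev (tail (tail p)) Y h i) ⟩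
  p 0 * Y (suc (suc (i ℕ.+ i))) + (p 1 * 0ℚ + (Ev (tail (tail p)) ⊛ Ev Y) i)
    ≡⟨ ringᵠ₈₃ (p 0) (Y (suc (suc (i ℕ.+ i)))) (p 1) ((Ev (tail (tail p)) ⊛ Ev Y) i) ⟩
  p 0 * Y (suc (suc (i ℕ.+ i))) + (Ev (tail (tail p)) ⊛ Ev Y) i
    ≡⟨ cong₂ (λ a b → p 0 * Y a + b) (sym (dbl i)) (⊛-cong′ {g = Ev Y} (λ j → cong p (sym (dbl j))) (λ _ → refl) i) ⟩
  p 0 * Y (suc i ℕ.+ suc i) + (tail (Ev p) ⊛ Ev Y) i ∎
  where
  open ≡-Reasoning

⊛-Od : ∀ p Y → Even Y → ∀ i → (p ⊛ Y) (suc (i ℕ.+ i)) ≡ (Od p ⊛ Ev Y) i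
⊛-Od p Y h i = trans (cong₂ _+_ (trans (cong (p 0 *_) (h i)) (ℚₚ.*-zeroʳ (p 0))) (⊛-Ev (tail p) Y h i)) (ℚₚ.+-identityˡ ((Od p ⊛ Ev Y) i))

Even-⊛ : ∀ {f g} → Even f → Even g → Even (f ⊛ g)
Even-⊛ {f} {g} p q i = trans (⊛-Od f g q i) (0⊛ (Ev g) p i)

Even-κ : ∀ c → Even (κ c)
Even-κ c i = refl

Even-^ : ∀ {f} n → Even f → Even (f ^ˢ n)
Even-^ zero p = Even-κ 1ℚ
Even-^ {f} (suc n) p = Even-⊛ {f} {f ^ˢ n} p (Even-^ n p)

Even-I2 : Even I2
Even-I2 zero = refl
Even-I2 (suc i) = trans (cong I2 (cong suc (dbl i))) (Even-I2 i)

Even-I4 : Even I4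
Even-I4 zero = refl
Even-I4 (suc zero) = refl
Even-I4 (suc (suc i)) = trans (cong I4 (cong suc (trans (dbl (suc i)) (cong (λ z → suc (suc z)) (dbl i))))) (Even-I4 i)

Even-R : Even R
Even-R = Even-⊛ {I4} {I2 ⊛ I2 ⊛ I2} Even-I4 (Even-⊛ {I2 ⊛ I2} {I2} (Even-⊛ {I2} {I2} Even-I2 Even-I2) Even-I2)

pev : ℕ → PS → ℚ → ℚ
pev zero f x = f 0
pev (suc N) f x = f 0 + x * pev N (tail f) x

pev-cong : ∀ N {f g} x → (∀ i → f i ≡ g i) → pev N f x ≡ pev N g x
pev-cong zero x p = p 0
pev-cong (suc N) x p = cong₂ (λ a b → a + x * b) (p 0) (pev-cong N x (λ i → p (suc i)))

ringᵠ₈₄ : ∀ a b x c d → a + b + x * (c + d) ≡ a + x * c + (b + x * d)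
ringᵠ₈₄ = solveᵠ 5 λ a b x c d → a :+ b :+ x :* (c :+ d) := a :+ x :* c :+ (b :+ x :* d)

pev-⊕ : ∀ N f g x → pev N (f ⊕ g) x ≡ pev N f x + pev N g x
pev-⊕ zero f g x = refl
pev-⊕ (suc N) f g x = trans (cong (λ z → f 0 + g 0 + x * z) (pev-⊕ N (tail f) (tail g) x)) (ringᵠ₈₄ (f 0) (g 0) x (pev N (tail f) x) (pev N (tail g) x))

ringᵠ₈₅ : ∀ c a x b → c * a + x * (c * b) ≡ c * (a + x * b)
ringᵠ₈₅ = solveᵠ 4 λ c a x b → c :* a :+ x :* (c :* b) := c :* (a :+ x :* b)

pev-scale : ∀ N c f x → pev N (λ i → c * f i) x ≡ c * pev N f x
pev-scale zero c f x = refl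
pev-scale (suc N) c f x = trans (cong (λ z → c * f 0 + x * z) (pev-scale N c (tail f) x)) (ringᵠ₈₅ c (f 0) x (pev N (tail f) x))

Deg≤ : ℕ → PS → Set
Deg≤ N f = ∀ i → N ℕ.< i → f i ≡ 0ℚ

pev-zero : ∀ N f x → (∀ i → f i ≡ 0ℚ) → pev N f x ≡ 0ℚ
pev-zero zero f x p = p 0
pev-zero (suc N) f x p = trans (cong₂ (λ a b → a + x * b) (p 0) (pev-zero N (tail f) x (λ i → p (suc i)))) (trans (cong (0ℚ +_) (ℚₚ.*-zeroʳ x)) refl)

pev-deg : ∀ N M f x → Deg≤ N f → pev (N ℕ.+ M) f x ≡ pev N f x
pev-deg zero zero f x p = refl
pev-deg zero (suc M) f x p = trans (cong (λ z → f 0 + x * z) (pev-zero M (tail f) x (λ i → p (suc i) (s≤s z≤n)))) (trans (cong (f 0 +_) (ℚₚ.*-zeroʳ x)) (ℚₚ.+-identityʳ (f 0)))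
pev-deg (suc N) M f x p = cong (λ z → f 0 + x * z) (pev-deg N M (tail f) x (λ i q → p (suc i) (s≤s q)))

pev-X : ∀ N f x → pev (suc N) (X ⊛ f) x ≡ x * pev N f x
pev-X N f x = trans (cong₂ (λ a b → a + x * b) (X⊛-zero f) (pev-cong N x (X⊛-suc f))) (ℚₚ.+-identityˡ (x * pev N f x))

ringˢ₆₇ : ∀ a b x f → (a ⊕ b ⊛ x) ⊛ f ≈ a ⊛ f ⊕ x ⊛ (b ⊛ f)
ringˢ₆₇ = solveˢ 4 (λ a b x f → (a :+ b :* x) :* f := a :* f :+ x :* (b :* f))

lin-⊛ : ∀ a b f → (κ a ⊕ κ b ⊛ X) ⊛ f ≈ κ a ⊛ f ⊕ X ⊛ (κ b ⊛ f)
lin-⊛ a b f = ringˢ₆₇ (κ a) (κ b) X f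

Deg-lin : ∀ N a b f → Deg≤ N f → Deg≤ (suc N) ((κ a ⊕ κ b ⊛ X) ⊛ f)
Deg-lin N a b f p (suc i) (s≤s q) = trans (at (lin-⊛ a b f) (suc i)) (trans (cong₂ _+_
  (trans (κ⊛ a f (suc i)) (trans (cong (a *_) (p (suc i) (ℕₚ.<-trans q (ℕₚ.n<1+n i)))) (ℚₚ.*-zeroʳ a)))
  (trans (X⊛-suc (κ b ⊛ f) i) (trans (κ⊛ b f i) (trans (cong (b *_) (p i q)) (ℚₚ.*-zeroʳ b))))) refl)

ringᵠ₈₆ : ∀ a b x p → a * p + x * (b * p) ≡ (a + b * x) * p
ringᵠ₈₆ = solveᵠ 4 λ a b x p → a :* p :+ x :* (b :* p) := (a :+ b :* x) :* p

pev-lin : ∀ N a b f x → Deg≤ N f → pev (suc N) ((κ a ⊕ κ b ⊛ X) ⊛ f) x ≡ (a + b * x) * pev N f x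
pev-lin N a b f x p = begin
  pev (suc N) ((κ a ⊕ κ b ⊛ X) ⊛ f) x ≡⟨ pev-cong (suc N) x (at (lin-⊛ a b f)) ⟩
  pev (suc N) (κ a ⊛ f ⊕ X ⊛ (κ b ⊛ f)) x ≡⟨ pev-⊕ (suc N) (κ a ⊛ f) (X ⊛ (κ b ⊛ f)) x ⟩
  pev (suc N) (κ a ⊛ f) x + pev (suc N) (X ⊛ (κ b ⊛ f)) x
    ≡⟨ cong₂ _+_ (trans (pev-cong (suc N) x (κ⊛ a f)) (trans (pev-scale (suc N) a f x) (cong (a *_) (trans (cong (λ z → pev z f x) (ℕₚ.+-comm 1 N)) (pev-deg N 1 f x p)))))
                 (trans (pev-X N (κ b ⊛ f) x) (cong (x *_) (trans (pev-cong N x (κ⊛ b f)) (pev-scale N b f x)))) ⟩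
  a * pev N f x + x * (b * pev N f x) ≡⟨ ringᵠ₈₆ a b x (pev N f x) ⟩
  (a + b * x) * pev N f x ∎
  where
  open ≡-Reasoning

ringᵠ₈₇ : ∀ a b x c d → a + x * (b + x * (c + x * d)) ≡ (a + x * x * c) + x * (b + x * x * d)
ringᵠ₈₇ = solveᵠ 5 λ a b x c d → a :+ x :* (b :+ x :* (c :+ x :* d)) := a :+ x :* x :* c :+ x :* (b :+ x :* x :* d)

pev-split : ∀ N f x → pev (suc (N ℕ.+ N)) f x ≡ pev N (Ev f) (x * x) + x * pev N (Od f) (x * x)
pev-split zero f x = refl
pev-split (suc N) f x = begin
  pev (suc (suc N ℕ.+ suc N)) f x ≡⟨ cong (λ z → pev (suc z) f x) (dbl N) ⟩
  f 0 + x * (f 1 + x * pev (suc (N ℕ.+ N)) (tail (tail f)) x) ≡⟨ cong (λ z → f 0 + x * (f 1 + x * z)) (pev-split N (tail (tail f)) x) ⟩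
  f 0 + x * (f 1 + x * (pev N (Ev (tail (tail f))) (x * x) + x * pev N (Od (tail (tail f))) (x * x)))
    ≡⟨ cong₂ (λ a b → f 0 + x * (f 1 + x * (a + x * b))) (pev-cong N (x * x) (λ i → cong f (sym (dbl i)))) (pev-cong N (x * x) (λ i → cong f (cong suc (sym (dbl i))))) ⟩
  f 0 + x * (f 1 + x * (pev N (tail (Ev f)) (x * x) + x * pev N (tail (Od f)) (x * x)))
    ≡⟨ ringᵠ₈₇ (f 0) (f 1) x (pev N (tail (Ev f)) (x * x)) (pev N (tail (Od f)) (x * x)) ⟩
  (f 0 + x * x * pev N (tail (Ev f)) (x * x)) + x * (f 1 + x * x * pev N (tail (Od f)) (x * x)) ∎
  where
  open ≡-Reasoning

-- Convolution of a sequence with one sign change against a geometrically dominated sequence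

PN : PS → Set
PN d = ∀ i → 0ℚ ≤ d i ⊎ (∀ j → i ℕ.≤ j → d j ≤ 0ℚ)

PN-tail : ∀ {d} → PN d → PN (tail d)
PN-tail p i with p (suc i)
... | inj₁ q = inj₁ q
... | inj₂ q = inj₂ (λ j r → q (suc j) (s≤s r))

pev-nonpos : ∀ N d x → 0ℚ ≤ x → (∀ j → d j ≤ 0ℚ) → pev N d x ≤ 0ℚ
pev-nonpos zero d x p q = q 0
pev-nonpos (suc N) d x p q = +-mono-≤ (q 0) (≤-trans (*-monoˡ p (pev-nonpos N (tail d) x p (λ j → q (suc j)))) (≤-reflexive (ℚₚ.*-zeroʳ x)))

PN-split : ∀ m {d} → PN d → (∀ i → i ℕ.≤ m → 0ℚ ≤ d i) ⊎ (∀ j → m ℕ.< j → d j ≤ 0ℚ)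
PN-split zero pn with pn 0
... | inj₁ q = inj₁ λ { zero _ → q }
... | inj₂ q = inj₂ λ j _ → q j z≤n
PN-split (suc m) {d} pn with pn 0
... | inj₂ q = inj₂ λ j _ → q j z≤n
... | inj₁ q with PN-split m {tail d} (PN-tail {d} pn)
...   | inj₁ r = inj₁ λ { zero _ → q ; (suc i) (s≤s le) → r i le }
...   | inj₂ r = inj₂ λ { (suc j) (s≤s lt) → r j lt }

pev-nonneg : ∀ N d x → 0ℚ ≤ x → (∀ j → j ℕ.≤ N → 0ℚ ≤ d j) → 0ℚ ≤ pev N d x
pev-nonneg zero d x p q = q 0 z≤n
pev-nonneg (suc N) d x p q = 0≤+ (q 0 z≤n) (0≤* p (pev-nonneg N (tail d) x p (λ j r → q (suc j) (s≤s r))))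

pev-drop : ∀ m N d x → 0ℚ ≤ x → (∀ j → m ℕ.< j → d j ≤ 0ℚ) → pev (m ℕ.+ N) d x ≤ pev m d x
pev-drop zero zero d x p q = ≤-refl
pev-drop zero (suc N) d x p q = ≤-trans (+-mono-≤ (≤-refl {d 0}) (≤-trans (*-monoˡ p (pev-nonpos N (tail d) x p (λ j → q (suc j) (s≤s z≤n)))) (≤-reflexive (ℚₚ.*-zeroʳ x)))) (≤-reflexive (ℚₚ.+-identityʳ (d 0)))
pev-drop (suc m) N d x p q = +-mono-≤ (≤-refl {d 0}) (*-monoˡ p (pev-drop m N (tail d) x p (λ j r → q (suc j) (s≤s r))))

-- Truncation cannot spoil the sign: either the cut lies in the nonnegative range, or only
-- nonpositive terms are cut off.
pev-partial : ∀ m N d x → 0ℚ ≤ x → PN d → 0ℚ ≤ pev (m ℕ.+ N) d x → 0ℚ ≤ pev m d x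
pev-partial m N d x p pn h with PN-split m {d} pn
... | inj₁ q = pev-nonneg m d x p q
... | inj₂ q = ≤-trans h (pev-drop m N d x p q)

ringᵠ₈₈ : ∀ d y y' σ p → d * y + y' * p - y * (d + σ * p) ≡ (σ * y - y') * (0ℚ - p)
ringᵠ₈₈ = solveᵠ 5 λ d y y' σ p → d :* y :+ y' :* p :- y :* (d :+ σ :* p) := (σ :* y :- y') :* (con 0ℚ :- p)

-- Compared with σ^i, the weights y_(m-i) in the coefficient of index m decrease with i. A sequence
-- that turns from nonnegative to nonpositive thus has its early terms favoured, and its value at σ
-- decides the sign of the convolution.
module _ (y : PS) (σ : ℚ) (σ≥0 : 0ℚ ≤ σ) (y≥0 : ∀ i → 0ℚ ≤ y i) where

  ⊛-≥-pev : ∀ m d → (∀ i → i ℕ.< m → y i ≤ σ * y (suc i)) → (∀ j → d j ≤ 0ℚ) → y m * pev m d σ ≤ (d ⊛ y) m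
  ⊛-≥-pev zero d h q = ≤-reflexive (ℚₚ.*-comm (y 0) (d 0))
  ⊛-≥-pev (suc m) d h q = ≤-trans
    (by≤ (ringᵠ₈₈ (d 0) (y (suc m)) (y m) σ (pev m (tail d) σ)) (0≤* (≤⇒0≤- (h m (ℕₚ.n<1+n m))) (≤⇒0≤- (pev-nonpos m (tail d) σ σ≥0 (λ j → q (suc j))))))
    (+-mono-≤ (≤-refl {d 0 * y (suc m)}) (⊛-≥-pev m (tail d) (λ i r → h i (ℕₚ.<-trans r (ℕₚ.n<1+n m))) (λ j → q (suc j))))

  -- Both claims are proved together: the second is needed after the first positive terms are split off.
  ⊛-PN : ∀ m d → (∀ i → i ℕ.< m → y i ≤ σ * y (suc i)) → PN d →
    (0ℚ ≤ pev m d σ → 0ℚ ≤ (d ⊛ y) m) × (pev m d σ ≤ 0ℚ → y m * pev m d σ ≤ (d ⊛ y) m)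
  ⊛-PN zero d h pn = (λ q → 0≤* q (y≥0 0)) , (λ q → ≤-reflexive (ℚₚ.*-comm (y 0) (d 0)))
  ⊛-PN (suc m) d h pn with pn 0
  ... | inj₂ q = (λ r → ≤-trans (0≤* (y≥0 (suc m)) r) all-neg) , (λ _ → all-neg)
    where
    all-neg : y (suc m) * pev (suc m) d σ ≤ (d ⊛ y) (suc m)
    all-neg = ⊛-≥-pev (suc m) d h (λ j → q j z≤n)
  ... | inj₁ q with ⊛-PN m (tail d) (λ i r → h i (ℕₚ.<-trans r (ℕₚ.n<1+n m))) (PN-tail {d} pn) | ℚₚ.≤-total 0ℚ (pev m (tail d) σ)
  ...   | ih₁ , ih₂ | inj₁ r = (λ _ → nn) , (λ t → ≤-trans (≤-trans (*-monoˡ (y≥0 (suc m)) t) (≤-reflexive (ℚₚ.*-zeroʳ (y (suc m))))) nn)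
    where
    nn : 0ℚ ≤ (d ⊛ y) (suc m)
    nn = 0≤+ (0≤* q (y≥0 (suc m))) (ih₁ r)
  ...   | ih₁ , ih₂ | inj₂ r = (λ t → ≤-trans (0≤* (y≥0 (suc m)) t) low) , (λ _ → low)
    where
    low : y (suc m) * pev (suc m) d σ ≤ (d ⊛ y) (suc m)
    low = ≤-trans (by≤ (ringᵠ₈₈ (d 0) (y (suc m)) (y m) σ (pev m (tail d) σ)) (0≤* (≤⇒0≤- (h m (ℕₚ.n<1+n m))) (≤⇒0≤- r)))
      (+-mono-≤ (≤-refl {d 0 * y (suc m)}) (ih₂ r))

T≈ : T ≈ κ 1ℚ ⊕ κ 1ℚ ⊛ X
T≈ = ⊕-congˡ one (≈-sym (idˡ X))

Deg-T^ : ∀ B → Deg≤ B (T ^ˢ B)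
Deg-T^ zero (suc i) p = refl
Deg-T^ (suc B) i p = trans (at (congʳ (T ^ˢ B) T≈) i) (Deg-lin B 1ℚ 1ℚ (T ^ˢ B) (Deg-T^ B) i p)

pev-T^ : ∀ B x → pev B (T ^ˢ B) x ≡ (1ℚ + x) ^ B
pev-T^ zero x = refl
pev-T^ (suc B) x = trans (pev-cong (suc B) x (at (congʳ (T ^ˢ B) T≈))) (trans (pev-lin B 1ℚ 1ℚ (T ^ˢ B) x (Deg-T^ B)) (cong₂ (λ a b → (1ℚ + a) * b) (ℚₚ.*-identityˡ x) (pev-T^ B x)))

ringᵠ₈₉ : ∀ a b → a ≡ a + b - b
ringᵠ₈₉ = solveᵠ 2 λ a b → a := a :+ b :- b

ringˢ₆₈ : ∀ x p → p ⊕ x ⊛ p ≈ (one ⊕ x) ⊛ p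
ringˢ₆₈ = solveˢ 2 (λ x p → p :+ x :* p := (con 1ℚ :+ x) :* p)

ringᵠ₉₀ : ∀ a b p → a * p - b * p ≡ (a - b) * p
ringᵠ₉₀ = solveᵠ 3 λ a b p → a :* p :- b :* p := (a :- b) :* p

ringˢ₆₉ : ∀ t p b x i → t ⊛ (p ⊛ (b ⊛ (x ⊛ i))) ≈ (t ⊛ i) ⊛ (x ⊛ (b ⊛ p))
ringˢ₆₉ = solveˢ 5 (λ t p b x i → t :* (p :* (b :* (x :* i))) := (t :* i) :* (x :* (b :* p)))

-- The recurrence of binomial coefficients, read off from the differential equation (1 + t) θ(T^B) =
-- B t T^B.
T^-rec : ∀ B i → ι (suc i) * (T ^ˢ B) (suc i) ≡ (ι B - ι i) * (T ^ˢ B) i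
T^-rec B i = begin
  θ P (suc i) ≡⟨ ringᵠ₈₉ (θ P (suc i)) (θ P i) ⟩
  (θ P (suc i) + θ P i) - ι i * P i ≡⟨ cong (λ z → θ P (suc i) + z - ι i * P i) (sym (X⊛-suc (θ P) i)) ⟩
  (θ P ⊕ X ⊛ θ P) (suc i) - ι i * P i ≡⟨ cong (_- ι i * P i) (trans (at (ringˢ₆₈ X (θ P)) (suc i)) (at Tθ (suc i))) ⟩
  (X ⊛ (κ (ι B) ⊛ P)) (suc i) - ι i * P i ≡⟨ cong (_- ι i * P i) (trans (X⊛-suc (κ (ι B) ⊛ P) i) (κ⊛ (ι B) P i)) ⟩
  ι B * P i - ι i * P i ≡⟨ ringᵠ₉₀ (ι B) (ι i) (P i) ⟩
  (ι B - ι i) * P i ∎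
  where
  open ≡-Reasoning
  P : PS
  P = T ^ˢ B
  Tθ : T ⊛ θ P ≈ X ⊛ (κ (ι B) ⊛ P)
  Tθ = ≈-trans (congˡ T (LD-^ B LD-T)) (≈-trans (ringˢ₆₉ T P (κ (ι B)) X Ti) (≈-trans (congʳ (X ⊛ (κ (ι B) ⊛ P)) T⊛Ti) (idˡ (X ⊛ (κ (ι B) ⊛ P)))))

linT : ℕ → ℚ → PS
linT B τ = (κ τ ⊕ κ (- 1ℚ) ⊛ X) ⊛ T ^ˢ B

ringᵠ₉₁ : ∀ τ → τ + (- 1ℚ) * 0ℚ ≡ τ
ringᵠ₉₁ = solveᵠ 1 λ τ → τ :+ (:- con 1ℚ) :* con 0ℚ := τ

linT-0 : ∀ B τ → linT B τ 0 ≡ τ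
linT-0 B τ = trans (cong₂ _*_ (ringᵠ₉₁ τ) (T0 B)) (ℚₚ.*-identityʳ τ)
  where
  T0 : ∀ B → (T ^ˢ B) 0 ≡ 1ℚ
  T0 zero = refl
  T0 (suc B) = trans (cong (1ℚ *_) (T0 B)) refl

ringᵠ₉₂ : ∀ c τ a b → c * (τ * a + (- 1ℚ) * b) ≡ τ * (c * a) - c * b
ringᵠ₉₂ = solveᵠ 4 λ c τ a b → c :* (τ :* a :+ (:- con 1ℚ) :* b) := τ :* (c :* a) :- c :* b

ringᵠ₉₃ : ∀ τ d a c → τ * (d * a) - c * a ≡ (τ * d - c) * a
ringᵠ₉₃ = solveᵠ 4 λ τ d a c → τ :* (d :* a) :- c :* a := (τ :* d :- c) :* a

linT-suc : ∀ B τ i → ι (suc i) * linT B τ (suc i) ≡ (τ * (ι B - ι i) - ι (suc i)) * (T ^ˢ B) i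
linT-suc B τ i = begin
  ι (suc i) * linT B τ (suc i) ≡⟨ cong (ι (suc i) *_) (trans (at (lin-⊛ τ (- 1ℚ) (T ^ˢ B)) (suc i)) (cong₂ _+_ (κ⊛ τ (T ^ˢ B) (suc i)) (trans (X⊛-suc (κ (- 1ℚ) ⊛ T ^ˢ B) i) (κ⊛ (- 1ℚ) (T ^ˢ B) i)))) ⟩
  ι (suc i) * (τ * (T ^ˢ B) (suc i) + (- 1ℚ) * (T ^ˢ B) i) ≡⟨ ringᵠ₉₂ (ι (suc i)) τ ((T ^ˢ B) (suc i)) ((T ^ˢ B) i) ⟩
  τ * (ι (suc i) * (T ^ˢ B) (suc i)) - ι (suc i) * (T ^ˢ B) i ≡⟨ cong (λ z → τ * z - ι (suc i) * (T ^ˢ B) i) (T^-rec B i) ⟩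
  τ * ((ι B - ι i) * (T ^ˢ B) i) - ι (suc i) * (T ^ˢ B) i ≡⟨ ringᵠ₉₃ τ (ι B - ι i) ((T ^ˢ B) i) (ι (suc i)) ⟩
  (τ * (ι B - ι i) - ι (suc i)) * (T ^ˢ B) i ∎
  where
  open ≡-Reasoning

ringᵠ₉₄ : ∀ τ b i j i' j' → τ * (b - i) - i' - (τ * (b - j) - j') ≡ τ * (j - i) + (j' - i')
ringᵠ₉₄ = solveᵠ 6 λ τ b i j i' j' → τ :* (b :- i) :- i' :- (τ :* (b :- j) :- j') := τ :* (j :- i) :+ (j' :- i')

-- Past the constant term the sign is that of τ (B - i) - (i + 1), which decreases in i.
PN-linT : ∀ B τ → 0ℚ ≤ τ → PN (linT B τ)
PN-linT B τ τ≥0 zero = inj₁ (subst (0ℚ ≤_) (sym (linT-0 B τ)) τ≥0)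
PN-linT B τ τ≥0 (suc i) with ℚₚ.≤-total 0ℚ (τ * (ι B - ι i) - ι (suc i))
... | inj₁ q = inj₁ (*-cancelˡ-0≤ (ι-pos i) (subst (0ℚ ≤_) (sym (linT-suc B τ i)) (0≤* q (NN-^ B NN-T i))))
... | inj₂ q = inj₂ later
  where
  later : ∀ j → suc i ℕ.≤ j → linT B τ j ≤ 0ℚ
  later (suc j) (s≤s le) = *-cancelˡ (ι-pos j) (≤-trans (≤-reflexive (linT-suc B τ j)) (≤-trans
    (≤-trans (*-monoʳ (NN-^ B NN-T j) (≤-trans (by≤ (ringᵠ₉₄ τ (ι B) (ι i) (ι j) (ι (suc i)) (ι (suc j))) (0≤+ (0≤* τ≥0 (≤⇒0≤- (ι-mono le))) (≤⇒0≤- (ι-mono (s≤s le))))) q)) (≤-reflexive (ℚₚ.*-zeroˡ ((T ^ˢ B) j))))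
    (≤-reflexive (sym (ℚₚ.*-zeroʳ (ι (suc j)))))))

PN-Ev : ∀ {d} → PN d → PN (Ev d)
PN-Ev p i with p (i ℕ.+ i)
... | inj₁ q = inj₁ q
... | inj₂ q = inj₂ λ j le → q (j ℕ.+ j) (ℕₚ.+-mono-≤ le le)

PN-Od : ∀ {d} → PN d → PN (Od d)
PN-Od p i with p (suc (i ℕ.+ i))
... | inj₁ q = inj₁ q
... | inj₂ q = inj₂ λ j le → q (suc (j ℕ.+ j)) (s≤s (ℕₚ.+-mono-≤ le le))

ringᵠ₉₅ : ∀ τ x → τ + (- 1ℚ) * x ≡ τ - x
ringᵠ₉₅ = solveᵠ 2 λ τ x → τ :+ (:- con 1ℚ) :* x := τ :- x

pev-linT : ∀ B τ x → pev (suc B) (linT B τ) x ≡ (τ - x) * (1ℚ + x) ^ B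
pev-linT B τ x = trans (pev-lin B τ (- 1ℚ) (T ^ˢ B) x (Deg-T^ B)) (cong₂ _*_ (ringᵠ₉₅ τ x) (pev-T^ B x))

ringⁿ₂₀ : ∀ B N → suc (suc B ℕ.+ N ℕ.+ (suc B ℕ.+ N)) ≡ suc B ℕ.+ suc (suc (B ℕ.+ N ℕ.+ N))
ringⁿ₂₀ = ℕR.solve-∀

ringᵠ₉₆ : ∀ x → (- x) * (- x) ≡ x * x
ringᵠ₉₆ = solveᵠ 1 λ x → (:- x) :* (:- x) := x :* x

ringᵠ₉₇ : ∀ a b c → a - b * c ≡ a + (- b) * c
ringᵠ₉₇ = solveᵠ 3 λ a b c → a :- b :* c := a :+ (:- b) :* c

ringᵠ₉₈ : ∀ a b → a - (- b) ≡ a + b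
ringᵠ₉₈ = solveᵠ 2 λ a b → a :- (:- b) := a :+ b

ringᵠ₉₉ : ∀ a b → 2ℚ * a ≡ a + b + (a - b)
ringᵠ₉₉ = solveᵠ 2 λ a b → con 2ℚ :* a := a :+ b :+ (a :- b)

ringᵠ₁₀₀ : ∀ a b c → 2ℚ * b * c ≡ a + b * c - (a - b * c)
ringᵠ₁₀₀ = solveᵠ 3 λ a b c → con 2ℚ :* b :* c := a :+ b :* c :- (a :- b :* c)

-- As Y is even, the even and the odd part of (τ - t)(1 + t)^B act separately, and each has a single
-- sign change. Their values at τ₀² come from the values of the polynomial at τ₀ and -τ₀: the sum
-- gives the even part, the difference the odd part, and the hypothesis on B keeps that difference
-- nonnegative.
linT-⊛-nonneg : ∀ (Y : PS) B τ τ₀ e → 0ℚ < τ₀ → τ₀ ≤ τ → τ₀ ≤ 1ℚ →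
  (τ + τ₀) * (1ℚ - τ₀) ^ B ≤ (τ - τ₀) * (1ℚ + τ₀) ^ B →
  Even Y → NN Y → (∀ i → suc i ℕ.+ suc i ℕ.≤ e → Ev Y i ≤ τ₀ * τ₀ * Ev Y (suc i)) →
  ∀ j → j ℕ.≤ e → 0ℚ ≤ (linT B τ ⊛ Y) j
linT-⊛-nonneg Y B τ τ₀ e τ₀>0 τ₀≤τ τ₀≤1 hB evenY nnY ratio = go
  where
  τ≥0 : 0ℚ ≤ τ
  τ≥0 = ≤-trans (<⇒≤ τ₀>0) τ₀≤τ
  σ≥0 : 0ℚ ≤ τ₀ * τ₀
  σ≥0 = 0≤* (<⇒≤ τ₀>0) (<⇒≤ τ₀>0)
  p : PS
  p = linT B τ
  full : ∀ N x → pev (suc (suc B ℕ.+ N ℕ.+ (suc B ℕ.+ N))) p x ≡ (τ - x) * (1ℚ + x) ^ B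
  full N x = trans (cong (λ z → pev z p x) (ringⁿ₂₀ B N)) (trans (pev-deg (suc B) (suc (suc (B ℕ.+ N ℕ.+ N))) p x (Deg-lin B τ (- 1ℚ) (T ^ˢ B) (Deg-T^ B))) (pev-linT B τ x))
  E O : ℕ → ℚ
  E N = pev (suc B ℕ.+ N) (Ev p) (τ₀ * τ₀)
  O N = pev (suc B ℕ.+ N) (Od p) (τ₀ * τ₀)
  plus : ∀ N → E N + τ₀ * O N ≡ (τ - τ₀) * (1ℚ + τ₀) ^ B
  plus N = trans (sym (pev-split (suc B ℕ.+ N) p τ₀)) (full N τ₀)
  minus : ∀ N → E N - τ₀ * O N ≡ (τ + τ₀) * (1ℚ - τ₀) ^ B
  minus N = trans (trans (ringᵠ₉₇ (E N) τ₀ (O N)) (cong (λ z → pev (suc B ℕ.+ N) (Ev p) z + (- τ₀) * pev (suc B ℕ.+ N) (Od p) z) (sym (ringᵠ₉₆ τ₀))))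
    (trans (sym (pev-split (suc B ℕ.+ N) p (- τ₀))) (trans (full N (- τ₀)) (cong (_* (1ℚ - τ₀) ^ B) (ringᵠ₉₈ τ τ₀))))
  E≥0 : ∀ N → 0ℚ ≤ E N
  E≥0 N = *-cancelˡ-0≤ {c = 2ℚ} lit< (by0≤ (trans (ringᵠ₉₉ (E N) (τ₀ * O N)) (cong₂ _+_ (plus N) (minus N)))
    (0≤+ (0≤* (≤⇒0≤- τ₀≤τ) (^-nonneg B (0≤+ 0≤1 (<⇒≤ τ₀>0)))) (0≤* (0≤+ τ≥0 (<⇒≤ τ₀>0)) (^-nonneg B (≤⇒0≤- τ₀≤1)))))
  O≥0 : ∀ N → 0ℚ ≤ O N
  O≥0 N = *-cancelˡ-0≤ {c = 2ℚ * τ₀} (0<* {2ℚ} {τ₀} lit< τ₀>0) (by0≤ (trans (ringᵠ₁₀₀ (E N) τ₀ (O N)) (cong₂ _-_ (plus N) (minus N))) (≤⇒0≤- hB))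
  nnE : ∀ i → 0ℚ ≤ Ev Y i
  nnE i = nnY (i ℕ.+ i)
  comm : ∀ B i → i ℕ.+ suc B ≡ suc B ℕ.+ i
  comm B i = ℕₚ.+-comm i (suc B)
  evenCase : ∀ i → i ℕ.+ i ℕ.≤ e → 0ℚ ≤ (p ⊛ Y) (i ℕ.+ i)
  evenCase i le = subst (0ℚ ≤_) (sym (⊛-Ev p Y evenY i))
    (proj₁ (⊛-PN (Ev Y) (τ₀ * τ₀) σ≥0 nnE i (Ev p) (λ j lt → ratio j (ℕₚ.≤-trans (ℕₚ.+-mono-≤ lt lt) le)) (PN-Ev {p} (PN-linT B τ τ≥0)))
      (pev-partial i (suc B) (Ev p) (τ₀ * τ₀) σ≥0 (PN-Ev {p} (PN-linT B τ τ≥0)) (subst (λ z → 0ℚ ≤ pev z (Ev p) (τ₀ * τ₀)) (sym (comm B i)) (E≥0 i))))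
  oddCase : ∀ i → suc (i ℕ.+ i) ℕ.≤ e → 0ℚ ≤ (p ⊛ Y) (suc (i ℕ.+ i))
  oddCase i le = subst (0ℚ ≤_) (sym (⊛-Od p Y evenY i))
    (proj₁ (⊛-PN (Ev Y) (τ₀ * τ₀) σ≥0 nnE i (Od p) (λ j lt → ratio j (ℕₚ.≤-trans (ℕₚ.+-mono-≤ lt lt) (ℕₚ.≤-trans (ℕₚ.n≤1+n (i ℕ.+ i)) le))) (PN-Od {p} (PN-linT B τ τ≥0)))
      (pev-partial i (suc B) (Od p) (τ₀ * τ₀) σ≥0 (PN-Od {p} (PN-linT B τ τ≥0)) (subst (λ z → 0ℚ ≤ pev z (Od p) (τ₀ * τ₀)) (sym (comm B i)) (O≥0 i))))
  parity : ∀ j → ∃ λ i → (j ≡ i ℕ.+ i) ⊎ (j ≡ suc (i ℕ.+ i))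
  parity zero = 0 , inj₁ refl
  parity (suc j) with parity j
  ... | i , inj₁ refl = i , inj₂ refl
  ... | i , inj₂ refl = suc i , inj₁ (sym (dbl i))
  go : ∀ j → j ℕ.≤ e → 0ℚ ≤ (p ⊛ Y) j
  go j le with parity j
  ... | i , inj₁ refl = evenCase i le
  ... | i , inj₂ refl = oddCase i le

-- Three-term recurrences (i+2) y_{i+2} = α y_{i+1} + (β+i) y_i

record Rec (y : PS) (α β : ℚ) : Set where
  field
    y₀ : y 0 ≡ 1ℚ
    y₁ : y 1 ≡ α * y 0
    y₂ : ∀ i → ι (suc (suc i)) * y (suc (suc i)) ≡ α * y (suc i) + (β + ι i) * y i

ringᵠ₁₀₁ : ∀ σ α y → σ * (α * y) - y ≡ (σ * α - 1ℚ) * y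
ringᵠ₁₀₁ = solveᵠ 3 λ σ α y → σ :* (α :* y) :- y := (σ :* α :- con 1ℚ) :* y

ringᵠ₁₀₂ : ∀ a b → a + b - 1ℚ ≡ a - 1ℚ + b
ringᵠ₁₀₂ = solveᵠ 2 λ a b → a :+ b :- con 1ℚ := a :- con 1ℚ :+ b

ringᵠ₁₀₃ : ∀ σ α β m i → σ * α + σ * σ * (β + i) - (1ℚ + (1ℚ + i)) - 1ℚ ≡ σ * α + σ * σ * β - (m * (1ℚ - σ * σ) + 1ℚ + 2ℚ * (σ * σ)) + (m - (1ℚ + (1ℚ + i))) * (1ℚ - σ * σ)
ringᵠ₁₀₃ = solveᵠ 5 λ σ α β m i → σ :* α :+ σ :* σ :* (β :+ i) :- (con 1ℚ :+ (con 1ℚ :+ i)) :- con 1ℚ := σ :* α :+ σ :* σ :* β :- (m :* (con 1ℚ :- σ :* σ) :+ con 1ℚ :+ con 2ℚ :* (σ :* σ)) :+ (m :- (con 1ℚ :+ (con 1ℚ :+ i))) :* (con 1ℚ :- σ :* σ)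

ringᵠ₁₀₄ : ∀ α b σ y → (α + b * σ) * y - 1ℚ * (α * y) ≡ b * σ * y
ringᵠ₁₀₄ = solveᵠ 4 λ α b σ y → (α :+ b :* σ) :* y :- con 1ℚ :* (α :* y) := b :* σ :* y

ringᵠ₁₀₅ : ∀ α β j σ y y' → (α + (β + (1ℚ + j) - 1ℚ) * σ) * y - (α * y + (β + j) * y') ≡ (β + j) * (σ * y - y')
ringᵠ₁₀₅ = solveᵠ 6 λ α β j σ y y' → (α :+ (β :+ (con 1ℚ :+ j) :- con 1ℚ) :* σ) :* y :- (α :* y :+ (β :+ j) :* y') := (β :+ j) :* (σ :* y :- y')

ringᵠ₁₀₆ : ∀ σ b → σ * (b + 1ℚ) - σ ≡ σ * b
ringᵠ₁₀₆ = solveᵠ 2 λ σ b → σ :* (b :+ con 1ℚ) :- σ := σ :* b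

ringᵠ₁₀₇ : ∀ σ α b i → σ * (α * (α + (b - 1ℚ) * σ) + b * i) - (α + (b - 1ℚ) * σ) * (1ℚ + i) ≡ (σ * α + σ * σ * b - (1ℚ + i) - 1ℚ) * (α - σ) + (α - σ * (b + 1ℚ)) + σ * σ * σ * b
ringᵠ₁₀₇ = solveᵠ 4 λ σ α b i → σ :* (α :* (α :+ (b :- con 1ℚ) :* σ) :+ b :* i) :- (α :+ (b :- con 1ℚ) :* σ) :* (con 1ℚ :+ i) := (σ :* α :+ σ :* σ :* b :- (con 1ℚ :+ i) :- con 1ℚ) :* (α :- σ) :+ (α :- σ :* (b :+ con 1ℚ)) :+ σ :* σ :* σ :* b

ringᵠ₁₀₈ : ∀ d i σ y → d * i * (σ * y) ≡ σ * d * (i * y)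
ringᵠ₁₀₈ = solveᵠ 4 λ d i σ y → d :* i :* (σ :* y) := σ :* d :* (i :* y)

ringᵠ₁₀₉ : ∀ σ d α y b y' i → σ * d * (α * y + b * y') - σ * (α * d + b * i) * y ≡ σ * b * (d * y' - i * y)
ringᵠ₁₀₉ = solveᵠ 7 λ σ d α y b y' i → σ :* d :* (α :* y :+ b :* y') :- σ :* (α :* d :+ b :* i) :* y := σ :* b :* (d :* y' :- i :* y)

-- The hypothesis `h₁` makes σ satisfy the fixed point equation of the ratio recursion with surplus
-- 1. The induction closes through an opposite bound: the previous ratio limits the growth from y_i
-- to y_(i+1), so y_i still contributes enough to y_(i+2).
module Ratio (y : PS) (α β σ : ℚ) (rec : Rec y α β) (y≥0 : ∀ i → 0ℚ ≤ y i) (m : ℕ)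
  (σ>0 : 0ℚ < σ) (σ<1 : σ ≤ 1ℚ) (α>0 : 0ℚ < α) (β≥1 : 1ℚ ≤ β)
  (h₀ : 1ℚ ≤ σ * α)
  (h₁ : ι m * (1ℚ - σ * σ) + 1ℚ + 2ℚ * (σ * σ) ≤ σ * α + σ * σ * β)
  (h₂ : σ * (β + ι m + 1ℚ) ≤ α) where
  open Rec rec

  ratio : ∀ i → suc i ℕ.≤ m → y i ≤ σ * y (suc i)
  ratio zero le = by≤ (trans (cong (λ z → σ * z - y 0) y₁) (ringᵠ₁₀₁ σ α (y 0))) (0≤* (≤⇒0≤- h₀) (y≥0 0))
  ratio (suc i) le = *-cancelˡ (0<* D>0 (ι-pos (suc i))) (≤-trans step₁ step₂)
    where
    b D Δ I : ℚ
    b = β + ι i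
    D = α + (b - 1ℚ) * σ
    I = ι (suc (suc i))
    Δ = σ * α + σ * σ * b - I
    b≥1 : 0ℚ ≤ b - 1ℚ
    b≥1 = by0≤ (ringᵠ₁₀₂ β (ι i)) (0≤+ (≤⇒0≤- β≥1) (ι-nonneg i))
    b≥0 : 0ℚ ≤ b
    b≥0 = 0≤+ (≤-trans 0≤1 β≥1) (ι-nonneg i)
    D>0 : 0ℚ < D
    D>0 = 0<+ α>0 (0≤* b≥1 (<⇒≤ σ>0))
    σ²≤1 : 0ℚ ≤ 1ℚ - σ * σ
    σ²≤1 = ≤⇒0≤- (*-mono (<⇒≤ σ>0) σ<1 (<⇒≤ σ>0) σ<1)
    I≤m : I ≤ ι m
    I≤m = ι-mono le
    I≡ : I ≡ 1ℚ + (1ℚ + ι i)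
    I≡ = trans (ι-suc (suc i)) (cong (1ℚ +_) (ι-suc i))
    -- The case i + 2 = m is the worst one, because σ² ≤ 1, and there this is `h₁`.
    Δ≥1 : 0ℚ ≤ Δ - 1ℚ
    Δ≥1 = by0≤ (trans (cong (λ z → σ * α + σ * σ * (β + ι i) - z - 1ℚ) I≡) (trans (ringᵠ₁₀₃ σ α β (ι m) (ι i)) (cong (λ z → σ * α + σ * σ * β - (ι m * (1ℚ - σ * σ) + 1ℚ + 2ℚ * (σ * σ)) + (ι m - z) * (1ℚ - σ * σ)) (sym I≡))))
      (0≤+ (≤⇒0≤- h₁) (0≤* (≤⇒0≤- I≤m) σ²≤1))
    prev : ι (suc i) * y (suc i) ≤ D * y i
    prev = prev' i refl
      where
      prev' : ∀ j → j ≡ i → ι (suc j) * y (suc j) ≤ D * y j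
      prev' zero refl = by≤ (trans (cong (λ z → D * y 0 - ι 1 * z) y₁) (ringᵠ₁₀₄ α (b - 1ℚ) σ (y 0))) (0≤* (0≤* b≥1 (<⇒≤ σ>0)) (y≥0 0))
      prev' (suc j) refl = by≤ (trans (cong (λ z → D * y (suc j) - z) (y₂ j)) (trans (cong (λ z → (α + (β + z - 1ℚ) * σ) * y (suc j) - (α * y (suc j) + (β + ι j) * y j)) (ι-suc j)) (ringᵠ₁₀₅ α β (ι j) σ (y (suc j)) (y j))))
        (0≤* (0≤+ (≤-trans 0≤1 β≥1) (ι-nonneg j)) (≤⇒0≤- (ratio j (ℕₚ.≤-trans (ℕₚ.n≤1+n (suc j)) (ℕₚ.≤-trans (ℕₚ.n≤1+n (suc (suc j))) le)))))
    hb : σ * (b + 1ℚ) ≤ α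
    hb = ≤-trans (*-monoˡ (<⇒≤ σ>0) (+-mono-≤ (+-mono-≤ (≤-refl {β}) (ι-mono (ℕₚ.≤-trans (ℕₚ.n≤1+n i) (ℕₚ.≤-trans (ℕₚ.n≤1+n (suc i)) le)))) (≤-refl {1ℚ}))) h₂
    ineq : 0ℚ ≤ σ * (α * D + b * ι (suc i)) - D * I
    ineq = by0≤ (trans (cong (λ z → σ * (α * D + b * ι (suc i)) - D * z) (ι-suc (suc i))) (trans (ringᵠ₁₀₇ σ α b (ι (suc i))) (cong (λ z → (σ * α + σ * σ * b - z - 1ℚ) * (α - σ) + (α - σ * (b + 1ℚ)) + σ * σ * σ * b) (sym (ι-suc (suc i))))))
      (0≤+ (0≤+ (0≤* Δ≥1 (≤⇒0≤- (≤-trans (by≤ (ringᵠ₁₀₆ σ b) (0≤* (<⇒≤ σ>0) b≥0)) hb))) (≤⇒0≤- hb)) (0≤* (0≤* (0≤* (<⇒≤ σ>0) (<⇒≤ σ>0)) (<⇒≤ σ>0)) b≥0))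
    step₁ : D * I * y (suc i) ≤ σ * (α * D + b * ι (suc i)) * y (suc i)
    step₁ = *-monoʳ {D * I} {σ * (α * D + b * ι (suc i))} {y (suc i)} (y≥0 (suc i)) (0≤-⇒≤ {D * I} {σ * (α * D + b * ι (suc i))} ineq)
    step₂ : σ * (α * D + b * ι (suc i)) * y (suc i) ≤ D * I * (σ * y (suc (suc i)))
    step₂ = by≤ (trans (cong (λ z → z - σ * (α * D + b * ι (suc i)) * y (suc i)) (trans (ringᵠ₁₀₈ D I σ (y (suc (suc i)))) (cong (σ * D *_) (y₂ i)))) (ringᵠ₁₀₉ σ D α (y (suc i)) b (y i) (ι (suc i))))
      (0≤* (0≤* (<⇒≤ σ>0) b≥0) (≤⇒0≤- prev))

-- The coefficients of R^N, as a series in t²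

ringˢ₇₀ : ∀ a b i → a ⊛ (b ⊛ i) ≈ b ⊛ (a ⊛ i)
ringˢ₇₀ = solveˢ 3 (λ a b i → a :* (b :* i) := b :* (a :* i))

L-1-s² : (one ⊖ s ⊛ s) ⊛ L ≈ κ (pos 6 / 1) ⊛ s ⊕ κ (pos 10 / 1) ⊛ (s ⊛ s)
L-1-s² = ≈-trans (ringˢ₇₀ (one ⊖ s ⊛ s) (κ (pos 6 / 1) ⊛ s ⊕ κ (pos 10 / 1) ⊛ (s ⊛ s)) I4) (≈-trans (congˡ (κ (pos 6 / 1) ⊛ s ⊕ κ (pos 10 / 1) ⊛ (s ⊛ s)) I4-eq) (idʳ (κ (pos 6 / 1) ⊛ s ⊕ κ (pos 10 / 1) ⊛ (s ⊛ s))))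

ringˢ₇₁ : ∀ s f → f ⊖ s ⊛ (s ⊛ f) ≈ (one ⊖ s ⊛ s) ⊛ f
ringˢ₇₁ = solveˢ 2 (λ s f → f :- s :* (s :* f) := (con 1ℚ :- s :* s) :* f)

ringˢ₇₂ : ∀ a z n l → a ⊛ (z ⊛ (n ⊛ l)) ≈ (n ⊛ z) ⊛ (a ⊛ l)
ringˢ₇₂ = solveˢ 4 (λ a z n l → a :* (z :* (n :* l)) := (n :* z) :* (a :* l))

ringˢ₇₃ : ∀ s z n → (n ⊛ z) ⊛ (κ (pos 6 / 1) ⊛ s ⊕ κ (pos 10 / 1) ⊛ (s ⊛ s)) ≈ n ⊛ (κ (pos 6 / 1) ⊛ (s ⊛ z) ⊕ κ (pos 10 / 1) ⊛ (s ⊛ (s ⊛ z)))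
ringˢ₇₃ = solveˢ 3 (λ s z n → (n :* z) :* (con (pos 6 / 1) :* s :+ con (pos 10 / 1) :* (s :* s)) := n :* (con (pos 6 / 1) :* (s :* z) :+ con (pos 10 / 1) :* (s :* (s :* z))))

ringᵠ₁₁₀ : ∀ a → a ≡ pos 1 / 2 * (2ℚ * a)
ringᵠ₁₁₀ = solveᵠ 1 λ a → a := con (pos 1 / 2) :* (con 2ℚ :* a)

ringᵠ₁₁₁ : ∀ a → a ≡ a - 0ℚ
ringᵠ₁₁₁ = solveᵠ 1 λ a → a := a :- con 0ℚ

ringᵠ₁₁₂ : ∀ n z → n * (pos 6 / 1 * z + pos 10 / 1 * 0ℚ) ≡ 2ℚ * (pos 3 / 1 * n * z)
ringᵠ₁₁₂ = solveᵠ 2 λ n z → n :* (con (pos 6 / 1) :* z :+ con (pos 10 / 1) :* con 0ℚ) := con 2ℚ :* (con (pos 3 / 1) :* n :* z)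

ringⁿ₂₁ : ∀ i → suc (suc i) ℕ.+ suc (suc i) ≡ 4 ℕ.+ (i ℕ.+ i)
ringⁿ₂₁ = ℕR.solve-∀

ringⁿ₂₂ : ∀ i → suc i ℕ.+ suc i ≡ 2 ℕ.+ (i ℕ.+ i)
ringⁿ₂₂ = ℕR.solve-∀

ringⁿ₂₃ : ∀ i → 2 ℕ.* suc (suc i) ≡ 4 ℕ.+ (i ℕ.+ i)
ringⁿ₂₃ = ℕR.solve-∀

ringᵠ₁₁₃ : ∀ a b → a ≡ (a - b) + b
ringᵠ₁₁₃ = solveᵠ 2 λ a b → a := a :- b :+ b

ringᵠ₁₁₄ : ∀ n a b i → n * (pos 6 / 1 * a + pos 10 / 1 * b) + (i + i) * b ≡ 2ℚ * (pos 3 / 1 * n * a + (pos 5 / 1 * n + i) * b)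
ringᵠ₁₁₄ = solveᵠ 4 λ n a b i → n :* (con (pos 6 / 1) :* a :+ con (pos 10 / 1) :* b) :+ (i :+ i) :* b := con 2ℚ :* (con (pos 3 / 1) :* n :* a :+ (con (pos 5 / 1) :* n :+ i) :* b)

-- Clearing the denominator 1 - t⁴ in t Z' = N L Z gives the recurrence; 6 and 10 are halved because
-- the index counts powers of t².
R^-rec : ∀ N → Rec (Ev (R ^ˢ N)) (pos 3 / 1 * ι N) (pos 5 / 1 * ι N)
R^-rec N = record { y₀ = Z0 N ; y₁ = rec₁ ; y₂ = rec₂ }
  where
  open ≡-Reasoning
  Z : PS
  Z = R ^ˢ N
  Z0 : ∀ N → (R ^ˢ N) 0 ≡ 1ℚ
  Z0 zero = refl
  Z0 (suc N) = trans (cong (R 0 *_) (Z0 N)) refl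
  ode : θ Z ⊖ s ⊛ (s ⊛ θ Z) ≈ κ (ι N) ⊛ (κ (pos 6 / 1) ⊛ (s ⊛ Z) ⊕ κ (pos 10 / 1) ⊛ (s ⊛ (s ⊛ Z)))
  ode = ≈-trans (ringˢ₇₁ s (θ Z)) (≈-trans (congˡ (one ⊖ s ⊛ s) (LD-^ N LD-R)) (≈-trans (ringˢ₇₂ (one ⊖ s ⊛ s) Z (κ (ι N)) L) (≈-trans (congˡ (κ (ι N) ⊛ Z) L-1-s²) (ringˢ₇₃ s Z (κ (ι N))))))
  ode-at : ∀ i → θ Z i - (s ⊛ (s ⊛ θ Z)) i ≡ ι N * (pos 6 / 1 * (s ⊛ Z) i + pos 10 / 1 * (s ⊛ (s ⊛ Z)) i)
  ode-at i = trans (at ode i) (trans (κ⊛ (ι N) (κ (pos 6 / 1) ⊛ (s ⊛ Z) ⊕ κ (pos 10 / 1) ⊛ (s ⊛ (s ⊛ Z))) i)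
    (cong (ι N *_) (cong₂ _+_ (κ⊛ (pos 6 / 1) (s ⊛ Z) i) (κ⊛ (pos 10 / 1) (s ⊛ (s ⊛ Z)) i))))
  half : ∀ {a b} → 2ℚ * a ≡ 2ℚ * b → a ≡ b
  half {a} {b} e = trans (ringᵠ₁₁₀ a) (trans (cong (pos 1 / 2 *_) e) (sym (ringᵠ₁₁₀ b)))
  rec₁ : Z 2 ≡ pos 3 / 1 * ι N * Z 0
  rec₁ = half (begin
    2ℚ * Z 2 ≡⟨ ringᵠ₁₁₁ (2ℚ * Z 2) ⟩
    θ Z 2 - 0ℚ ≡⟨ cong (λ z → θ Z 2 - z) (sym (trans (s⊛-+ (s ⊛ θ Z) 0) (s⊛-0 (θ Z)))) ⟩
    θ Z 2 - (s ⊛ (s ⊛ θ Z)) 2 ≡⟨ ode-at 2 ⟩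
    ι N * (pos 6 / 1 * (s ⊛ Z) 2 + pos 10 / 1 * (s ⊛ (s ⊛ Z)) 2) ≡⟨ cong₂ (λ a b → ι N * (pos 6 / 1 * a + pos 10 / 1 * b)) (s⊛-+ Z 0) (trans (s⊛-+ (s ⊛ Z) 0) (s⊛-0 Z)) ⟩
    ι N * (pos 6 / 1 * Z 0 + pos 10 / 1 * 0ℚ) ≡⟨ ringᵠ₁₁₂ (ι N) (Z 0) ⟩
    2ℚ * (pos 3 / 1 * ι N * Z 0) ∎)
  rec₂ : ∀ i → ι (suc (suc i)) * Ev Z (suc (suc i)) ≡ pos 3 / 1 * ι N * Ev Z (suc i) + (pos 5 / 1 * ι N + ι i) * Ev Z i
  rec₂ i = half (begin
    2ℚ * (ι (suc (suc i)) * Z (suc (suc i) ℕ.+ suc (suc i))) ≡⟨ trans (sym (ℚₚ.*-assoc 2ℚ (ι (suc (suc i))) (Z (suc (suc i) ℕ.+ suc (suc i))))) (cong₂ (λ a b → a * Z b) (trans (sym (ι-* 2 (suc (suc i)))) (cong ι (ringⁿ₂₃ i))) (ringⁿ₂₁ i)) ⟩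
    θ Z (4 ℕ.+ j) ≡⟨ ringᵠ₁₁₃ (θ Z (4 ℕ.+ j)) (θ Z j) ⟩
    (θ Z (4 ℕ.+ j) - θ Z j) + θ Z j ≡⟨ cong (λ z → (θ Z (4 ℕ.+ j) - z) + θ Z j) (sym (trans (s⊛-+ (s ⊛ θ Z) (2 ℕ.+ j)) (s⊛-+ (θ Z) j))) ⟩
    (θ Z (4 ℕ.+ j) - (s ⊛ (s ⊛ θ Z)) (4 ℕ.+ j)) + θ Z j ≡⟨ cong (_+ θ Z j) (ode-at (4 ℕ.+ j)) ⟩
    ι N * (pos 6 / 1 * (s ⊛ Z) (4 ℕ.+ j) + pos 10 / 1 * (s ⊛ (s ⊛ Z)) (4 ℕ.+ j)) + ι j * Z j
      ≡⟨ cong₂ (λ a b → ι N * (pos 6 / 1 * a + pos 10 / 1 * b) + ι j * Z j) (trans (s⊛-+ Z (2 ℕ.+ j)) (cong Z (sym (ringⁿ₂₂ i)))) (trans (s⊛-+ (s ⊛ Z) (2 ℕ.+ j)) (s⊛-+ Z j)) ⟩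
    ι N * (pos 6 / 1 * Ev Z (suc i) + pos 10 / 1 * Z j) + ι j * Z j ≡⟨ cong (λ z → ι N * (pos 6 / 1 * Ev Z (suc i) + pos 10 / 1 * Z j) + z * Z j) (ι-+ i i) ⟩
    ι N * (pos 6 / 1 * Ev Z (suc i) + pos 10 / 1 * Z j) + (ι i + ι i) * Z j ≡⟨ ringᵠ₁₁₄ (ι N) (Ev Z (suc i)) (Z j) (ι i) ⟩
    2ℚ * (pos 3 / 1 * ι N * Ev Z (suc i) + (pos 5 / 1 * ι N + ι i) * Z j) ∎)
    where
    j : ℕ
    j = i ℕ.+ i

-- Division of a polynomial by a linear factor

seriesQ : List ℚ → PS
seriesQ [] = κ 0ℚ
seriesQ (a ∷ l) = κ a ⊕ X ⊛ seriesQ l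

evalQ : List ℚ → ℚ → ℚ
evalQ [] x = 0ℚ
evalQ (a ∷ l) x = a + x * evalQ l x

-- Synthetic division by X - τ: the coefficients of the quotient are the Horner values at τ of the
-- successive tails.
quotQ : ℚ → List ℚ → List ℚ
quotQ τ [] = []
quotQ τ (a ∷ []) = []
quotQ τ (a ∷ b ∷ l) = evalQ (b ∷ l) τ ∷ quotQ τ (b ∷ l)

ringˢ₇₄ : ∀ x t → κ 0ℚ ≈ κ 0ℚ ⊕ (x ⊖ t) ⊛ κ 0ℚ
ringˢ₇₄ = solveˢ 2 (λ x t → con 0ℚ := con 0ℚ :+ (x :- t) :* con 0ℚ)

ringˢ₇₅ : ∀ a x t → a ⊕ x ⊛ κ 0ℚ ≈ a ⊕ (x ⊖ t) ⊛ κ 0ℚ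
ringˢ₇₅ = solveˢ 3 (λ a x t → a :+ x :* con 0ℚ := a :+ (x :- t) :* con 0ℚ)

ringˢ₇₆ : ∀ a x t c q → a ⊕ x ⊛ (c ⊕ (x ⊖ t) ⊛ q) ≈ (a ⊕ t ⊛ c) ⊕ (x ⊖ t) ⊛ (c ⊕ x ⊛ q)
ringˢ₇₆ = solveˢ 5 (λ a x t c q → a :+ x :* (c :+ (x :- t) :* q) := (a :+ t :* c) :+ (x :- t) :* (c :+ x :* q))

quotQ-eq : ∀ τ l → seriesQ l ≈ κ (evalQ l τ) ⊕ (X ⊖ κ τ) ⊛ seriesQ (quotQ τ l)
quotQ-eq τ [] = ringˢ₇₄ X (κ τ)
quotQ-eq τ (a ∷ []) = ≈-trans (ringˢ₇₅ (κ a) X (κ τ)) (⊕-congʳ ((X ⊖ κ τ) ⊛ κ 0ℚ) (κ-cong (sym (trans (cong (a +_) (ℚₚ.*-zeroʳ τ)) (ℚₚ.+-identityʳ a)))))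
quotQ-eq τ (a ∷ b ∷ l) = ≈-trans (⊕-congˡ (κ a) (congˡ X (quotQ-eq τ (b ∷ l)))) (≈-trans (ringˢ₇₆ (κ a) X (κ τ) (κ (evalQ (b ∷ l) τ)) (seriesQ (quotQ τ (b ∷ l))))
  (⊕-congʳ ((X ⊖ κ τ) ⊛ (κ (evalQ (b ∷ l) τ) ⊕ X ⊛ seriesQ (quotQ τ (b ∷ l)))) (≈-sym (≈-trans (κ-+ a (τ * evalQ (b ∷ l) τ)) (⊕-congˡ (κ a) (κ-* τ (evalQ (b ∷ l) τ)))))))

Bd : ℚ → ℚ → Set
Bd c x = (- c ≤ x) × (x ≤ c)

-- For r ≤ 1/120 the coefficients of f from degree 2 on are at most 924/120 = 7.7 in absolute value,
-- hence below 39/5. The Horner bound closes since 39/5 + 8/120 ≤ 8.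
c₈ c₇ : ℚ
c₈ = pos 8 / 1
c₇ = pos 39 / 5

ringᵠ₁₁₅ : ∀ τ → τ * (- c₈) - (- (pos 1 / 15)) ≡ c₈ * (pos 1 / 120 - τ)
ringᵠ₁₁₅ = solveᵠ 1 λ τ → τ :* (:- con c₈) :- (:- con (pos 1 / 15)) := con c₈ :* (con (pos 1 / 120) :- τ)

ringᵠ₁₁₆ : ∀ τ → pos 1 / 15 - τ * c₈ ≡ c₈ * (pos 1 / 120 - τ)
ringᵠ₁₁₆ = solveᵠ 1 λ τ → con (pos 1 / 15) :- τ :* con c₈ := con c₈ :* (con (pos 1 / 120) :- τ)

Bd-τ : ∀ {τ x} → 0ℚ ≤ τ → τ ≤ pos 1 / 120 → Bd c₈ x → Bd (pos 1 / 15) (τ * x)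
Bd-τ {τ} {x} p q (lo , hi) =
    ≤-trans {c = τ * x} (by≤ {a = - (pos 1 / 15)} {b = τ * (- c₈)} (ringᵠ₁₁₅ τ) nn) (*-monoˡ { - c₈} {x} {τ} p lo)
  , ≤-trans {a = τ * x} (*-monoˡ {x} {c₈} {τ} p hi) (by≤ {a = τ * c₈} {b = pos 1 / 15} (ringᵠ₁₁₆ τ) nn)
  where
  nn : 0ℚ ≤ c₈ * (pos 1 / 120 - τ)
  nn = 0≤* {c₈} {pos 1 / 120 - τ} lit≤ (≤⇒0≤- {τ} {pos 1 / 120} q)

evalQ-Bd : ∀ {τ} → 0ℚ ≤ τ → τ ≤ pos 1 / 120 → ∀ {l} → All (Bd c₇) l → Bd c₈ (evalQ l τ)
evalQ-Bd p q [] = lit≤ , lit≤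
evalQ-Bd {τ} p q {a ∷ l} ((lo , hi) ∷ bs) = let lo' , hi' = Bd-τ {τ} {evalQ l τ} p q (evalQ-Bd {τ} p q {l} bs) in
                  ≤-trans { - c₈} { - c₇ + - (pos 1 / 15)} lit≤ (+-mono-≤ { - c₇} {a} { - (pos 1 / 15)} {τ * evalQ l τ} lo lo')
                , ≤-trans {b = c₇ + pos 1 / 15} (+-mono-≤ {a} {c₇} {τ * evalQ l τ} {pos 1 / 15} hi hi') lit≤

quotQ-Bd : ∀ {τ} → 0ℚ ≤ τ → τ ≤ pos 1 / 120 → ∀ {a l} → All (Bd c₇) l → All (Bd c₈) (quotQ τ (a ∷ l))
quotQ-Bd p q {l = []} [] = []
quotQ-Bd {τ} p q {l = b ∷ l} (d ∷ ds) = evalQ-Bd {τ} p q {b ∷ l} (d ∷ ds) ∷ quotQ-Bd {τ} p q {b} {l} ds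

ones : List ℚ → PS
ones [] = κ 0ℚ
ones (a ∷ l) = one ⊕ X ⊛ ones l

ringˢ₇₇ : ∀ c → κ 0ℚ ≈ c ⊛ κ 0ℚ ⊕ κ 0ℚ
ringˢ₇₇ = solveˢ 1 (λ c → con 0ℚ := c :* con 0ℚ :+ con 0ℚ)

ringᵠ₁₁₇ : ∀ a → c₈ + a ≡ a - (- c₈)
ringᵠ₁₁₇ = solveᵠ 1 λ a → con c₈ :+ a := a :- (:- con c₈)

ringˢ₇₈ : ∀ c a x o l → c ⊕ a ⊕ x ⊛ (c ⊛ o ⊕ l) ≈ c ⊛ (one ⊕ x ⊛ o) ⊕ (a ⊕ x ⊛ l)
ringˢ₇₈ = solveˢ 5 (λ c a x o l → c :+ a :+ x :* (c :* o :+ l) := c :* (con 1ℚ :+ x :* o) :+ (a :+ x :* l))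

NN-8+ : ∀ {l} → All (Bd c₈) l → NN (κ c₈ ⊛ ones l ⊕ seriesQ l)
NN-8+ [] = NN-≈ (ringˢ₇₇ (κ c₈)) (NN-κ ≤-refl)
NN-8+ {a ∷ l} ((lo , hi) ∷ bs) = NN-≈ (≈-trans (⊕-congʳ (X ⊛ (κ c₈ ⊛ ones l ⊕ seriesQ l)) (κ-+ c₈ a)) (ringˢ₇₈ (κ c₈) (κ a) X (ones l) (seriesQ l)))
  (NN-⊕ (NN-κ (by0≤ (ringᵠ₁₁₇ a) (≤⇒0≤- lo))) (NN-⊛ NN-X (NN-8+ bs)))

ringˢ₇₉ : ∀ c → κ 0ℚ ≈ c ⊛ κ 0ℚ ⊖ κ 0ℚ
ringˢ₇₉ = solveˢ 1 (λ c → con 0ℚ := c :* con 0ℚ :- con 0ℚ)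

ringˢ₈₀ : ∀ c a x o l → c ⊕ (⊝ a) ⊕ x ⊛ (c ⊛ o ⊖ l) ≈ c ⊛ (one ⊕ x ⊛ o) ⊖ (a ⊕ x ⊛ l)
ringˢ₈₀ = solveˢ 5 (λ c a x o l → c :+ (:- a) :+ x :* (c :* o :- l) := c :* (con 1ℚ :+ x :* o) :- (a :+ x :* l))

NN-8- : ∀ {l} → All (Bd c₈) l → NN (κ c₈ ⊛ ones l ⊖ seriesQ l)
NN-8- [] = NN-≈ (ringˢ₇₉ (κ c₈)) (NN-κ ≤-refl)
NN-8- {a ∷ l} ((lo , hi) ∷ bs) = NN-≈ (≈-trans (⊕-congʳ (X ⊛ (κ c₈ ⊛ ones l ⊖ seriesQ l)) (≈-trans (κ-+ c₈ (- a)) (⊕-congˡ (κ c₈) (mk≈ λ { zero → refl ; (suc n) → refl })))) (ringˢ₈₀ (κ c₈) (κ a) X (ones l) (seriesQ l)))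
  (NN-⊕ (NN-κ (≤⇒0≤- hi)) (NN-⊛ NN-X (NN-8- bs)))

fL : ℚ → List ℚ
fL r = r ∷ pos 12 / 1 * r - 1ℚ ∷ pos 66 / 1 * r ∷ pos 220 / 1 * r + pos 3 / 1 ∷ pos 495 / 1 * r ∷ pos 792 / 1 * r - 2ℚ ∷ pos 924 / 1 * r
  ∷ pos 792 / 1 * r - 2ℚ ∷ pos 495 / 1 * r ∷ pos 220 / 1 * r + pos 3 / 1 ∷ pos 66 / 1 * r ∷ pos 12 / 1 * r - 1ℚ ∷ r ∷ []

κ-lin : ∀ a b r → κ (a * r + b) ≈ κ a ⊛ κ r ⊕ κ b
κ-lin a b r = ≈-trans (κ-+ (a * r) b) (⊕-congʳ (κ b) (κ-* a r))

infixr 5 _∷≈_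
_∷≈_ : ∀ {a b f g} → a ≈ b → f ≈ g → a ⊕ X ⊛ f ≈ b ⊕ X ⊛ g
p ∷≈ q = +-congˢ p (congˡ X q)

fˢ≈ : ∀ r → fˢ r ≈ seriesQ (fL r)
fˢ≈ r = ≈-trans (l X (κ r)) (≈-sym (
  ≈-refl {κ r} ∷≈ κ-lin (pos 12 / 1) (- 1ℚ) r ∷≈ κ-* (pos 66 / 1) r ∷≈ κ-lin (pos 220 / 1) (pos 3 / 1) r ∷≈ κ-* (pos 495 / 1) r ∷≈ κ-lin (pos 792 / 1) (- 2ℚ) r ∷≈ κ-* (pos 924 / 1) r
  ∷≈ κ-lin (pos 792 / 1) (- 2ℚ) r ∷≈ κ-* (pos 495 / 1) r ∷≈ κ-lin (pos 220 / 1) (pos 3 / 1) r ∷≈ κ-* (pos 66 / 1) r ∷≈ κ-lin (pos 12 / 1) (- 1ℚ) r ∷≈ ≈-refl {κ r} ∷≈ ≈-refl {κ 0ℚ}))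
  where
  l : ∀ x r → r ⊛ (one ⊕ x) ^ˢ 12 ⊖ x ⊛ ((one ⊕ x ⊛ x) ⊛ ((one ⊖ x ⊛ x) ⊛ (one ⊖ x ⊛ x) ⊛ (one ⊖ x ⊛ x) ⊛ (one ⊖ x ⊛ x))) ≈
    r ⊕ x ⊛ ((κ (pos 12 / 1) ⊛ r ⊕ κ (- 1ℚ)) ⊕ x ⊛ (κ (pos 66 / 1) ⊛ r ⊕ x ⊛ ((κ (pos 220 / 1) ⊛ r ⊕ κ (pos 3 / 1)) ⊕ x ⊛ (κ (pos 495 / 1) ⊛ r ⊕ x ⊛ ((κ (pos 792 / 1) ⊛ r ⊕ κ (- 2ℚ)) ⊕ x ⊛ (κ (pos 924 / 1) ⊛ r
      ⊕ x ⊛ ((κ (pos 792 / 1) ⊛ r ⊕ κ (- 2ℚ)) ⊕ x ⊛ (κ (pos 495 / 1) ⊛ r ⊕ x ⊛ ((κ (pos 220 / 1) ⊛ r ⊕ κ (pos 3 / 1)) ⊕ x ⊛ (κ (pos 66 / 1) ⊛ r ⊕ x ⊛ ((κ (pos 12 / 1) ⊛ r ⊕ κ (- 1ℚ)) ⊕ x ⊛ (r ⊕ x ⊛ κ 0ℚ))))))))))))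
  l = solveˢ 2 (λ x r → let o = con 1ℚ ; t = o :+ x ; u = o :- x :* x in
    r :* (t :* (t :* (t :* (t :* (t :* (t :* (t :* (t :* (t :* (t :* (t :* (t :* o)))))))))))) :- x :* ((o :+ x :* x) :* (u :* u :* u :* u)) :=
    r :+ x :* ((con (pos 12 / 1) :* r :+ con (- 1ℚ)) :+ x :* (con (pos 66 / 1) :* r :+ x :* ((con (pos 220 / 1) :* r :+ con (pos 3 / 1)) :+ x :* (con (pos 495 / 1) :* r :+ x :* ((con (pos 792 / 1) :* r :+ con (- 2ℚ)) :+ x :* (con (pos 924 / 1) :* r
      :+ x :* ((con (pos 792 / 1) :* r :+ con (- 2ℚ)) :+ x :* (con (pos 495 / 1) :* r :+ x :* ((con (pos 220 / 1) :* r :+ con (pos 3 / 1)) :+ x :* (con (pos 66 / 1) :* r :+ x :* ((con (pos 12 / 1) :* r :+ con (- 1ℚ)) :+ x :* (r :+ x :* con 0ℚ)))))))))))))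

κ-neg : ∀ c → ⊝ κ c ≈ κ (- c)
κ-neg c = mk≈ λ { zero → refl ; (suc n) → refl }

ringᵠ₁₁₈ : ∀ a r b → a * r + b - b ≡ a * r
ringᵠ₁₁₈ = solveᵠ 3 λ a r b → a :* r :+ b :- b := a :* r

fL-Bd : ∀ {r} → 0ℚ ≤ r → r ≤ pos 1 / 120 → ∀ a b →
  True (- c₇ ≤? b) → True (b ≤? c₇) → True (a * (pos 1 / 120) + b ≤? c₇) → True (0ℚ ≤? a) → Bd c₇ (a * r + b)
fL-Bd {r} p q a b lo hi' hi na =
    ≤-trans { - c₇} {b} (toWitness lo) (by≤ {a = b} {b = a * r + b} (ringᵠ₁₁₈ a r b) (0≤* {a} {r} (toWitness na) p))
  , ≤-trans {a * r + b} {a * (pos 1 / 120) + b} (+-mono-≤ {a * r} {a * (pos 1 / 120)} {b} {b} (*-monoˡ {r} {pos 1 / 120} {a} (toWitness na) q) ≤-refl) (toWitness hi)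

fL-Bd₀ : ∀ {r} → 0ℚ ≤ r → r ≤ pos 1 / 120 → ∀ a → True (a * (pos 1 / 120) ≤? c₇) → True (0ℚ ≤? a) → Bd c₇ (a * r)
fL-Bd₀ {r} p q a hi na =
    ≤-trans { - c₇} {0ℚ} lit≤ (0≤* {a} {r} (toWitness na) p)
  , ≤-trans {a * r} {a * (pos 1 / 120)} (*-monoˡ {r} {pos 1 / 120} {a} (toWitness na) q) (toWitness hi)

fL-tail-Bd : ∀ {r} → 0ℚ ≤ r → r ≤ pos 1 / 120 → All (Bd c₇)
  (pos 66 / 1 * r ∷ pos 220 / 1 * r + pos 3 / 1 ∷ pos 495 / 1 * r ∷ pos 792 / 1 * r - 2ℚ ∷ pos 924 / 1 * r
  ∷ pos 792 / 1 * r - 2ℚ ∷ pos 495 / 1 * r ∷ pos 220 / 1 * r + pos 3 / 1 ∷ pos 66 / 1 * r ∷ pos 12 / 1 * r - 1ℚ ∷ r ∷ [])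
fL-tail-Bd {r} p q = fL-Bd₀ p q (pos 66 / 1) tt tt ∷ fL-Bd p q (pos 220 / 1) (pos 3 / 1) tt tt tt tt ∷ fL-Bd₀ p q (pos 495 / 1) tt tt ∷ fL-Bd p q (pos 792 / 1) (- 2ℚ) tt tt tt tt ∷ fL-Bd₀ p q (pos 924 / 1) tt tt
  ∷ fL-Bd p q (pos 792 / 1) (- 2ℚ) tt tt tt tt ∷ fL-Bd₀ p q (pos 495 / 1) tt tt ∷ fL-Bd p q (pos 220 / 1) (pos 3 / 1) tt tt tt tt ∷ fL-Bd₀ p q (pos 66 / 1) tt tt ∷ fL-Bd p q (pos 12 / 1) (- 1ℚ) tt tt tt tt
  ∷ (≤-trans { - c₇} {0ℚ} lit≤ p , ≤-trans {r} {pos 1 / 120} q lit≤) ∷ []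

NN-⊛-upto : ∀ e {f g} → (∀ j → j ℕ.≤ e → 0ℚ ≤ f j) → NN g → 0ℚ ≤ (f ⊛ g) e
NN-⊛-upto zero p q = 0≤* (p 0 z≤n) (q 0)
NN-⊛-upto (suc e) {f} {g} p q = 0≤+ (0≤* (p 0 z≤n) (q (suc e))) (NN-⊛-upto e {tail f} {g} (λ j le → p (suc j) (s≤s le)) q)

ringˢ₈₁ : ∀ s → κ 0ℚ ⊕ (⊝ (κ 2ℚ ⊛ s ⊛ s ⊕ s ⊛ (κ 2ℚ ⊛ s))) ≈ ⊝ (κ (pos 4 / 1) ⊛ (s ⊛ s))
ringˢ₈₁ = solveˢ 1 (λ s → con 0ℚ :+ (:- (con 2ℚ :* s :* s :+ s :* (con 2ℚ :* s))) := :- (con (pos 4 / 1) :* (s :* s)))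

θ-1-s² : θ (one ⊖ s ⊛ s) ≈ ⊝ (κ (pos 4 / 1) ⊛ (s ⊛ s))
θ-1-s² = ≈-trans (θ-⊕ one (⊝ (s ⊛ s))) (≈-trans (+-congˢ (θ-κ 1ℚ) (≈-trans (θ-⊝ (s ⊛ s)) (PSR.-‿cong (≈-trans (θ-⊛ s s) (+-congˢ (congʳ s θ-s) (congˡ s θ-s)))))) (ringˢ₈₁ s))

ringˢ₈₂ : ∀ c → c ⊛ κ 0ℚ ≈ κ 0ℚ
ringˢ₈₂ = solveˢ 1 (λ c → c :* con 0ℚ := con 0ℚ)

LD-κ : ∀ c → LD (κ c) (κ 0ℚ)
LD-κ c = ≈-trans (θ-κ c) (≈-sym (ringˢ₈₂ (κ c)))

-- `w₁` scales the exact derivative that `Tail` adds; the factor 1 - t⁴ in `v₁` clears the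
-- denominator of `L`, leaving `ℓ`.
w₁ v₁ U TK ℓ : PS
w₁ = κ (pos 80 / 1) ⊛ T ^ˢ 42
v₁ = (one ⊖ s ⊛ s) ⊛ w₁
U = evalˢ Uₑ
TK = T ^ˢ 31
ℓ = κ (pos 6 / 1) ⊛ s ⊕ κ (pos 10 / 1) ⊛ (s ⊛ s)

ringˢ₈₃ : ∀ t a s w b x i → t ⊛ ((⊝ (a ⊛ (s ⊛ s))) ⊛ w ⊕ (one ⊖ s ⊛ s) ⊛ (w ⊛ (κ 0ℚ ⊕ b ⊛ (x ⊛ i)))) ≈ (one ⊖ s ⊛ s) ⊛ (b ⊛ (x ⊛ w)) ⊛ (t ⊛ i) ⊖ a ⊛ (s ⊛ s) ⊛ (t ⊛ w)
ringˢ₈₃ = solveˢ 7 (λ t a s w b x i → t :* ((:- (a :* (s :* s))) :* w :+ (con 1ℚ :- s :* s) :* (w :* (con 0ℚ :+ b :* (x :* i)))) := (con 1ℚ :- s :* s) :* (b :* (x :* w)) :* (t :* i) :- a :* (s :* s) :* (t :* w))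

Tθv₁ : T ⊛ θ v₁ ≈ (one ⊖ s ⊛ s) ⊛ (κ (pos 42 / 1) ⊛ (X ⊛ w₁)) ⊖ κ (pos 4 / 1) ⊛ (s ⊛ s) ⊛ (T ⊛ w₁)
Tθv₁ = begin
  T ⊛ θ v₁ ≈⟨ congˡ T (θ-⊛ (one ⊖ s ⊛ s) w₁) ⟩
  T ⊛ (θ (one ⊖ s ⊛ s) ⊛ w₁ ⊕ (one ⊖ s ⊛ s) ⊛ θ w₁) ≈⟨ congˡ T (+-congˢ (congʳ w₁ θ-1-s²) (congˡ (one ⊖ s ⊛ s) (LD-⊛ (LD-κ (pos 80 / 1)) (LD-^ 42 LD-T)))) ⟩
  T ⊛ ((⊝ (κ (pos 4 / 1) ⊛ (s ⊛ s))) ⊛ w₁ ⊕ (one ⊖ s ⊛ s) ⊛ (w₁ ⊛ (κ 0ℚ ⊕ κ (ι 42) ⊛ (X ⊛ Ti)))) ≈⟨ ringˢ₈₃ T (κ (pos 4 / 1)) s w₁ (κ (ι 42)) X Ti ⟩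
  (one ⊖ s ⊛ s) ⊛ (κ (ι 42) ⊛ (X ⊛ w₁)) ⊛ (T ⊛ Ti) ⊖ κ (pos 4 / 1) ⊛ (s ⊛ s) ⊛ (T ⊛ w₁)
    ≈⟨ ⊕-congʳ (⊝ (κ (pos 4 / 1) ⊛ (s ⊛ s) ⊛ (T ⊛ w₁))) (≈-trans (congˡ ((one ⊖ s ⊛ s) ⊛ (κ (ι 42) ⊛ (X ⊛ w₁))) T⊛Ti) (idʳ ((one ⊖ s ⊛ s) ⊛ (κ (ι 42) ⊛ (X ⊛ w₁))))) ⟩
  (one ⊖ s ⊛ s) ⊛ (κ (pos 42 / 1) ⊛ (X ⊛ w₁)) ⊖ κ (pos 4 / 1) ⊛ (s ⊛ s) ⊛ (T ⊛ w₁) ∎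
  where
  open ≈-Reasoning

g₀ : ℚ → ℚ → ℚ
g₀ r τ = - evalQ (Data.List.drop 1 (fL r)) τ

gT : ℚ → ℚ → List ℚ
gT r τ = quotQ τ (Data.List.drop 1 (fL r))

h₁ˢ : ℚ → ℚ → PS
h₁ˢ r τ = ⊝ (X ⊛ seriesQ (gT r τ))

ringᵠ₁₁₉ : ∀ r τ → r + τ * ((pos 12 / 1 * r - 1ℚ) + τ * (pos 66 / 1 * r + τ * ((pos 220 / 1 * r + pos 3 / 1) + τ * (pos 495 / 1 * r + τ * ((pos 792 / 1 * r - 2ℚ) + τ * (pos 924 / 1 * r + τ * ((pos 792 / 1 * r - 2ℚ) + τ * (pos 495 / 1 * r + τ * ((pos 220 / 1 * r + pos 3 / 1) + τ * (pos 66 / 1 * r + τ * ((pos 12 / 1 * r - 1ℚ) + τ * (r + τ * (0ℚ))))))))))))) ≡ r * ((1ℚ + τ) * ((1ℚ + τ) * ((1ℚ + τ) * ((1ℚ + τ) * ((1ℚ + τ) * ((1ℚ + τ) * ((1ℚ + τ) * ((1ℚ + τ) * ((1ℚ + τ) * ((1ℚ + τ) * ((1ℚ + τ) * ((1ℚ + τ) * (1ℚ))))))))))))) - τ * (1ℚ + τ * τ) * ((1ℚ - τ * τ) * ((1ℚ - τ * τ) * ((1ℚ - τ * τ) * ((1ℚ - τ * τ) * (1ℚ)))))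
ringᵠ₁₁₉ = solveᵠ 2 λ r τ → r :+ τ :* (con (pos 12 / 1) :* r :- con 1ℚ :+ τ :* (con (pos 66 / 1) :* r :+ τ :* (con (pos 220 / 1) :* r :+ con (pos 3 / 1) :+ τ :* (con (pos 495 / 1) :* r :+ τ :* (con (pos 792 / 1) :* r :- con 2ℚ :+ τ :* (con (pos 924 / 1) :* r :+ τ :* (con (pos 792 / 1) :* r :- con 2ℚ :+ τ :* (con (pos 495 / 1) :* r :+ τ :* (con (pos 220 / 1) :* r :+ con (pos 3 / 1) :+ τ :* (con (pos 66 / 1) :* r :+ τ :* (con (pos 12 / 1) :* r :- con 1ℚ :+ τ :* (r :+ τ :* con 0ℚ)))))))))))) := r :* ((con 1ℚ :+ τ) :* ((con 1ℚ :+ τ) :* ((con 1ℚ :+ τ) :* ((con 1ℚ :+ τ) :* ((con 1ℚ :+ τ) :* ((con 1ℚ :+ τ) :* ((con 1ℚ :+ τ) :* ((con 1ℚ :+ τ) :* ((con 1ℚ :+ τ) :* ((con 1ℚ :+ τ) :* ((con 1ℚ :+ τ) :* ((con 1ℚ :+ τ) :* con 1ℚ)))))))))))) :- τ :* (con 1ℚ :+ τ :* τ) :* ((con 1ℚ :- τ :* τ) :* ((con 1ℚ :- τ :* τ) :* ((con 1ℚ :- τ :* τ) :* ((con 1ℚ :- τ :* τ) :* con 1ℚ))))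

root-eq : ∀ r τ → evalQ (fL r) τ ≡ r * (1ℚ + τ) ^ 12 - τ * (1ℚ + τ * τ) * (1ℚ - τ * τ) ^ 4
root-eq r τ = ringᵠ₁₁₉ r τ

ringˢ₈₄ : ∀ x t c y → κ 0ℚ ⊕ (x ⊖ t) ⊛ (c ⊕ y) ≈ (t ⊖ x) ⊛ ((⊝ c) ⊕ (⊝ y))
ringˢ₈₄ = solveˢ 4 (λ x t c y → con 0ℚ :+ (x :- t) :* (c :+ y) := (t :- x) :* ((:- c) :+ (:- y)))

-- Oriented as τ - t, so that the constant term `g₀` of the cofactor is positive, close to 1.
fˢ-factor : ∀ r τ → r * (1ℚ + τ) ^ 12 ≡ τ * (1ℚ + τ * τ) * (1ℚ - τ * τ) ^ 4 → fˢ r ≈ (κ τ ⊖ X) ⊛ (κ (g₀ r τ) ⊕ h₁ˢ r τ)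
fˢ-factor r τ e = begin
  fˢ r ≈⟨ ≈-trans (fˢ≈ r) (quotQ-eq τ (fL r)) ⟩
  κ (evalQ (fL r) τ) ⊕ (X ⊖ κ τ) ⊛ (κ c ⊕ X ⊛ seriesQ (gT r τ))
    ≈⟨ ⊕-congʳ ((X ⊖ κ τ) ⊛ (κ c ⊕ X ⊛ seriesQ (gT r τ))) (κ-cong (trans (root-eq r τ) (trans (cong (_- τ * (1ℚ + τ * τ) * (1ℚ - τ * τ) ^ 4) e) (ℚₚ.+-inverseʳ (τ * (1ℚ + τ * τ) * (1ℚ - τ * τ) ^ 4))))) ⟩
  κ 0ℚ ⊕ (X ⊖ κ τ) ⊛ (κ c ⊕ X ⊛ seriesQ (gT r τ)) ≈⟨ ringˢ₈₄ X (κ τ) (κ c) (X ⊛ seriesQ (gT r τ)) ⟩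
  (κ τ ⊖ X) ⊛ ((⊝ κ c) ⊕ h₁ˢ r τ) ≈⟨ congˡ (κ τ ⊖ X) (⊕-congʳ (h₁ˢ r τ) (κ-neg c)) ⟩
  (κ τ ⊖ X) ⊛ (κ (g₀ r τ) ⊕ h₁ˢ r τ) ∎
  where
  open ≈-Reasoning
  c : ℚ
  c = evalQ (Data.List.drop 1 (fL r)) τ

U≈ : ∀ r τ → U ≈ X ⊛ ones (gT r τ)
U≈ r τ = l X
  where
  l : ∀ x → x ⊛ (one ⊕ x ⊛ (one ⊕ x ⊛ (one ⊕ x ⊛ (one ⊕ x ⊛ (one ⊕ x ⊛ (one ⊕ x ⊛ (one ⊕ x ⊛ (one ⊕ x ⊛ (one ⊕ x ⊛ (one ⊕ x))))))))))
    ≈ x ⊛ (one ⊕ x ⊛ (one ⊕ x ⊛ (one ⊕ x ⊛ (one ⊕ x ⊛ (one ⊕ x ⊛ (one ⊕ x ⊛ (one ⊕ x ⊛ (one ⊕ x ⊛ (one ⊕ x ⊛ (one ⊕ x ⊛ (one ⊕ x ⊛ κ 0ℚ)))))))))))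
  l = solveˢ 1 (λ x → let o = con 1ℚ in x :* (o :+ x :* (o :+ x :* (o :+ x :* (o :+ x :* (o :+ x :* (o :+ x :* (o :+ x :* (o :+ x :* (o :+ x :* (o :+ x))))))))))
    := x :* (o :+ x :* (o :+ x :* (o :+ x :* (o :+ x :* (o :+ x :* (o :+ x :* (o :+ x :* (o :+ x :* (o :+ x :* (o :+ x :* (o :+ x :* con 0ℚ))))))))))))

ringˢ₈₅ : ∀ c x o q → x ⊛ (c ⊛ o ⊖ q) ≈ c ⊛ (x ⊛ o) ⊕ (⊝ (x ⊛ q))
ringˢ₈₅ = solveˢ 4 (λ c x o q → x :* (c :* o :- q) := c :* (x :* o) :+ (:- (x :* q)))

ringˢ₈₆ : ∀ c x o q → x ⊛ (c ⊛ o ⊕ q) ≈ c ⊛ (x ⊛ o) ⊕ (⊝ (⊝ (x ⊛ q)))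
ringˢ₈₆ = solveˢ 4 (λ c x o q → x :* (c :* o :+ q) := c :* (x :* o) :+ (:- (:- (x :* q))))

ringᵠ₁₂₀ : ∀ r t → - (pos 12 / 1 * r - 1ℚ + t) - pos 4 / 5 ≡ pos 1 / 30 + pos 12 / 1 * (pos 1 / 120 - r) + (pos 1 / 15 - t)
ringᵠ₁₂₀ = solveᵠ 2 λ r t → (:- (con (pos 12 / 1) :* r :- con 1ℚ :+ t)) :- con (pos 4 / 5) := con (pos 1 / 30) :+ con (pos 12 / 1) :* (con (pos 1 / 120) :- r) :+ (con (pos 1 / 15) :- t)

ringᵠ₁₂₁ : ∀ r t → pos 11 / 10 - (- (pos 12 / 1 * r - 1ℚ + t)) ≡ pos 1 / 30 + pos 12 / 1 * r + (t - (- (pos 1 / 15)))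
ringᵠ₁₂₁ = solveᵠ 2 λ r t → con (pos 11 / 10) :- (:- (con (pos 12 / 1) :* r :- con 1ℚ :+ t)) := con (pos 1 / 30) :+ con (pos 12 / 1) :* r :+ (t :- (:- con (pos 1 / 15)))

module _ (r τ : ℚ) (r≥0 : 0ℚ ≤ r) (r≤ : r ≤ pos 1 / 120) (τ≥0 : 0ℚ ≤ τ) (τ≤ : τ ≤ pos 1 / 120) where

  gT-Bd : All (Bd c₈) (gT r τ)
  gT-Bd = quotQ-Bd {τ} τ≥0 τ≤ {a = pos 12 / 1 * r - 1ℚ} (fL-tail-Bd r≥0 r≤)

  NN-8U+h : NN (κ c₈ ⊛ U ⊕ h₁ˢ r τ)
  NN-8U+h = NN-≈ (≈-trans (ringˢ₈₅ (κ c₈) X (ones (gT r τ)) (seriesQ (gT r τ))) (⊕-congʳ (h₁ˢ r τ) (congˡ (κ c₈) (≈-sym (U≈ r τ))))) (NN-⊛ NN-X (NN-8- gT-Bd))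

  NN-8U-h : NN (κ c₈ ⊛ U ⊖ h₁ˢ r τ)
  NN-8U-h = NN-≈ (≈-trans (ringˢ₈₆ (κ c₈) X (ones (gT r τ)) (seriesQ (gT r τ))) (⊕-congʳ (⊝ h₁ˢ r τ) (congˡ (κ c₈) (≈-sym (U≈ r τ))))) (NN-⊛ NN-X (NN-8+ gT-Bd))

  private
    rest : Bd (pos 1 / 15) (τ * evalQ (Data.List.drop 2 (fL r)) τ)
    rest = Bd-τ {τ} {evalQ (Data.List.drop 2 (fL r)) τ} τ≥0 τ≤ (evalQ-Bd {τ} τ≥0 τ≤ (fL-tail-Bd r≥0 r≤))

  g₀≥ : pos 4 / 5 ≤ g₀ r τ
  g₀≥ = by≤ (ringᵠ₁₂₀ r (τ * evalQ (Data.List.drop 2 (fL r)) τ)) (0≤+ (0≤+ (lit≤ {0ℚ} {pos 1 / 30}) (0≤* {pos 12 / 1} {pos 1 / 120 - r} lit≤ (≤⇒0≤- r≤))) (≤⇒0≤- (proj₂ rest)))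

  g₀≤ : g₀ r τ ≤ pos 11 / 10
  g₀≤ = by≤ (ringᵠ₁₂₁ r (τ * evalQ (Data.List.drop 2 (fL r)) τ)) (0≤+ (0≤+ (lit≤ {0ℚ} {pos 1 / 30}) (0≤* {pos 12 / 1} {r} lit≤ r≥0)) (≤⇒0≤- (proj₁ rest)))

-- Nonnegativity of Φ k for k close to J

ringˢ₈₇ : ∀ a b x c t s w → (a ⊖ x) ⊛ c ⊖ t ⊛ (x ⊛ ((one ⊖ s ⊛ s) ⊛ w)) ≈ (b ⊖ x) ⊛ c ⊕ ((a ⊖ b) ⊛ c ⊖ (t ⊛ x) ⊛ w ⊕ (t ⊛ x) ⊛ (s ⊛ s ⊛ w))
ringˢ₈₇ = solveˢ 7 (λ a b x c t s w → (a :- x) :* c :- t :* (x :* ((con 1ℚ :- s :* s) :* w)) := (b :- x) :* c :+ ((a :- b) :* c :- (t :* x) :* w :+ (t :* x) :* (s :* s :* w)))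

ringˢ₈₈ : ∀ a d p m w → a ⊛ (d ⊕ p ⊛ m ⊛ w) ⊖ m ⊛ w ≈ a ⊛ d ⊕ (a ⊛ p ⊖ one) ⊛ (m ⊛ w)
ringˢ₈₈ = solveˢ 5 (λ a d p m w → a :* (d :+ p :* m :* w) :- m :* w := a :* d :+ (a :* p :- con 1ℚ) :* (m :* w))

ringˢ₈₉ : ∀ h e w t k → h ⊛ (e ⊛ w ⊕ t ⊖ k ⊛ w) ≈ (h ⊛ e) ⊛ w ⊕ h ⊛ t ⊖ k ⊛ (h ⊛ w)
ringˢ₈₉ = solveˢ 5 (λ h e w t k → h :* (e :* w :+ t :- k :* w) := (h :* e) :* w :+ h :* t :- k :* (h :* w))

ringˢ₉₀ : ∀ x → κ 0ℚ ⊕ (⊝ x) ≈ ⊝ x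
ringˢ₉₀ = solveˢ 1 (λ x → con 0ℚ :+ (:- x) := :- x)

ringˢ₉₁ : ∀ l a b c d e f → l ⊛ a ⊕ l ⊛ b ⊕ l ⊛ c ⊕ l ⊛ d ⊖ l ⊛ e ⊖ f ≈ l ⊛ (a ⊕ (b ⊕ c ⊖ e ⊕ d)) ⊖ f
ringˢ₉₁ = solveˢ 7 (λ l a b c d e f → l :* a :+ l :* b :+ l :* c :+ l :* d :- l :* e :- f := l :* (a :+ (b :+ c :- e :+ d)) :- f)

ringˢ₉₂ : ∀ t y a x c r → (t ⊛ y) ⊛ ((a ⊖ x) ⊛ c ⊕ r) ≈ (((a ⊕ κ (- 1ℚ) ⊛ x) ⊛ t) ⊛ y) ⊛ c ⊕ (t ⊛ y) ⊛ r
ringˢ₉₂ = solveˢ 6 (λ t y a x c r → (t :* y) :* ((a :- x) :* c :+ r) := (((a :+ con (- 1ℚ) :* x) :* t) :* y) :* c :+ (t :* y) :* r)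

-- Here kT - nX is k - d t, in practice with d near 11 k. It is negative just above t = 1/11, so no
-- power of 1 + t makes it coefficientwise nonnegative. The remedy is to add the derivative of
-- T^(B+1) R^(J+1) (τ₁ - t) v₁, corrected so that its coefficient of index e vanishes: through `L`
-- it brings in a multiple of k (6t² + 10t⁴).
module Tail (n J B k e d : ℕ) (r τ₀ τ₂ τ₁ : ℚ)
  (eJ : suc J ≡ k ℕ.+ e) (en : n ≡ k ℕ.+ d)
  (r≥0 : 0ℚ ≤ r) (r≤ : r ≤ pos 1 / 120) (τ₀>0 : 0ℚ < τ₀) (τ₀≤τ₂ : τ₀ ≤ τ₂) (τ₂≤τ₁ : τ₂ ≤ τ₁) (τ₁≤ : τ₁ ≤ pos 1 / 120)
  (root : r * (1ℚ + τ₁) ^ 12 ≡ τ₁ * (1ℚ + τ₁ * τ₁) * (1ℚ - τ₁ * τ₁) ^ 4)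
  (hB : (τ₂ + τ₀) * (1ℚ - τ₀) ^ B ≤ (τ₂ - τ₀) * (1ℚ + τ₀) ^ B)
  (ratio : ∀ i → suc i ℕ.+ suc i ℕ.≤ e → Ev (R ^ˢ suc J) i ≤ τ₀ * τ₀ * Ev (R ^ˢ suc J) (suc i))
  (hd : ι d ≤ pos 12 / 1 * ι k)
  (κ′ : ℚ) (κ′≡ : ι k ≡ pos 1000 / 1 * κ′)
  (he : ι e ≤ κ′) (hb : ι (suc B) ≤ κ′) (h1 : 1ℚ ≤ κ′) (hτ : 1ℚ ≤ (τ₁ - τ₂) * κ′)
  where

  private
    τ₁≥0 : 0ℚ ≤ τ₁
    τ₁≥0 = ≤-trans (<⇒≤ τ₀>0) (≤-trans τ₀≤τ₂ τ₂≤τ₁)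
    Y K N N' E b D₁₂ κp g₀ˢ h : PS
    Y = R ^ˢ suc J
    K = κ (ι k)
    N = κ (ι d)
    N' = κ (ι (suc J))
    E = κ (ι e)
    b = κ (ι (suc B))
    κp = κ κ′
    g₀ˢ = κ (g₀ r τ₁)
    h = h₁ˢ r τ₁
    D₁₂ = κ (pos 12 / 1 * ι k - ι d)

    lin₁ : PS
    lin₁ = κ τ₁ ⊖ X

    -- The common cofactor once T^B R^(J+1) (τ₁ - t) is taken out. Differentiating τ₁ - t itself
    -- leaves the separate term -t T v₁.
    C : PS
    C = TK ⊛ ((K ⊛ T ⊖ κ (ι n) ⊛ X) ⊛ (g₀ˢ ⊕ h)) ⊕ (b ⊛ (X ⊛ v₁) ⊕ N' ⊛ (T ⊛ (ℓ ⊛ w₁)) ⊖ E ⊛ (T ⊛ v₁) ⊕ T ⊛ θ v₁)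

    K≈ : K ≈ κ (pos 1000 / 1) ⊛ κp
    K≈ = ≈-trans (κ-cong κ′≡) (κ-* (pos 1000 / 1) κ′)

    N'≈ : N' ≈ K ⊕ E
    N'≈ = ≈-trans (κ-cong (trans (cong ι eJ) (ι-+ k e))) (κ-+ (ι k) (ι e))

    κn≈ : κ (ι n) ≈ K ⊕ N
    κn≈ = ≈-trans (κ-cong (trans (cong ι en) (ι-+ k d))) (κ-+ (ι k) (ι d))

    -- C minus a multiple of T X w₁ is a nonnegative combination plus the fixed polynomial Cmin
    partA : TK ⊛ ((K ⊛ T ⊖ κ (ι n) ⊛ X) ⊛ (g₀ˢ ⊕ h)) ≈
      TK ⊛ (K ⊛ κ (g₀ r τ₁ - pos 4 / 5) ⊕ K ⊛ (κ c₈ ⊛ U ⊕ h) ⊕ N ⊛ X ⊛ (κ c₈ ⊛ U ⊖ h) ⊕ D₁₂ ⊛ X ⊛ (g₀ˢ ⊕ κ c₈ ⊛ U) ⊕ κ (pos 12 / 1) ⊛ K ⊛ κ (pos 11 / 10 - g₀ r τ₁) ⊛ X)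
      ⊕ κp ⊛ (TK ⊛ (κ (pos 800 / 1) ⊖ κ (pos 8000 / 1) ⊛ U ⊖ κ (pos 13200 / 1) ⊛ X ⊖ κ (pos 96000 / 1) ⊛ (X ⊛ U)))
    partA = begin
      TK ⊛ ((K ⊛ T ⊖ κ (ι n) ⊛ X) ⊛ (g₀ˢ ⊕ h)) ≈⟨ congˡ TK (congʳ (g₀ˢ ⊕ h) (⊕-congˡ (K ⊛ T) (PSR.-‿cong (congʳ X κn≈)))) ⟩
      TK ⊛ ((K ⊛ (one ⊕ X) ⊖ (K ⊕ N) ⊛ X) ⊛ (g₀ˢ ⊕ h)) ≈⟨ l₁ TK K N X g₀ˢ h U ⟩
      TK ⊛ (K ⊛ (g₀ˢ ⊖ κ (pos 4 / 5)) ⊕ K ⊛ (κ c₈ ⊛ U ⊕ h) ⊕ N ⊛ X ⊛ (κ c₈ ⊛ U ⊖ h) ⊕ (κ (pos 12 / 1) ⊛ K ⊖ N) ⊛ X ⊛ (g₀ˢ ⊕ κ c₈ ⊛ U) ⊕ κ (pos 12 / 1) ⊛ K ⊛ (κ (pos 11 / 10) ⊖ g₀ˢ) ⊛ X)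
        ⊕ K ⊛ (TK ⊛ (κ (pos 4 / 5) ⊖ κ c₈ ⊛ U ⊖ κ (pos 66 / 5) ⊛ X ⊖ κ (pos 96 / 1) ⊛ (X ⊛ U)))
        ≈⟨ +-congˢ (congˡ TK (+-congˢ (+-congˢ (⊕-congʳ (N ⊛ X ⊛ (κ c₈ ⊛ U ⊖ h)) (⊕-congʳ (K ⊛ (κ c₈ ⊛ U ⊕ h)) (congˡ K (κ-sub (g₀ r τ₁) (pos 4 / 5)))))
             (congʳ (g₀ˢ ⊕ κ c₈ ⊛ U) (congʳ X (≈-trans (⊕-congʳ (⊝ N) (≈-sym (κ-* (pos 12 / 1) (ι k)))) (κ-sub (pos 12 / 1 * ι k) (ι d))))))
             (congʳ X (congˡ (κ (pos 12 / 1) ⊛ K) (κ-sub (pos 11 / 10) (g₀ r τ₁))))))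
           (≈-trans (congʳ (TK ⊛ (κ (pos 4 / 5) ⊖ κ c₈ ⊛ U ⊖ κ (pos 66 / 5) ⊛ X ⊖ κ (pos 96 / 1) ⊛ (X ⊛ U))) K≈) (l₂ TK κp U X)) ⟩
      TK ⊛ (K ⊛ κ (g₀ r τ₁ - pos 4 / 5) ⊕ K ⊛ (κ c₈ ⊛ U ⊕ h) ⊕ N ⊛ X ⊛ (κ c₈ ⊛ U ⊖ h) ⊕ D₁₂ ⊛ X ⊛ (g₀ˢ ⊕ κ c₈ ⊛ U) ⊕ κ (pos 12 / 1) ⊛ K ⊛ κ (pos 11 / 10 - g₀ r τ₁) ⊛ X)
        ⊕ κp ⊛ (TK ⊛ (κ (pos 800 / 1) ⊖ κ (pos 8000 / 1) ⊛ U ⊖ κ (pos 13200 / 1) ⊛ X ⊖ κ (pos 96000 / 1) ⊛ (X ⊛ U))) ∎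
      where
      open ≈-Reasoning
      κ-sub : ∀ a b → κ a ⊖ κ b ≈ κ (a - b)
      κ-sub a b = ≈-trans (⊕-congˡ (κ a) (κ-neg b)) (≈-sym (κ-+ a (- b)))
      l₁ : ∀ t k n x g h u → t ⊛ ((k ⊛ (one ⊕ x) ⊖ (k ⊕ n) ⊛ x) ⊛ (g ⊕ h)) ≈
        t ⊛ (k ⊛ (g ⊖ κ (pos 4 / 5)) ⊕ k ⊛ (κ c₈ ⊛ u ⊕ h) ⊕ n ⊛ x ⊛ (κ c₈ ⊛ u ⊖ h) ⊕ (κ (pos 12 / 1) ⊛ k ⊖ n) ⊛ x ⊛ (g ⊕ κ c₈ ⊛ u) ⊕ κ (pos 12 / 1) ⊛ k ⊛ (κ (pos 11 / 10) ⊖ g) ⊛ x)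
        ⊕ k ⊛ (t ⊛ (κ (pos 4 / 5) ⊖ κ c₈ ⊛ u ⊖ κ (pos 66 / 5) ⊛ x ⊖ κ (pos 96 / 1) ⊛ (x ⊛ u)))
      l₁ = solveˢ 7 (λ t k n x g h u → t :* ((k :* (con 1ℚ :+ x) :- (k :+ n) :* x) :* (g :+ h)) :=
        t :* (k :* (g :- con (pos 4 / 5)) :+ k :* (con c₈ :* u :+ h) :+ n :* x :* (con c₈ :* u :- h) :+ (con (pos 12 / 1) :* k :- n) :* x :* (g :+ con c₈ :* u) :+ con (pos 12 / 1) :* k :* (con (pos 11 / 10) :- g) :* x)
        :+ k :* (t :* (con (pos 4 / 5) :- con c₈ :* u :- con (pos 66 / 5) :* x :- con (pos 96 / 1) :* (x :* u))))
      l₂ : ∀ t p u x → κ (pos 1000 / 1) ⊛ p ⊛ (t ⊛ (κ (pos 4 / 5) ⊖ κ c₈ ⊛ u ⊖ κ (pos 66 / 5) ⊛ x ⊖ κ (pos 96 / 1) ⊛ (x ⊛ u))) ≈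
        p ⊛ (t ⊛ (κ (pos 800 / 1) ⊖ κ (pos 8000 / 1) ⊛ u ⊖ κ (pos 13200 / 1) ⊛ x ⊖ κ (pos 96000 / 1) ⊛ (x ⊛ u)))
      l₂ = solveˢ 4 (λ t p u x → con (pos 1000 / 1) :* p :* (t :* (con (pos 4 / 5) :- con c₈ :* u :- con (pos 66 / 5) :* x :- con (pos 96 / 1) :* (x :* u))) :=
        p :* (t :* (con (pos 800 / 1) :- con (pos 8000 / 1) :* u :- con (pos 13200 / 1) :* x :- con (pos 96000 / 1) :* (x :* u))))

    s² 4T+ : PS
    s² = s ⊛ s
    4T+ = κ (pos 4 / 1) ⊛ T ⊕ κ (pos 42 / 1) ⊛ X

    partB : (b ⊛ (X ⊛ v₁) ⊕ N' ⊛ (T ⊛ (ℓ ⊛ w₁)) ⊖ E ⊛ (T ⊛ v₁) ⊕ T ⊛ θ v₁) ≈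
      (b ⊛ X ⊕ (κp ⊖ b) ⊛ X ⊛ s² ⊕ E ⊛ T ⊛ ℓ ⊕ (κp ⊖ E) ⊛ T ⊕ E ⊛ T ⊛ s² ⊕ κ (pos 42 / 1) ⊛ X ⊕ (κp ⊖ one) ⊛ 4T+ ⊛ s²) ⊛ w₁
      ⊕ (κp ⊛ (T ⊛ X) ⊛ w₁ ⊕ κp ⊛ ((T ⊛ (κ (pos 6000 / 1) ⊛ s ⊕ κ (pos 10000 / 1) ⊛ s²) ⊖ (X ⊛ s² ⊕ T ⊕ 4T+ ⊛ s² ⊕ T ⊛ X)) ⊛ w₁))
    partB = begin
      b ⊛ (X ⊛ v₁) ⊕ N' ⊛ (T ⊛ (ℓ ⊛ w₁)) ⊖ E ⊛ (T ⊛ v₁) ⊕ T ⊛ θ v₁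
        ≈⟨ +-congˢ (⊕-congʳ (⊝ (E ⊛ (T ⊛ v₁))) (⊕-congˡ (b ⊛ (X ⊛ v₁)) (congʳ (T ⊛ (ℓ ⊛ w₁)) (≈-trans N'≈ (⊕-congʳ E K≈))))) Tθv₁ ⟩
      b ⊛ (X ⊛ v₁) ⊕ (κ (pos 1000 / 1) ⊛ κp ⊕ E) ⊛ (T ⊛ (ℓ ⊛ w₁)) ⊖ E ⊛ (T ⊛ v₁) ⊕ ((one ⊖ s ⊛ s) ⊛ (κ (pos 42 / 1) ⊛ (X ⊛ w₁)) ⊖ κ (pos 4 / 1) ⊛ (s ⊛ s) ⊛ (T ⊛ w₁))
        ≈⟨ l b X s w₁ κp E T ⟩
      (b ⊛ X ⊕ (κp ⊖ b) ⊛ X ⊛ s² ⊕ E ⊛ T ⊛ ℓ ⊕ (κp ⊖ E) ⊛ T ⊕ E ⊛ T ⊛ s² ⊕ κ (pos 42 / 1) ⊛ X ⊕ (κp ⊖ one) ⊛ 4T+ ⊛ s²) ⊛ w₁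
      ⊕ (κp ⊛ (T ⊛ X) ⊛ w₁ ⊕ κp ⊛ ((T ⊛ (κ (pos 6000 / 1) ⊛ s ⊕ κ (pos 10000 / 1) ⊛ s²) ⊖ (X ⊛ s² ⊕ T ⊕ 4T+ ⊛ s² ⊕ T ⊛ X)) ⊛ w₁)) ∎
      where
      open ≈-Reasoning
      l : ∀ b x s w p e t →
        b ⊛ (x ⊛ ((one ⊖ s ⊛ s) ⊛ w)) ⊕ (κ (pos 1000 / 1) ⊛ p ⊕ e) ⊛ (t ⊛ ((κ (pos 6 / 1) ⊛ s ⊕ κ (pos 10 / 1) ⊛ (s ⊛ s)) ⊛ w)) ⊖ e ⊛ (t ⊛ ((one ⊖ s ⊛ s) ⊛ w)) ⊕ ((one ⊖ s ⊛ s) ⊛ (κ (pos 42 / 1) ⊛ (x ⊛ w)) ⊖ κ (pos 4 / 1) ⊛ (s ⊛ s) ⊛ (t ⊛ w)) ≈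
        (b ⊛ x ⊕ (p ⊖ b) ⊛ x ⊛ (s ⊛ s) ⊕ e ⊛ t ⊛ (κ (pos 6 / 1) ⊛ s ⊕ κ (pos 10 / 1) ⊛ (s ⊛ s)) ⊕ (p ⊖ e) ⊛ t ⊕ e ⊛ t ⊛ (s ⊛ s) ⊕ κ (pos 42 / 1) ⊛ x ⊕ (p ⊖ one) ⊛ (κ (pos 4 / 1) ⊛ t ⊕ κ (pos 42 / 1) ⊛ x) ⊛ (s ⊛ s)) ⊛ w
        ⊕ (p ⊛ (t ⊛ x) ⊛ w ⊕ p ⊛ ((t ⊛ (κ (pos 6000 / 1) ⊛ s ⊕ κ (pos 10000 / 1) ⊛ (s ⊛ s)) ⊖ (x ⊛ (s ⊛ s) ⊕ t ⊕ (κ (pos 4 / 1) ⊛ t ⊕ κ (pos 42 / 1) ⊛ x) ⊛ (s ⊛ s) ⊕ t ⊛ x)) ⊛ w))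
      l = solveˢ 7 (λ b x s w p e t → let o = con 1ℚ ; q = s :* s ; l = con (pos 6 / 1) :* s :+ con (pos 10 / 1) :* q ; f = con (pos 4 / 1) :* t :+ con (pos 42 / 1) :* x in
        b :* (x :* ((o :- q) :* w)) :+ (con (pos 1000 / 1) :* p :+ e) :* (t :* (l :* w)) :- e :* (t :* ((o :- q) :* w)) :+ ((o :- q) :* (con (pos 42 / 1) :* (x :* w)) :- con (pos 4 / 1) :* q :* (t :* w)) :=
        (b :* x :+ (p :- b) :* x :* q :+ e :* t :* l :+ (p :- e) :* t :+ e :* t :* q :+ con (pos 42 / 1) :* x :+ (p :- o) :* f :* q) :* w
        :+ (p :* (t :* x) :* w :+ p :* ((t :* (con (pos 6000 / 1) :* s :+ con (pos 10000 / 1) :* q) :- (x :* q :+ t :+ f :* q :+ t :* x)) :* w)))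

    nnA nnB D : PS
    nnA = TK ⊛ (K ⊛ κ (g₀ r τ₁ - pos 4 / 5) ⊕ K ⊛ (κ c₈ ⊛ U ⊕ h) ⊕ N ⊛ X ⊛ (κ c₈ ⊛ U ⊖ h) ⊕ D₁₂ ⊛ X ⊛ (g₀ˢ ⊕ κ c₈ ⊛ U) ⊕ κ (pos 12 / 1) ⊛ K ⊛ κ (pos 11 / 10 - g₀ r τ₁) ⊛ X)
    nnB = (b ⊛ X ⊕ (κp ⊖ b) ⊛ X ⊛ s² ⊕ E ⊛ T ⊛ ℓ ⊕ (κp ⊖ E) ⊛ T ⊕ E ⊛ T ⊛ s² ⊕ κ (pos 42 / 1) ⊛ X ⊕ (κp ⊖ one) ⊛ 4T+ ⊛ s²) ⊛ w₁
    D = nnA ⊕ nnB ⊕ κ (κ′ * (pos 1 / 5)) ⊛ evalˢ CminE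

    C≈ : C ≈ D ⊕ κp ⊛ (T ⊛ X) ⊛ w₁
    C≈ = ≈-trans (+-congˢ partA partB) (≈-trans (l nnA nnB κp TK U X w₁) (⊕-congʳ (κp ⊛ (T ⊛ X) ⊛ w₁) (⊕-congˡ (nnA ⊕ nnB) (congʳ (evalˢ CminE) (≈-sym (κ-* κ′ (pos 1 / 5)))))))
      where
      l : ∀ a b p t u x w →
        a ⊕ p ⊛ (t ⊛ (κ (pos 800 / 1) ⊖ κ (pos 8000 / 1) ⊛ u ⊖ κ (pos 13200 / 1) ⊛ x ⊖ κ (pos 96000 / 1) ⊛ (x ⊛ u)))
        ⊕ (b ⊕ (p ⊛ ((one ⊕ x) ⊛ x) ⊛ w ⊕ p ⊛ (((one ⊕ x) ⊛ (κ (pos 6000 / 1) ⊛ (x ⊛ x) ⊕ κ (pos 10000 / 1) ⊛ (x ⊛ x ⊛ (x ⊛ x))) ⊖ (x ⊛ (x ⊛ x ⊛ (x ⊛ x)) ⊕ (one ⊕ x) ⊕ (κ (pos 4 / 1) ⊛ (one ⊕ x) ⊕ κ (pos 42 / 1) ⊛ x) ⊛ (x ⊛ x ⊛ (x ⊛ x)) ⊕ (one ⊕ x) ⊛ x)) ⊛ w)))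
        ≈ a ⊕ b ⊕ p ⊛ κ (pos 1 / 5) ⊛ (t ⊛ (κ (pos 4000 / 1) ⊕ κ (- 1ℚ) ⊛ (κ (pos 40000 / 1) ⊛ u) ⊕ κ (- 1ℚ) ⊛ (κ (pos 66000 / 1) ⊛ x) ⊕ κ (- 1ℚ) ⊛ (κ (pos 480000 / 1) ⊛ (x ⊛ u)))
          ⊕ ((one ⊕ x) ⊛ (κ (pos 30000 / 1) ⊛ (x ⊛ x) ⊕ κ (pos 50000 / 1) ⊛ (x ⊛ x ⊛ (x ⊛ x)))
             ⊕ κ (- 1ℚ) ⊛ (κ (pos 5 / 1) ⊛ (x ⊛ (x ⊛ x ⊛ (x ⊛ x)) ⊕ (one ⊕ x) ⊕ (κ (pos 4 / 1) ⊛ (one ⊕ x) ⊕ κ (pos 42 / 1) ⊛ x) ⊛ (x ⊛ x ⊛ (x ⊛ x)) ⊕ (one ⊕ x) ⊛ x))) ⊛ w)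
        ⊕ p ⊛ ((one ⊕ x) ⊛ x) ⊛ w
      l = solveˢ 7 (λ a b p t u x w → let o = con 1ℚ ; q = x :* x :* (x :* x) ; z = o :+ x ; m = con (- 1ℚ) ; y = x :* q :+ z :+ (con (pos 4 / 1) :* z :+ con (pos 42 / 1) :* x) :* q :+ z :* x in
        a :+ p :* (t :* (con (pos 800 / 1) :- con (pos 8000 / 1) :* u :- con (pos 13200 / 1) :* x :- con (pos 96000 / 1) :* (x :* u)))
        :+ (b :+ (p :* (z :* x) :* w :+ p :* ((z :* (con (pos 6000 / 1) :* (x :* x) :+ con (pos 10000 / 1) :* q) :- y) :* w)))
        := a :+ b :+ p :* con (pos 1 / 5) :* (t :* (con (pos 4000 / 1) :+ m :* (con (pos 40000 / 1) :* u) :+ m :* (con (pos 66000 / 1) :* x) :+ m :* (con (pos 480000 / 1) :* (x :* u)))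
          :+ (z :* (con (pos 30000 / 1) :* (x :* x) :+ con (pos 50000 / 1) :* q) :+ m :* (con (pos 5 / 1) :* y)) :* w)
        :+ p :* (z :* x) :* w)

    NNK : ∀ i → NN (κ (ι i))
    NNK i = NN-κ (ι-nonneg i)

    κ′≥0 : 0ℚ ≤ κ′
    κ′≥0 = ≤-trans 0≤1 h1

    NN-w₁ : NN w₁
    NN-w₁ = NN-⊛ (NN-κ lit≤) (NN-^ 42 NN-T)

    NN-U : NN U
    NN-U = NN-evalˢ Uₑ

    NN-s² : NN s²
    NN-s² = NN-⊛ NN-s NN-s

    NN-ℓ : NN ℓ
    NN-ℓ = NN-⊕ (NN-⊛ (NN-κ lit≤) NN-s) (NN-⊛ (NN-κ lit≤) NN-s²)

    NN-sub : ∀ {a c} → a ≤ c → NN (κ c ⊖ κ a)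
    NN-sub {a} {c} p = NN-≈ (≈-trans (κ-+ c (- a)) (⊕-congˡ (κ c) (≈-sym (κ-neg a)))) (NN-κ (≤⇒0≤- p))

    g₀≥0 : 0ℚ ≤ g₀ r τ₁
    g₀≥0 = ≤-trans (lit≤ {0ℚ} {pos 4 / 5}) (g₀≥ r τ₁ r≥0 r≤ τ₁≥0 τ₁≤)

    NN-nnA : NN nnA
    NN-nnA = NN-⊛ (NN-^ 31 NN-T) (NN-⊕ (NN-⊕ (NN-⊕ (NN-⊕ (NN-⊛ (NNK k) (NN-κ (≤⇒0≤- (g₀≥ r τ₁ r≥0 r≤ τ₁≥0 τ₁≤)))) (NN-⊛ (NNK k) (NN-8U+h r τ₁ r≥0 r≤ τ₁≥0 τ₁≤)))
      (NN-⊛ (NN-⊛ (NNK d) NN-X) (NN-8U-h r τ₁ r≥0 r≤ τ₁≥0 τ₁≤))) (NN-⊛ (NN-⊛ (NN-κ (≤⇒0≤- hd)) NN-X) (NN-⊕ (NN-κ g₀≥0) (NN-⊛ (NN-κ lit≤) NN-U))))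
      (NN-⊛ (NN-⊛ (NN-⊛ (NN-κ lit≤) (NNK k)) (NN-κ (≤⇒0≤- (g₀≤ r τ₁ r≥0 r≤ τ₁≥0 τ₁≤)))) NN-X))

    NN-nnB : NN nnB
    NN-nnB = NN-⊛ (NN-⊕ (NN-⊕ (NN-⊕ (NN-⊕ (NN-⊕ (NN-⊕ (NN-⊛ (NNK (suc B)) NN-X) (NN-⊛ (NN-⊛ (NN-sub hb) NN-X) NN-s²)) (NN-⊛ (NN-⊛ (NNK e) NN-T) NN-ℓ)) (NN-⊛ (NN-sub he) NN-T))
      (NN-⊛ (NN-⊛ (NNK e) NN-T) NN-s²)) (NN-⊛ (NN-κ lit≤) NN-X)) (NN-⊛ (NN-⊛ (NN-sub h1) (NN-⊕ (NN-⊛ (NN-κ lit≤) NN-T) (NN-⊛ (NN-κ lit≤) NN-X))) NN-s²)) NN-w₁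

    NN-D : NN D
    NN-D = NN-⊕ (NN-⊕ NN-nnA NN-nnB) (NN-⊛ (NN-κ (0≤* {κ′} {pos 1 / 5} κ′≥0 lit≤)) NN-Cmin)

    NN-C : NN C
    NN-C = NN-≈ (≈-sym C≈) (NN-⊕ NN-D (NN-⊛ (NN-⊛ (NN-κ κ′≥0) (NN-⊛ NN-T NN-X)) NN-w₁))

    rem : PS
    rem = κ (τ₁ - τ₂) ⊛ D ⊕ κ ((τ₁ - τ₂) * κ′ - 1ℚ) ⊛ ((T ⊛ X) ⊛ w₁) ⊕ (T ⊛ X) ⊛ (s² ⊛ w₁)

    NN-rem : NN rem
    NN-rem = NN-⊕ (NN-⊕ (NN-⊛ (NN-κ (≤⇒0≤- τ₂≤τ₁)) NN-D) (NN-⊛ (NN-κ (≤⇒0≤- hτ)) (NN-⊛ (NN-⊛ NN-T NN-X) NN-w₁))) (NN-⊛ (NN-⊛ NN-T NN-X) (NN-⊛ NN-s² NN-w₁))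

    -- The step from τ₁ down to τ₂ pays for -t T v₁: C contains κ′ t T w₁, and (τ₁ - τ₂) κ′ ≥ 1.
    split : lin₁ ⊛ C ⊖ T ⊛ (X ⊛ v₁) ≈ (κ τ₂ ⊖ X) ⊛ C ⊕ rem
    split = begin
      lin₁ ⊛ C ⊖ T ⊛ (X ⊛ v₁) ≈⟨ ringˢ₈₇ (κ τ₁) (κ τ₂) X C T s w₁ ⟩
      (κ τ₂ ⊖ X) ⊛ C ⊕ ((κ τ₁ ⊖ κ τ₂) ⊛ C ⊖ (T ⊛ X) ⊛ w₁ ⊕ (T ⊛ X) ⊛ (s ⊛ s ⊛ w₁))
        ≈⟨ ⊕-congˡ ((κ τ₂ ⊖ X) ⊛ C) (⊕-congʳ ((T ⊛ X) ⊛ (s ⊛ s ⊛ w₁)) (⊕-congʳ (⊝ ((T ⊛ X) ⊛ w₁)) (⊛-cong κ-diff C≈))) ⟩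
      (κ τ₂ ⊖ X) ⊛ C ⊕ (κ (τ₁ - τ₂) ⊛ (D ⊕ κp ⊛ (T ⊛ X) ⊛ w₁) ⊖ (T ⊛ X) ⊛ w₁ ⊕ (T ⊛ X) ⊛ (s ⊛ s ⊛ w₁))
        ≈⟨ ⊕-congˡ ((κ τ₂ ⊖ X) ⊛ C) (⊕-congʳ ((T ⊛ X) ⊛ (s ⊛ s ⊛ w₁)) (≈-trans (ringˢ₈₈ (κ (τ₁ - τ₂)) D κp (T ⊛ X) w₁) (⊕-congˡ (κ (τ₁ - τ₂) ⊛ D) (congʳ ((T ⊛ X) ⊛ w₁) κ-prod)))) ⟩
      (κ τ₂ ⊖ X) ⊛ C ⊕ rem ∎
      where
      open ≈-Reasoning
      κ-diff : κ τ₁ ⊖ κ τ₂ ≈ κ (τ₁ - τ₂)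
      κ-diff = ≈-trans (⊕-congˡ (κ τ₁) (κ-neg τ₂)) (≈-sym (κ-+ τ₁ (- τ₂)))
      κ-prod : κ (τ₁ - τ₂) ⊛ κp ⊖ one ≈ κ ((τ₁ - τ₂) * κ′ - 1ℚ)
      κ-prod = ≈-trans (+-congˢ (≈-sym (κ-* (τ₁ - τ₂) κ′)) (κ-neg 1ℚ)) (≈-sym (κ-+ ((τ₁ - τ₂) * κ′) (- 1ℚ)))

    H₀ W E₀ : PS
    H₀ = T ^ˢ suc B ⊛ Y
    W = lin₁ ⊛ v₁
    E₀ = b ⊛ (X ⊛ Ti) ⊕ N' ⊛ L

    -- `E₀` is the logarithmic derivative of `H₀`, so the series is θ(H₀ W) - e H₀ W.
    null : (H₀ ⊛ (E₀ ⊛ W ⊕ θ W ⊖ E ⊛ W)) e ≡ 0ℚ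
    null = begin
      (H₀ ⊛ (E₀ ⊛ W ⊕ θ W ⊖ E ⊛ W)) e ≡⟨ at (ringˢ₈₉ H₀ E₀ W (θ W) E) e ⟩
      ((H₀ ⊛ E₀) ⊛ W ⊕ H₀ ⊛ θ W ⊖ E ⊛ (H₀ ⊛ W)) e
        ≡⟨ cong₂ _-_ (at (≈-trans (⊕-congʳ (H₀ ⊛ θ W) (congʳ W (≈-sym (LD-⊛ (LD-^ (suc B) LD-T) (LD-^ (suc J) LD-R))))) (≈-sym (θ-⊛ H₀ W))) e) (κ⊛ (ι e) (H₀ ⊛ W) e) ⟩
      ι e * (H₀ ⊛ W) e - ι e * (H₀ ⊛ W) e ≡⟨ ℚₚ.+-inverseʳ (ι e * (H₀ ⊛ W) e) ⟩
      0ℚ ∎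
      where
      open ≡-Reasoning

    θW : θ W ≈ (⊝ X) ⊛ v₁ ⊕ lin₁ ⊛ θ v₁
    θW = ≈-trans (θ-⊛ lin₁ v₁) (⊕-congʳ (lin₁ ⊛ θ v₁) (congʳ v₁ (≈-trans (θ-⊕ (κ τ₁) (⊝ X)) (≈-trans (+-congˢ (θ-κ τ₁) (≈-trans (θ-⊝ X) (PSR.-‿cong θ-X))) (ringˢ₉₀ X)))))

    Gₖ : PS
    Gₖ = (T ^ˢ (B ℕ.+ 31) ⊛ Y) ⊛ ((K ⊛ T ⊖ κ (ι n) ⊛ X) ⊛ fˢ r)

    total≈ : Gₖ ⊕ H₀ ⊛ (E₀ ⊛ W ⊕ θ W ⊖ E ⊛ W) ≈ (T ^ˢ B ⊛ Y) ⊛ (lin₁ ⊛ C ⊖ T ⊛ (X ⊛ v₁))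
    total≈ = begin
      Gₖ ⊕ H₀ ⊛ (E₀ ⊛ W ⊕ θ W ⊖ E ⊛ W)
        ≈⟨ +-congˢ (⊛-cong (congʳ Y (^ˢ-+ T B 31)) (congˡ Q (fˢ-factor r τ₁ root))) (congˡ H₀ (⊕-congʳ (⊝ (E ⊛ W)) (⊕-congˡ (E₀ ⊛ W) θW))) ⟩
      ((T ^ˢ B ⊛ TK) ⊛ Y) ⊛ (Q ⊛ (lin₁ ⊛ G)) ⊕ ((T ⊛ T ^ˢ B) ⊛ Y) ⊛ ((b ⊛ (X ⊛ Ti) ⊕ N' ⊛ L) ⊛ (lin₁ ⊛ ((one ⊖ s ⊛ s) ⊛ w₁)) ⊕ ((⊝ X) ⊛ v₁ ⊕ lin₁ ⊛ θ v₁) ⊖ E ⊛ (lin₁ ⊛ v₁))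
        ≈⟨ l₁ (T ^ˢ B) TK Y Q lin₁ G T b X Ti N' L (one ⊖ s ⊛ s) w₁ v₁ (θ v₁) E ⟩
      (T ^ˢ B ⊛ Y) ⊛ (lin₁ ⊛ (TK ⊛ (Q ⊛ G)) ⊕ (T ⊛ Ti) ⊛ (lin₁ ⊛ (b ⊛ (X ⊛ ((one ⊖ s ⊛ s) ⊛ w₁)))) ⊕ lin₁ ⊛ (N' ⊛ (T ⊛ (((one ⊖ s ⊛ s) ⊛ L) ⊛ w₁))) ⊕ lin₁ ⊛ (T ⊛ θ v₁) ⊖ lin₁ ⊛ (E ⊛ (T ⊛ v₁)) ⊖ T ⊛ (X ⊛ v₁))
        ≈⟨ congˡ (T ^ˢ B ⊛ Y) (⊕-congʳ (⊝ (T ⊛ (X ⊛ v₁))) (⊕-congʳ (⊝ (lin₁ ⊛ (E ⊛ (T ⊛ v₁)))) (⊕-congʳ (lin₁ ⊛ (T ⊛ θ v₁)) (+-congˢ (⊕-congˡ (lin₁ ⊛ (TK ⊛ (Q ⊛ G))) (≈-trans (congʳ (lin₁ ⊛ (b ⊛ (X ⊛ v₁))) T⊛Ti) (idˡ (lin₁ ⊛ (b ⊛ (X ⊛ v₁))))))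
             (congˡ lin₁ (congˡ N' (congˡ T (congʳ w₁ L-1-s²)))))))) ⟩
      (T ^ˢ B ⊛ Y) ⊛ (lin₁ ⊛ (TK ⊛ (Q ⊛ G)) ⊕ lin₁ ⊛ (b ⊛ (X ⊛ v₁)) ⊕ lin₁ ⊛ (N' ⊛ (T ⊛ (ℓ ⊛ w₁))) ⊕ lin₁ ⊛ (T ⊛ θ v₁) ⊖ lin₁ ⊛ (E ⊛ (T ⊛ v₁)) ⊖ T ⊛ (X ⊛ v₁))
        ≈⟨ congˡ (T ^ˢ B ⊛ Y) (ringˢ₉₁ lin₁ (TK ⊛ (Q ⊛ G)) (b ⊛ (X ⊛ v₁)) (N' ⊛ (T ⊛ (ℓ ⊛ w₁))) (T ⊛ θ v₁) (E ⊛ (T ⊛ v₁)) (T ⊛ (X ⊛ v₁))) ⟩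
      (T ^ˢ B ⊛ Y) ⊛ (lin₁ ⊛ C ⊖ T ⊛ (X ⊛ v₁)) ∎
      where
      open ≈-Reasoning
      Q G : PS
      Q = K ⊛ T ⊖ κ (ι n) ⊛ X
      G = g₀ˢ ⊕ h
      l₁ : ∀ tb tk y q l g t b x ti n' L a w v tv e →
        ((tb ⊛ tk) ⊛ y) ⊛ (q ⊛ (l ⊛ g)) ⊕ ((t ⊛ tb) ⊛ y) ⊛ ((b ⊛ (x ⊛ ti) ⊕ n' ⊛ L) ⊛ (l ⊛ (a ⊛ w)) ⊕ ((⊝ x) ⊛ v ⊕ l ⊛ tv) ⊖ e ⊛ (l ⊛ v)) ≈
        (tb ⊛ y) ⊛ (l ⊛ (tk ⊛ (q ⊛ g)) ⊕ (t ⊛ ti) ⊛ (l ⊛ (b ⊛ (x ⊛ (a ⊛ w)))) ⊕ l ⊛ (n' ⊛ (t ⊛ ((a ⊛ L) ⊛ w))) ⊕ l ⊛ (t ⊛ tv) ⊖ l ⊛ (e ⊛ (t ⊛ v)) ⊖ t ⊛ (x ⊛ v))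
      l₁ = solveˢ 17 (λ tb tk y q l g t b x ti n' L a w v tv e →
        ((tb :* tk) :* y) :* (q :* (l :* g)) :+ ((t :* tb) :* y) :* ((b :* (x :* ti) :+ n' :* L) :* (l :* (a :* w)) :+ ((:- x) :* v :+ l :* tv) :- e :* (l :* v)) :=
        (tb :* y) :* (l :* (tk :* (q :* g)) :+ (t :* ti) :* (l :* (b :* (x :* (a :* w)))) :+ l :* (n' :* (t :* ((a :* L) :* w))) :+ l :* (t :* tv) :- l :* (e :* (t :* v)) :- t :* (x :* v)))

  Φ-nonneg : 0ℚ ≤ Φ n J (B ℕ.+ 31) r k
  Φ-nonneg = by0≤ eq (0≤+ first second)
    where
    open ≡-Reasoning
    eq : Φ n J (B ℕ.+ 31) r k ≡ ((linT B τ₂ ⊛ Y) ⊛ C) e + ((T ^ˢ B ⊛ Y) ⊛ rem) e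
    eq = begin
      (X ^ˢ k ⊛ Gₖ) (suc J) ≡⟨ cong (X ^ˢ k ⊛ Gₖ) eJ ⟩
      (X ^ˢ k ⊛ Gₖ) (k ℕ.+ e) ≡⟨ X^⊛-+ k Gₖ e ⟩
      Gₖ e ≡⟨ ℚₚ.+-identityʳ (Gₖ e) ⟨
      Gₖ e + 0ℚ ≡⟨ cong (Gₖ e +_) null ⟨
      (Gₖ ⊕ H₀ ⊛ (E₀ ⊛ W ⊕ θ W ⊖ E ⊛ W)) e ≡⟨ at total≈ e ⟩
      ((T ^ˢ B ⊛ Y) ⊛ (lin₁ ⊛ C ⊖ T ⊛ (X ⊛ v₁))) e ≡⟨ at (congˡ (T ^ˢ B ⊛ Y) split) e ⟩
      ((T ^ˢ B ⊛ Y) ⊛ ((κ τ₂ ⊖ X) ⊛ C ⊕ rem)) e ≡⟨ at (ringˢ₉₂ (T ^ˢ B) Y (κ τ₂) X C rem) e ⟩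
      ((linT B τ₂ ⊛ Y) ⊛ C) e + ((T ^ˢ B ⊛ Y) ⊛ rem) e ∎
    τ₀≤1 : τ₀ ≤ 1ℚ
    τ₀≤1 = ≤-trans τ₀≤τ₂ (≤-trans τ₂≤τ₁ (≤-trans τ₁≤ lit≤))
    first : 0ℚ ≤ ((linT B τ₂ ⊛ Y) ⊛ C) e
    first = NN-⊛-upto e {linT B τ₂ ⊛ Y} {C} (linT-⊛-nonneg Y B τ₂ τ₀ e τ₀>0 τ₀≤τ₂ τ₀≤1 hB (Even-^ {R} (suc J) Even-R) (NN-^ {R} (suc J) NN-R) ratio) NN-C
    second : 0ℚ ≤ ((T ^ˢ B ⊛ Y) ⊛ rem) e
    second = NN-⊛ (NN-⊛ (NN-^ B NN-T) (NN-^ {R} (suc J) NN-R)) NN-rem e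

-- Convolutions evaluated approximately through ratios of consecutive terms.

Ab : ℚ → ℚ → Set
Ab x c = (- c ≤ x) × (x ≤ c)

ringᵠ₁₂₂ : ∀ c d → - (c + d) ≡ - c + - d
ringᵠ₁₂₂ = solveᵠ 2 λ c d → (:- (c :+ d)) := (:- c) :+ (:- d)

Ab-+ : ∀ {x y c d} → Ab x c → Ab y d → Ab (x + y) (c + d)
Ab-+ {x} {y} {c} {d} (a , b) (a' , b') = ≤-trans (≤-reflexive (ringᵠ₁₂₂ c d)) (+-mono-≤ { - c} {x} { - d} {y} a a') , +-mono-≤ {x} {c} {y} {d} b b'

Ab-neg : ∀ {x c} → Ab x c → Ab (- x) c
Ab-neg {x} {c} (a , b) = ℚₚ.neg-antimono-≤ b , subst (- x ≤_) (neg-neg c) (ℚₚ.neg-antimono-≤ a)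

Ab-mono : ∀ {x c d} → c ≤ d → Ab x c → Ab x d
Ab-mono {x} {c} {d} p (a , b) = ≤-trans { - d} { - c} (ℚₚ.neg-antimono-≤ p) a , ≤-trans {x} {c} b p

ringᵠ₁₂₃ : ∀ k c → - (k * c) ≡ k * (- c)
ringᵠ₁₂₃ = solveᵠ 2 λ k c → (:- (k :* c)) := k :* (:- c)

Ab-scale : ∀ {x c k} → 0ℚ ≤ k → Ab x c → Ab (k * x) (k * c)
Ab-scale {x} {c} {k} p (a , b) = ≤-trans { - (k * c)} {k * (- c)} (≤-reflexive (ringᵠ₁₂₃ k c)) (*-monoˡ { - c} {x} {k} p a) , *-monoˡ {x} {c} {k} p b

Ab-cancel : ∀ {x c k} → 0ℚ < k → Ab (k * x) (k * c) → Ab x c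
Ab-cancel {x} {c} {k} p (a , b) = *-cancelˡ { - c} {x} {k} p (subst (_≤ k * x) (ringᵠ₁₂₃ k c) a) , *-cancelˡ {x} {c} {k} p b

ringᵠ₁₂₄ : ∀ x y c d → x * y - (- (c * d)) ≡ pos 1 / 2 * ((x - (- c)) * (y - (- d)) + (c - x) * (d - y))
ringᵠ₁₂₄ = solveᵠ 4 λ x y c d → x :* y :- (:- (c :* d)) := con (pos 1 / 2) :* ((x :- (:- c)) :* (y :- (:- d)) :+ (c :- x) :* (d :- y))

ringᵠ₁₂₅ : ∀ x y c d → c * d - x * y ≡ pos 1 / 2 * ((c - x) * (y - (- d)) + (x - (- c)) * (d - y))
ringᵠ₁₂₅ = solveᵠ 4 λ x y c d → c :* d :- x :* y := con (pos 1 / 2) :* ((c :- x) :* (y :- (:- d)) :+ (x :- (:- c)) :* (d :- y))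

Ab-* : ∀ {x y c d} → 0ℚ ≤ d → Ab x c → Ab y d → Ab (x * y) (c * d)
Ab-* {x} {y} {c} {d} d≥0 (a , b) (a' , b') =
    by≤ (ringᵠ₁₂₄ x y c d) (0≤* {pos 1 / 2} lit≤ (0≤+ (0≤* p q') (0≤* q p')))
  , by≤ (ringᵠ₁₂₅ x y c d) (0≤* {pos 1 / 2} lit≤ (0≤+ (0≤* q q') (0≤* p p')))
  where
  p : 0ℚ ≤ x - (- c)
  p = ≤⇒0≤- a
  q : 0ℚ ≤ c - x
  q = ≤⇒0≤- b
  p' : 0ℚ ≤ d - y
  p' = ≤⇒0≤- b'
  q' : 0ℚ ≤ y - (- d)
  q' = ≤⇒0≤- a'

Ab-self : ∀ x → Ab x (Data.Rational.∣ x ∣)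
Ab-self x = subst (- Data.Rational.∣ x ∣ ≤_) (neg-neg x) (ℚₚ.neg-antimono-≤ (subst (- x ≤_) (ℚₚ.∣-p∣≡∣p∣ x) (x≤∣x∣ (- x)))) , x≤∣x∣ x
  where
  x≤∣x∣ : ∀ x → x ≤ Data.Rational.∣ x ∣
  x≤∣x∣ x = case (ℚₚ.≤-total 0ℚ x)
    where
    case : 0ℚ ≤ x ⊎ x ≤ 0ℚ → x ≤ Data.Rational.∣ x ∣
    case (inj₁ p) = ≤-reflexive (sym (ℚₚ.0≤p⇒∣p∣≡p p))
    case (inj₂ p) = ≤-trans p (ℚₚ.0≤∣p∣ x)

Sabs : ℕ → PS → ℚ
Sabs zero d = Data.Rational.∣ d 0 ∣
Sabs (suc D) d = Data.Rational.∣ d 0 ∣ + Sabs D (tail d)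

Sabs-nonneg : ∀ D d → 0ℚ ≤ Sabs D d
Sabs-nonneg zero d = ℚₚ.0≤∣p∣ (d 0)
Sabs-nonneg (suc D) d = 0≤+ (ℚₚ.0≤∣p∣ (d 0)) (Sabs-nonneg D (tail d))

pev-Ab : ∀ D d x → 0ℚ ≤ x → x ≤ 1ℚ → Ab (pev D d x) (Sabs D d)
pev-Ab zero d x p q = Ab-self (d 0)
pev-Ab (suc D) d x p q = Ab-+ {d 0} {x * pev D (tail d) x} (Ab-self (d 0))
  (Ab-mono (≤-trans (*-monoʳ {x} {1ℚ} {Sabs D (tail d)} (Sabs-nonneg D (tail d)) q) (≤-reflexive (ℚₚ.*-identityˡ (Sabs D (tail d))))) (Ab-scale {pev D (tail d) x} p (pev-Ab D (tail d) x p q)))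

ringᵠ₁₂₆ : ∀ a b → 0ℚ * a * b ≡ 0ℚ
ringᵠ₁₂₆ = solveᵠ 2 λ a b → con 0ℚ :* a :* b := con 0ℚ

ringᵠ₁₂₇ : ∀ d y c x p y' → d * y + c - y * (d + x * p) ≡ c - y' * p + (y' - x * y) * p
ringᵠ₁₂₇ = solveᵠ 6 λ d y c x p y' → d :* y :+ c :- y :* (d :+ x :* p) := c :- y' :* p :+ (y' :- x :* y) :* p

ringᵠ₁₂₈ : ∀ n e s y c → (1ℚ + n) * (e * (c + s)) * y - (n * (e * s) * y + e * y * s) ≡ (1ℚ + n) * (e * c) * y
ringᵠ₁₂₈ = solveᵠ 5 λ n e s y c → (con 1ℚ :+ n) :* (e :* (c :+ s)) :* y :- (n :* (e :* s) :* y :+ e :* y :* s) := (con 1ℚ :+ n) :* (e :* c) :* y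

module _ (y : PS) (x ε : ℚ) (x≥0 : 0ℚ ≤ x) (x≤1 : x ≤ 1ℚ) (ε≥0 : 0ℚ ≤ ε) (y≥0 : ∀ i → 0ℚ ≤ y i) where

  -- If y_i is x y_(i+1) up to relative error ε, each of the D Horner steps costs at most ε times
  -- the ℓ¹ norm of the remaining coefficients.
  conv-approx : ∀ D m d → Deg≤ D d → (∀ i → m ℕ.≤ i → i ℕ.< D ℕ.+ m → Ab (y i - x * y (suc i)) (ε * y (suc i))) →
    (∀ i → m ℕ.≤ i → i ℕ.< D ℕ.+ m → y i ≤ y (suc i)) →
    Ab ((d ⊛ y) (D ℕ.+ m) - y (D ℕ.+ m) * pev D d x) (ι D * (ε * Sabs D d) * y (D ℕ.+ m))
  conv-approx zero m d deg ap mono = subst₂ Ab (sym zero-diff) (sym (ringᵠ₁₂₆ (ε * Sabs 0 d) (y m))) (≤-refl , ≤-refl)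
    where
    zero-diff : (d ⊛ y) m - y m * d 0 ≡ 0ℚ
    zero-diff = trans (cong (_- y m * d 0) (trans (⊛-cong′ {d} {κ (d 0)} {y} {y} (λ { zero → refl ; (suc i) → deg (suc i) (s≤s z≤n) }) (λ _ → refl) m) (trans (κ⊛ (d 0) y m) (ℚₚ.*-comm (d 0) (y m))))) (ℚₚ.+-inverseʳ (y m * d 0))
  conv-approx (suc D) m d deg ap mono = subst (λ z → Ab z B) (sym split) (Ab-mono {z} bound (Ab-+ {a} {b} ih step))
    where
    M : ℕ
    M = D ℕ.+ m
    P a b z S B : ℚ
    P = pev D (tail d) x
    S = Sabs D (tail d)
    a = (tail d ⊛ y) M - y M * P
    b = (y M - x * y (suc M)) * P
    z = a + b
    B = ι (suc D) * (ε * Sabs (suc D) d) * y (suc M)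
    m≤M : m ℕ.≤ M
    m≤M = ℕₚ.m≤n+m m D
    ih : Ab a (ι D * (ε * S) * y M)
    ih = conv-approx D m (tail d) (λ i q → deg (suc i) (s≤s q)) (λ i p q → ap i p (ℕₚ.<-trans q (ℕₚ.n<1+n M))) (λ i p q → mono i p (ℕₚ.<-trans q (ℕₚ.n<1+n M)))
    step : Ab b (ε * y (suc M) * S)
    step = Ab-* {y M - x * y (suc M)} {P} (Sabs-nonneg D (tail d)) (ap M m≤M (ℕₚ.n<1+n M)) (pev-Ab D (tail d) x x≥0 x≤1)
    split : (d ⊛ y) (suc M) - y (suc M) * pev (suc D) d x ≡ z
    split = ringᵠ₁₂₇ (d 0) (y (suc M)) ((tail d ⊛ y) M) x P (y M)
    bound : ι D * (ε * S) * y M + ε * y (suc M) * S ≤ B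
    bound = ≤-trans (+-mono-≤ {b = ι D * (ε * S) * y (suc M)} (*-monoˡ {y M} {y (suc M)} {ι D * (ε * S)} (0≤* (ι-nonneg D) (0≤* ε≥0 (Sabs-nonneg D (tail d)))) (mono M m≤M (ℕₚ.n<1+n M))) (≤-refl {ε * y (suc M) * S}))
      (by≤ (trans (cong (λ q → q * (ε * (Data.Rational.∣ d 0 ∣ + S)) * y (suc M) - (ι D * (ε * S) * y (suc M) + ε * y (suc M) * S)) (ι-suc D)) (ringᵠ₁₂₈ (ι D) ε S (y (suc M)) (Data.Rational.∣ d 0 ∣)))
        (0≤* (0≤* (0≤+ 0≤1 (ι-nonneg D)) (0≤* ε≥0 (ℚₚ.0≤∣p∣ (d 0)))) (y≥0 (suc M))))

½ : ℚ
½ = pos 1 / 2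

-- Ratios of consecutive terms of a three-term recurrence converge, by contraction

ringᵠ₁₂₉ : ∀ a b → a + b - a ≡ b
ringᵠ₁₂₉ = solveᵠ 2 λ a b → a :+ b :- a := b

ringᵠ₁₃₀ : ∀ η → 1ℚ + 2ℚ * η - 1ℚ ≡ 2ℚ * η
ringᵠ₁₃₀ = solveᵠ 1 λ η → con 1ℚ :+ con 2ℚ :* η :- con 1ℚ := con 2ℚ :* η

ringᵠ₁₃₁ : ∀ a η → ½ * (a + 2ℚ * η) + η ≡ ½ * a + 2ℚ * η
ringᵠ₁₃₁ = solveᵠ 2 λ a η → con ½ :* (a :+ con 2ℚ :* η) :+ η := con ½ :* a :+ con 2ℚ :* η

ringᵠ₁₃₂ : ∀ a s b → a - s * b - (- (1ℚ * b)) ≡ a + (1ℚ - s) * b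
ringᵠ₁₃₂ = solveᵠ 3 λ a s b → a :- s :* b :- (:- (con 1ℚ :* b)) := a :+ (con 1ℚ :- s) :* b

ringᵠ₁₃₃ : ∀ a s b → 1ℚ * b - (a - s * b) ≡ b - a + s * b
ringᵠ₁₃₃ = solveᵠ 3 λ a s b → con 1ℚ :* b :- (a :- s :* b) := b :- a :+ s :* b

ringᵠ₁₃₄ : ∀ n a s b → n * (a - s * b) ≡ n * a - s * (n * b)
ringᵠ₁₃₄ = solveᵠ 4 λ n a s b → n :* (a :- s :* b) := n :* a :- s :* (n :* b)

ringᵠ₁₃₅ : ∀ n a s α b c → n * a - s * (α * a + b * c) ≡ (n - s * α - s * s * b) * a + - (s * b * (c - s * a))
ringᵠ₁₃₅ = solveᵠ 6 λ n a s α b c → n :* a :- s :* (α :* a :+ b :* c) := (n :- s :* α :- s :* s :* b) :* a :+ (:- (s :* b :* (c :- s :* a)))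

ringᵠ₁₃₆ : ∀ η α y b e → (½ * e + η) * (α * y) - (η * α * y + b * (e * y)) ≡ (½ * α - b) * (e * y)
ringᵠ₁₃₆ = solveᵠ 5 λ η α y b e → (con ½ :* e :+ η) :* (α :* y) :- (η :* α :* y :+ b :* (e :* y)) := (con ½ :* α :- b) :* (e :* y)

-- With ρ_i = y_i / y_(i+1) the recurrence reads i + 2 = ρ_(i+1) (α + (β + i) ρ_i). By `hη` the
-- point s* is fixed up to a relative error η, and `hs` makes the error halve at each step. It
-- starts at 1 because both ρ and s* lie in [0, 1].
module Contraction (y : PS) (α β s* η : ℚ) (rec : Rec y α β) (y≥0 : ∀ i → 0ℚ ≤ y i) (i₀ i₁ : ℕ)
  (α>0 : 0ℚ < α) (β≥0 : 0ℚ ≤ β) (s*≥0 : 0ℚ ≤ s*) (s*≤1 : s* ≤ 1ℚ) (η≥0 : 0ℚ ≤ η)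
  (hα : ι (suc (suc i₁)) ≤ α)
  (hs : s* * (β + ι i₁) ≤ ½ * α)
  (hη : ∀ i → i₀ ℕ.≤ i → i ℕ.≤ i₁ → Ab (ι (suc (suc i)) - s* * α - s* * s* * (β + ι i)) (η * α))
  where
  open Rec rec

  αy≤ : ∀ i → α * y i ≤ ι (suc i) * y (suc i)
  αy≤ zero = ≤-reflexive (trans (sym y₁) (sym (ℚₚ.*-identityˡ (y 1))))
  αy≤ (suc i) = subst (α * y (suc i) ≤_) (sym (y₂ i)) (by≤ (ringᵠ₁₂₉ (α * y (suc i)) ((β + ι i) * y i)) (0≤* (0≤+ β≥0 (ι-nonneg i)) (y≥0 i)))

  mono : ∀ i → i ℕ.≤ suc i₁ → y i ≤ y (suc i)
  mono i le = *-cancelˡ {y i} {y (suc i)} {α} α>0 (≤-trans (αy≤ i) (*-monoʳ {ι (suc i)} {α} {y (suc i)} (y≥0 (suc i)) (≤-trans (ι-mono (s≤s le)) hα)))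

  εₗ : ℕ → ℚ
  εₗ zero = 1ℚ
  εₗ (suc l) = ½ * εₗ l + η

  εₗ-nonneg : ∀ l → 0ℚ ≤ εₗ l
  εₗ-nonneg zero = 0≤1
  εₗ-nonneg (suc l) = 0≤+ (0≤* {½} lit≤ (εₗ-nonneg l)) η≥0

  εₗ-bound : ∀ l → εₗ l ≤ ½ ^ l + 2ℚ * η
  εₗ-bound zero = by≤ (ringᵠ₁₃₀ η) (0≤* {2ℚ} lit≤ η≥0)
  εₗ-bound (suc l) = ≤-trans (+-mono-≤ {½ * εₗ l} {½ * (½ ^ l + 2ℚ * η)} {η} {η} (*-monoˡ {c = ½} lit≤ (εₗ-bound l)) ≤-refl) (≤-reflexive (ringᵠ₁₃₁ (½ ^ l) η))

  approx : ∀ l → i₀ ℕ.+ l ℕ.≤ i₁ → Ab (y (i₀ ℕ.+ l) - s* * y (suc (i₀ ℕ.+ l))) (εₗ l * y (suc (i₀ ℕ.+ l)))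
  approx zero le = subst (λ i → Ab (y i - s* * y (suc i)) (1ℚ * y (suc i))) (sym (ℕₚ.+-identityʳ i₀))
    ( by≤ (ringᵠ₁₃₂ (y i₀) s* (y (suc i₀))) (0≤+ (y≥0 i₀) (0≤* (≤⇒0≤- s*≤1) (y≥0 (suc i₀))))
    , by≤ (ringᵠ₁₃₃ (y i₀) s* (y (suc i₀))) (0≤+ (≤⇒0≤- (mono i₀ (ℕₚ.≤-trans (ℕₚ.≤-trans (ℕₚ.m≤m+n i₀ 0) le) (ℕₚ.n≤1+n i₁)))) (0≤* s*≥0 (y≥0 (suc i₀)))))
  approx (suc l) le = subst (λ i → Ab (y i - s* * y (suc i)) (εₗ (suc l) * y (suc i))) (sym (ℕₚ.+-suc i₀ l))
    (Ab-cancel {k = ι (suc (suc i))} (ι-pos (suc i)) (subst (λ z → Ab z (ι (suc (suc i)) * (εₗ (suc l) * y (suc (suc i))))) (sym key)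
      (Ab-mono {c₀ * y (suc i) + - (s* * (β + ι i) * (y i - s* * y (suc i)))} final
        (Ab-+ {c₀ * y (suc i)} { - (s* * (β + ι i) * (y i - s* * y (suc i)))} {η * α * y (suc i)} {s* * (β + ι i) * (εₗ l * y (suc i))} first second))))
    where
    i : ℕ
    i = i₀ ℕ.+ l
    si≤ : suc i ℕ.≤ i₁
    si≤ = subst (ℕ._≤ i₁) (ℕₚ.+-suc i₀ l) le
    i≤ : i ℕ.≤ i₁
    i≤ = ℕₚ.≤-trans (ℕₚ.n≤1+n i) si≤
    c₀ : ℚ
    c₀ = ι (suc (suc i)) - s* * α - s* * s* * (β + ι i)
    sb≥0 : 0ℚ ≤ s* * (β + ι i)
    sb≥0 = 0≤* s*≥0 (0≤+ β≥0 (ι-nonneg i))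
    key : ι (suc (suc i)) * (y (suc i) - s* * y (suc (suc i))) ≡ c₀ * y (suc i) + - (s* * (β + ι i) * (y i - s* * y (suc i)))
    key = trans (ringᵠ₁₃₄ (ι (suc (suc i))) (y (suc i)) s* (y (suc (suc i)))) (trans (cong (λ z → ι (suc (suc i)) * y (suc i) - s* * z) (y₂ i)) (ringᵠ₁₃₅ (ι (suc (suc i))) (y (suc i)) s* α (β + ι i) (y i)))
    first : Ab (c₀ * y (suc i)) (η * α * y (suc i))
    first = subst₂ Ab (ℚₚ.*-comm (y (suc i)) c₀) (ℚₚ.*-comm (y (suc i)) (η * α)) (Ab-scale {c₀} {η * α} {y (suc i)} (y≥0 (suc i)) (hη i (ℕₚ.m≤m+n i₀ l) i≤))
    second : Ab (- (s* * (β + ι i) * (y i - s* * y (suc i)))) (s* * (β + ι i) * (εₗ l * y (suc i)))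
    second = Ab-neg {s* * (β + ι i) * (y i - s* * y (suc i))} (Ab-scale {y i - s* * y (suc i)} sb≥0 (approx l i≤))
    final : η * α * y (suc i) + s* * (β + ι i) * (εₗ l * y (suc i)) ≤ ι (suc (suc i)) * (εₗ (suc l) * y (suc (suc i)))
    final = ≤-trans {b = (½ * εₗ l + η) * (α * y (suc i))}
      (by≤ (ringᵠ₁₃₆ η α (y (suc i)) (s* * (β + ι i)) (εₗ l)) (0≤* (≤⇒0≤- (≤-trans {b = s* * (β + ι i₁)} (*-monoˡ {β + ι i} {β + ι i₁} {s*} s*≥0 (+-mono-≤ {β} {β} {ι i} {ι i₁} ≤-refl (ι-mono i≤))) hs)) (0≤* (εₗ-nonneg l) (y≥0 (suc i)))))
      (≤-trans {b = εₗ (suc l) * (ι (suc (suc i)) * y (suc (suc i)))} (*-monoˡ {α * y (suc i)} {ι (suc (suc i)) * y (suc (suc i))} {εₗ (suc l)} (εₗ-nonneg (suc l)) (αy≤ (suc i))) (≤-reflexive (ringᵠ₆₉ (εₗ (suc l)) (ι (suc (suc i))) (y (suc (suc i))))))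

Deg-seriesQ : ∀ a l → Deg≤ (Data.List.length l) (seriesQ (a ∷ l))
Deg-seriesQ a l (suc i) p = trans (cong (0ℚ +_) (X⊛-suc (seriesQ l) i)) (trans (ℚₚ.+-identityˡ (seriesQ l i)) (rest l i p))
  where
  rest : ∀ l i → Data.List.length l ℕ.< suc i → seriesQ l i ≡ 0ℚ
  rest [] zero p = refl
  rest [] (suc i) p = refl
  rest (b ∷ l) (suc i) (s≤s p) = Deg-seriesQ b l (suc i) p

pev-seriesQ : ∀ a l x → pev (Data.List.length l) (seriesQ (a ∷ l)) x ≡ evalQ (a ∷ l) x
pev-seriesQ a [] x = trans (cong (a +_) (X⊛-zero (κ 0ℚ))) (trans (ℚₚ.+-identityʳ a) (sym (trans (cong (a +_) (ℚₚ.*-zeroʳ x)) (ℚₚ.+-identityʳ a))))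
pev-seriesQ a (b ∷ l) x = cong₂ (λ u v → u + x * v) (trans (cong (a +_) (X⊛-zero (seriesQ (b ∷ l)))) (ℚₚ.+-identityʳ a))
  (trans (pev-cong (Data.List.length l) x (λ i → trans (cong (0ℚ +_) (X⊛-suc (seriesQ (b ∷ l)) i)) (ℚₚ.+-identityˡ (seriesQ (b ∷ l) i)))) (pev-seriesQ b l x))

pˢ : ℕ → ℚ → PS
pˢ A r = T ^ˢ A ⊛ (⊝ fˢ r)

⊝κ : ∀ f → ⊝ f ≈ κ (- 1ℚ) ⊛ f
⊝κ = solveˢ 1 (λ f → :- f := con (- 1ℚ) :* f)

pˢ-suc : ∀ A r → pˢ (suc A) r ≈ (κ 1ℚ ⊕ κ 1ℚ ⊛ X) ⊛ pˢ A r
pˢ-suc A r = ≈-trans (assocˢ T (T ^ˢ A) (⊝ fˢ r)) (congʳ (pˢ A r) T≈)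

pˢ-zero : ∀ r → pˢ 0 r ≈ κ (- 1ℚ) ⊛ seriesQ (fL r)
pˢ-zero r = ≈-trans (idˡ (⊝ fˢ r)) (≈-trans (⊝κ (fˢ r)) (congˡ (κ (- 1ℚ)) (fˢ≈ r)))

Deg-pˢ : ∀ A r → Deg≤ (A ℕ.+ 12) (pˢ A r)
Deg-pˢ zero r i p = trans (at (pˢ-zero r) i) (trans (κ⊛ (- 1ℚ) (seriesQ (fL r)) i) (trans (cong ((- 1ℚ) *_) (Deg-seriesQ r (Data.List.drop 1 (fL r)) i p)) (ℚₚ.*-zeroʳ (- 1ℚ))))
Deg-pˢ (suc A) r i p = trans (at (pˢ-suc A r) i) (Deg-lin (A ℕ.+ 12) 1ℚ 1ℚ (pˢ A r) (Deg-pˢ A r) i p)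

ringᵠ₁₃₇ : ∀ a → (- 1ℚ) * a ≡ 1ℚ * (- a)
ringᵠ₁₃₇ = solveᵠ 1 λ a → (:- con 1ℚ) :* a := con 1ℚ :* (:- a)

pev-pˢ : ∀ A r x → pev (A ℕ.+ 12) (pˢ A r) x ≡ (1ℚ + x) ^ A * (- evalQ (fL r) x)
pev-pˢ zero r x = begin
  pev 12 (pˢ 0 r) x ≡⟨ pev-cong 12 x (λ i → trans (at (pˢ-zero r) i) (κ⊛ (- 1ℚ) (seriesQ (fL r)) i)) ⟩
  pev 12 (λ i → (- 1ℚ) * seriesQ (fL r) i) x ≡⟨ pev-scale 12 (- 1ℚ) (seriesQ (fL r)) x ⟩
  (- 1ℚ) * pev 12 (seriesQ (fL r)) x ≡⟨ cong ((- 1ℚ) *_) (pev-seriesQ r (Data.List.drop 1 (fL r)) x) ⟩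
  (- 1ℚ) * evalQ (fL r) x ≡⟨ ringᵠ₁₃₇ (evalQ (fL r) x) ⟩
  1ℚ * (- evalQ (fL r) x) ∎
  where
  open ≡-Reasoning
pev-pˢ (suc A) r x = begin
  pev (suc (A ℕ.+ 12)) (pˢ (suc A) r) x ≡⟨ pev-cong (suc (A ℕ.+ 12)) x (at (pˢ-suc A r)) ⟩
  pev (suc (A ℕ.+ 12)) ((κ 1ℚ ⊕ κ 1ℚ ⊛ X) ⊛ pˢ A r) x ≡⟨ pev-lin (A ℕ.+ 12) 1ℚ 1ℚ (pˢ A r) x (Deg-pˢ A r) ⟩
  (1ℚ + 1ℚ * x) * pev (A ℕ.+ 12) (pˢ A r) x ≡⟨ cong₂ (λ a b → (1ℚ + a) * b) (ℚₚ.*-identityˡ x) (pev-pˢ A r x) ⟩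
  (1ℚ + x) * ((1ℚ + x) ^ A * (- evalQ (fL r) x)) ≡⟨ sym (ℚₚ.*-assoc (1ℚ + x) ((1ℚ + x) ^ A) (- evalQ (fL r) x)) ⟩
  (1ℚ + x) * (1ℚ + x) ^ A * (- evalQ (fL r) x) ∎
  where open ≡-Reasoning

^-≤1 : ∀ {a} n → 0ℚ ≤ a → a ≤ 1ℚ → a ^ n ≤ 1ℚ
^-≤1 {a} n p q = ≤-trans (^-mono n p q) (≤-reflexive (1^ n))

ringᵠ₁₃₈ : ∀ x → 1ℚ - (1ℚ + - x) ≡ x
ringᵠ₁₃₈ = solveᵠ 1 λ x → con 1ℚ :- (con 1ℚ :+ (:- x)) := x

ringᵠ₁₃₉ : ∀ x → 1ℚ - (1ℚ - x) ≡ x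
ringᵠ₁₃₉ = solveᵠ 1 λ x → con 1ℚ :- (con 1ℚ :- x) := x

ringᵠ₁₄₀ : ∀ a x b c → a - (- x) * b * c ≡ a + x * b * c
ringᵠ₁₄₀ = solveᵠ 4 λ a x b c → a :- (:- x) :* b :* c := a :+ x :* b :* c

-- A crude bound for the mirror point -x: r (1 - x)¹² ≤ 1/120, and x (1 + x²) ≤ 2/5 · 29/25 =
-- 58/125.
evalQ-neg≤2 : ∀ r x → 0ℚ ≤ r → r ≤ pos 1 / 120 → 0ℚ ≤ x → x ≤ pos 2 / 5 → evalQ (fL r) (- x) ≤ 2ℚ
evalQ-neg≤2 r x r≥0 r≤ x≥0 x≤ = ≤-trans (≤-reflexive (trans (root-eq r (- x)) (l r (1ℚ + - x) x))) (≤-trans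
  (+-mono-≤ {r * (1ℚ + - x) ^ 12} {pos 1 / 120} {x * (1ℚ + x * x) * (1ℚ - x * x) ^ 4} {pos 58 / 125}
    (≤-trans (*-mono r≥0 r≤ (^-nonneg 12 1-x≥0) (^-≤1 12 1-x≥0 1-x≤1)) (≤-reflexive (ℚₚ.*-identityʳ (pos 1 / 120))))
    (≤-trans (*-mono (0≤* x≥0 (0≤+ 0≤1 x²≥0)) (*-mono {x} {pos 2 / 5} {1ℚ + x * x} {pos 29 / 25} x≥0 x≤ (0≤+ 0≤1 x²≥0) (+-mono-≤ {1ℚ} {1ℚ} {x * x} {pos 4 / 25} ≤-refl x²≤)) (^-nonneg 4 1-x²≥0) (^-≤1 4 1-x²≥0 1-x²≤1)) (≤-reflexive (ℚₚ.*-identityʳ (pos 58 / 125)))))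
  lit≤)
  where
  x²≥0 : 0ℚ ≤ x * x
  x²≥0 = 0≤* x≥0 x≥0
  x²≤ : x * x ≤ pos 4 / 25
  x²≤ = *-mono {x} {pos 2 / 5} {x} {pos 2 / 5} x≥0 x≤ x≥0 x≤
  1-x≥0 : 0ℚ ≤ 1ℚ + - x
  1-x≥0 = ≤⇒0≤- {x} {1ℚ} (≤-trans {x} {pos 2 / 5} x≤ lit≤)
  1-x≤1 : 1ℚ + - x ≤ 1ℚ
  1-x≤1 = by≤ {1ℚ + - x} {1ℚ} (ringᵠ₁₃₈ x) x≥0
  1-x²≥0 : 0ℚ ≤ 1ℚ - x * x
  1-x²≥0 = ≤⇒0≤- {x * x} {1ℚ} (≤-trans {x * x} {pos 4 / 25} x²≤ lit≤)
  1-x²≤1 : 1ℚ - x * x ≤ 1ℚ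
  1-x²≤1 = by≤ {1ℚ - x * x} {1ℚ} (ringᵠ₁₃₉ (x * x)) x²≥0
  l : ∀ r u x → r * u ^ 12 - (- x) * (1ℚ + (- x) * (- x)) * (1ℚ - (- x) * (- x)) ^ 4 ≡ r * u ^ 12 + x * (1ℚ + x * x) * (1ℚ - x * x) ^ 4
  l r u x = trans (cong (λ z → r * u ^ 12 - (- x) * (1ℚ + z) * (1ℚ - z) ^ 4) (ringᵠ₉₆ x)) (ringᵠ₁₄₀ (r * u ^ 12) x (1ℚ + x * x) ((1ℚ - x * x) ^ 4))

½^-anti : ∀ L l → ½ ^ (L ℕ.+ l) ≤ ½ ^ L
½^-anti L l = subst (_≤ ½ ^ L) (sym (^-+ ½ L l)) (≤-trans (*-monoˡ {½ ^ l} {1ℚ} {½ ^ L} (^-nonneg {½} L lit≤) (^-≤1 {½} l lit≤ lit≤)) (≤-reflexive (ℚₚ.*-identityʳ (½ ^ L))))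

ringᵠ₁₄₁ : ∀ e x o → 2ℚ * e ≡ e + x * o + (e + (- x) * o)
ringᵠ₁₄₁ = solveᵠ 3 λ e x o → con 2ℚ :* e := e :+ x :* o :+ (e :+ (:- x) :* o)

ringᵠ₁₄₂ : ∀ d x a → d + x * a - 2ℚ - 1ℚ ≡ d + (x - pos 1 / 4) * a + pos 1 / 4 * (a - pos 12 / 1)
ringᵠ₁₄₂ = solveᵠ 3 λ d x a → d :+ x :* a :- con 2ℚ :- con 1ℚ := d :+ (x :- con (pos 1 / 4)) :* a :+ con (pos 1 / 4) :* (a :- con (pos 12 / 1))

ringᵠ₁₄₃ : ∀ t d x a → t * d - 2ℚ - (d + x * (d * a) - 2ℚ) ≡ (t - (1ℚ + a * x)) * d
ringᵠ₁₄₃ = solveᵠ 4 λ t d x a → t :* d :- con 2ℚ :- (d :+ x :* (d :* a) :- con 2ℚ) := (t :- (con 1ℚ :+ a :* x)) :* d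

ringᵠ₁₄₄ : ∀ c g → c * (- g) - (- 2ℚ) ≡ c * (2ℚ - g) + 2ℚ * (1ℚ - c)
ringᵠ₁₄₄ = solveᵠ 2 λ c g → c :* (:- g) :- (:- con 2ℚ) := c :* (con 2ℚ :- g) :+ con 2ℚ :* (con 1ℚ :- c)

ringᵠ₁₄₅ : ∀ j → pos 3 / 1 * (1ℚ + 2ℚ * j) ≡ pos 3 / 1 + pos 6 / 1 * j
ringᵠ₁₄₅ = solveᵠ 1 λ j → con (pos 3 / 1) :* (con 1ℚ :+ con 2ℚ :* j) := con (pos 3 / 1) :+ con (pos 6 / 1) :* j

ringᵠ₁₄₆ : ∀ j → pos 5 / 1 * (1ℚ + 2ℚ * j) ≡ pos 5 / 1 + pos 10 / 1 * j
ringᵠ₁₄₆ = solveᵠ 1 λ j → con (pos 5 / 1) :* (con 1ℚ :+ con 2ℚ :* j) := con (pos 5 / 1) :+ con (pos 10 / 1) :* j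

ringᵠ₁₄₇ : ∀ j → pos 3 / 1 + pos 6 / 1 * j - (1ℚ + (1ℚ + j)) ≡ 1ℚ + pos 5 / 1 * j
ringᵠ₁₄₇ = solveᵠ 1 λ j → con (pos 3 / 1) :+ con (pos 6 / 1) :* j :- (con 1ℚ :+ (con 1ℚ :+ j)) := con 1ℚ :+ con (pos 5 / 1) :* j

ringᵠ₁₄₈ : ∀ j → ½ * (pos 3 / 1 + pos 6 / 1 * j) - pos 4 / 25 * (pos 5 / 1 + pos 10 / 1 * j + j) ≡ pos 7 / 10 + pos 31 / 25 * j
ringᵠ₁₄₈ = solveᵠ 1 λ j → con ½ :* (con (pos 3 / 1) :+ con (pos 6 / 1) :* j) :- con (pos 4 / 25) :* (con (pos 5 / 1) :+ con (pos 10 / 1) :* j :+ j) := con (pos 7 / 10) :+ con (pos 31 / 25) :* j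

ringᵠ₁₄₉ : ∀ j c s → 1ℚ + (1ℚ + (j - c)) - s * (pos 3 / 1 + pos 6 / 1 * j) - s * s * (pos 5 / 1 + pos 10 / 1 * j + (j - c)) ≡ j * (1ℚ - pos 6 / 1 * s - pos 11 / 1 * (s * s)) + (2ℚ - c - pos 3 / 1 * s - pos 5 / 1 * (s * s) + c * (s * s))
ringᵠ₁₄₉ = solveᵠ 3 λ j c s → con 1ℚ :+ (con 1ℚ :+ (j :- c)) :- s :* (con (pos 3 / 1) :+ con (pos 6 / 1) :* j) :- s :* s :* (con (pos 5 / 1) :+ con (pos 10 / 1) :* j :+ (j :- c)) := j :* (con 1ℚ :- con (pos 6 / 1) :* s :- con (pos 11 / 1) :* (s :* s)) :+ (con 2ℚ :- c :- con (pos 3 / 1) :* s :- con (pos 5 / 1) :* (s :* s) :+ c :* (s :* s))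

ringᵠ₁₅₀ : ∀ c s t → 2ℚ - c - pos 3 / 1 * s - pos 5 / 1 * t + c * t - (- (c + pos 10 / 1)) ≡ pos 4 / 1 + pos 3 / 1 * (1ℚ - s) + pos 5 / 1 * (1ℚ - t) + c * t
ringᵠ₁₅₀ = solveᵠ 3 λ c s t → con 2ℚ :- c :- con (pos 3 / 1) :* s :- con (pos 5 / 1) :* t :+ c :* t :- (:- (c :+ con (pos 10 / 1))) := con (pos 4 / 1) :+ con (pos 3 / 1) :* (con 1ℚ :- s) :+ con (pos 5 / 1) :* (con 1ℚ :- t) :+ c :* t

ringᵠ₁₅₁ : ∀ c s t → c + pos 10 / 1 - (2ℚ - c - pos 3 / 1 * s - pos 5 / 1 * t + c * t) ≡ pos 8 / 1 + c + pos 3 / 1 * s + pos 5 / 1 * t + c * (1ℚ - t)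
ringᵠ₁₅₁ = solveᵠ 3 λ c s t → c :+ con (pos 10 / 1) :- (con 2ℚ :- c :- con (pos 3 / 1) :* s :- con (pos 5 / 1) :* t :+ c :* t) := con (pos 8 / 1) :+ c :+ con (pos 3 / 1) :* s :+ con (pos 5 / 1) :* t :+ c :* (con 1ℚ :- t)

ringᵠ₁₅₂ : ∀ η j → η * (pos 3 / 1 + pos 6 / 1 * j) - (j * η + pos 5 / 1 * η * j) ≡ pos 3 / 1 * η
ringᵠ₁₅₂ = solveᵠ 2 λ η j → η :* (con (pos 3 / 1) :+ con (pos 6 / 1) :* j) :- (j :* η :+ con (pos 5 / 1) :* η :* j) := con (pos 3 / 1) :* η

ringᵠ₁₅₃ : ∀ y → y * (pos 1 / 4) - pos 1 / 4 ≡ pos 1 / 4 * (y - 1ℚ)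
ringᵠ₁₅₃ = solveᵠ 1 λ y → y :* con (pos 1 / 4) :- con (pos 1 / 4) := con (pos 1 / 4) :* (y :- con 1ℚ)

ringᵠ₁₅₄ : ∀ c y e t → c - y * (pos 1 / 4) ≡ (c - y * e - (- (t * y))) + y * (e - ½) + y * (pos 1 / 4 - t)
ringᵠ₁₅₄ = solveᵠ 4 λ c y e t → c :- y :* con (pos 1 / 4) := c :- y :* e :- (:- (t :* y)) :+ y :* (e :- con ½) :+ y :* (con (pos 1 / 4) :- t)

ringˢ₉₃ : ∀ a y t n x f → one ⊛ ((a ⊛ y) ⊛ ((κ 0ℚ ⊛ t ⊖ n ⊛ x) ⊛ f)) ≈ x ⊛ (n ⊛ ((a ⊛ (⊝ f)) ⊛ y))
ringˢ₉₃ = solveˢ 6 (λ a y t n x f → con 1ℚ :* ((a :* y) :* ((con 0ℚ :* t :- n :* x) :* f)) := x :* (n :* ((a :* (:- f)) :* y)))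

-- `Φ` at 0 is n times a coefficient of T^A (-f) R^(J+1). As R is even and J = 2j, only the even
-- part of T^A (-f) matters, and the ratio asymptotics replaces the convolution by the mean of its
-- values at x and -x. A large A makes (1 + x)^A dominate (1 - x)^A.
module Origin (n j A L i₀ : ℕ) (r x δ η : ℚ)
  (ej : j ≡ A ℕ.+ 12 ℕ.+ (L ℕ.+ i₀))
  (n>0 : 0ℚ < ι n)
  (r≥0 : 0ℚ ≤ r) (r≤ : r ≤ pos 1 / 120) (x≥ : pos 1 / 4 ≤ x) (x≤ : x ≤ pos 2 / 5)
  (hδ : δ ≤ - evalQ (fL r) x) (hA : pos 12 / 1 ≤ δ * ι A) (δ≥0 : 0ℚ ≤ δ)
  (η≥0 : 0ℚ ≤ η) (hx : Ab (1ℚ - pos 6 / 1 * (x * x) - pos 11 / 1 * (x * x * (x * x))) η)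
  (hε : ι (A ℕ.+ 12) * ((½ ^ L + 2ℚ * η) * Sabs (A ℕ.+ 12) (Ev (pˢ A r))) ≤ pos 1 / 4)
  (hj : ι (A ℕ.+ 12 ℕ.+ L) + pos 10 / 1 ≤ pos 5 / 1 * η * ι j)
  where

  private
    x≥0 : 0ℚ ≤ x
    x≥0 = ≤-trans (lit≤ {0ℚ} {pos 1 / 4}) x≥
    D N J m : ℕ
    D = A ℕ.+ 12
    J = 2 ℕ.* j
    N = suc J
    m = L ℕ.+ i₀
    s* ε S Eₚ : ℚ
    s* = x * x
    ε = ½ ^ L + 2ℚ * η
    p y Y : PS
    p = pˢ A r
    Y = R ^ˢ N
    y = Ev Y
    S = Sabs D (Ev p)
    Eₚ = pev D (Ev p) s*

    s*≥0 : 0ℚ ≤ s*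
    s*≥0 = 0≤* x≥0 x≥0
    s*≤ : s* ≤ pos 4 / 25
    s*≤ = *-mono {x} {pos 2 / 5} {x} {pos 2 / 5} x≥0 x≤ x≥0 x≤
    s*≤1 : s* ≤ 1ℚ
    s*≤1 = ≤-trans {s*} {pos 4 / 25} s*≤ lit≤

    y≥0 : ∀ i → 0ℚ ≤ y i
    y≥0 i = NN-^ {R} N NN-R (i ℕ.+ i)

    full : ∀ z → pev (suc (D ℕ.+ D)) p z ≡ (1ℚ + z) ^ A * (- evalQ (fL r) z)
    full z = trans (cong (λ k → pev k p z) (sym (ℕₚ.+-suc D D))) (trans (pev-deg D (suc D) p z (Deg-pˢ A r)) (pev-pˢ A r z))

    -- By Bernoulli the value at x is at least δ + x δ A ≥ 3, using x ≥ 1/4 and δ A ≥ 12, while the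
    -- value at -x is at least -2.
    Eₚ≥½ : ½ ≤ Eₚ
    Eₚ≥½ = *-cancelˡ {½} {Eₚ} {2ℚ} lit< (≤-trans {2ℚ * ½} {δ + x * (δ * ι A) - 2ℚ} lower (≤-trans (by≤ bern (0≤* (≤⇒0≤- (bernoulli x A x≥0)) δ≥0)) (≤-trans upper (≤-reflexive (sym double)))))
      where
      O : ℚ
      O = pev D (Od p) s*
      gx g-x : ℚ
      gx = - evalQ (fL r) x
      g-x = - evalQ (fL r) (- x)
      double : 2ℚ * Eₚ ≡ (1ℚ + x) ^ A * gx + (1ℚ + - x) ^ A * g-x
      double = trans (ringᵠ₁₄₁ Eₚ x O) (cong₂ _+_ (trans (sym (pev-split D p x)) (full x))
        (trans (cong (λ z → pev D (Ev p) z + (- x) * pev D (Od p) z) (sym (ringᵠ₉₆ x))) (trans (sym (pev-split D p (- x))) (full (- x)))))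
      lower : 2ℚ * ½ ≤ δ + x * (δ * ι A) - 2ℚ
      lower = by≤ {2ℚ * ½} {δ + x * (δ * ι A) - 2ℚ} (ringᵠ₁₄₂ δ x (δ * ι A)) (0≤+ (0≤+ δ≥0 (0≤* (≤⇒0≤- x≥) (≤-trans (lit≤ {0ℚ} {pos 12 / 1}) hA))) (0≤* {pos 1 / 4} lit≤ (≤⇒0≤- hA)))
      bern : (1ℚ + x) ^ A * δ - 2ℚ - (δ + x * (δ * ι A) - 2ℚ) ≡ ((1ℚ + x) ^ A - (1ℚ + ι A * x)) * δ
      bern = ringᵠ₁₄₃ ((1ℚ + x) ^ A) δ x (ι A)
      1-x≥0 : 0ℚ ≤ 1ℚ + - x
      1-x≥0 = ≤⇒0≤- {x} {1ℚ} (≤-trans {x} {pos 2 / 5} x≤ lit≤)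
      1-x≤1 : 1ℚ + - x ≤ 1ℚ
      1-x≤1 = by≤ {1ℚ + - x} {1ℚ} (ringᵠ₁₃₈ x) x≥0
      q-part : - 2ℚ ≤ (1ℚ + - x) ^ A * g-x
      q-part = by≤ { - 2ℚ} {(1ℚ + - x) ^ A * g-x} (ringᵠ₁₄₄ ((1ℚ + - x) ^ A) (evalQ (fL r) (- x))) (0≤+ (0≤* {c} {2ℚ - evalQ (fL r) (- x)} (^-nonneg A 1-x≥0) (≤⇒0≤- (evalQ-neg≤2 r x r≥0 r≤ x≥0 x≤))) (0≤* {2ℚ} lit≤ (≤⇒0≤- (^-≤1 A 1-x≥0 1-x≤1))))
        where
        c : ℚ
        c = (1ℚ + - x) ^ A
      upper : (1ℚ + x) ^ A * δ - 2ℚ ≤ (1ℚ + x) ^ A * gx + (1ℚ + - x) ^ A * g-x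
      upper = +-mono-≤ {(1ℚ + x) ^ A * δ} {(1ℚ + x) ^ A * gx} { - 2ℚ} {(1ℚ + - x) ^ A * g-x} (*-monoˡ {δ} {gx} {(1ℚ + x) ^ A} (^-nonneg A (0≤+ 0≤1 x≥0)) hδ) q-part

    N≡ : ι N ≡ 1ℚ + 2ℚ * ι j
    N≡ = trans (ι-suc J) (cong (1ℚ +_) (ι-* 2 j))
    α β : ℚ
    α = pos 3 / 1 * ι N
    β = pos 5 / 1 * ι N

    αj : α ≡ pos 3 / 1 + pos 6 / 1 * ι j
    αj = trans (cong (pos 3 / 1 *_) N≡) (ringᵠ₁₄₅ (ι j))
    βj : β ≡ pos 5 / 1 + pos 10 / 1 * ι j
    βj = trans (cong (pos 5 / 1 *_) N≡) (ringᵠ₁₄₆ (ι j))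

    hα : ι (suc (suc j)) ≤ α
    hα = subst (ι (suc (suc j)) ≤_) (sym αj) (by≤ (trans (cong (λ z → pos 3 / 1 + pos 6 / 1 * ι j - z) (trans (ι-suc (suc j)) (cong (1ℚ +_) (ι-suc j)))) (ringᵠ₁₄₇ (ι j))) (0≤+ 0≤1 (0≤* {pos 5 / 1} lit≤ (ι-nonneg j))))

    hs : s* * (β + ι j) ≤ ½ * α
    hs = ≤-trans (*-monoʳ {s*} {pos 4 / 25} {β + ι j} (0≤+ (0≤* {pos 5 / 1} lit≤ (ι-nonneg N)) (ι-nonneg j)) s*≤) (by≤ (trans (cong₂ (λ a b → ½ * a - pos 4 / 25 * (b + ι j)) αj βj) (ringᵠ₁₄₈ (ι j))) (0≤+ {pos 7 / 10} lit≤ (0≤* {pos 31 / 25} lit≤ (ι-nonneg j))))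

    -- For i within a bounded distance of j, α is about 6j and β + i about 11j, so x² is nearly
    -- fixed as soon as 6x² + 11x⁴ is nearly 1.
    hη : ∀ i → i₀ ℕ.≤ i → i ℕ.≤ j → Ab (ι (suc (suc i)) - s* * α - s* * s* * (β + ι i)) (η * α)
    hη i lo hi = sub (ℕₚ.m≤n⇒∃[o]m+o≡n hi)
      where
      sub : (∃ λ c → i ℕ.+ c ≡ j) → Ab (ι (suc (suc i)) - s* * α - s* * s* * (β + ι i)) (η * α)
      sub (c , ec) = subst (λ z → Ab z (η * α)) (sym expr) (Ab-mono {ι j * q + w} bnd (Ab-+ {ι j * q} {w} {ι j * η} (Ab-scale {q} {η} {ι j} (ι-nonneg j) hx) w-bd))
        where
        q w : ℚ
        q = 1ℚ - pos 6 / 1 * s* - pos 11 / 1 * (s* * s*)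
        w = 2ℚ - ι c - pos 3 / 1 * s* - pos 5 / 1 * (s* * s*) + ι c * (s* * s*)
        ij : ι i ≡ ι j - ι c
        ij = trans (ringᵠ₈₉ (ι i) (ι c)) (cong (_- ι c) (trans (sym (ι-+ i c)) (cong ι ec)))
        expr : ι (suc (suc i)) - s* * α - s* * s* * (β + ι i) ≡ ι j * q + w
        expr = trans (cong (λ z → z - s* * α - s* * s* * (β + ι i)) (trans (ι-suc (suc i)) (cong (1ℚ +_) (ι-suc i)))) (trans (cong₂ (λ a b → 1ℚ + (1ℚ + ι i) - s* * a - s* * s* * (b + ι i)) αj βj)
          (trans (cong (λ z → 1ℚ + (1ℚ + z) - s* * (pos 3 / 1 + pos 6 / 1 * ι j) - s* * s* * (pos 5 / 1 + pos 10 / 1 * ι j + z)) ij) (ringᵠ₁₄₉ (ι j) (ι c) s*)))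
        s²≥0 : 0ℚ ≤ s* * s*
        s²≥0 = 0≤* s*≥0 s*≥0
        s²≤1 : s* * s* ≤ 1ℚ
        s²≤1 = *-mono {s*} {1ℚ} {s*} {1ℚ} s*≥0 s*≤1 s*≥0 s*≤1
        w-bd : Ab w (ι c + pos 10 / 1)
        w-bd = by≤ { - (ι c + pos 10 / 1)} {w} (ringᵠ₁₅₀ (ι c) s* (s* * s*)) (0≤+ (0≤+ (0≤+ {pos 4 / 1} lit≤ (0≤* {pos 3 / 1} lit≤ (≤⇒0≤- s*≤1))) (0≤* {pos 5 / 1} lit≤ (≤⇒0≤- s²≤1))) (0≤* (ι-nonneg c) s²≥0))
             , by≤ {w} {ι c + pos 10 / 1} (ringᵠ₁₅₁ (ι c) s* (s* * s*)) (0≤+ (0≤+ (0≤+ (0≤+ {pos 8 / 1} lit≤ (ι-nonneg c)) (0≤* {pos 3 / 1} lit≤ s*≥0)) (0≤* {pos 5 / 1} lit≤ s²≥0)) (0≤* (ι-nonneg c) (≤⇒0≤- s²≤1)))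
        c≤ : c ℕ.≤ D ℕ.+ L
        c≤ = ℕₚ.+-cancelʳ-≤ i c (D ℕ.+ L) (ℕₚ.≤-trans (ℕₚ.≤-reflexive (trans (ℕₚ.+-comm c i) (trans ec (trans ej (sym (ℕₚ.+-assoc D L i₀)))))) (ℕₚ.+-monoʳ-≤ (D ℕ.+ L) lo))
        bnd : ι j * η + (ι c + pos 10 / 1) ≤ η * α
        bnd = ≤-trans (+-mono-≤ {ι j * η} {ι j * η} {ι c + pos 10 / 1} {pos 5 / 1 * η * ι j} ≤-refl (≤-trans (+-mono-≤ {ι c} {ι (D ℕ.+ L)} {pos 10 / 1} {pos 10 / 1} (ι-mono c≤) ≤-refl) hj))
          (by≤ (trans (cong (λ z → η * z - (ι j * η + pos 5 / 1 * η * ι j)) αj) (ringᵠ₁₅₂ η (ι j))) (0≤* {pos 3 / 1} lit≤ η≥0))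

    α>0 : 0ℚ < α
    α>0 = 0<* {pos 3 / 1} {ι N} lit< (ι-pos J)

    open Contraction y α β s* η (R^-rec N) y≥0 i₀ j α>0 (0≤* {pos 5 / 1} lit≤ (ι-nonneg N)) s*≥0 s*≤1 η≥0 hα hs hη

    ε≥0 : 0ℚ ≤ ε
    ε≥0 = 0≤+ (^-nonneg {½} L lit≤) (0≤* {2ℚ} lit≤ η≥0)

    D+m≡j : D ℕ.+ m ≡ j
    D+m≡j = sym ej

    ap : ∀ i → m ℕ.≤ i → i ℕ.< D ℕ.+ m → Ab (y i - s* * y (suc i)) (ε * y (suc i))
    ap i lo hi = sub (ℕₚ.m≤n⇒∃[o]m+o≡n lo)
      where
      sub : (∃ λ l → m ℕ.+ l ≡ i) → Ab (y i - s* * y (suc i)) (ε * y (suc i))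
      sub (l , el) = Ab-mono {y i - s* * y (suc i)} (*-monoʳ {εₗ (L ℕ.+ l)} {ε} {y (suc i)} (y≥0 (suc i)) (≤-trans (εₗ-bound (L ℕ.+ l)) (+-mono-≤ {½ ^ (L ℕ.+ l)} {½ ^ L} {2ℚ * η} {2ℚ * η} (½^-anti L l) ≤-refl)))
        (subst (λ z → Ab (y z - s* * y (suc z)) (εₗ (L ℕ.+ l) * y (suc z))) idx (approx (L ℕ.+ l) (subst (ℕ._≤ j) (sym idx) (ℕₚ.≤-trans (ℕₚ.<⇒≤ hi) (ℕₚ.≤-reflexive D+m≡j)))))
        where
        idx : i₀ ℕ.+ (L ℕ.+ l) ≡ i
        idx = trans (trans (sym (ℕₚ.+-assoc i₀ L l)) (cong (ℕ._+ l) (ℕₚ.+-comm i₀ L))) el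

    mono' : ∀ i → m ℕ.≤ i → i ℕ.< D ℕ.+ m → y i ≤ y (suc i)
    mono' i lo hi = mono i (ℕₚ.≤-trans (ℕₚ.<⇒≤ hi) (ℕₚ.≤-trans (ℕₚ.≤-reflexive D+m≡j) (ℕₚ.n≤1+n j)))

    y≥1 : ∀ i → i ℕ.≤ suc (suc j) → 1ℚ ≤ y i
    y≥1 zero _ = ≤-reflexive (sym (Rec.y₀ (R^-rec N)))
    y≥1 (suc i) (s≤s le) = ≤-trans (y≥1 i (ℕₚ.≤-trans le (ℕₚ.n≤1+n (suc j)))) (mono i le)

    conv>0 : 0ℚ < (Ev p ⊛ y) j
    conv>0 = ℚₚ.<-≤-trans {0ℚ} {pos 1 / 4} lit< (≤-trans {pos 1 / 4} {y j * (pos 1 / 4)} (by≤ {pos 1 / 4} {y j * (pos 1 / 4)} (ringᵠ₁₅₃ (y j)) (0≤* {pos 1 / 4} lit≤ (≤⇒0≤- (y≥1 j (ℕₚ.m≤n+m j 2)))))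
      (by≤ {y j * (pos 1 / 4)} {(Ev p ⊛ y) j} (ringᵠ₁₅₄ ((Ev p ⊛ y) j) (y j) Eₚ (ι D * (ε * S)))
        (0≤+ (0≤+ (≤⇒0≤- (proj₁ cv)) (0≤* (y≥0 j) (≤⇒0≤- Eₚ≥½))) (0≤* (y≥0 j) (≤⇒0≤- hε)))))
      where
      Deg-Ev : Deg≤ D (Ev p)
      Deg-Ev i q = Deg-pˢ A r (i ℕ.+ i) (ℕₚ.<-≤-trans q (ℕₚ.m≤m+n i i))
      cv : Ab ((Ev p ⊛ y) j - y j * Eₚ) (ι D * (ε * S) * y j)
      cv = subst (λ z → Ab ((Ev p ⊛ y) z - y z * Eₚ) (ι D * (ε * S) * y z)) D+m≡j (conv-approx y s* ε s*≥0 s*≤1 ε≥0 y≥0 D m (Ev p) Deg-Ev ap mono')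

  Φ₀-positive : 0ℚ < Φ n (2 ℕ.* j) A r 0
  Φ₀-positive = by0< eq (0<* n>0 conv>0)
    where
    open ≡-Reasoning
    eq : Φ n J A r 0 ≡ ι n * (Ev p ⊛ y) j
    eq = begin
      (one ⊛ ((T ^ˢ A ⊛ Y) ⊛ ((κ (ι 0) ⊛ T ⊖ κ (ι n) ⊛ X) ⊛ fˢ r))) (suc J) ≡⟨ at (ringˢ₉₃ (T ^ˢ A) Y T (κ (ι n)) X (fˢ r)) (suc J) ⟩
      (X ⊛ (κ (ι n) ⊛ (p ⊛ Y))) (suc J) ≡⟨ X⊛-suc (κ (ι n) ⊛ (p ⊛ Y)) J ⟩
      (κ (ι n) ⊛ (p ⊛ Y)) J ≡⟨ κ⊛ (ι n) (p ⊛ Y) J ⟩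
      ι n * (p ⊛ Y) J ≡⟨ cong (ι n *_) (trans (cong (p ⊛ Y) (cong (j ℕ.+_) (ℕₚ.+-identityʳ j))) (⊛-Ev p Y (Even-^ {R} N Even-R) j)) ⟩
      ι n * (Ev p ⊛ y) j ∎

-- The polynomial of the theorem

hornerE : List ℤ.ℤ → Expr → Expr
hornerE [] e = lit (pos 0)
hornerE (a ∷ l) e = lit a ⊹ e ✶ hornerE l e

evalE-horner : ∀ l e x → evalE (hornerE l e) x ≡ evalL l (evalE e x)
evalE-horner [] e x = refl
evalE-horner (a ∷ l) e x = cong (λ z → zq a + evalE e x * z) (evalE-horner l e x)

-- Homogenisation: a list of d + 1 coefficients gives a form of degree d in a and b. `evalE-hom`
-- multiplies by one more b because it counts by the length of the list.
homE : List ℤ.ℤ → Expr → Expr → Expr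
homE [] a b = lit (pos 0)
homE (c ∷ l) a b = lit c ✶ b ↑ Data.List.length l ⊹ a ✶ homE l a b

ringᵠ₁₅₅ : ∀ b → 0ℚ * b ≡ 1ℚ * 0ℚ
ringᵠ₁₅₅ = solveᵠ 1 λ b → con 0ℚ :* b := con 1ℚ :* con 0ℚ

ringᵠ₁₅₆ : ∀ c w a h b → (c * w + a * h) * b ≡ c * (w * b) + a * (h * b)
ringᵠ₁₅₆ = solveᵠ 5 λ c w a h b → (c :* w :+ a :* h) :* b := c :* (w :* b) :+ a :* (h :* b)

ringᵠ₁₅₇ : ∀ c w b q l → c * (w * b) + b * q * (w * l) ≡ b * w * (c + q * l)
ringᵠ₁₅₇ = solveᵠ 5 λ c w b q l → c :* (w :* b) :+ b :* q :* (w :* l) := b :* w :* (c :+ q :* l)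

evalE-hom : ∀ l a b x q → evalE a x ≡ evalE b x * q →
  evalE (homE l a b) x * evalE b x ≡ evalE b x ^ Data.List.length l * evalL l q
evalE-hom [] a b x q e = ringᵠ₁₅₅ (evalE b x)
evalE-hom (c ∷ l) a b x q e = trans (ringᵠ₁₅₆ (zq c) (evalE b x ^ Data.List.length l) (evalE a x) (evalE (homE l a b) x) (evalE b x))
  (trans (cong₂ (λ s t → zq c * (evalE b x ^ Data.List.length l * evalE b x) + s * t) e (evalE-hom l a b x q e))
    (ringᵠ₁₅₇ (zq c) (evalE b x ^ Data.List.length l) (evalE b x) q (evalL l q)))

evalL-mono : ∀ {l} → All (pos 0 ℤ.≤_) l → ∀ {a b} → 0ℚ ≤ a → a ≤ b → evalL l a ≤ evalL l b
evalL-mono [] p q = ≤-refl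
evalL-mono {c ∷ l} (_ ∷ cs) {a} {b} p q =
  +-mono-≤ {zq c} {zq c} {a * evalL l a} {b * evalL l b} ≤-refl (*-mono p q (evalL-nonneg cs p) (evalL-mono cs p q))

evalL-mono-tail : ∀ c {l} → All (pos 0 ℤ.≤_) l → ∀ {a b} → 0ℚ ≤ a → a ≤ b → evalL (c ∷ l) a ≤ evalL (c ∷ l) b
evalL-mono-tail c {l} cs {a} {b} p q =
  +-mono-≤ {zq c} {zq c} {a * evalL l a} {b * evalL l b} ≤-refl (*-mono p q (evalL-nonneg cs p) (evalL-mono cs p q))

-- A Lipschitz constant on [0, 1] when all coefficients but the constant one are nonnegative, from
-- (c + x q)' = q + x q' ≤ q(1) + x q'.
lipL : List ℤ.ℤ → ℚ
lipL [] = 0ℚ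
lipL (c ∷ l) = evalL l 1ℚ + lipL l

lipL-nonneg : ∀ {l} → All (pos 0 ℤ.≤_) l → 0ℚ ≤ lipL l
lipL-nonneg [] = ≤-refl
lipL-nonneg (_ ∷ cs) = 0≤+ (evalL-nonneg cs 0≤1) (lipL-nonneg cs)

ringᵠ₁₅₈ : ∀ c a b → c + b * 0ℚ ≡ c + a * 0ℚ + (0ℚ + 0ℚ) * (b - a)
ringᵠ₁₅₈ = solveᵠ 3 λ c a b → c :+ b :* con 0ℚ := c :+ a :* con 0ℚ :+ (con 0ℚ :+ con 0ℚ) :* (b :- a)

ringᵠ₁₅₉ : ∀ c a b s t o k → c + a * s + (o + k) * (b - a) - (c + b * t) ≡ (b - a) * (o - t) + (a * (s + k * (b - a) - t) + k * ((b - a) * (1ℚ - a)))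
ringᵠ₁₅₉ = solveᵠ 7 λ c a b s t o k → c :+ a :* s :+ (o :+ k) :* (b :- a) :- (c :+ b :* t) := (b :- a) :* (o :- t) :+ (a :* (s :+ k :* (b :- a) :- t) :+ k :* ((b :- a) :* (con 1ℚ :- a)))

evalL-lipschitz : ∀ c {l} → All (pos 0 ℤ.≤_) l → ∀ {a b} → 0ℚ ≤ a → a ≤ b → b ≤ 1ℚ →
  evalL (c ∷ l) b ≤ evalL (c ∷ l) a + lipL (c ∷ l) * (b - a)
evalL-lipschitz c [] {a} {b} p q r = ≤-reflexive (ringᵠ₁₅₈ (zq c) a b)
evalL-lipschitz c {d ∷ l} cs@(_ ∷ ds) {a} {b} p q r = by≤ (ringᵠ₁₅₉ (zq c) a b (evalL (d ∷ l) a) (evalL (d ∷ l) b) (evalL (d ∷ l) 1ℚ) (lipL (d ∷ l)))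
  (0≤+ (0≤* (≤⇒0≤- q) (≤⇒0≤- (evalL-mono cs (≤-trans p q) r)))
    (0≤+ (0≤* p (≤⇒0≤- (evalL-lipschitz d ds p q r))) (0≤* (lipL-nonneg cs) (0≤* (≤⇒0≤- q) (≤⇒0≤- (≤-trans q r))))))

-- 6¹⁶ poly ((5 + u) / 6) as a polynomial in u, whose only negative coefficient is the constant one.
Pᵤ⁺ Pᵤ : List ℤ.ℤ
Pᵤ⁺ = pos 25576440880 ∷ pos 412782009288 ∷ pos 2502754225040 ∷ pos 5746024669252 ∷ pos 7315353928560 ∷ pos 5371287686552 ∷ pos 2795847718480 ∷ pos 969045058962 ∷ pos 216779424400 ∷ pos 31416114488 ∷ pos 2946702000 ∷ pos 174436900 ∷ pos 6092240 ∷ pos 109032 ∷ pos 880 ∷ pos 11 ∷ []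
Pᵤ = -[1+ 5449860 ] ∷ Pᵤ⁺

Pᵤ⁺-nonneg : All (pos 0 ℤ.≤_) Pᵤ⁺
Pᵤ⁺-nonneg = toWitness {a? = nonneg-coeffs? Pᵤ⁺} tt

polyE : Expr
polyE = lit (pos 11) ✶ var ↑ 16 ⊹ lit (pos 2112) ✶ var ↑ 14 ⊹ neg (lit (pos 8525) ✶ var ↑ 12)
  ⊹ lit (pos 15048) ✶ var ↑ 10 ⊹ neg (lit (pos 15218) ✶ var ↑ 8) ⊹ lit (pos 9552) ✶ var ↑ 6
  ⊹ neg (lit (pos 3718) ✶ var ↑ 4) ⊹ lit (pos 828) ✶ var ↑ 2 ⊹ neg (lit (pos 81))

pw≡^ : ∀ y k → pw y k ≡ y ^ k
pw≡^ y zero = refl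
pw≡^ y (suc k) = cong (y *_) (pw≡^ y k)

ringᵠ₁₆₀ : ∀ a b c d e f g h i → a + b - c + d - e + f - g + h - i ≡ a + b + (- 1ℚ) * c + d + (- 1ℚ) * e + f + (- 1ℚ) * g + h + (- 1ℚ) * i
ringᵠ₁₆₀ = solveᵠ 9 λ a b c d e f g h i → a :+ b :- c :+ d :- e :+ f :- g :+ h :- i := a :+ b :+ (:- con 1ℚ) :* c :+ d :+ (:- con 1ℚ) :* e :+ f :+ (:- con 1ℚ) :* g :+ h :+ (:- con 1ℚ) :* i

poly≡polyE : ∀ y → poly y ≡ evalE polyE y
poly≡polyE y = trans
  (cong₂ _-_ (cong₂ _+_ (cong₂ _-_ (cong₂ _+_ (cong₂ _-_ (cong₂ _+_ (cong₂ _-_ (cong₂ _+_ (c (pos 11) 16) (c (pos 2112) 14)) (c (pos 8525) 12)) (c (pos 15048) 10)) (c (pos 15218) 8)) (c (pos 9552) 6)) (c (pos 3718) 4)) (c (pos 828) 2)) (refl {x = zq (pos 81)}))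
  (ringᵠ₁₆₀ (zq (pos 11) * y ^ 16) (zq (pos 2112) * y ^ 14) (zq (pos 8525) * y ^ 12) (zq (pos 15048) * y ^ 10) (zq (pos 15218) * y ^ 8) (zq (pos 9552) * y ^ 6) (zq (pos 3718) * y ^ 4) (zq (pos 828) * y ^ 2) (zq (pos 81)))
  where
  c : ∀ z k → zq z * pw y k ≡ zq z * y ^ k
  c z k = cong (zq z *_) (pw≡^ y k)

Pᵤ-poly : ∀ y → evalL Pᵤ (zq -[1+ 4 ] + zq (pos 6) * y) ≡ zq (pos 2821109907456) * poly y
Pᵤ-poly y = trans (sym (evalE-horner Pᵤ (lit -[1+ 4 ] ⊹ lit (pos 6) ✶ var) y))
  (trans (poly-identity (hornerE Pᵤ (lit -[1+ 4 ] ⊹ lit (pos 6) ✶ var)) (lit (pos 2821109907456) ✶ polyE) y)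
    (cong (zq (pos 2821109907456) *_) (sym (poly≡polyE y))))

Pᵤ-small : ∀ {u} → 0ℚ ≤ u → evalL Pᵤ u < 0ℚ → u ≤ pos 1 / 2500
Pᵤ-small {u} p q = case (ℚₚ.≤-total u (pos 1 / 2500))
  where
  pos-at : 0ℚ ≤ evalL Pᵤ (pos 1 / 2500)
  pos-at = toWitness {a? = 0ℚ ≤? evalL Pᵤ (pos 1 / 2500)} tt
  case : u ≤ pos 1 / 2500 ⊎ pos 1 / 2500 ≤ u → u ≤ pos 1 / 2500
  case (inj₁ h) = h
  case (inj₂ h) = ⊥-elim (ℚₚ.<-irrefl refl (ℚₚ.≤-<-trans (≤-trans pos-at (evalL-mono-tail -[1+ 5449860 ] Pᵤ⁺-nonneg {pos 1 / 2500} {u} lit≤ h)) q))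

-- With 6σ + 10σ² = (1 - σ²) u and σ = τ², the polynomial factors over ℤ[τ].
mL Qᵤ : List ℤ.ℤ
mL = pos 1 ∷ -[1+ 22 ] ∷ pos 33 ∷ -[1+ 22 ] ∷ pos 1 ∷ []
Qᵤ = -[1+ 5449860 ] ∷ -[1+ 96638255 ] ∷ -[1+ 862248535 ] ∷ -[1+ 4209327503 ] ∷ -[1+ 11563817355 ] ∷ -[1+ 16722087983 ] ∷ -[1+ 6028099687 ] ∷ pos 19954131696 ∷ pos 34772107682 ∷ pos 19954131696 ∷ -[1+ 6028099687 ] ∷ -[1+ 16722087983 ] ∷ -[1+ 11563817355 ] ∷ -[1+ 4209327503 ] ∷ -[1+ 862248535 ] ∷ -[1+ 96638255 ] ∷ -[1+ 5449860 ] ∷ []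

σE ℓE ωE TE : Expr
σE = var ✶ var
ℓE = lit (pos 6) ✶ σE ⊹ lit (pos 10) ✶ (σE ✶ σE)
ωE = lit (pos 1) ⊹ neg (σE ✶ σE)
TE = (lit (pos 1) ⊹ var) ↑ 4

-- With λ = 8τ(1 + τ²)/(1 + τ)⁴, which is U⁴/T⁴ at t = τ, `M⁺` is (1 + τ)¹⁶ m(λ), and `M⁻` arises
-- from it by τ ↦ -τ. The quartic m vanishes at V⁴/T⁴ for t = t₀, so the sign of `M⁺` compares the
-- two saddle points.
M⁺ M⁻ : Expr
M⁺ = homE mL (lit (pos 8) ✶ var ✶ (lit (pos 1) ⊹ var ✶ var)) TE
M⁻ = homE mL (lit -[1+ 7 ] ✶ var ✶ (lit (pos 1) ⊹ var ✶ var)) ((lit (pos 1) ⊹ neg var) ↑ 4)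

Pᵤ-factor : ∀ τ → evalE (homE Pᵤ ℓE ωE) τ ≡ evalE (M⁺ ✶ (M⁻ ✶ hornerE Qᵤ σE)) τ
Pᵤ-factor = poly-identity (homE Pᵤ ℓE ωE) (M⁺ ✶ (M⁻ ✶ hornerE Qᵤ σE))

ringᵠ₁₆₁ : ∀ K → 0ℚ - (- (2ℚ * K)) ≡ 2ℚ * K
ringᵠ₁₆₁ = solveᵠ 1 λ K → con 0ℚ :- (:- (con 2ℚ :* K)) := con 2ℚ :* K

ringᵠ₁₆₂ : ∀ K x → 2ℚ * K - (K + x * (2ℚ * K)) ≡ 2ℚ * K * (½ - x)
ringᵠ₁₆₂ = solveᵠ 2 λ K x → con 2ℚ :* K :- (K :+ x :* (con 2ℚ :* K)) := con 2ℚ :* K :* (con ½ :- x)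

evalL-bounded : ∀ (K : ℚ) → 0ℚ ≤ K → ∀ {l} → All (λ a → Ab (zq a) K) l → ∀ {x} → 0ℚ ≤ x → x ≤ ½ → Ab (evalL l x) (2ℚ * K)
evalL-bounded K K≥0 [] p q = by≤ (ringᵠ₁₆₁ K) (0≤* {2ℚ} lit≤ K≥0) , 0≤* {2ℚ} lit≤ K≥0
evalL-bounded K K≥0 {a ∷ l} (b ∷ bs) {x} p q = Ab-mono {zq a + x * evalL l x}
  (by≤ (ringᵠ₁₆₂ K x) (0≤* (0≤* {2ℚ} lit≤ K≥0) (≤⇒0≤- q)))
  (Ab-+ {zq a} {x * evalL l x} {K} {x * (2ℚ * K)} b (Ab-scale {evalL l x} {2ℚ * K} {x} p (evalL-bounded K K≥0 bs p q)))

Ab? : ∀ x c → Dec (Ab x c)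
Ab? x c = (- c ≤? x) ×-dec (x ≤? c)

ringᵠ₁₆₃ : ∀ s t k → - (zq -[1+ 5449860 ] + s * t) - (pos 5449861 / 1 - pos 1 / 14400 * k) ≡ s * (k - t) + (pos 1 / 14400 - s) * k
ringᵠ₁₆₃ = solveᵠ 3 λ s t k → (:- (con (zq -[1+ 5449860 ]) :+ s :* t)) :- (con (pos 5449861 / 1) :- con (pos 1 / 14400) :* k) := s :* (k :- t) :+ (con (pos 1 / 14400) :- s) :* k

-- The constant term -5449861 prevails: the other coefficients are below 35·10⁹ in absolute value,
-- and 2 · 35·10⁹ / 14400 is less than 5449861.
Qᵤ-negative : ∀ {σ} → 0ℚ ≤ σ → σ ≤ pos 1 / 14400 → 0ℚ < - evalL Qᵤ σ
Qᵤ-negative {σ} p q = ℚₚ.<-≤-trans {0ℚ} {pos 5449861 / 1 - pos 1 / 14400 * (2ℚ * K)} lit<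
  (by≤ (ringᵠ₁₆₃ σ t (2ℚ * K)) (0≤+ (0≤* p (≤⇒0≤- {t} {2ℚ * K} (proj₂ bd))) (0≤* (≤⇒0≤- q) (0≤* {2ℚ} {K} lit≤ lit≤))))
  where
  K t : ℚ
  K = pos 35000000000 / 1
  t = evalL (Data.List.drop 1 Qᵤ) σ
  bd : Ab t (2ℚ * K)
  bd = evalL-bounded K lit≤ (toWitness {a? = All.all? (λ a → Ab? (zq a) K) (Data.List.drop 1 Qᵤ)} tt) p (≤-trans q lit≤)

ringᵠ₁₆₄ : ∀ s t k → pos 6648 / 1 + s * t ≡ pos 6648 / 1 - pos 1 / 120 * k + (s * (t - - k) + (pos 1 / 120 - s) * k)
ringᵠ₁₆₄ = solveᵠ 3 λ s t k → con (pos 6648 / 1) :+ s :* t := con (pos 6648 / 1) :- con (pos 1 / 120) :* k :+ (s :* (t :- (:- k)) :+ (con (pos 1 / 120) :- s) :* k)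

-- The expansion starts 1 + 168τ + 24τ² + 6648τ³, and 6648 outweighs τ times the tail, which is at
-- most 2 · 137016 / 120.
M⁻-positive : ∀ {τ} → 0ℚ ≤ τ → τ ≤ pos 1 / 120 → 0ℚ < evalE M⁻ τ
M⁻-positive {τ} p q = by0< (trans (poly-identity M⁻ e τ) (cong (λ z → zq (pos 1) + τ * (zq (pos 168) + τ * (zq (pos 24) + τ * (zq (pos 6648) + τ * z)))) (evalE-horner ts var τ)))
  (0<+ {1ℚ} lit< (0≤* p (0≤+ {pos 168 / 1} lit≤ (0≤* p (0≤+ {pos 24 / 1} lit≤ (0≤* p rest))))))
  where
  ts : List ℤ.ℤ
  ts = -[1+ 20515 ] ∷ pos 52776 ∷ -[1+ 82007 ] ∷ pos 137016 ∷ -[1+ 122681 ] ∷ pos 137016 ∷ -[1+ 82007 ] ∷ pos 52776 ∷ -[1+ 20515 ] ∷ pos 6648 ∷ pos 24 ∷ pos 168 ∷ pos 1 ∷ []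
  e : Expr
  e = lit (pos 1) ⊹ var ✶ (lit (pos 168) ⊹ var ✶ (lit (pos 24) ⊹ var ✶ (lit (pos 6648) ⊹ var ✶ hornerE ts var)))
  K t : ℚ
  K = pos 137016 / 1
  t = evalL ts τ
  bd : Ab t (2ℚ * K)
  bd = evalL-bounded K lit≤ (toWitness {a? = All.all? (λ a → Ab? (zq a) K) ts} tt) p (≤-trans q lit≤)
  rest : 0ℚ ≤ pos 6648 / 1 + τ * t
  rest = by0≤ (ringᵠ₁₆₄ τ t (2ℚ * K)) (0≤+ {pos 6648 / 1 - pos 1 / 120 * (2ℚ * K)} lit≤ (0≤+ (0≤* p (≤⇒0≤- { - (2ℚ * K)} {t} (proj₁ bd))) (0≤* (≤⇒0≤- q) (0≤* {2ℚ} {K} lit≤ lit≤))))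

-- A discrete intermediate value theorem, used to bracket irrational zeros on rational grids.
crossing : (P : ℕ → Set) → (∀ k → Dec (P k)) → ∀ m → ¬ P 0 → P m → ∃ λ l → ¬ P l × P (suc l) × suc l ℕ.≤ m
crossing P P? zero ¬p p = ⊥-elim (¬p p)
crossing P P? (suc m) ¬p p with P? m
... | no ¬q = m , ¬q , p , ℕₚ.≤-refl
... | yes q = let l , a , b , c = crossing P P? m ¬p q in l , a , b , ℕₚ.≤-trans c (ℕₚ.n≤1+n m)

-- The choice of τ₀ < τ₂ < τ₁

κ-gap : ℚ → ℚ → ℚ
κ-gap u τ = pos 6 / 1 * (τ * τ) + pos 10 / 1 * (τ * τ * (τ * τ)) - (1ℚ - τ * τ * (τ * τ)) * u

-- Three equally spaced points just beyond the saddle point. `τ₀` controls the coefficient ratios of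
-- R^(J+1), the step to `τ₂` makes (τ₂ - t)(1 + t)^B usable, and the step to `τ₁`, where f vanishes,
-- absorbs the derivative term of `Tail`.
record Taus (u : ℚ) : Set where
  field
    τ₀ τ₂ τ₁ ν : ℚ
    N : ℕ
    ν>0 : 0ℚ < ν
    ν*N : ι N * ν ≡ 1ℚ
    τ₀>0 : 0ℚ < τ₀
    τ₂≡ : τ₂ ≡ τ₀ + ν
    τ₁≡ : τ₁ ≡ τ₂ + ν
    τ₁≤ : τ₁ ≤ pos 1 / 120
    gap : 0ℚ < κ-gap u τ₀
    M⁺>0 : 0ℚ < evalE M⁺ τ₁

ringᵠ₁₆₅ : ∀ u a b → pos 6 / 1 * (a * a) + pos 10 / 1 * (a * a * (a * a)) - (1ℚ - a * a * (a * a)) * u + pos 17 / 1 * (b - a) - (pos 6 / 1 * (b * b) + pos 10 / 1 * (b * b * (b * b)) - (1ℚ - b * b * (b * b)) * u) ≡ (b - a) * (pos 17 / 1 - (a + b) * (pos 6 / 1 + (a * a + b * b) * (pos 10 / 1 + u)))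
ringᵠ₁₆₅ = solveᵠ 3 λ u a b → con (pos 6 / 1) :* (a :* a) :+ con (pos 10 / 1) :* (a :* a :* (a :* a)) :- (con 1ℚ :- a :* a :* (a :* a)) :* u :+ con (pos 17 / 1) :* (b :- a) :- (con (pos 6 / 1) :* (b :* b) :+ con (pos 10 / 1) :* (b :* b :* (b :* b)) :- (con 1ℚ :- b :* b :* (b :* b)) :* u) := (b :- a) :* (con (pos 17 / 1) :- (a :+ b) :* (con (pos 6 / 1) :+ (a :* a :+ b :* b) :* (con (pos 10 / 1) :+ u)))

-- The difference quotient is (a + b)(6 + (a² + b²)(10 + u)), at most 6 + 11.
κ-gap-lipschitz : ∀ {u a b} → 0ℚ ≤ u → u ≤ 1ℚ → 0ℚ ≤ a → a ≤ b → b ≤ ½ → κ-gap u b ≤ κ-gap u a + pos 17 / 1 * (b - a)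
κ-gap-lipschitz {u} {a} {b} u≥0 u≤1 a≥0 a≤b b≤½ = by≤ (ringᵠ₁₆₅ u a b) (0≤* (≤⇒0≤- a≤b) (≤⇒0≤- bound))
  where
  b≥0 : 0ℚ ≤ b
  b≥0 = ≤-trans a≥0 a≤b
  a≤½ : a ≤ ½
  a≤½ = ≤-trans a≤b b≤½
  W : ℚ
  W = a * a + b * b
  W≥0 : 0ℚ ≤ W
  W≥0 = 0≤+ (0≤* a≥0 a≥0) (0≤* b≥0 b≥0)
  W≤1 : W ≤ 1ℚ
  W≤1 = ≤-trans {W} {½ * ½ + ½ * ½} {1ℚ} (+-mono-≤ {a * a} {½ * ½} {b * b} {½ * ½} (*-mono {a} {½} {a} {½} a≥0 a≤½ a≥0 a≤½) (*-mono {b} {½} {b} {½} b≥0 b≤½ b≥0 b≤½)) lit≤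
  inner≤ : W * (pos 10 / 1 + u) ≤ pos 11 / 1
  inner≤ = ≤-trans {W * (pos 10 / 1 + u)} {1ℚ * (pos 11 / 1)} {pos 11 / 1} (*-mono {W} {1ℚ} {pos 10 / 1 + u} {pos 11 / 1} W≥0 W≤1 (0≤+ {pos 10 / 1} {u} lit≤ u≥0) (+-mono-≤ {pos 10 / 1} {pos 10 / 1} {u} {1ℚ} ≤-refl u≤1)) lit≤
  bound : (a + b) * (pos 6 / 1 + W * (pos 10 / 1 + u)) ≤ pos 17 / 1
  bound = ≤-trans {(a + b) * (pos 6 / 1 + W * (pos 10 / 1 + u))} {1ℚ * (pos 17 / 1)} {pos 17 / 1}
    (*-mono {a + b} {1ℚ} {pos 6 / 1 + W * (pos 10 / 1 + u)} {pos 17 / 1} (0≤+ a≥0 b≥0) (+-mono-≤ {a} {½} {b} {½} a≤½ b≤½)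
      (0≤+ {pos 6 / 1} {W * (pos 10 / 1 + u)} lit≤ (0≤* W≥0 (0≤+ {pos 10 / 1} {u} lit≤ u≥0)))
      (+-mono-≤ {pos 6 / 1} {pos 6 / 1} {W * (pos 10 / 1 + u)} {pos 11 / 1} ≤-refl inner≤)) lit≤

ringᵠ₁₆₆ : ∀ σ → 1ℚ + (- 1ℚ) * (σ * σ) - ½ ≡ pos 1 / 14400 * (pos 1 / 14400) - σ * σ + (½ - pos 1 / 14400 * (pos 1 / 14400))
ringᵠ₁₆₆ = solveᵠ 1 λ σ → con 1ℚ :+ (:- con 1ℚ) :* (σ :* σ) :- con ½ := con (pos 1 / 14400) :* con (pos 1 / 14400) :- σ :* σ :+ (con ½ :- con (pos 1 / 14400) :* con (pos 1 / 14400))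

ringᵠ₁₆₇ : ∀ l w v → l * (w * v) ≡ w * (l * v)
ringᵠ₁₆₇ = solveᵠ 3 λ l w v → l :* (w :* v) := w :* (l :* v)

ringᵠ₁₆₈ : ∀ s u v → (1ℚ + (- 1ℚ) * (s * s)) * v - (pos 6 / 1 * s + pos 10 / 1 * (s * s)) ≡ ½ * (v - u) - (pos 6 / 1 * s + pos 10 / 1 * (s * s) - (1ℚ - s * s) * u) + (1ℚ + (- 1ℚ) * (s * s) - ½) * (v - u)
ringᵠ₁₆₈ = solveᵠ 3 λ s u v → (con 1ℚ :+ (:- con 1ℚ) :* (s :* s)) :* v :- (con (pos 6 / 1) :* s :+ con (pos 10 / 1) :* (s :* s)) := con ½ :* (v :- u) :- (con (pos 6 / 1) :* s :+ con (pos 10 / 1) :* (s :* s) :- (con 1ℚ :- s :* s) :* u) :+ (con 1ℚ :+ (:- con 1ℚ) :* (s :* s) :- con ½) :* (v :- u)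

ringᵠ₁₆₉ : ∀ w a b c → w * (a * (- b) * c) ≡ - (c * (a * b) * w)
ringᵠ₁₆₉ = solveᵠ 4 λ w a b c → w :* (a :* (:- b) :* c) := (:- (c :* (a :* b) :* w))

ringᵠ₁₇₀ : ∀ a b → - (a * b) ≡ a * (- b)
ringᵠ₁₇₀ = solveᵠ 2 λ a b → (:- (a :* b)) := a :* (:- b)

-- The number u₂ for which τ is exactly the saddle point satisfies u₂ ≤ u₁, so `Pᵤ` is negative at
-- u₂ by monotonicity. In its factorisation at τ the signs of `M⁻` and `Qᵤ` are known, and that of
-- `M⁺` follows.
M⁺-positive : ∀ {τ u u₁ : ℚ} → 0ℚ ≤ τ → τ ≤ pos 1 / 120 → 0ℚ ≤ u → evalL Pᵤ u₁ < 0ℚ → u ≤ u₁ → κ-gap u τ ≤ ½ * (u₁ - u) → 0ℚ < evalE M⁺ τ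
M⁺-positive {τ} {u} {u₁} τ≥0 τ≤ u≥0 neg-u₁ u≤u₁ gap = *-cancelˡ-0< {evalE M⁺ τ} {evalE M⁻ τ * (- evalL Qᵤ σ)} (<⇒≤ MQ>0)
    (*-cancelˡ-0< {c = w} (<⇒≤ w>0) (by0< chain (0<* (^-pos 17 w>0) (subst (0ℚ <_) (ℚₚ.+-identityˡ (- evalL Pᵤ u₂)) (<⇒0<- neg-u₂)))))
  where
  σ w ℓτ : ℚ
  σ = τ * τ
  w = evalE ωE τ
  ℓτ = evalE ℓE τ
  σ≥0 : 0ℚ ≤ σ
  σ≥0 = 0≤* τ≥0 τ≥0
  σ≤ : σ ≤ pos 1 / 14400
  σ≤ = *-mono {τ} {pos 1 / 120} {τ} {pos 1 / 120} τ≥0 τ≤ τ≥0 τ≤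
  w≥½ : ½ ≤ w
  w≥½ = by≤ (ringᵠ₁₆₆ σ) (0≤+ {pos 1 / 14400 * (pos 1 / 14400) - σ * σ} {½ - pos 1 / 14400 * (pos 1 / 14400)} (≤⇒0≤- (*-mono {σ} {pos 1 / 14400} {σ} {pos 1 / 14400} σ≥0 σ≤ σ≥0 σ≤)) lit≤)
  w>0 : 0ℚ < w
  w>0 = ℚₚ.<-≤-trans {0ℚ} {½} {w} lit< w≥½
  inv : ∃ λ v → (w * v ≡ 1ℚ) × 0ℚ < v
  inv = recip w w>0
  u₂ : ℚ
  u₂ = ℓτ * proj₁ inv
  ℓτ≡ : ℓτ ≡ w * u₂
  ℓτ≡ = trans (trans (sym (ℚₚ.*-identityʳ ℓτ)) (cong (ℓτ *_) (sym (proj₁ (proj₂ inv))))) (ringᵠ₁₆₇ ℓτ w (proj₁ inv))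
  ℓτ≥0 : 0ℚ ≤ ℓτ
  ℓτ≥0 = 0≤+ (0≤* {pos 6 / 1} lit≤ σ≥0) (0≤* {pos 10 / 1} lit≤ (0≤* σ≥0 σ≥0))
  u₂≥0 : 0ℚ ≤ u₂
  u₂≥0 = 0≤* ℓτ≥0 (<⇒≤ (proj₂ (proj₂ inv)))
  u₂≤u₁ : u₂ ≤ u₁
  u₂≤u₁ = *-cancelˡ {u₂} {u₁} {w} w>0 (subst (_≤ w * u₁) ℓτ≡ (by≤ (ringᵠ₁₆₈ σ u u₁) (0≤+ (≤⇒0≤- gap) (0≤* (≤⇒0≤- w≥½) (≤⇒0≤- u≤u₁)))))
  neg-u₂ : evalL Pᵤ u₂ < 0ℚ
  neg-u₂ = ℚₚ.≤-<-trans (evalL-mono-tail -[1+ 5449860 ] Pᵤ⁺-nonneg u₂≥0 u₂≤u₁) neg-u₁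
  MQ>0 : 0ℚ < evalE M⁻ τ * (- evalL Qᵤ σ)
  MQ>0 = 0<* (M⁻-positive τ≥0 τ≤) (Qᵤ-negative σ≥0 σ≤)
  chain : w * (evalE M⁻ τ * (- evalL Qᵤ σ) * evalE M⁺ τ) ≡ w ^ 17 * (- evalL Pᵤ u₂)
  chain = begin
    w * (evalE M⁻ τ * (- evalL Qᵤ σ) * evalE M⁺ τ) ≡⟨ ringᵠ₁₆₉ w (evalE M⁻ τ) (evalL Qᵤ σ) (evalE M⁺ τ) ⟩
    - (evalE M⁺ τ * (evalE M⁻ τ * evalL Qᵤ σ) * w) ≡⟨ cong (λ z → - (evalE M⁺ τ * (evalE M⁻ τ * z) * w)) (sym (evalE-horner Qᵤ σE τ)) ⟩
    - (evalE (M⁺ ✶ (M⁻ ✶ hornerE Qᵤ σE)) τ * w) ≡⟨ cong (λ z → - (z * w)) (sym (Pᵤ-factor τ)) ⟩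
    - (evalE (homE Pᵤ ℓE ωE) τ * w) ≡⟨ cong -_ (evalE-hom Pᵤ ℓE ωE τ u₂ ℓτ≡) ⟩
    - (w ^ 17 * evalL Pᵤ u₂) ≡⟨ ringᵠ₁₇₀ (w ^ 17) (evalL Pᵤ u₂) ⟩
    w ^ 17 * (- evalL Pᵤ u₂) ∎
    where
    open ≡-Reasoning

ringᵠ₁₇₁ : ∀ a b → (1ℚ + a) * b ≡ a * b + b
ringᵠ₁₇₁ = solveᵠ 2 λ a b → (con 1ℚ :+ a) :* b := a :* b :+ b

ringᵠ₁₇₂ : ∀ z → z ≡ pos 1 / 121 * (pos 121 / 1 * z)
ringᵠ₁₇₂ = solveᵠ 1 λ z → z := con (pos 1 / 121) :* (con (pos 121 / 1) :* z)

ringᵠ₁₇₃ : ∀ u v → 0ℚ - (pos 6 / 1 * (0ℚ * v * (0ℚ * v)) + pos 10 / 1 * (0ℚ * v * (0ℚ * v) * (0ℚ * v * (0ℚ * v))) - (1ℚ - 0ℚ * v * (0ℚ * v) * (0ℚ * v * (0ℚ * v))) * u) ≡ u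
ringᵠ₁₇₃ = solveᵠ 2 λ u v → con 0ℚ :- (con (pos 6 / 1) :* (con 0ℚ :* v :* (con 0ℚ :* v)) :+ con (pos 10 / 1) :* (con 0ℚ :* v :* (con 0ℚ :* v) :* (con 0ℚ :* v :* (con 0ℚ :* v))) :- (con 1ℚ :- con 0ℚ :* v :* (con 0ℚ :* v) :* (con 0ℚ :* v :* (con 0ℚ :* v))) :* u) := u

ringᵠ₁₇₄ : ∀ u → pos 6 / 1 * (pos 1 / 121 * (pos 1 / 121)) + pos 10 / 1 * (pos 1 / 121 * (pos 1 / 121) * (pos 1 / 121 * (pos 1 / 121))) - (1ℚ - pos 1 / 121 * (pos 1 / 121) * (pos 1 / 121 * (pos 1 / 121))) * u ≡ (pos 6 / 1 * (pos 1 / 121 * (pos 1 / 121)) + pos 10 / 1 * (pos 1 / 121 * (pos 1 / 121) * (pos 1 / 121 * (pos 1 / 121))) - (1ℚ - pos 1 / 121 * (pos 1 / 121) * (pos 1 / 121 * (pos 1 / 121))) * (pos 1 / 2500)) + (1ℚ - pos 1 / 14641 * (pos 1 / 14641)) * (pos 1 / 2500 - u)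
ringᵠ₁₇₄ = solveᵠ 1 λ u → con (pos 6 / 1) :* (con (pos 1 / 121) :* con (pos 1 / 121)) :+ con (pos 10 / 1) :* (con (pos 1 / 121) :* con (pos 1 / 121) :* (con (pos 1 / 121) :* con (pos 1 / 121))) :- (con 1ℚ :- con (pos 1 / 121) :* con (pos 1 / 121) :* (con (pos 1 / 121) :* con (pos 1 / 121))) :* u := con (pos 6 / 1) :* (con (pos 1 / 121) :* con (pos 1 / 121)) :+ con (pos 10 / 1) :* (con (pos 1 / 121) :* con (pos 1 / 121) :* (con (pos 1 / 121) :* con (pos 1 / 121))) :- (con 1ℚ :- con (pos 1 / 121) :* con (pos 1 / 121) :* (con (pos 1 / 121) :* con (pos 1 / 121))) :* con (pos 1 / 2500) :+ (con 1ℚ :- con (pos 1 / 14641) :* con (pos 1 / 14641)) :* (con (pos 1 / 2500) :- u)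

ringⁿ₂₄ : ∀ K → 120 ℕ.* (2 ℕ.+ (240 ℕ.+ K)) ℕ.+ K ≡ 121 ℕ.* (240 ℕ.+ K)
ringⁿ₂₄ = ℕR.solve-∀

ringᵠ₁₇₅ : ∀ u e → u + e - u ≡ e
ringᵠ₁₇₅ = solveᵠ 2 λ u e → u :+ e :- u := e

ringᵠ₁₇₆ : ∀ p a b v → p * ((a + b) * v) - p * (a * v) ≡ p * (b * v)
ringᵠ₁₇₆ = solveᵠ 4 λ p a b v → p :* ((a :+ b) :* v) :- p :* (a :* v) := p :* (b :* v)

ringᵠ₁₇₇ : ∀ c p q v → c * (pos 102 / 1 * v) * (p * q) ≡ p * (c * (pos 102 / 1) * q * v)
ringᵠ₁₇₇ = solveᵠ 4 λ c p q v → c :* (con (pos 102 / 1) :* v) :* (p :* q) := p :* (c :* con (pos 102 / 1) :* q :* v)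

ringᵠ₁₇₈ : ∀ u v k a → ½ * (u + pos 102 / 1 * v - u) - (k + pos 17 / 1 * (a + v + v + v - a)) ≡ 0ℚ - k
ringᵠ₁₇₈ = solveᵠ 4 λ u v k a → con ½ :* (u :+ con (pos 102 / 1) :* v :- u) :- (k :+ con (pos 17 / 1) :* (a :+ v :+ v :+ v :- a)) := con 0ℚ :- k

-- On multiples of ν = 1/N a sign change of the gap is found. Three steps later the gap is at most 3
-- · 17 ν, which is ε/2 for ε = 102ν; the Lipschitz constant c keeps `Pᵤ` negative up to u + ε. The
-- grid point 1/121 is already beyond the zero, and the summand 240 in k gives 120 (k + 2) ≤ 121 k,
-- so that `τ₁` still is at most 1/120.
module Grid {u c p p' : ℚ} (u≥0 : 0ℚ ≤ u) (u≤ : u ≤ pos 1 / 2500) (p>0 : 0ℚ < p) (p*p' : p * p' ≡ 1ℚ)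
  (neg-near : ∀ ε → 0ℚ ≤ ε → ε ≤ ½ → c * ε < p → evalL Pᵤ (u + ε) < 0ℚ)
  (K k N : ℕ) (arch : c * (pos 102 / 1) * p' ≤ ι K) (k≡ : k ≡ 240 ℕ.+ K) (N≡ : N ≡ 121 ℕ.* k) where

  k≤N : k ℕ.≤ N
  k≤N = subst (k ℕ.≤_) (sym N≡) (ℕₚ.m≤n*m k 121)
  240≤N : 240 ℕ.≤ N
  240≤N = ℕₚ.≤-trans (subst (240 ℕ.≤_) (sym k≡) (ℕₚ.m≤m+n 240 K)) k≤N
  1≤N : 1 ℕ.≤ N
  1≤N = ℕₚ.≤-trans (s≤s z≤n) 240≤N
  K<N : K ℕ.< N
  K<N = ℕₚ.≤-trans (subst (K ℕ.<_) (sym k≡) (s≤s (ℕₚ.m≤n+m K 239))) k≤N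
  ν⁻¹ : ∃ λ q → (ι N * q ≡ 1ℚ) × 0ℚ < q
  ν⁻¹ = recip (ι N) (ℚₚ.<-≤-trans {0ℚ} {1ℚ} {ι N} lit< (ι-mono 1≤N))
  ν ε : ℚ
  ν = proj₁ ν⁻¹
  ε = pos 102 / 1 * ν
  ν>0 : 0ℚ < ν
  ν>0 = proj₂ (proj₂ ν⁻¹)
  ν≥0 : 0ℚ ≤ ν
  ν≥0 = <⇒≤ ν>0
  Nν≡1 : ι N * ν ≡ 1ℚ
  Nν≡1 = proj₁ (proj₂ ν⁻¹)
  g : ℕ → ℚ
  g i = ι i * ν
  g-nonneg : ∀ i → 0ℚ ≤ g i
  g-nonneg i = 0≤* (ι-nonneg i) ν≥0
  g-suc : ∀ i → g (suc i) ≡ g i + ν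
  g-suc i = trans (cong (_* ν) (ι-suc i)) (ringᵠ₁₇₁ (ι i) ν)
  g-mono : ∀ {i j} → i ℕ.≤ j → g i ≤ g j
  g-mono q = *-monoʳ ν≥0 (ι-mono q)
  kν : pos 121 / 1 * g k ≡ 1ℚ
  kν = trans (trans (sym (ℚₚ.*-assoc (pos 121 / 1) (ι k) ν)) (cong (_* ν) (sym (trans (cong ι N≡) (ι-* 121 k))))) Nν≡1
  gk : g k ≡ pos 1 / 121
  gk = trans (ringᵠ₁₇₂ (g k)) (cong (pos 1 / 121 *_) kν)
  P : ℕ → Set
  P i = 0ℚ < κ-gap u (g i)
  ¬P0 : ¬ P 0
  ¬P0 h = ℚₚ.<-irrefl refl (ℚₚ.<-≤-trans h (by≤ (ringᵠ₁₇₃ u ν) u≥0))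
  Pk : P k
  Pk = subst (λ z → 0ℚ < κ-gap u z) (sym gk) (by0< (ringᵠ₁₇₄ u) (0<+ {κ-gap (pos 1 / 2500) (pos 1 / 121)} lit< (0≤* {1ℚ - pos 1 / 14641 * (pos 1 / 14641)} {pos 1 / 2500 - u} lit≤ (≤⇒0≤- u≤))))
  found : ∃ λ l → ¬ P l × P (suc l) × suc l ℕ.≤ k
  found = crossing P (λ i → 0ℚ <? κ-gap u (g i)) k ¬P0 Pk
  l : ℕ
  l = proj₁ found
  τ₁≤ : g (3 ℕ.+ l) ≤ pos 1 / 120
  τ₁≤ = *-cancelˡ {g (3 ℕ.+ l)} {pos 1 / 120} {pos 120 / 1} lit< (≤-trans {pos 120 / 1 * g (3 ℕ.+ l)} {g N}
    (subst (_≤ g N) (trans (cong (_* ν) (ι-* 120 (3 ℕ.+ l))) (ℚₚ.*-assoc (pos 120 / 1) (ι (3 ℕ.+ l)) ν)) (g-mono bound))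
    (≤-reflexive Nν≡1))
    where
    eq : 120 ℕ.* (2 ℕ.+ k) ℕ.+ K ≡ N
    eq = trans (cong (λ z → 120 ℕ.* (2 ℕ.+ z) ℕ.+ K) k≡) (trans (ringⁿ₂₄ K) (sym (trans N≡ (cong (121 ℕ.*_) k≡))))
    bound : 120 ℕ.* (3 ℕ.+ l) ℕ.≤ N
    bound = ℕₚ.≤-trans (ℕₚ.*-monoʳ-≤ 120 (s≤s (s≤s (proj₂ (proj₂ (proj₂ found)))))) (subst (120 ℕ.* (2 ℕ.+ k) ℕ.≤_) eq (ℕₚ.m≤m+n (120 ℕ.* (2 ℕ.+ k)) K))
  u≤u+ε : u ≤ u + ε
  u≤u+ε = by≤ (ringᵠ₁₇₅ u ε) (0≤* {pos 102 / 1} lit≤ ν≥0)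
  ε≤ : ε ≤ ½
  ε≤ = subst₂ _≤_ refl (trans (cong (½ *_) Nν≡1) (ℚₚ.*-identityʳ ½)) (subst (ε ≤_) (ℚₚ.*-assoc ½ (ι N) ν) (*-monoʳ {pos 102 / 1} {½ * ι N} {ν} ν≥0
    (≤-trans {pos 102 / 1} {½ * (pos 240 / 1)} {½ * ι N} lit≤ (*-monoˡ {pos 240 / 1} {ι N} {½} lit≤ (ι-mono {240} {N} 240≤N)))))
  cε<p : c * ε < p
  cε<p = ℚₚ.≤-<-trans {c * ε} {p * g K} {p} step (subst (p * g K <_) (trans (cong (p *_) Nν≡1) (ℚₚ.*-identityʳ p))
      (0<-⇒< (by0< (trans (cong (λ z → p * (z * ν) - p * (ι K * ν)) N≡′) (ringᵠ₁₇₆ p (ι K) (ι D) ν)) (0<* p>0 (0<* ιD>0 ν>0)))))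
    where
    N-split : ∃ λ D → N ≡ K ℕ.+ suc D
    N-split = let D , e = ℕₚ.m≤n⇒∃[o]m+o≡n K<N in D , trans (sym e) (sym (ℕₚ.+-suc K D))
    D : ℕ
    D = suc (proj₁ N-split)
    ιD>0 : 0ℚ < ι D
    ιD>0 = ι-pos (proj₁ N-split)
    N≡′ : ι N ≡ ι K + ι D
    N≡′ = trans (cong ι (proj₂ N-split)) (ι-+ K D)
    step : c * ε ≤ p * g K
    step = subst (_≤ p * g K) (trans (sym (ringᵠ₁₇₇ c p (p') ν)) (trans (cong (c * ε *_) p*p') (ℚₚ.*-identityʳ (c * ε))))
      (*-monoˡ {c * (pos 102 / 1) * p' * ν} {g K} {p} (<⇒≤ p>0) (*-monoʳ {c * (pos 102 / 1) * p'} {ι K} {ν} ν≥0 arch))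
  neg-u+ε : evalL Pᵤ (u + ε) < 0ℚ
  neg-u+ε = neg-near ε (0≤* {pos 102 / 1} lit≤ ν≥0) ε≤ cε<p
  gap₁ : κ-gap u (g (3 ℕ.+ l)) ≤ ½ * (u + ε - u)
  gap₁ = ≤-trans {κ-gap u (g (3 ℕ.+ l))} {κ-gap u (g l) + pos 17 / 1 * (g (3 ℕ.+ l) - g l)}
    (κ-gap-lipschitz u≥0 (≤-trans {u} {pos 1 / 2500} {1ℚ} u≤ lit≤) (g-nonneg l) (g-mono (ℕₚ.m≤n+m l 3)) (≤-trans {g (3 ℕ.+ l)} {pos 1 / 120} {½} τ₁≤ lit≤))
    (by≤ (trans (cong (λ z → ½ * (u + ε - u) - (κ-gap u (g l) + pos 17 / 1 * (z - g l))) (trans (g-suc (2 ℕ.+ l)) (cong (_+ ν) (trans (g-suc (suc l)) (cong (_+ ν) (g-suc l)))))) (ringᵠ₁₇₈ u ν (κ-gap u (g l)) (g l)))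
      (≤⇒0≤- (ℚₚ.≮⇒≥ (proj₁ (proj₂ found)))))

  taus-grid : Taus u
  taus-grid = record
    { τ₀ = g (suc l) ; τ₂ = g (2 ℕ.+ l) ; τ₁ = g (3 ℕ.+ l) ; ν = ν ; N = N
    ; ν>0 = ν>0 ; ν*N = Nν≡1
    ; τ₀>0 = 0<* (ι-pos l) ν>0 ; τ₂≡ = g-suc (suc l) ; τ₁≡ = g-suc (2 ℕ.+ l) ; τ₁≤ = τ₁≤
    ; gap = proj₁ (proj₂ (proj₂ found))
    ; M⁺>0 = M⁺-positive {g (3 ℕ.+ l)} {u} {u + ε} (g-nonneg (3 ℕ.+ l)) τ₁≤ u≥0 neg-u+ε u≤u+ε gap₁ }

ringᵠ₁₇₉ : ∀ a c u e → 0ℚ - (a + c * (u + e - u)) ≡ - a - c * e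
ringᵠ₁₇₉ = solveᵠ 4 λ a c u e → con 0ℚ :- (a :+ c :* (u :+ e :- u)) := (:- a) :- c :* e

Pᵤ-near : ∀ {u} → 0ℚ ≤ u → u ≤ pos 1 / 2500 → ∀ ε → 0ℚ ≤ ε → ε ≤ ½ → lipL Pᵤ * ε < - evalL Pᵤ u → evalL Pᵤ (u + ε) < 0ℚ
Pᵤ-near {u} u≥0 u≤ ε ε≥0 ε≤ lt = ℚₚ.≤-<-trans {evalL Pᵤ (u + ε)} {evalL Pᵤ u + lipL Pᵤ * (u + ε - u)} {0ℚ}
    (evalL-lipschitz -[1+ 5449860 ] Pᵤ⁺-nonneg u≥0 (by≤ (ringᵠ₁₇₅ u ε) ε≥0) (≤-trans {u + ε} {pos 1 / 2500 + ½} {1ℚ} (+-mono-≤ {u} {pos 1 / 2500} {ε} {½} u≤ ε≤) lit≤))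
    (by< (ringᵠ₁₇₉ (evalL Pᵤ u) (lipL Pᵤ) u ε) (<⇒0<- lt))

taus : ∀ {u} → 0ℚ ≤ u → evalL Pᵤ u < 0ℚ → Taus u
taus {u} u≥0 neg-u =
  let p>0 = subst (0ℚ <_) (ℚₚ.+-identityˡ (- evalL Pᵤ u)) (<⇒0<- neg-u)
      q , pq , _ = recip (- evalL Pᵤ u) p>0
      K , arch = archimedes (lipL Pᵤ * (pos 102 / 1) * q)
      u≤ = Pᵤ-small u≥0 neg-u
  in Grid.taus-grid {u} {lipL Pᵤ} { - evalL Pᵤ u} {q} u≥0 u≤ p>0 pq (Pᵤ-near u≥0 u≤) K (240 ℕ.+ K) (121 ℕ.* (240 ℕ.+ K)) arch refl refl

-- The multiplier r = λ (1 - λ) / 8 with λ = 8 τ (1 + τ²) / (1 + τ)⁴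

Gᵗ : ℚ → ℚ
Gᵗ x = pos 11 / 1 * (x * x * (x * x)) + pos 6 / 1 * (x * x) - 1ℚ

-- `below` is the condition f(t₀) < 0 made robust: f ≤ -δ₁ on a one-sided neighbourhood of t₀ whose
-- width is measured by `Gᵗ`.
record Multiplier (τ : ℚ) : Set where
  field
    r δ₁ η₀ : ℚ
    r≥0 : 0ℚ ≤ r
    r≤ : r ≤ pos 1 / 120
    root : r * (1ℚ + τ) ^ 12 ≡ τ * (1ℚ + τ * τ) * (1ℚ - τ * τ) ^ 4
    δ₁>0 : 0ℚ < δ₁
    η₀>0 : 0ℚ < η₀
    below : ∀ {x} → pos 1 / 4 ≤ x → x ≤ pos 2 / 5 → 0ℚ ≤ Gᵗ x → Gᵗ x ≤ η₀ → δ₁ ≤ - evalQ (fL r) x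

div-by : ∀ {a b b'} → b * b' ≡ 1ℚ → a ≡ b * (a * b')
div-by {a} {b} {b'} e = trans (trans (sym (ℚₚ.*-identityʳ a)) (cong (a *_) (sym e))) (ringᵠ₁₆₇ a b b')

1≤^ : ∀ {a} n → 1ℚ ≤ a → 1ℚ ≤ a ^ n
1≤^ {a} n p = ≤-trans (≤-reflexive (sym (1^ n))) (^-mono n 0≤1 p)

ringᵠ₁₈₀ : ∀ m → m ≡ 2ℚ * (½ * m)
ringᵠ₁₈₀ = solveᵠ 1 λ m → m := con 2ℚ :* (con ½ :* m)

ringᵠ₁₈₁ : ∀ d → 2ℚ * (d * (pos 25 / 1)) ≡ pos 50 / 1 * d
ringᵠ₁₈₁ = solveᵠ 1 λ d → con 2ℚ :* (d :* con (pos 25 / 1)) := con (pos 50 / 1) :* d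

ringᵠ₁₈₂ : ∀ a b → pos 1 / 1 + a * (- (pos 23 / 1) + a * (pos 33 / 1 + a * (- (pos 23 / 1) + a * (pos 1 / 1 + a * 0ℚ)))) - (pos 1 / 1 + b * (- (pos 23 / 1) + b * (pos 33 / 1 + b * (- (pos 23 / 1) + b * (pos 1 / 1 + b * 0ℚ))))) ≡ (b - a) * (pos 23 / 1 - pos 33 / 1 * (a + b) + pos 23 / 1 * (a * a + a * b + b * b) - (a + b) * (a * a + b * b))
ringᵠ₁₈₂ = solveᵠ 2 λ a b → con (pos 1 / 1) :+ a :* ((:- con (pos 23 / 1)) :+ a :* (con (pos 33 / 1) :+ a :* ((:- con (pos 23 / 1)) :+ a :* (con (pos 1 / 1) :+ a :* con 0ℚ)))) :- (con (pos 1 / 1) :+ b :* ((:- con (pos 23 / 1)) :+ b :* (con (pos 33 / 1) :+ b :* ((:- con (pos 23 / 1)) :+ b :* (con (pos 1 / 1) :+ b :* con 0ℚ))))) := (b :- a) :* (con (pos 23 / 1) :- con (pos 33 / 1) :* (a :+ b) :+ con (pos 23 / 1) :* (a :* a :+ a :* b :+ b :* b) :- (a :+ b) :* (a :* a :+ b :* b))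

ringᵠ₁₈₃ : ∀ x y → x - y - ½ * x ≡ ½ * x - y
ringᵠ₁₈₃ = solveᵠ 2 λ x y → x :- y :- con ½ :* x := con ½ :* x :- y

ringᵠ₁₈₄ : ∀ s t q → pos 23 / 1 - pos 33 / 1 * s + pos 23 / 1 * t - s * q ≡ pos 33 / 1 * (pos 2 / 7 - s) + pos 23 / 1 * t + (pos 23 / 1 - pos 66 / 7 - pos 4 / 343 + (pos 2 / 7 * (pos 2 / 49) - s * q))
ringᵠ₁₈₄ = solveᵠ 3 λ s t q → con (pos 23 / 1) :- con (pos 33 / 1) :* s :+ con (pos 23 / 1) :* t :- s :* q := con (pos 33 / 1) :* (con (pos 2 / 7) :- s) :+ con (pos 23 / 1) :* t :+ (con (pos 23 / 1) :- con (pos 66 / 7) :- con (pos 4 / 343) :+ (con (pos 2 / 7) :* con (pos 2 / 49) :- s :* q))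

ringᵠ₁₈₅ : ∀ s x y z → pos 25 / 1 - (pos 23 / 1 - pos 33 / 1 * s + pos 23 / 1 * (x + y + z) - s * (x + z)) ≡ pos 33 / 1 * s + s * (x + z) + (pos 23 / 1 * (pos 1 / 49 - x + (pos 1 / 49 - y) + (pos 1 / 49 - z)) + (2ℚ - pos 69 / 49))
ringᵠ₁₈₅ = solveᵠ 4 λ s x y z → con (pos 25 / 1) :- (con (pos 23 / 1) :- con (pos 33 / 1) :* s :+ con (pos 23 / 1) :* (x :+ y :+ z) :- s :* (x :+ z)) := con (pos 33 / 1) :* s :+ s :* (x :+ z) :+ (con (pos 23 / 1) :* (con (pos 1 / 49) :- x :+ (con (pos 1 / 49) :- y) :+ (con (pos 1 / 49) :- z)) :+ (con 2ℚ :- con (pos 69 / 49)))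

-- On [0, 1/7] the difference quotient of m lies between -25 and 0, so a drop of m from λ₁ to μ
-- forces μ beyond λ₁ by a definite amount.
m-decreasing : ∀ {λ₁ μ} → 0ℚ ≤ λ₁ → λ₁ ≤ pos 1 / 7 → 0ℚ ≤ μ → μ ≤ pos 1 / 7 → 0ℚ < evalL mL λ₁ →
  evalL mL μ ≤ ½ * evalL mL λ₁ → evalL mL λ₁ ≤ pos 50 / 1 * (μ - λ₁)
m-decreasing {a} {b} a≥0 a≤ b≥0 b≤ m>0 mb≤ =
  ≤-trans {evalL mL a} {2ℚ * ((b - a) * S)} (≤-trans {b = 2ℚ * (½ * evalL mL a)} (≤-reflexive (ringᵠ₁₈₀ (evalL mL a))) (*-monoˡ {½ * evalL mL a} {(b - a) * S} {2ℚ} lit≤ half≤))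
    (≤-trans {2ℚ * ((b - a) * S)} {2ℚ * ((b - a) * (pos 25 / 1))} (*-monoˡ {(b - a) * S} {(b - a) * (pos 25 / 1)} {2ℚ} lit≤ (*-monoˡ {S} {pos 25 / 1} {b - a} b-a≥0 S≤)) (≤-reflexive (ringᵠ₁₈₁ (b - a))))
  where
  S ς ϑ : ℚ
  ς = a + b
  ϑ = a * a + a * b + b * b
  S = pos 23 / 1 - pos 33 / 1 * ς + pos 23 / 1 * ϑ - ς * (a * a + b * b)
  factor : evalL mL a - evalL mL b ≡ (b - a) * S
  factor = ringᵠ₁₈₂ a b
  half≤ : ½ * evalL mL a ≤ (b - a) * S
  half≤ = subst (½ * evalL mL a ≤_) factor (by≤ (ringᵠ₁₈₃ (evalL mL a) (evalL mL b)) (≤⇒0≤- mb≤))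
  ς≥0 : 0ℚ ≤ ς
  ς≥0 = 0≤+ a≥0 b≥0
  ς≤ : ς ≤ pos 2 / 7
  ς≤ = +-mono-≤ {a} {pos 1 / 7} {b} {pos 1 / 7} a≤ b≤
  aa≤ : a * a ≤ pos 1 / 49
  aa≤ = *-mono {a} {pos 1 / 7} {a} {pos 1 / 7} a≥0 a≤ a≥0 a≤
  ab≤ : a * b ≤ pos 1 / 49
  ab≤ = *-mono {a} {pos 1 / 7} {b} {pos 1 / 7} a≥0 a≤ b≥0 b≤
  bb≤ : b * b ≤ pos 1 / 49
  bb≤ = *-mono {b} {pos 1 / 7} {b} {pos 1 / 7} b≥0 b≤ b≥0 b≤
  q≥0 : 0ℚ ≤ a * a + b * b
  q≥0 = 0≤+ (0≤* a≥0 a≥0) (0≤* b≥0 b≥0)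
  q≤ : a * a + b * b ≤ pos 2 / 49
  q≤ = +-mono-≤ {a * a} {pos 1 / 49} {b * b} {pos 1 / 49} aa≤ bb≤
  S>0 : 0ℚ ≤ S
  S>0 = by0≤ (ringᵠ₁₈₄ ς ϑ (a * a + b * b)) (0≤+ {pos 33 / 1 * (pos 2 / 7 - ς) + pos 23 / 1 * ϑ} (0≤+ (0≤* {pos 33 / 1} lit≤ (≤⇒0≤- ς≤)) (0≤* {pos 23 / 1} lit≤ (0≤+ (0≤+ (0≤* a≥0 a≥0) (0≤* a≥0 b≥0)) (0≤* b≥0 b≥0))))
     (0≤+ {pos 23 / 1 - pos 66 / 7 - pos 4 / 343} lit≤ (≤⇒0≤- (*-mono {ς} {pos 2 / 7} {a * a + b * b} {pos 2 / 49} ς≥0 ς≤ q≥0 q≤))))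
  S≤ : S ≤ pos 25 / 1
  S≤ = by≤ (ringᵠ₁₈₅ ς (a * a) (a * b) (b * b)) (0≤+ {pos 33 / 1 * ς + ς * (a * a + b * b)} (0≤+ (0≤* {pos 33 / 1} lit≤ ς≥0) (0≤* ς≥0 q≥0)) (0≤+ {pos 23 / 1 * (pos 1 / 49 - a * a + (pos 1 / 49 - a * b) + (pos 1 / 49 - b * b))} (0≤* {pos 23 / 1} lit≤ (0≤+ (0≤+ (≤⇒0≤- aa≤) (≤⇒0≤- ab≤)) (≤⇒0≤- bb≤))) lit≤))
  b-a≥0 : 0ℚ ≤ b - a
  b-a≥0 = <⇒≤ (*-cancelˡ-0< {b - a} {S} S>0 (subst (0ℚ <_) (ℚₚ.*-comm (b - a) S) (ℚₚ.<-≤-trans {0ℚ} {½ * evalL mL a} (0<* {½} lit< m>0) half≤)))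

ringᵠ₁₈₆ : ∀ x → 1ℚ + x - 1ℚ ≡ x
ringᵠ₁₈₆ = solveᵠ 1 λ x → con 1ℚ :+ x :- con 1ℚ := x

ringᵠ₁₈₇ : ∀ x → pos 3 / 5 * (1ℚ + x) - (1ℚ - x) ≡ pos 8 / 5 * (x - pos 1 / 4)
ringᵠ₁₈₇ = solveᵠ 1 λ x → con (pos 3 / 5) :* (con 1ℚ :+ x) :- (con 1ℚ :- x) := con (pos 8 / 5) :* (x :- con (pos 1 / 4))

ringᵠ₁₈₈ : ∀ x → (1ℚ + (- 1ℚ) * x) * ((1ℚ + (- 1ℚ) * x) * ((1ℚ + (- 1ℚ) * x) * ((1ℚ + (- 1ℚ) * x) * 1ℚ))) ≡ (1ℚ - x) * ((1ℚ - x) * ((1ℚ - x) * ((1ℚ - x) * 1ℚ)))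
ringᵠ₁₈₈ = solveᵠ 1 λ x → (con 1ℚ :+ (:- con 1ℚ) :* x) :* ((con 1ℚ :+ (:- con 1ℚ) :* x) :* ((con 1ℚ :+ (:- con 1ℚ) :* x) :* ((con 1ℚ :+ (:- con 1ℚ) :* x) :* con 1ℚ))) := (con 1ℚ :- x) :* ((con 1ℚ :- x) :* ((con 1ℚ :- x) :* ((con 1ℚ :- x) :* con 1ℚ)))

ringᵠ₁₈₉ : ∀ u w g c → u * w * (pos 11 / 1 * g) - g * c * u ≡ u * g * (pos 11 / 1 * w + (- 1ℚ) * c)
ringᵠ₁₈₉ = solveᵠ 4 λ u w g c → u :* w :* (con (pos 11 / 1) :* g) :- g :* c :* u := u :* g :* (con (pos 11 / 1) :* w :+ (:- con 1ℚ) :* c)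

ringᵠ₁₉₀ : ∀ r x → - (r * ((1ℚ + x) * ((1ℚ + x) * ((1ℚ + x) * ((1ℚ + x) * ((1ℚ + x) * ((1ℚ + x) * ((1ℚ + x) * ((1ℚ + x) * ((1ℚ + x) * ((1ℚ + x) * ((1ℚ + x) * ((1ℚ + x) * 1ℚ)))))))))))) - x * (1ℚ + x * x) * ((1ℚ - x * x) * ((1ℚ - x * x) * ((1ℚ - x * x) * ((1ℚ - x * x) * 1ℚ))))) ≡ pos 1 / 8 * (((1ℚ + x) * ((1ℚ + x) * ((1ℚ + x) * ((1ℚ + x) * 1ℚ))) - (1ℚ - x) * ((1ℚ - x) * ((1ℚ - x) * ((1ℚ - x) * 1ℚ)))) * ((1ℚ - x) * ((1ℚ - x) * ((1ℚ - x) * ((1ℚ - x) * 1ℚ))) * ((1ℚ + x) * ((1ℚ + x) * ((1ℚ + x) * ((1ℚ + x) * 1ℚ)))))) - r * ((1ℚ + x) * ((1ℚ + x) * ((1ℚ + x) * ((1ℚ + x) * 1ℚ))) * ((1ℚ + x) * ((1ℚ + x) * ((1ℚ + x) * ((1ℚ + x) * 1ℚ))) * ((1ℚ + x) * ((1ℚ + x) * ((1ℚ + x) * ((1ℚ + x) * 1ℚ))))))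
ringᵠ₁₉₀ = solveᵠ 2 λ r x → (:- (r :* ((con 1ℚ :+ x) :* ((con 1ℚ :+ x) :* ((con 1ℚ :+ x) :* ((con 1ℚ :+ x) :* ((con 1ℚ :+ x) :* ((con 1ℚ :+ x) :* ((con 1ℚ :+ x) :* ((con 1ℚ :+ x) :* ((con 1ℚ :+ x) :* ((con 1ℚ :+ x) :* ((con 1ℚ :+ x) :* ((con 1ℚ :+ x) :* con 1ℚ)))))))))))) :- x :* (con 1ℚ :+ x :* x) :* ((con 1ℚ :- x :* x) :* ((con 1ℚ :- x :* x) :* ((con 1ℚ :- x :* x) :* ((con 1ℚ :- x :* x) :* con 1ℚ)))))) := con (pos 1 / 8) :* (((con 1ℚ :+ x) :* ((con 1ℚ :+ x) :* ((con 1ℚ :+ x) :* ((con 1ℚ :+ x) :* con 1ℚ))) :- (con 1ℚ :- x) :* ((con 1ℚ :- x) :* ((con 1ℚ :- x) :* ((con 1ℚ :- x) :* con 1ℚ)))) :* ((con 1ℚ :- x) :* ((con 1ℚ :- x) :* ((con 1ℚ :- x) :* ((con 1ℚ :- x) :* con 1ℚ))) :* ((con 1ℚ :+ x) :* ((con 1ℚ :+ x) :* ((con 1ℚ :+ x) :* ((con 1ℚ :+ x) :* con 1ℚ)))))) :- r :* ((con 1ℚ :+ x) :* ((con 1ℚ :+ x) :* ((con 1ℚ :+ x) :* ((con 1ℚ :+ x) :* con 1ℚ))) :* ((con 1ℚ :+ x) :* ((con 1ℚ :+ x) :* ((con 1ℚ :+ x) :* ((con 1ℚ :+ x) :* con 1ℚ)))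 :* ((con 1ℚ :+ x) :* ((con 1ℚ :+ x) :* ((con 1ℚ :+ x) :* ((con 1ℚ :+ x) :* con 1ℚ))))))

ringᵠ₁₉₁ : ∀ u m a → pos 1 / 8 * ((u - u * m) * (u * m * u)) - pos 1 / 8 * (a * (1ℚ - a)) * (u * (u * u)) ≡ u * (u * u) * (pos 1 / 8 * ((m - a) * (1ℚ - m - a)))
ringᵠ₁₉₁ = solveᵠ 3 λ u m a → con (pos 1 / 8) :* ((u :- u :* m) :* (u :* m :* u)) :- con (pos 1 / 8) :* (a :* (con 1ℚ :- a)) :* (u :* (u :* u)) := u :* (u :* u) :* (con (pos 1 / 8) :* ((m :- a) :* (con 1ℚ :- m :- a)))

ringᵠ₁₉₂ : ∀ d → pos 1 / 800 * (pos 50 / 1 * d) ≡ pos 1 / 8 * (d * ½)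
ringᵠ₁₉₂ = solveᵠ 1 λ d → con (pos 1 / 800) :* (con (pos 50 / 1) :* d) := con (pos 1 / 8) :* (d :* con ½)

ringᵠ₁₉₃ : ∀ m → pos 11 / 1 * (pos 1 / 22 * m) ≡ ½ * m
ringᵠ₁₉₃ = solveᵠ 1 λ m → con (pos 11 / 1) :* (con (pos 1 / 22) :* m) := con ½ :* m

ringᵠ₁₉₄ : ∀ m a → 1ℚ - m - a - ½ ≡ pos 1 / 7 - m + (pos 1 / 7 - a) + pos 3 / 14
ringᵠ₁₉₄ = solveᵠ 2 λ m a → con 1ℚ :- m :- a :- con ½ := con (pos 1 / 7) :- m :+ (con (pos 1 / 7) :- a) :+ con (pos 3 / 14)

-- Here μ is V⁴/T⁴ at t = x, at most (3/5)⁴ < 1/7. Both r and the value of t q / T¹² have the form a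
-- (1 - a)/8, with a = λ₁ and a = μ, so -f(x) is a positive multiple of (μ - λ₁)(1 - μ - λ₁).
module Mirror {x : ℚ} (x≥ : pos 1 / 4 ≤ x) (x≤ : x ≤ pos 2 / 5) where
  x≥0 : 0ℚ ≤ x
  x≥0 = ≤-trans {0ℚ} {pos 1 / 4} {x} lit≤ x≥
  1-x≥0 : 0ℚ ≤ 1ℚ - x
  1-x≥0 = ≤⇒0≤- {x} {1ℚ} (≤-trans {x} {pos 2 / 5} {1ℚ} x≤ lit≤)
  1≤1+x : 1ℚ ≤ 1ℚ + x
  1≤1+x = by≤ (ringᵠ₁₈₆ x) x≥0
  Uₓ Vₓ : ℚ
  Uₓ = (1ℚ + x) ^ 4
  Vₓ = (1ℚ - x) ^ 4
  1≤Uₓ : 1ℚ ≤ Uₓ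
  1≤Uₓ = 1≤^ 4 1≤1+x
  Uₓ>0 : 0ℚ < Uₓ
  Uₓ>0 = ℚₚ.<-≤-trans {0ℚ} {1ℚ} {Uₓ} lit< 1≤Uₓ
  inv : ∃ λ v → (Uₓ * v ≡ 1ℚ) × 0ℚ < v
  inv = recip Uₓ Uₓ>0
  μ : ℚ
  μ = Vₓ * proj₁ inv
  Vₓ≡ : Vₓ ≡ Uₓ * μ
  Vₓ≡ = div-by {Vₓ} {Uₓ} (proj₁ (proj₂ inv))
  μ≥0 : 0ℚ ≤ μ
  μ≥0 = 0≤* (^-nonneg 4 1-x≥0) (<⇒≤ (proj₂ (proj₂ inv)))
  μ≤ : μ ≤ pos 1 / 7
  μ≤ = *-cancelˡ {μ} {pos 1 / 7} {Uₓ} Uₓ>0 (subst (_≤ Uₓ * (pos 1 / 7)) Vₓ≡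
    (≤-trans {Vₓ} {(pos 3 / 5) ^ 4 * Uₓ} (≤-trans {Vₓ} {(pos 3 / 5 * (1ℚ + x)) ^ 4} (^-mono {1ℚ - x} {pos 3 / 5 * (1ℚ + x)} 4 1-x≥0 (by≤ {1ℚ - x} {pos 3 / 5 * (1ℚ + x)} (ringᵠ₁₈₇ x) (0≤* {pos 8 / 5} lit≤ (≤⇒0≤- x≥)))) (≤-reflexive (^-*-distrib (pos 3 / 5) (1ℚ + x) 4)))
      (≤-trans {(pos 3 / 5) ^ 4 * Uₓ} {pos 1 / 7 * Uₓ} (*-monoʳ {(pos 3 / 5) ^ 4} {pos 1 / 7} {Uₓ} (<⇒≤ Uₓ>0) lit≤) (≤-reflexive (ℚₚ.*-comm (pos 1 / 7) Uₓ)))))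

  VE cofE GE : Expr
  VE = (lit (pos 1) ⊹ neg var) ↑ 4
  GE = lit (pos 11) ✶ (var ✶ var ✶ (var ✶ var)) ⊹ lit (pos 6) ✶ (var ✶ var) ⊹ lit -[1+ 0 ]
  cofE = hornerE (pos 11 ∷ pos 1194 ∷ pos 1065 ∷ pos 1308 ∷ pos 621 ∷ -[1+ 101 ] ∷ -[1+ 0 ] ∷ []) (var ✶ var)

  -- The numerator of m(μ) is divisible by 11x⁴ + 6x² - 1, which is why m vanishes at t₀. The
  -- cofactor is coefficientwise at most 11 (1 + x)¹⁶.
  m-μ≤ : 0ℚ ≤ Gᵗ x → evalL mL μ ≤ pos 11 / 1 * Gᵗ x
  m-μ≤ G≥0 = *-cancelˡ {evalL mL μ} {pos 11 / 1 * Gᵗ x} {Uₓ ^ 5} (^-pos 5 Uₓ>0)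
    (subst (_≤ Uₓ ^ 5 * (pos 11 / 1 * Gᵗ x)) (trans (cong (_* Uₓ) (sym (poly-identity (homE mL VE TE) (GE ✶ cofE) x))) hom)
      (by≤ (ringᵠ₁₈₉ Uₓ (Uₓ ^ 4) (Gᵗ x) (evalE cofE x)) (0≤* (0≤* (<⇒≤ Uₓ>0) G≥0) cof≤)))
    where
    VE≡ : evalE VE x ≡ Uₓ * μ
    VE≡ = trans (ringᵠ₁₈₈ x) Vₓ≡
    hom : evalE (homE mL VE TE) x * Uₓ ≡ Uₓ ^ 5 * evalL mL μ
    hom = evalE-hom mL VE TE x μ VE≡
    cof≤ : 0ℚ ≤ pos 11 / 1 * Uₓ ^ 4 + (- 1ℚ) * evalE cofE x
    cof≤ = poly-nonneg (lit (pos 11) ✶ TE ↑ 4 ⊹ neg cofE) x≥0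

  f-value : ∀ λ₁ → - evalQ (fL (pos 1 / 8 * (λ₁ * (1ℚ - λ₁)))) x ≡ Uₓ * (Uₓ * Uₓ) * (pos 1 / 8 * ((μ - λ₁) * (1ℚ - μ - λ₁)))
  f-value a = trans (cong -_ (root-eq (pos 1 / 8 * (a * (1ℚ - a))) x)) (trans (ringᵠ₁₉₀ (pos 1 / 8 * (a * (1ℚ - a))) x) (trans (cong (λ z → pos 1 / 8 * ((Uₓ - z) * (z * Uₓ)) - pos 1 / 8 * (a * (1ℚ - a)) * (Uₓ * (Uₓ * Uₓ))) Vₓ≡) (ringᵠ₁₉₁ Uₓ μ a)))

  -- 1/22 turns the bound 11 `Gᵗ` into half of m(λ₁); 1/800 is 1/8 · 1/2 · 1/50, from the factor
  -- 1/8, from 1 - μ - λ₁ ≥ 1/2 and from `m-decreasing`.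
  f-below : ∀ {λ₁} → 0ℚ ≤ λ₁ → λ₁ ≤ pos 1 / 7 → 0ℚ < evalL mL λ₁ → 0ℚ ≤ Gᵗ x → Gᵗ x ≤ pos 1 / 22 * evalL mL λ₁ →
    pos 1 / 800 * evalL mL λ₁ ≤ - evalQ (fL (pos 1 / 8 * (λ₁ * (1ℚ - λ₁)))) x
  f-below {a} a≥0 a≤ m>0 G≥0 G≤ = subst (pos 1 / 800 * evalL mL a ≤_) (sym (f-value a))
    (≤-trans {pos 1 / 800 * evalL mL a} {pos 1 / 8 * ((μ - a) * (1ℚ - μ - a))} (≤-trans {pos 1 / 800 * evalL mL a} {pos 1 / 8 * ((μ - a) * ½)}
      (≤-trans {pos 1 / 800 * evalL mL a} {pos 1 / 800 * (pos 50 / 1 * (μ - a))} (*-monoˡ {evalL mL a} {pos 50 / 1 * (μ - a)} {pos 1 / 800} lit≤ main) (≤-reflexive (ringᵠ₁₉₂ (μ - a))))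
      (*-monoˡ {(μ - a) * ½} {(μ - a) * (1ℚ - μ - a)} {pos 1 / 8} lit≤ (*-monoˡ {½} {1ℚ - μ - a} {μ - a} μ-a≥0 half≤)))
      (≤-trans {pos 1 / 8 * ((μ - a) * (1ℚ - μ - a))} {1ℚ * (pos 1 / 8 * ((μ - a) * (1ℚ - μ - a)))} (≤-reflexive (sym (ℚₚ.*-identityˡ (pos 1 / 8 * ((μ - a) * (1ℚ - μ - a))))))
        (*-monoʳ {1ℚ} {Uₓ * (Uₓ * Uₓ)} {pos 1 / 8 * ((μ - a) * (1ℚ - μ - a))} (0≤* {pos 1 / 8} lit≤ (0≤* μ-a≥0 (≤-trans {0ℚ} {½} lit≤ half≤))) Uₓ³≥1)))
    where
    Uₓ³≥1 : 1ℚ ≤ Uₓ * (Uₓ * Uₓ)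
    Uₓ³≥1 = *-mono {1ℚ} {Uₓ} {1ℚ * 1ℚ} {Uₓ * Uₓ} 0≤1 1≤Uₓ 0≤1 (*-mono {1ℚ} {Uₓ} {1ℚ} {Uₓ} 0≤1 1≤Uₓ 0≤1 1≤Uₓ)
    main : evalL mL a ≤ pos 50 / 1 * (μ - a)
    main = m-decreasing a≥0 a≤ μ≥0 μ≤ m>0 (≤-trans {evalL mL μ} {pos 11 / 1 * Gᵗ x} (m-μ≤ G≥0) (≤-trans {pos 11 / 1 * Gᵗ x} {pos 11 / 1 * (pos 1 / 22 * evalL mL a)} (*-monoˡ {Gᵗ x} {pos 1 / 22 * evalL mL a} {pos 11 / 1} lit≤ G≤) (≤-reflexive (ringᵠ₁₉₃ (evalL mL a)))))
    μ-a≥0 : 0ℚ ≤ μ - a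
    μ-a≥0 = *-cancelˡ-0≤ {μ - a} {pos 50 / 1} lit< (≤-trans (<⇒≤ m>0) main)
    half≤ : ½ ≤ 1ℚ - μ - a
    half≤ = by≤ (ringᵠ₁₉₄ μ a) (0≤+ {pos 1 / 7 - μ + (pos 1 / 7 - a)} (0≤+ (≤⇒0≤- μ≤) (≤⇒0≤- a≤)) lit≤)

ringᵠ₁₉₅ : ∀ a → pos 1 / 8 * a - pos 1 / 8 * (a * (1ℚ - a)) ≡ pos 1 / 8 * (a * a)
ringᵠ₁₉₅ = solveᵠ 1 λ a → con (pos 1 / 8) :* a :- con (pos 1 / 8) :* (a :* (con 1ℚ :- a)) := con (pos 1 / 8) :* (a :* a)

ringᵠ₁₉₆ : ∀ t a → pos 1 / 8 * (t * a) ≡ t * (pos 1 / 8 * a)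
ringᵠ₁₉₆ = solveᵠ 2 λ t a → con (pos 1 / 8) :* (t :* a) := t :* (con (pos 1 / 8) :* a)

ringᵠ₁₉₇ : ∀ t → (1ℚ + t) * ((1ℚ + t) * ((1ℚ + t) * ((1ℚ + t) * 1ℚ))) * t - pos 1 / 8 * (pos 8 / 1 * t * (1ℚ + t * t)) ≡ t * (t * (pos 4 / 1 + pos 5 / 1 * t + pos 4 / 1 * (t * t) + t * (t * t)))
ringᵠ₁₉₇ = solveᵠ 1 λ t → (con 1ℚ :+ t) :* ((con 1ℚ :+ t) :* ((con 1ℚ :+ t) :* ((con 1ℚ :+ t) :* con 1ℚ))) :* t :- con (pos 1 / 8) :* (con (pos 8 / 1) :* t :* (con 1ℚ :+ t :* t)) := t :* (t :* (con (pos 4 / 1) :+ con (pos 5 / 1) :* t :+ con (pos 4 / 1) :* (t :* t) :+ t :* (t :* t)))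

ringᵠ₁₉₈ : ∀ x → ((1ℚ + x) * ((1ℚ + x) * ((1ℚ + x) * ((1ℚ + x) * ((1ℚ + x) * ((1ℚ + x) * ((1ℚ + x) * ((1ℚ + x) * ((1ℚ + x) * ((1ℚ + x) * ((1ℚ + x) * ((1ℚ + x) * 1ℚ)))))))))))) ≡ (1ℚ + x) * ((1ℚ + x) * ((1ℚ + x) * ((1ℚ + x) * 1ℚ))) * ((1ℚ + x) * ((1ℚ + x) * ((1ℚ + x) * ((1ℚ + x) * 1ℚ))) * ((1ℚ + x) * ((1ℚ + x) * ((1ℚ + x) * ((1ℚ + x) * 1ℚ)))))
ringᵠ₁₉₈ = solveᵠ 1 λ x → (con 1ℚ :+ x) :* ((con 1ℚ :+ x) :* ((con 1ℚ :+ x) :* ((con 1ℚ :+ x) :* ((con 1ℚ :+ x) :* ((con 1ℚ :+ x) :* ((con 1ℚ :+ x) :* ((con 1ℚ :+ x) :* ((con 1ℚ :+ x) :* ((con 1ℚ :+ x) :* ((con 1ℚ :+ x) :* ((con 1ℚ :+ x) :* con 1ℚ))))))))))) := (con 1ℚ :+ x) :* ((con 1ℚ :+ x) :* ((con 1ℚ :+ x) :* ((con 1ℚ :+ x) :* con 1ℚ))) :* ((con 1ℚ :+ x) :* ((con 1ℚ :+ x) :* ((con 1ℚ :+ x) :* ((con 1ℚ :+ x) :* con 1ℚ))) :* ((con 1ℚ :+ x) :* ((con 1ℚ :+ x) :* ((con 1ℚ :+ x) :* ((con 1ℚ :+ x) :* con 1ℚ)))))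

ringᵠ₁₉₉ : ∀ a t → pos 1 / 8 * (a * (1ℚ - a)) * (t * (t * t)) ≡ pos 1 / 8 * (t * a * ((t - t * a) * t))
ringᵠ₁₉₉ = solveᵠ 2 λ a t → con (pos 1 / 8) :* (a :* (con 1ℚ :- a)) :* (t :* (t :* t)) := con (pos 1 / 8) :* (t :* a :* ((t :- t :* a) :* t))

ringᵠ₂₀₀ : ∀ x → pos 1 / 8 * (pos 8 / 1 * x * (1ℚ + x * x) * (((1ℚ + x) * ((1ℚ + x) * ((1ℚ + x) * ((1ℚ + x) * 1ℚ))) - pos 8 / 1 * x * (1ℚ + x * x)) * ((1ℚ + x) * ((1ℚ + x) * ((1ℚ + x) * ((1ℚ + x) * 1ℚ)))))) ≡ x * (1ℚ + x * x) * ((1ℚ - x * x) * ((1ℚ - x * x) * ((1ℚ - x * x) * ((1ℚ - x * x) * 1ℚ))))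
ringᵠ₂₀₀ = solveᵠ 1 λ x → con (pos 1 / 8) :* (con (pos 8 / 1) :* x :* (con 1ℚ :+ x :* x) :* (((con 1ℚ :+ x) :* ((con 1ℚ :+ x) :* ((con 1ℚ :+ x) :* ((con 1ℚ :+ x) :* con 1ℚ))) :- con (pos 8 / 1) :* x :* (con 1ℚ :+ x :* x)) :* ((con 1ℚ :+ x) :* ((con 1ℚ :+ x) :* ((con 1ℚ :+ x) :* ((con 1ℚ :+ x) :* con 1ℚ)))))) := x :* (con 1ℚ :+ x :* x) :* ((con 1ℚ :- x :* x) :* ((con 1ℚ :- x :* x) :* ((con 1ℚ :- x :* x) :* ((con 1ℚ :- x :* x) :* con 1ℚ))))

multiplier : ∀ {τ} → 0ℚ < τ → τ ≤ pos 1 / 120 → 0ℚ < evalE M⁺ τ → Multiplier τ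
multiplier {τ} τ>0 τ≤ M>0 = record
  { r = pos 1 / 8 * (a * (1ℚ - a)) ; δ₁ = pos 1 / 800 * evalL mL a ; η₀ = pos 1 / 22 * evalL mL a
  ; r≥0 = 0≤* {pos 1 / 8} lit≤ (0≤* a≥0 (≤⇒0≤- (≤-trans {a} {pos 1 / 7} {1ℚ} a≤ lit≤)))
  ; r≤ = ≤-trans {pos 1 / 8 * (a * (1ℚ - a))} {τ} (≤-trans {pos 1 / 8 * (a * (1ℚ - a))} {pos 1 / 8 * a} (by≤ (ringᵠ₁₉₅ a) (0≤* {pos 1 / 8} lit≤ (0≤* a≥0 a≥0))) a/8≤τ) τ≤
  ; root = root
  ; δ₁>0 = 0<* {pos 1 / 800} lit< m>0 ; η₀>0 = 0<* {pos 1 / 22} lit< m>0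
  ; below = λ x≥ x≤ → Mirror.f-below x≥ x≤ a≥0 a≤ m>0 }
  where
  τ≥0 : 0ℚ ≤ τ
  τ≥0 = <⇒≤ τ>0
  T⁴ g : ℚ
  T⁴ = (1ℚ + τ) ^ 4
  g = pos 8 / 1 * τ * (1ℚ + τ * τ)
  T⁴>0 : 0ℚ < T⁴
  T⁴>0 = ^-pos 4 (0<+ {1ℚ} {τ} lit< τ≥0)
  inv : ∃ λ v → (T⁴ * v ≡ 1ℚ) × 0ℚ < v
  inv = recip T⁴ T⁴>0
  a : ℚ
  a = g * proj₁ inv
  g≡ : g ≡ T⁴ * a
  g≡ = div-by {g} {T⁴} (proj₁ (proj₂ inv))
  a≥0 : 0ℚ ≤ a
  a≥0 = 0≤* (0≤* (0≤* {pos 8 / 1} lit≤ τ≥0) (0≤+ 0≤1 (0≤* τ≥0 τ≥0))) (<⇒≤ (proj₂ (proj₂ inv)))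
  a/8≤τ : pos 1 / 8 * a ≤ τ
  a/8≤τ = *-cancelˡ {pos 1 / 8 * a} {τ} {T⁴} T⁴>0 (subst (_≤ T⁴ * τ) (trans (cong (pos 1 / 8 *_) g≡) (ringᵠ₁₉₆ T⁴ a))
    (by≤ (ringᵠ₁₉₇ τ) (0≤* τ≥0 (poly-nonneg (var ✶ (lit (pos 4) ⊹ lit (pos 5) ✶ var ⊹ lit (pos 4) ✶ (var ✶ var) ⊹ var ✶ (var ✶ var))) τ≥0))))
  a≤ : a ≤ pos 1 / 7
  a≤ = *-cancelˡ {a} {pos 1 / 7} {pos 1 / 8} lit< (≤-trans {pos 1 / 8 * a} {pos 1 / 120} (≤-trans a/8≤τ τ≤) lit≤)
  m>0 : 0ℚ < evalL mL a
  m>0 = *-cancelˡ-0< {evalL mL a} {T⁴ ^ 5} (^-nonneg 5 (<⇒≤ T⁴>0)) (subst (0ℚ <_) (evalE-hom mL (lit (pos 8) ✶ var ✶ (lit (pos 1) ⊹ var ✶ var)) TE τ a g≡) (0<* M>0 T⁴>0))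
  root : pos 1 / 8 * (a * (1ℚ - a)) * (1ℚ + τ) ^ 12 ≡ τ * (1ℚ + τ * τ) * (1ℚ - τ * τ) ^ 4
  root = trans (cong (pos 1 / 8 * (a * (1ℚ - a)) *_) (ringᵠ₁₉₈ τ)) (trans (ringᵠ₁₉₉ a T⁴) (trans (cong (λ z → pos 1 / 8 * (z * ((T⁴ - z) * T⁴))) (sym g≡)) (ringᵠ₂₀₀ τ)))

-- Rational points just above the positive zero of 11x⁴ + 6x² - 1

ringᵠ₂₀₁ : ∀ a b → pos 11 / 1 * (a * a * (a * a)) + pos 6 / 1 * (a * a) - 1ℚ + pos 12 / 1 * (b - a) - (pos 11 / 1 * (b * b * (b * b)) + pos 6 / 1 * (b * b) - 1ℚ) ≡ (b - a) * (pos 12 / 1 - (a + b) * (pos 6 / 1 + pos 11 / 1 * (a * a + b * b)))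
ringᵠ₂₀₁ = solveᵠ 2 λ a b → con (pos 11 / 1) :* (a :* a :* (a :* a)) :+ con (pos 6 / 1) :* (a :* a) :- con 1ℚ :+ con (pos 12 / 1) :* (b :- a) :- (con (pos 11 / 1) :* (b :* b :* (b :* b)) :+ con (pos 6 / 1) :* (b :* b) :- con 1ℚ) := (b :- a) :* (con (pos 12 / 1) :- (a :+ b) :* (con (pos 6 / 1) :+ con (pos 11 / 1) :* (a :* a :+ b :* b)))

-- The difference quotient (a + b)(6 + 11(a² + b²)) is at most 6 + 11/2.
Gᵗ-lipschitz : ∀ {a b} → 0ℚ ≤ a → a ≤ b → b ≤ ½ → Gᵗ b ≤ Gᵗ a + pos 12 / 1 * (b - a)
Gᵗ-lipschitz {a} {b} a≥0 a≤b b≤½ = by≤ (ringᵠ₂₀₁ a b) (0≤* (≤⇒0≤- a≤b) (≤⇒0≤- bound))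
  where
  b≥0 : 0ℚ ≤ b
  b≥0 = ≤-trans a≥0 a≤b
  a≤½ : a ≤ ½
  a≤½ = ≤-trans a≤b b≤½
  W≤ : a * a + b * b ≤ ½
  W≤ = +-mono-≤ {a * a} {½ * ½} {b * b} {½ * ½} (*-mono {a} {½} {a} {½} a≥0 a≤½ a≥0 a≤½) (*-mono {b} {½} {b} {½} b≥0 b≤½ b≥0 b≤½)
  W≥0 : 0ℚ ≤ a * a + b * b
  W≥0 = 0≤+ (0≤* a≥0 a≥0) (0≤* b≥0 b≥0)
  bound : (a + b) * (pos 6 / 1 + pos 11 / 1 * (a * a + b * b)) ≤ pos 12 / 1
  bound = ≤-trans {(a + b) * (pos 6 / 1 + pos 11 / 1 * (a * a + b * b))} {1ℚ * (pos 6 / 1 + pos 11 / 1 * ½)} {pos 12 / 1}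
    (*-mono {a + b} {1ℚ} {pos 6 / 1 + pos 11 / 1 * (a * a + b * b)} {pos 6 / 1 + pos 11 / 1 * ½} (0≤+ a≥0 b≥0) (+-mono-≤ {a} {½} {b} {½} a≤½ b≤½)
      (0≤+ {pos 6 / 1} lit≤ (0≤* {pos 11 / 1} lit≤ W≥0)) (+-mono-≤ {pos 6 / 1} {pos 6 / 1} {pos 11 / 1 * (a * a + b * b)} {pos 11 / 1 * ½} ≤-refl (*-monoˡ {a * a + b * b} {½} {pos 11 / 1} lit≤ W≤))) lit≤

Gᵗ-mono : ∀ {a b} → 0ℚ ≤ a → a ≤ b → Gᵗ a ≤ Gᵗ b
Gᵗ-mono {a} {b} a≥0 a≤b = +-mono-≤ {pos 11 / 1 * (a * a * (a * a)) + pos 6 / 1 * (a * a)} {pos 11 / 1 * (b * b * (b * b)) + pos 6 / 1 * (b * b)} { - 1ℚ} { - 1ℚ}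
  (+-mono-≤ {pos 11 / 1 * (a * a * (a * a))} {pos 11 / 1 * (b * b * (b * b))} {pos 6 / 1 * (a * a)} {pos 6 / 1 * (b * b)}
    (*-monoˡ {a * a * (a * a)} {b * b * (b * b)} {pos 11 / 1} lit≤ (*-mono aa≥0 aa≤ aa≥0 aa≤)) (*-monoˡ {a * a} {b * b} {pos 6 / 1} lit≤ aa≤)) ≤-refl
  where
  aa≥0 : 0ℚ ≤ a * a
  aa≥0 = 0≤* a≥0 a≥0
  aa≤ : a * a ≤ b * b
  aa≤ = *-mono a≥0 a≤b a≥0 a≤b

Near : ℚ → Set
Near η = ∃ λ x → pos 1 / 4 ≤ x × x ≤ pos 2 / 5 × 0ℚ ≤ Gᵗ x × Gᵗ x ≤ η

ringᵠ₂₀₂ : ∀ a v → pos 2 / 1 * a * v ≡ pos 2 / 5 * (pos 5 / 1 * (a * v))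
ringᵠ₂₀₂ = solveᵠ 2 λ a v → con (pos 2 / 1) :* a :* v := con (pos 2 / 5) :* (con (pos 5 / 1) :* (a :* v))

ringᵠ₂₀₃ : ∀ v → 0ℚ - (pos 11 / 1 * (0ℚ * v * (0ℚ * v) * (0ℚ * v * (0ℚ * v))) + pos 6 / 1 * (0ℚ * v * (0ℚ * v)) - 1ℚ) ≡ 1ℚ
ringᵠ₂₀₃ = solveᵠ 1 λ v → con 0ℚ :- (con (pos 11 / 1) :* (con 0ℚ :* v :* (con 0ℚ :* v) :* (con 0ℚ :* v :* (con 0ℚ :* v))) :+ con (pos 6 / 1) :* (con 0ℚ :* v :* (con 0ℚ :* v)) :- con 1ℚ) := con 1ℚ

ringᵠ₂₀₄ : ∀ e k v → e * (pos 5 / 1 * (k * v)) - e * k * v ≡ pos 4 / 1 * (e * (k * v))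
ringᵠ₂₀₄ = solveᵠ 3 λ e k v → e :* (con (pos 5 / 1) :* (k :* v)) :- e :* k :* v := con (pos 4 / 1) :* (e :* (k :* v))

ringᵠ₂₀₅ : ∀ e G i v → e - (G + pos 12 / 1 * ((1ℚ + i) * v - i * v)) ≡ e - pos 12 / 1 * v + (0ℚ - G)
ringᵠ₂₀₅ = solveᵠ 4 λ e G i v → e :- (G :+ con (pos 12 / 1) :* ((con 1ℚ :+ i) :* v :- i :* v)) := e :- con (pos 12 / 1) :* v :+ (con 0ℚ :- G)

module NearGrid {η : ℚ} (K N : ℕ) (K>0 : 0ℚ < ι K) (N≡ : ι N ≡ pos 5 / 1 * ι K) (hη : pos 12 / 1 ≤ η * ι K) (η≥0 : 0ℚ ≤ η) where
  ν⁻¹ : ∃ λ q → (ι N * q ≡ 1ℚ) × 0ℚ < q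
  ν⁻¹ = recip (ι N) (subst (0ℚ <_) (sym N≡) (0<* {pos 5 / 1} lit< K>0))
  ν : ℚ
  ν = proj₁ ν⁻¹
  ν≥0 : 0ℚ ≤ ν
  ν≥0 = <⇒≤ (proj₂ (proj₂ ν⁻¹))
  g : ℕ → ℚ
  g i = ι i * ν
  g-nonneg : ∀ i → 0ℚ ≤ g i
  g-nonneg i = 0≤* (ι-nonneg i) ν≥0
  g-mono : ∀ {i j} → i ℕ.≤ j → g i ≤ g j
  g-mono q = *-monoʳ ν≥0 (ι-mono q)
  five : pos 5 / 1 * g K ≡ 1ℚ
  five = trans (trans (sym (ℚₚ.*-assoc (pos 5 / 1) (ι K) ν)) (cong (_* ν) (sym N≡))) (proj₁ (proj₂ ν⁻¹))
  top : g (2 ℕ.* K) ≡ pos 2 / 5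
  top = trans (cong (_* ν) (ι-* 2 K)) (trans (ringᵠ₂₀₂ (ι K) ν) (cong (pos 2 / 5 *_) five))
  P : ℕ → Set
  P i = 0ℚ < Gᵗ (g i)
  ¬P0 : ¬ P 0
  ¬P0 h = ℚₚ.<-asym h (by< (ringᵠ₂₀₃ ν) lit<)
  found : ∃ λ l → ¬ P l × P (suc l) × suc l ℕ.≤ 2 ℕ.* K
  found = crossing P (λ i → 0ℚ <? Gᵗ (g i)) (2 ℕ.* K) ¬P0 (subst (λ z → 0ℚ < Gᵗ z) (sym top) (lit< {0ℚ} {Gᵗ (pos 2 / 5)}))
  l : ℕ
  l = proj₁ found
  x≤ : g (suc l) ≤ pos 2 / 5
  x≤ = subst (g (suc l) ≤_) top (g-mono (proj₂ (proj₂ (proj₂ found))))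
  x≥ : pos 1 / 4 ≤ g (suc l) ⊎ g (suc l) ≤ pos 1 / 4 → pos 1 / 4 ≤ g (suc l)
  x≥ (inj₁ h) = h
  x≥ (inj₂ h) = ⊥-elim (ℚₚ.<-irrefl refl (ℚₚ.<-≤-trans (proj₁ (proj₂ (proj₂ found))) (≤-trans {Gᵗ (g (suc l))} {Gᵗ (pos 1 / 4)} {0ℚ} (Gᵗ-mono (g-nonneg (suc l)) h) lit≤)))
  12ν≤η : pos 12 / 1 * ν ≤ η
  12ν≤η = ≤-trans {pos 12 / 1 * ν} {η * ι K * ν} (*-monoʳ {pos 12 / 1} {η * ι K} {ν} ν≥0 hη)
    (by≤ (trans (cong (λ z → z - η * ι K * ν) (trans (sym (ℚₚ.*-identityʳ η)) (cong (η *_) (sym five)))) (ringᵠ₂₀₄ η (ι K) ν)) (0≤* {pos 4 / 1} lit≤ (0≤* η≥0 (g-nonneg K))))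
  near : Near η
  near = g (suc l) , x≥ (ℚₚ.≤-total (pos 1 / 4) (g (suc l))) , x≤ , <⇒≤ (proj₁ (proj₂ (proj₂ found))) ,
    ≤-trans {Gᵗ (g (suc l))} {Gᵗ (g l) + pos 12 / 1 * (g (suc l) - g l)}
      (Gᵗ-lipschitz (g-nonneg l) (g-mono (ℕₚ.n≤1+n l)) (≤-trans {g (suc l)} {pos 2 / 5} {½} x≤ lit≤))
      (by≤ (trans (cong (λ z → η - (Gᵗ (g l) + pos 12 / 1 * (z * ν - g l))) (ι-suc l)) (ringᵠ₂₀₅ η (Gᵗ (g l)) (ι l) ν)) (0≤+ (≤⇒0≤- 12ν≤η) (≤⇒0≤- (ℚₚ.≮⇒≥ (proj₁ (proj₂ found))))))

exceed : ∀ {a} → 0ℚ < a → ∀ b → ∃ λ K → ∀ n → K ℕ.≤ n → b ≤ a * ι n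
exceed {a} a>0 b = let a' , aa' , a'>0 = recip a a>0 ; K , h = archimedes (b * a') in
  K , λ n K≤n → subst (_≤ a * ι n) (sym (div-by {b} {a} aa')) (*-monoˡ (<⇒≤ a>0) (≤-trans h (ι-mono K≤n)))

near : ∀ {η} → 0ℚ < η → Near η
near {η} η>0 = let K , h = exceed η>0 (pos 12 / 1) in NearGrid.near {η} (suc K) (5 ℕ.* suc K) (ι-pos K) (ι-* 5 (suc K)) (h (suc K) (ℕₚ.n≤1+n K)) (<⇒≤ η>0)

-- Nonnegativity of Φ at all weights beyond the claimed bound

ringᵠ₂₀₆ : ∀ a → a + pos 13 / 1 - a ≡ pos 13 / 1
ringᵠ₂₀₆ = solveᵠ 1 λ a → a :+ con (pos 13 / 1) :- a := con (pos 13 / 1)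

ringᵠ₂₀₇ : ∀ a → a + pos 13 / 1 - pos 13 / 1 ≡ a
ringᵠ₂₀₇ = solveᵠ 1 λ a → a :+ con (pos 13 / 1) :- con (pos 13 / 1) := a

ringᵠ₂₀₈ : ∀ V → pos 1001 / 1 * V ≡ ½ * (pos 2002 / 1 * V)
ringᵠ₂₀₈ = solveᵠ 1 λ V → con (pos 1001 / 1) :* V := con ½ :* (con (pos 2002 / 1) :* V)

ringᵠ₂₀₉ : ∀ n a → n ≡ n + a - a
ringᵠ₂₀₉ = solveᵠ 2 λ n a → n := n :+ a :- a

ringᵠ₂₁₀ : ∀ k e → k ≡ k + e - e
ringᵠ₂₁₀ = solveᵠ 2 λ k e → k := k :+ e :- e

ringᵠ₂₁₁ : ∀ u q a e V → pos 12 / 1 * (u * q + V) - pos 12 / 1 * e ≡ pos 12 / 1 * (1ℚ + q - e) - (1ℚ - u) * (pos 12 / 1 * q - (1ℚ + a)) + (V - (a + pos 13 / 1) + u * (1ℚ + a) + pos 11 / 1 * V)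
ringᵠ₂₁₁ = solveᵠ 5 λ u q a e V → con (pos 12 / 1) :* (u :* q :+ V) :- con (pos 12 / 1) :* e := con (pos 12 / 1) :* (con 1ℚ :+ q :- e) :- (con 1ℚ :- u) :* (con (pos 12 / 1) :* q :- (con 1ℚ :+ a)) :+ (V :- (a :+ con (pos 13 / 1)) :+ u :* (con 1ℚ :+ a) :+ con (pos 11 / 1) :* V)

ringᵠ₂₁₂ : ∀ u q e V → q - pos 1001 / 1 * e ≡ pos 1001 / 1 * (u * q + V - e) + pos 1001 / 1 * ((pos 1 / 2500 - u) * q) + (pos 249 / 2500 * q + (½ * q - pos 1001 / 1 * V))
ringᵠ₂₁₂ = solveᵠ 4 λ u q e V → q :- con (pos 1001 / 1) :* e := con (pos 1001 / 1) :* (u :* q :+ V :- e) :+ con (pos 1001 / 1) :* ((con (pos 1 / 2500) :- u) :* q) :+ (con (pos 249 / 2500) :* q :+ (con ½ :* q :- con (pos 1001 / 1) :* V))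

ringᵠ₂₁₃ : ∀ q e → pos 1 / 1000 * (1ℚ + q - e) - e ≡ pos 1 / 1000 * (1ℚ + (q - pos 1001 / 1 * e))
ringᵠ₂₁₃ = solveᵠ 2 λ q e → con (pos 1 / 1000) :* (con 1ℚ :+ q :- e) :- e := con (pos 1 / 1000) :* (con 1ℚ :+ (q :- con (pos 1001 / 1) :* e))

ringᵠ₂₁₄ : ∀ q e → 1ℚ + q - e - ½ * q ≡ 1ℚ + (½ * (q - pos 1001 / 1 * e) + pos 999 / 2 * e)
ringᵠ₂₁₄ = solveᵠ 2 λ q e → con 1ℚ :+ q :- e :- con ½ :* q := con 1ℚ :+ (con ½ :* (q :- con (pos 1001 / 1) :* e) :+ con (pos 999 / 2) :* e)

ringᵠ₂₁₅ : ∀ V q → pos 1 / 1000 * (½ * q) - V ≡ pos 1 / 1000 * (½ * q - pos 1001 / 1 * V + V)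
ringᵠ₂₁₅ = solveᵠ 2 λ V q → con (pos 1 / 1000) :* (con ½ :* q) :- V := con (pos 1 / 1000) :* (con ½ :* q :- con (pos 1001 / 1) :* V :+ V)

ringᵠ₂₁₆ : ∀ q a e V → pos 12 / 1 * q - (1ℚ + a) - (1ℚ + q - e) ≡ V - (a + pos 13 / 1) + (q - pos 2002 / 1 * V + e) + (pos 10 / 1 * q + pos 2001 / 1 * V + pos 11 / 1)
ringᵠ₂₁₆ = solveᵠ 4 λ q a e V → con (pos 12 / 1) :* q :- (con 1ℚ :+ a) :- (con 1ℚ :+ q :- e) := V :- (a :+ con (pos 13 / 1)) :+ (q :- con (pos 2002 / 1) :* V :+ e) :+ (con (pos 10 / 1) :* q :+ con (pos 2001 / 1) :* V :+ con (pos 11 / 1))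

ringᵠ₂₁₇ : ∀ k d → d ≡ k + d - k
ringᵠ₂₁₇ = solveᵠ 2 λ k d → d := k :+ d :- k

ringᵠ₂₁₈ : ∀ u n k → pos 12 / 13 * (pos 12 / 1 * k) - pos 12 / 13 * (n - k) ≡ pos 12 / 1 * k - (1ℚ - u) * n + (pos 1 / 13 - pos 1 / 2500 + (pos 1 / 2500 - u)) * n
ringᵠ₂₁₈ = solveᵠ 3 λ u n k → con (pos 12 / 13) :* (con (pos 12 / 1) :* k) :- con (pos 12 / 13) :* (n :- k) := con (pos 12 / 1) :* k :- (con 1ℚ :- u) :* n :+ (con (pos 1 / 13) :- con (pos 1 / 2500) :+ (con (pos 1 / 2500) :- u)) :* n

ringᵠ₂₁₉ : ∀ q → 1ℚ + q - 1ℚ ≡ q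
ringᵠ₂₁₉ = solveᵠ 1 λ q → con 1ℚ :+ q :- con 1ℚ := q

ringᵠ₂₂₀ : ∀ n → pos 5 / 1 * n - 1ℚ ≡ n - 1ℚ + pos 4 / 1 * n
ringᵠ₂₂₀ = solveᵠ 1 λ n → con (pos 5 / 1) :* n :- con 1ℚ := n :- con 1ℚ :+ con (pos 4 / 1) :* n

ringᵠ₂₂₁ : ∀ m e → e - m ≡ e - (m + m) + m
ringᵠ₂₂₁ = solveᵠ 2 λ m e → e :- m := e :- (m :+ m) :+ m

ringᵠ₂₂₂ : ∀ k e → k + e - e ≡ k
ringᵠ₂₂₂ = solveᵠ 2 λ k e → k :+ e :- e := k

ringᵠ₂₂₃ : ∀ s q → s * (pos 3 / 1 * (1ℚ + q)) - 1ℚ ≡ s * q - 1ℚ + s * (pos 3 / 1 + 2ℚ * q)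
ringᵠ₂₂₃ = solveᵠ 2 λ s q → s :* (con (pos 3 / 1) :* (con 1ℚ :+ q)) :- con 1ℚ := s :* q :- con 1ℚ :+ s :* (con (pos 3 / 1) :+ con 2ℚ :* q)

ringᵠ₂₂₄ : ∀ s u q V e m → s * (pos 3 / 1 * (1ℚ + q)) + s * s * (pos 5 / 1 * (1ℚ + q)) - (m * (1ℚ - s * s) + 1ℚ + 2ℚ * (s * s)) ≡ ½ * ((pos 6 / 1 * s + pos 10 / 1 * (s * s) - (1ℚ - s * s) * u) * q - (V + 2ℚ) + (1ℚ - s * s) * (u * q + V - e + (e - (m + m))) + (s * s * (V + pos 6 / 1) + pos 6 / 1 * s))
ringᵠ₂₂₄ = solveᵠ 6 λ s u q V e m → s :* (con (pos 3 / 1) :* (con 1ℚ :+ q)) :+ s :* s :* (con (pos 5 / 1) :* (con 1ℚ :+ q)) :- (m :* (con 1ℚ :- s :* s) :+ con 1ℚ :+ con 2ℚ :* (s :* s)) := con ½ :* ((con (pos 6 / 1) :* s :+ con (pos 10 / 1) :* (s :* s) :- (con 1ℚ :- s :* s) :* u) :* q :- (V :+ con 2ℚ) :+ (con 1ℚ :- s :* s) :* (u :* q :+ V :- e :+ (e :- (m :+ m))) :+ (s :* s :* (V :+ con (pos 6 / 1)) :+ con (pos 6 / 1) :* s))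

ringᵠ₂₂₅ : ∀ n m → pos 7 / 1 * n - (pos 5 / 1 * n + m + 1ℚ) ≡ n - m + (n - 1ℚ)
ringᵠ₂₂₅ = solveᵠ 2 λ n m → con (pos 7 / 1) :* n :- (con (pos 5 / 1) :* n :+ m :+ con 1ℚ) := n :- m :+ (n :- con 1ℚ)

ringᵠ₂₂₆ : ∀ n → pos 3 / 1 * n - pos 1 / 14400 * (pos 7 / 1 * n) ≡ (pos 3 / 1 - pos 7 / 14400) * n
ringᵠ₂₂₆ = solveᵠ 1 λ n → con (pos 3 / 1) :* n :- con (pos 1 / 14400) :* (con (pos 7 / 1) :* n) := (con (pos 3 / 1) :- con (pos 7 / 14400)) :* n

ringᵠ₂₂₇ : ∀ v q k → v * (pos 1 / 1000 * k) - 1ℚ ≡ pos 1 / 2000 * (v * q - pos 2000 / 1) + v * (pos 1 / 1000 * (k - ½ * q))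
ringᵠ₂₂₇ = solveᵠ 3 λ v q k → v :* (con (pos 1 / 1000) :* k) :- con 1ℚ := con (pos 1 / 2000) :* (v :* q :- con (pos 2000 / 1)) :+ v :* (con (pos 1 / 1000) :* (k :- con ½ :* q))

ringᵠ₂₂₈ : ∀ k → k ≡ pos 1000 / 1 * (pos 1 / 1000 * k)
ringᵠ₂₂₈ = solveᵠ 1 λ k → k := con (pos 1000 / 1) :* (con (pos 1 / 1000) :* k)

-- V collects every quantity that stays bounded as n grows; the hypotheses `hJ₁` to `hJ₄` say that J
-- is large compared with V, 1/ν, 1/τ₀² and the reciprocal of the gap.
module TailBounds {u τ₀ τ₂ τ₁ ν r V : ℚ} (u≥0 : 0ℚ ≤ u) (u≤ : u ≤ pos 1 / 2500)
  (ν>0 : 0ℚ < ν) (τ₀>0 : 0ℚ < τ₀) (τ₂≡ : τ₂ ≡ τ₀ + ν) (τ₁≡ : τ₁ ≡ τ₂ + ν) (τ₁≤ : τ₁ ≤ pos 1 / 120)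
  (r≥0 : 0ℚ ≤ r) (r≤ : r ≤ pos 1 / 120) (root : r * (1ℚ + τ₁) ^ 12 ≡ τ₁ * (1ℚ + τ₁ * τ₁) * (1ℚ - τ₁ * τ₁) ^ 4)
  (n J B k₀ : ℕ) (eA : n ℕ.+ suc (B ℕ.+ 31) ≡ 12 ℕ.* J)
  (hB : (τ₂ + τ₀) * (1ℚ - τ₀) ^ B ≤ (τ₂ - τ₀) * (1ℚ + τ₀) ^ B)
  (hV : ι (B ℕ.+ 31) + pos 13 / 1 ≤ V)
  (hJ₁ : pos 1001 / 1 * V ≤ ½ * ι J) (hJ₂ : pos 2000 / 1 ≤ ν * ι J)
  (hJ₃ : 1ℚ ≤ τ₀ * τ₀ * ι J) (hJ₄ : V + 2ℚ ≤ κ-gap u τ₀ * ι J)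
  (hk₀ : (1ℚ - u) * ι n ≤ pos 12 / 1 * ι k₀) where

  private
    a q : ℚ
    a = ι (B ℕ.+ 31)
    q = ι J
    a≥0 : 0ℚ ≤ a
    a≥0 = ι-nonneg (B ℕ.+ 31)
    V≥a : a ≤ V
    V≥a = ≤-trans {a} {a + pos 13 / 1} (by≤ (ringᵠ₂₀₆ a) lit≤) hV
    V≥13 : pos 13 / 1 ≤ V
    V≥13 = ≤-trans {pos 13 / 1} {a + pos 13 / 1} (by≤ (ringᵠ₂₀₇ a) a≥0) hV
    V≥0 : 0ℚ ≤ V
    V≥0 = ≤-trans {0ℚ} {pos 13 / 1} lit≤ V≥13
    q≥ : pos 2002 / 1 * V ≤ q
    q≥ = *-cancelˡ {pos 2002 / 1 * V} {q} {½} lit< (subst (_≤ ½ * q) (ringᵠ₂₀₈ V) hJ₁)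
    q≥0 : 0ℚ ≤ q
    q≥0 = ι-nonneg J
    ιn : ι n ≡ pos 12 / 1 * q - (1ℚ + a)
    ιn = trans (ringᵠ₂₀₉ (ι n) (1ℚ + a)) (cong (_- (1ℚ + a)) (trans (cong (ι n +_) (sym (ι-suc (B ℕ.+ 31)))) (trans (sym (ι-+ n (suc (B ℕ.+ 31)))) (trans (cong ι eA) (ι-* 12 J)))))
    σ : ℚ
    σ = τ₀ * τ₀
    σ>0 : 0ℚ < σ
    σ>0 = 0<* τ₀>0 τ₀>0
    σ≥0 : 0ℚ ≤ σ
    σ≥0 = <⇒≤ σ>0
    τ₀≤τ₂ : τ₀ ≤ τ₂
    τ₀≤τ₂ = by≤ (trans (cong (_- τ₀) τ₂≡) (ringᵠ₁₂₉ τ₀ ν)) (<⇒≤ ν>0)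
    τ₁-τ₂ : τ₁ - τ₂ ≡ ν
    τ₁-τ₂ = trans (cong (_- τ₂) τ₁≡) (ringᵠ₁₂₉ τ₂ ν)
    τ₂≤τ₁ : τ₂ ≤ τ₁
    τ₂≤τ₁ = by≤ τ₁-τ₂ (<⇒≤ ν>0)
    τ₀≤ : τ₀ ≤ pos 1 / 120
    τ₀≤ = ≤-trans τ₀≤τ₂ (≤-trans τ₂≤τ₁ τ₁≤)
    σ≤ : σ ≤ pos 1 / 14400
    σ≤ = *-mono {τ₀} {pos 1 / 120} {τ₀} {pos 1 / 120} (<⇒≤ τ₀>0) τ₀≤ (<⇒≤ τ₀>0) τ₀≤

  module At (k e : ℕ) (k₀≤k : k₀ ℕ.≤ k) (eJ : suc J ≡ k ℕ.+ e) where
    hk : (1ℚ - u) * ι n ≤ pos 12 / 1 * ι k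
    hk = ≤-trans {b = pos 12 / 1 * ι k₀} hk₀ (*-monoˡ {ι k₀} {ι k} {pos 12 / 1} lit≤ (ι-mono k₀≤k))
    sJ : 1ℚ + q ≡ ι k + ι e
    sJ = trans (sym (ι-suc J)) (trans (cong ι eJ) (ι-+ k e))
    k-eq : ι k ≡ 1ℚ + q - ι e
    k-eq = trans (ringᵠ₂₁₀ (ι k) (ι e)) (cong (_- ι e) (sym sJ))
    hk′ : 0ℚ ≤ pos 12 / 1 * (1ℚ + q - ι e) - (1ℚ - u) * (pos 12 / 1 * q - (1ℚ + a))
    hk′ = subst₂ (λ y z → 0ℚ ≤ pos 12 / 1 * y - (1ℚ - u) * z) k-eq ιn (≤⇒0≤- hk)
    -- From 12k ≥ (1 - u) n and n = 12J - A - 1: the distance of k from J + 1 is at most uJ up to a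
    -- bounded error.
    e≤ : ι e ≤ u * q + V
    e≤ = *-cancelˡ {ι e} {u * q + V} {pos 12 / 1} lit< (by≤ (ringᵠ₂₁₁ u q a (ι e) V)
      (0≤+ hk′ (0≤+ {V - (a + pos 13 / 1) + u * (1ℚ + a)} {pos 11 / 1 * V} (0≤+ (≤⇒0≤- hV) (0≤* u≥0 (0≤+ {1ℚ} lit≤ a≥0))) (0≤* {pos 11 / 1} lit≤ V≥0))))
    1001e≤ : pos 1001 / 1 * ι e ≤ q
    1001e≤ = by≤ (ringᵠ₂₁₂ u q (ι e) V) (0≤+ {pos 1001 / 1 * (u * q + V - ι e) + pos 1001 / 1 * ((pos 1 / 2500 - u) * q)} {pos 249 / 2500 * q + (½ * q - pos 1001 / 1 * V)}
        (0≤+ (0≤* {pos 1001 / 1} lit≤ (≤⇒0≤- e≤)) (0≤* {pos 1001 / 1} lit≤ (0≤* (≤⇒0≤- u≤) q≥0))) (0≤+ (0≤* {pos 249 / 2500} lit≤ q≥0) (≤⇒0≤- hJ₁)))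
    e≤k/1000 : ι e ≤ pos 1 / 1000 * ι k
    e≤k/1000 = subst (λ z → ι e ≤ pos 1 / 1000 * z) (sym k-eq) (by≤ (ringᵠ₂₁₃ q (ι e)) (0≤* {pos 1 / 1000} lit≤ (0≤+ {1ℚ} lit≤ (≤⇒0≤- 1001e≤))))
    k≥½q : ½ * q ≤ ι k
    k≥½q = subst (½ * q ≤_) (sym k-eq) (by≤ (ringᵠ₂₁₄ q (ι e)) (0≤+ {1ℚ} lit≤ (0≤+ (0≤* {½} lit≤ (≤⇒0≤- 1001e≤)) (0≤* {pos 999 / 2} lit≤ (ι-nonneg e)))))
    V≤k/1000 : V ≤ pos 1 / 1000 * ι k
    V≤k/1000 = ≤-trans {V} {pos 1 / 1000 * (½ * q)} (by≤ (ringᵠ₂₁₅ V q) (0≤* {pos 1 / 1000} lit≤ (0≤+ (≤⇒0≤- hJ₁) V≥0))) (*-monoˡ {½ * q} {ι k} {pos 1 / 1000} lit≤ k≥½q)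
    k≤n : k ℕ.≤ n
    k≤n = ι-cancel {k} {n} (subst₂ _≤_ (sym k-eq) (sym ιn) (by≤ (ringᵠ₂₁₆ q a (ι e) V) (0≤+ (0≤+ (≤⇒0≤- hV) (0≤+ (≤⇒0≤- q≥) (ι-nonneg e))) (0≤+ {pos 10 / 1 * q + pos 2001 / 1 * V} (0≤+ (0≤* {pos 10 / 1} lit≤ q≥0) (0≤* {pos 2001 / 1} lit≤ V≥0)) lit≤))))
    d : ℕ
    d = proj₁ (ℕₚ.m≤n⇒∃[o]m+o≡n k≤n)
    en : n ≡ k ℕ.+ d
    en = sym (proj₂ (ℕₚ.m≤n⇒∃[o]m+o≡n k≤n))
    -- As n is close to 12k the true ratio is about 11; the constants 12 · 11/10 and 12 · 8 in
    -- `Tail` presuppose 12.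
    hd : ι d ≤ pos 12 / 1 * ι k
    hd = *-cancelˡ {ι d} {pos 12 / 1 * ι k} {12/13} lit< (by≤ (trans (cong (λ z → 12/13 * (pos 12 / 1 * ι k) - 12/13 * z) d-eq) (ringᵠ₂₁₈ u (ι n) (ι k)))
      (0≤+ (≤⇒0≤- hk) (0≤* (0≤+ {pos 1 / 13 - pos 1 / 2500} {pos 1 / 2500 - u} lit≤ (≤⇒0≤- u≤)) (ι-nonneg n))))
      where
      12/13 : ℚ
      12/13 = pos 12 / 13
      d-eq : ι d ≡ ι n - ι k
      d-eq = trans (ringᵠ₂₁₇ (ι k) (ι d)) (cong (_- ι k) (sym (trans (cong ι en) (ι-+ k d))))

    ratio : ∀ i → suc i ℕ.+ suc i ℕ.≤ e → Ev (R ^ˢ suc J) i ≤ σ * Ev (R ^ˢ suc J) (suc i)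
    ratio i le = Ratio.ratio (Ev (R ^ˢ suc J)) α β σ (R^-rec (suc J)) (λ i → NN-^ {R} (suc J) NN-R (i ℕ.+ i)) m
        σ>0 (≤-trans {σ} {pos 1 / 14400} σ≤ lit≤) (0<* {pos 3 / 1} lit< (ι-pos J)) β≥1 h₀ h₁ h₂ i ℕₚ.≤-refl
      where
      m : ℕ
      m = suc i
      α β N : ℚ
      N = ι (suc J)
      α = pos 3 / 1 * N
      β = pos 5 / 1 * N
      N≡ : N ≡ 1ℚ + q
      N≡ = ι-suc J
      N≥1 : 1ℚ ≤ N
      N≥1 = subst (1ℚ ≤_) (sym N≡) (by≤ (ringᵠ₂₁₉ q) q≥0)
      N≥0 : 0ℚ ≤ N
      N≥0 = ι-nonneg (suc J)
      β≥1 : 1ℚ ≤ β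
      β≥1 = by≤ (ringᵠ₂₂₀ N) (0≤+ (≤⇒0≤- N≥1) (0≤* {pos 4 / 1} lit≤ N≥0))
      2m≤e : ι m + ι m ≤ ι e
      2m≤e = subst (_≤ ι e) (ι-+ m m) (ι-mono le)
      m≥0 : 0ℚ ≤ ι m
      m≥0 = ι-nonneg m
      m≤N : ι m ≤ N
      m≤N = ≤-trans {ι m} {ι e} (by≤ (ringᵠ₂₂₁ (ι m) (ι e)) (0≤+ (≤⇒0≤- 2m≤e) m≥0)) (subst (ι e ≤_) (sym (trans N≡ sJ)) (by≤ (ringᵠ₂₂₂ (ι k) (ι e)) (ι-nonneg k)))
      h₀ : 1ℚ ≤ σ * α
      h₀ = subst (λ z → 1ℚ ≤ σ * (pos 3 / 1 * z)) (sym N≡) (by≤ (ringᵠ₂₂₃ σ q) (0≤+ (≤⇒0≤- hJ₃) (0≤* σ≥0 (0≤+ {pos 3 / 1} lit≤ (0≤* {2ℚ} lit≤ q≥0)))))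
      σσ≤1 : σ * σ ≤ 1ℚ
      σσ≤1 = ≤-trans {σ * σ} {pos 1 / 14400 * (pos 1 / 14400)} (*-mono {σ} {pos 1 / 14400} {σ} {pos 1 / 14400} σ≥0 σ≤ σ≥0 σ≤) lit≤
      -- The index counts powers of t², so m ≤ e/2 ≤ (uJ + V)/2. What is left is half of gap · J -
      -- (V + 2), which `hJ₄` makes nonnegative: τ₀ lies beyond the saddle point.
      h₁ : ι m * (1ℚ - σ * σ) + 1ℚ + 2ℚ * (σ * σ) ≤ σ * α + σ * σ * β
      h₁ = subst (λ z → ι m * (1ℚ - σ * σ) + 1ℚ + 2ℚ * (σ * σ) ≤ σ * (pos 3 / 1 * z) + σ * σ * (pos 5 / 1 * z)) (sym N≡)
        (by≤ (ringᵠ₂₂₄ σ u q V (ι e) (ι m)) (0≤* {½} lit≤ (0≤+ (0≤+ (≤⇒0≤- hJ₄) (0≤* (≤⇒0≤- σσ≤1) (0≤+ (≤⇒0≤- e≤) (≤⇒0≤- 2m≤e)))) (0≤+ (0≤* (0≤* σ≥0 σ≥0) (0≤+ {V} {pos 6 / 1} V≥0 lit≤)) (0≤* {pos 6 / 1} lit≤ σ≥0)))))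
      h₂ : σ * (β + ι m + 1ℚ) ≤ α
      h₂ = ≤-trans {σ * (β + ι m + 1ℚ)} {pos 1 / 14400 * (pos 7 / 1 * N)} (*-mono {σ} {pos 1 / 14400} {β + ι m + 1ℚ} {pos 7 / 1 * N} σ≥0 σ≤ (0≤+ {β + ι m} {1ℚ} (0≤+ (0≤* {pos 5 / 1} lit≤ N≥0) m≥0) lit≤) (by≤ (ringᵠ₂₂₅ N (ι m)) (0≤+ (≤⇒0≤- m≤N) (≤⇒0≤- N≥1))))
        (by≤ (ringᵠ₂₂₆ N) (0≤* {pos 3 / 1 - pos 7 / 14400} lit≤ N≥0))

    suc-B≤ : ι (suc B) ≤ pos 1 / 1000 * ι k
    suc-B≤ = ≤-trans (ι-mono {suc B} {B ℕ.+ 31} (subst (ℕ._≤ B ℕ.+ 31) (ℕₚ.+-comm B 1) (ℕₚ.+-monoʳ-≤ B (s≤s z≤n)))) (≤-trans V≥a V≤k/1000)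

    hτ : 1ℚ ≤ (τ₁ - τ₂) * (pos 1 / 1000 * ι k)
    hτ = subst (λ z → 1ℚ ≤ z * (pos 1 / 1000 * ι k)) (sym τ₁-τ₂) (by≤ (ringᵠ₂₂₇ ν q (ι k)) (0≤+ (0≤* {pos 1 / 2000} lit≤ (≤⇒0≤- hJ₂)) (0≤* (<⇒≤ ν>0) (0≤* {pos 1 / 1000} lit≤ (≤⇒0≤- k≥½q)))))

    Φ-at : 0ℚ ≤ Φ n J (B ℕ.+ 31) r k
    Φ-at = Tail.Φ-nonneg n J B k e d r τ₀ τ₂ τ₁ eJ en r≥0 r≤ τ₀>0 τ₀≤τ₂ τ₂≤τ₁ τ₁≤ root hB ratio hd (pos 1 / 1000 * ι k) (ringᵠ₂₂₈ (ι k)) e≤k/1000 suc-B≤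
      (≤-trans {1ℚ} {V} (≤-trans {1ℚ} {pos 13 / 1} lit≤ V≥13) V≤k/1000) hτ

  Φ-tail : ∀ k → k₀ ℕ.≤ k → 0ℚ ≤ Φ n J (B ℕ.+ 31) r k
  Φ-tail k le = case (k ℕ.≤? suc J)
    where
    case : Dec (k ℕ.≤ suc J) → 0ℚ ≤ Φ n J (B ℕ.+ 31) r k
    case (yes p) = At.Φ-at k (proj₁ (ℕₚ.m≤n⇒∃[o]m+o≡n p)) le (sym (proj₂ (ℕₚ.m≤n⇒∃[o]m+o≡n p)))
    -- Beyond J + 1 the factor t^k leaves no coefficient at all.
    case (no ¬p) = ≤-reflexive (sym (X^⊛-< k ((T ^ˢ (B ℕ.+ 31) ⊛ R ^ˢ suc J) ⊛ ((κ (ι k) ⊛ T ⊖ κ (ι n) ⊛ X) ⊛ fˢ r)) (suc J) (ℕₚ.≰⇒> ¬p)))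

-- Choice of the remaining parameters and assembly.

ringᵠ₂₂₉ : ∀ t → 1ℚ - (1ℚ - t) ≡ t
ringᵠ₂₂₉ = solveᵠ 1 λ t → con 1ℚ :- (con 1ℚ :- t) := t

ringᵠ₂₃₀ : ∀ t v → v ≡ t + v - t
ringᵠ₂₃₀ = solveᵠ 2 λ t v → v := t :+ v :- t

ringᵠ₂₃₁ : ∀ t v b → v * (1ℚ + b * t) - (t + v + t) * 1ℚ ≡ (b * v - (1ℚ + 1ℚ)) * t
ringᵠ₂₃₁ = solveᵠ 3 λ t v b → v :* (con 1ℚ :+ b :* t) :- (t :+ v :+ t) :* con 1ℚ := (b :* v :- (con 1ℚ :+ con 1ℚ)) :* t

ringᵠ₂₃₂ : ∀ b n v → (b - (n + n)) * v ≡ b * v - (n * v + n * v)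
ringᵠ₂₃₂ = solveᵠ 3 λ b n v → (b :- (n :+ n)) :* v := b :* v :- (n :* v :+ n :* v)

-- The left side is at most 2τ₀ + ν, the right side at least ν (1 + Bτ₀) by Bernoulli, and Bν ≥ 2.
hB-large : ∀ {τ₀ τ₂ ν N B} → 0ℚ < ν → ι N * ν ≡ 1ℚ → 0ℚ < τ₀ → τ₀ ≤ 1ℚ → τ₂ ≡ τ₀ + ν → N ℕ.+ N ℕ.≤ B →
  (τ₂ + τ₀) * (1ℚ - τ₀) ^ B ≤ (τ₂ - τ₀) * (1ℚ + τ₀) ^ B
hB-large {τ₀} {τ₂} {ν} {N} {B} ν>0 Nν τ₀>0 τ₀≤1 refl 2N≤B =
  ≤-trans {(τ₀ + ν + τ₀) * (1ℚ - τ₀) ^ B} {(τ₀ + ν + τ₀) * 1ℚ}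
    (*-monoˡ {(1ℚ - τ₀) ^ B} {1ℚ} {τ₀ + ν + τ₀} (0≤+ (0≤+ τ₀≥0 ν≥0) τ₀≥0) (^-≤1 B (≤⇒0≤- τ₀≤1) (by≤ (ringᵠ₂₂₉ τ₀) τ₀≥0)))
    (≤-trans {(τ₀ + ν + τ₀) * 1ℚ} {ν * (1ℚ + ι B * τ₀)}
      (by≤ (trans (ringᵠ₂₃₁ τ₀ ν (ι B)) (cong (λ z → ((ι B * ν) - (z + z)) * τ₀) (sym Nν))) (0≤* (subst (0ℚ ≤_) (ringᵠ₂₃₂ (ι B) (ι N) ν) (0≤* (≤⇒0≤- (subst (_≤ ι B) (ι-+ N N) (ι-mono 2N≤B))) ν≥0)) τ₀≥0))
      (≤-trans {ν * (1ℚ + ι B * τ₀)} {ν * (1ℚ + τ₀) ^ B} (*-monoˡ {1ℚ + ι B * τ₀} {(1ℚ + τ₀) ^ B} {ν} ν≥0 (bernoulli τ₀ B τ₀≥0)) (≤-reflexive (cong (_* (1ℚ + τ₀) ^ B) (ringᵠ₂₃₀ τ₀ ν)))))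
  where
  τ₀≥0 : 0ℚ ≤ τ₀
  τ₀≥0 = <⇒≤ τ₀>0
  ν≥0 : 0ℚ ≤ ν
  ν≥0 = <⇒≤ ν>0

ringᵠ₂₃₃ : ∀ a → 1ℚ + a * 1ℚ - a ≡ 1ℚ
ringᵠ₂₃₃ = solveᵠ 1 λ a → con 1ℚ :+ a :* con 1ℚ :- a := con 1ℚ

½^-bound : ∀ n → ½ ^ n * ι n ≤ 1ℚ
½^-bound n = ≤-trans {½ ^ n * ι n} {½ ^ n * (1ℚ + 1ℚ) ^ n}
  (*-monoˡ {ι n} {(1ℚ + 1ℚ) ^ n} {½ ^ n} (^-nonneg {½} n lit≤) (≤-trans {ι n} {1ℚ + ι n * 1ℚ} (by≤ (ringᵠ₂₃₃ (ι n)) 0≤1) (bernoulli 1ℚ n 0≤1)))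
  (≤-reflexive (trans (sym (^-*-distrib ½ (1ℚ + 1ℚ) n)) (1^ n)))

sumTo : (ℕ → ℚ) → ℕ → ℚ
sumTo f zero = f 0
sumTo f (suc n) = f (suc n) + sumTo f n

sumTo-nonneg : ∀ f → (∀ i → 0ℚ ≤ f i) → ∀ n → 0ℚ ≤ sumTo f n
sumTo-nonneg f p zero = p 0
sumTo-nonneg f p (suc n) = 0≤+ (p (suc n)) (sumTo-nonneg f p n)

≤-sumTo : ∀ f → (∀ i → 0ℚ ≤ f i) → ∀ n i → i ℕ.≤ n → f i ≤ sumTo f n
≤-sumTo f p zero zero _ = ≤-refl
≤-sumTo f p (suc n) i le = case (ℕₚ.m≤n⇒m<n∨m≡n le)
  where
  case : i ℕ.< suc n ⊎ i ≡ suc n → f i ≤ f (suc n) + sumTo f n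
  case (inj₁ (s≤s lt)) = subst (_≤ f (suc n) + sumTo f n) (ℚₚ.+-identityˡ (f i)) (+-mono-≤ {0ℚ} {f (suc n)} {f i} {sumTo f n} (p (suc n)) (≤-sumTo f p n i lt))
  case (inj₂ refl) = subst (_≤ f i + sumTo f n) (ℚₚ.+-identityʳ (f i)) (+-mono-≤ {f i} {f i} {0ℚ} {sumTo f n} ≤-refl (sumTo-nonneg f p n))

ringⁿ₂₅ : ∀ n B t → n ℕ.+ suc (B ℕ.+ t ℕ.+ 31) ≡ n ℕ.+ suc (B ℕ.+ 31) ℕ.+ t
ringⁿ₂₅ = ℕR.solve-∀

ringⁿ₂₆ : ∀ r q t → r ℕ.+ q ℕ.* 24 ℕ.+ t ≡ r ℕ.+ t ℕ.+ q ℕ.* 24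
ringⁿ₂₆ = ℕR.solve-∀

ringⁿ₂₇ : ∀ q → 24 ℕ.+ q ℕ.* 24 ≡ 24 ℕ.* suc q
ringⁿ₂₇ = ℕR.solve-∀

-- A multiple of 24 makes J = 2j even. As t takes finitely many values, all bounds depending on the
-- exponent A are uniform in n.
window : ∀ n B → ∃ λ t → ∃ λ j → t ℕ.≤ 24 × n ℕ.+ suc (B ℕ.+ t ℕ.+ 31) ≡ 24 ℕ.* j
window n B = 24 ℕ.∸ ρ , suc (m ℕ./ 24) , ℕₚ.m∸n≤m 24 ρ ,
  trans (ringⁿ₂₅ n B (24 ℕ.∸ ρ)) (trans (cong (ℕ._+ (24 ℕ.∸ ρ)) (DivMod.m≡m%n+[m/n]*n m 24)) (trans (ringⁿ₂₆ ρ (m ℕ./ 24) (24 ℕ.∸ ρ)) (trans (cong (ℕ._+ m ℕ./ 24 ℕ.* 24) (ℕₚ.m+[n∸m]≡n (ℕₚ.<⇒≤ (DivMod.m%n<n m 24)))) (ringⁿ₂₇ (m ℕ./ 24)))))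
  where
  m ρ : ℕ
  m = n ℕ.+ suc (B ℕ.+ 31)
  ρ = m ℕ.% 24

-- Finitely many instances of excluded middle hold jointly under double negation; this suffices
-- where the goal is absurdity.
¬¬-dec-Vec : ∀ n (P : Vec Z4 n → Set) → ¬ ¬ (∀ v → Dec (P v))
¬¬-dec-Vec zero P k = ¬¬-excluded-middle λ d → k λ { [] → d }
¬¬-dec-Vec (suc n) P k =
  ¬¬-dec-Vec n (λ v → P (zero ∷ v)) λ d₀ → ¬¬-dec-Vec n (λ v → P (suc zero ∷ v)) λ d₁ →
  ¬¬-dec-Vec n (λ v → P (suc (suc zero) ∷ v)) λ d₂ → ¬¬-dec-Vec n (λ v → P (suc (suc (suc zero)) ∷ v)) λ d₃ →
  k λ { (zero ∷ v) → d₀ v ; (suc zero ∷ v) → d₁ v ; (suc (suc zero) ∷ v) → d₂ v ; (suc (suc (suc zero)) ∷ v) → d₃ v }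

ringⁿ₂₈ : ∀ j → 24 ℕ.* j ≡ 12 ℕ.* (2 ℕ.* j)
ringⁿ₂₈ = ℕR.solve-∀

ringⁿ₂₉ : ∀ A j → 2 ℕ.* suc (2 ℕ.* j) ℕ.* 4 ℕ.+ suc A ℕ.+ 3 ≡ A ℕ.+ 12 ℕ.+ 16 ℕ.* j
ringⁿ₂₉ = ℕR.solve-∀

ringⁿ₃₀ : ∀ j → 48 ℕ.* j ≡ 6 ℕ.* (2 ℕ.* j) ℕ.* 4
ringⁿ₃₀ = ℕR.solve-∀

ringᵠ₂₃₄ : ∀ s e → 1ℚ - pos 6 / 1 * s - pos 11 / 1 * (s * s) - - e ≡ e - (pos 11 / 1 * (s * s) + pos 6 / 1 * s - 1ℚ)
ringᵠ₂₃₄ = solveᵠ 2 λ s e → con 1ℚ :- con (pos 6 / 1) :* s :- con (pos 11 / 1) :* (s :* s) :- (:- e) := e :- (con (pos 11 / 1) :* (s :* s) :+ con (pos 6 / 1) :* s :- con 1ℚ)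

ringᵠ₂₃₅ : ∀ s e → e - (1ℚ - pos 6 / 1 * s - pos 11 / 1 * (s * s)) ≡ pos 11 / 1 * (s * s) + pos 6 / 1 * s - 1ℚ + e
ringᵠ₂₃₅ = solveᵠ 2 λ s e → e :- (con 1ℚ :- con (pos 6 / 1) :* s :- con (pos 11 / 1) :* (s :* s)) := con (pos 11 / 1) :* (s :* s) :+ con (pos 6 / 1) :* s :- con 1ℚ :+ e

ringᵠ₂₃₆ : ∀ t v → t + v + v - t ≡ v + v
ringᵠ₂₃₆ = solveᵠ 2 λ t v → t :+ v :+ v :- t := v :+ v

ringᵠ₂₃₇ : ∀ k → pos 3 / 1 * (k * (pos 4 / 1)) ≡ pos 12 / 1 * k
ringᵠ₂₃₇ = solveᵠ 1 λ k → con (pos 3 / 1) :* (k :* con (pos 4 / 1)) := con (pos 12 / 1) :* k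

module Assembly {u : ℚ} (u≥0 : 0ℚ ≤ u) (u≤ : u ≤ pos 1 / 2500) (ts : Taus u) (mu : Multiplier (Taus.τ₁ ts))
  (B₀ L j₀ : ℕ) (x η V : ℚ)
  (2N≤B₀ : Taus.N ts ℕ.+ Taus.N ts ℕ.≤ B₀) (hδ : ∀ B → B₀ ℕ.≤ B → pos 12 / 1 ≤ Multiplier.δ₁ mu * ι B)
  (η≥0 : 0ℚ ≤ η) (x≥ : pos 1 / 4 ≤ x) (x≤ : x ≤ pos 2 / 5) (G≥0 : 0ℚ ≤ Gᵗ x) (G≤η : Gᵗ x ≤ η) (η≤η₀ : η ≤ Multiplier.η₀ mu)
  (hε : ∀ t → t ℕ.≤ 24 → ι (B₀ ℕ.+ t ℕ.+ 31 ℕ.+ 12) * ((½ ^ L + 2ℚ * η) * Sabs (B₀ ℕ.+ t ℕ.+ 31 ℕ.+ 12) (Ev (pˢ (B₀ ℕ.+ t ℕ.+ 31) (Multiplier.r mu)))) ≤ pos 1 / 4)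
  (hV : ι (B₀ ℕ.+ 24 ℕ.+ 31) + pos 13 / 1 ≤ V)
  (0<j₀ : 0 ℕ.< j₀)
  (c₁ : ∀ j → j₀ ℕ.≤ j → ι (B₀ ℕ.+ 24 ℕ.+ 31 ℕ.+ 12 ℕ.+ L) + pos 10 / 1 ≤ pos 5 / 1 * η * ι j)
  (c₂ : ∀ j → j₀ ℕ.≤ j → B₀ ℕ.+ 24 ℕ.+ 31 ℕ.+ 12 ℕ.+ L ℕ.≤ j)
  (c₃ : ∀ j → j₀ ℕ.≤ j → pos 1001 / 1 * V ≤ ½ * ι j)
  (c₄ : ∀ j → j₀ ℕ.≤ j → pos 2000 / 1 ≤ Taus.ν ts * ι j)
  (c₅ : ∀ j → j₀ ℕ.≤ j → 1ℚ ≤ Taus.τ₀ ts * Taus.τ₀ ts * ι j)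
  (c₆ : ∀ j → j₀ ℕ.≤ j → V + 2ℚ ≤ κ-gap u (Taus.τ₀ ts) * ι j)
  where
  open Taus ts
  open Multiplier mu

  module WithLength (n : ℕ) (n≥ : 24 ℕ.* j₀ ℕ.≤ n) (t j : ℕ) (t≤ : t ℕ.≤ 24) (eA : n ℕ.+ suc (B₀ ℕ.+ t ℕ.+ 31) ≡ 24 ℕ.* j) where
    A J : ℕ
    A = B₀ ℕ.+ t ℕ.+ 31
    J = 2 ℕ.* j
    A≤ : A ℕ.≤ B₀ ℕ.+ 24 ℕ.+ 31
    A≤ = ℕₚ.+-monoˡ-≤ 31 (ℕₚ.+-monoʳ-≤ B₀ t≤)
    A+12+L≤ : A ℕ.+ 12 ℕ.+ L ℕ.≤ B₀ ℕ.+ 24 ℕ.+ 31 ℕ.+ 12 ℕ.+ L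
    A+12+L≤ = ℕₚ.+-monoˡ-≤ L (ℕₚ.+-monoˡ-≤ 12 A≤)
    n≤24j : n ℕ.≤ 24 ℕ.* j
    n≤24j = ℕₚ.≤-trans (ℕₚ.m≤m+n n (suc A)) (ℕₚ.≤-reflexive eA)
    j₀≤j : j₀ ℕ.≤ j
    j₀≤j = ℕₚ.*-cancelˡ-≤ 24 (ℕₚ.≤-trans n≥ n≤24j)
    j₀≤J : j₀ ℕ.≤ J
    j₀≤J = ℕₚ.≤-trans j₀≤j (ℕₚ.m≤m+n j (j ℕ.+ 0))
    eA′ : n ℕ.+ suc A ≡ 12 ℕ.* J
    eA′ = trans eA (ringⁿ₂₈ j)
    A+12+L≤j : A ℕ.+ 12 ℕ.+ L ℕ.≤ j
    A+12+L≤j = ℕₚ.≤-trans A+12+L≤ (c₂ j j₀≤j)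
    A+12≤j : A ℕ.+ 12 ℕ.≤ j
    A+12≤j = ℕₚ.≤-trans (ℕₚ.m≤m+n (A ℕ.+ 12) L) A+12+L≤j
    lo : 2 ℕ.* suc (2 ℕ.* j) ℕ.≤ n ℕ./ 4
    lo = subst (ℕ._≤ n ℕ./ 4) (DivMod.m*n/n≡m (2 ℕ.* suc (2 ℕ.* j)) 4) (DivMod./-monoˡ-≤ 4 (ℕₚ.+-cancelʳ-≤ (suc A) (2 ℕ.* suc (2 ℕ.* j) ℕ.* 4) n
      (ℕₚ.≤-trans (ℕₚ.m≤m+n (2 ℕ.* suc (2 ℕ.* j) ℕ.* 4 ℕ.+ suc A) 3) (ℕₚ.≤-trans (ℕₚ.≤-reflexive (ringⁿ₂₉ A j))
        (ℕₚ.≤-trans (ℕₚ.+-mono-≤ A+12≤j (ℕₚ.*-monoˡ-≤ j (ℕₚ.m≤m+n 16 7))) (ℕₚ.≤-reflexive (sym eA)))))))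
    hi : n ℕ./ 4 ℕ.≤ 6 ℕ.* (2 ℕ.* j)
    hi = subst (n ℕ./ 4 ℕ.≤_) (DivMod.m*n/n≡m (6 ℕ.* (2 ℕ.* j)) 4) (DivMod./-monoˡ-≤ 4 (ℕₚ.≤-trans n≤24j (ℕₚ.≤-trans (ℕₚ.*-monoˡ-≤ j (ℕₚ.m≤m+n 24 24)) (ℕₚ.≤-reflexive (ringⁿ₃₀ j)))))
    i₀ : ℕ
    i₀ = proj₁ (ℕₚ.m≤n⇒∃[o]m+o≡n A+12+L≤j)
    ej : j ≡ A ℕ.+ 12 ℕ.+ (L ℕ.+ i₀)
    ej = trans (sym (proj₂ (ℕₚ.m≤n⇒∃[o]m+o≡n A+12+L≤j))) (ℕₚ.+-assoc (A ℕ.+ 12) L i₀)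
    n>0 : 0ℚ < ι n
    n>0 = ℚₚ.<-≤-trans {0ℚ} {ι 1} lit< (ι-mono (ℕₚ.≤-trans 0<j₀ (ℕₚ.≤-trans (ℕₚ.m≤n*m j₀ 24) n≥)))
    B₀≤A : B₀ ℕ.≤ A
    B₀≤A = ℕₚ.≤-trans (ℕₚ.m≤m+n B₀ t) (ℕₚ.m≤m+n (B₀ ℕ.+ t) 31)
    hx : Ab (1ℚ - pos 6 / 1 * (x * x) - pos 11 / 1 * (x * x * (x * x))) η
    hx = by≤ (ringᵠ₂₃₄ (x * x) η) (≤⇒0≤- G≤η) , by≤ (ringᵠ₂₃₅ (x * x) η) (0≤+ G≥0 η≥0)
    Φ₀ : 0ℚ < Φ n J A r 0
    Φ₀ = Origin.Φ₀-positive n j A L i₀ r x δ₁ η ej n>0 r≥0 r≤ x≥ x≤ (below x≥ x≤ G≥0 (≤-trans G≤η η≤η₀)) (hδ A B₀≤A) (<⇒≤ δ₁>0) η≥0 hx (hε t t≤)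
      (≤-trans {ι (A ℕ.+ 12 ℕ.+ L) + pos 10 / 1} {ι (B₀ ℕ.+ 24 ℕ.+ 31 ℕ.+ 12 ℕ.+ L) + pos 10 / 1}
        (+-mono-≤ {ι (A ℕ.+ 12 ℕ.+ L)} {ι (B₀ ℕ.+ 24 ℕ.+ 31 ℕ.+ 12 ℕ.+ L)} {pos 10 / 1} {pos 10 / 1} (ι-mono A+12+L≤) ≤-refl) (c₁ j j₀≤j))
    τ₀≤1 : τ₀ ≤ 1ℚ
    τ₀≤1 = ≤-trans {τ₀} {τ₁} (subst (τ₀ ≤_) (sym (trans τ₁≡ (cong (_+ ν) τ₂≡))) (by≤ (ringᵠ₂₃₆ τ₀ ν) (0≤+ (<⇒≤ ν>0) (<⇒≤ ν>0)))) (≤-trans {τ₁} {pos 1 / 120} {1ℚ} τ₁≤ lit≤)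
    Φₖ : ∀ k₀ → (1ℚ - u) * ι n ≤ pos 12 / 1 * ι k₀ → ∀ k → k₀ ℕ.≤ k → 0ℚ ≤ Φ n J A r k
    Φₖ k₀ hk₀ = TailBounds.Φ-tail {u} {τ₀} {τ₂} {τ₁} {ν} {r} {V} u≥0 u≤ ν>0 τ₀>0 τ₂≡ τ₁≡ τ₁≤ r≥0 r≤ root n J (B₀ ℕ.+ t) k₀ eA′
      (hB-large {τ₀} {τ₂} {ν} {N} {B₀ ℕ.+ t} ν>0 ν*N τ₀>0 τ₀≤1 τ₂≡ (ℕₚ.≤-trans 2N≤B₀ (ℕₚ.m≤m+n B₀ t)))
      (≤-trans {ι A + pos 13 / 1} {ι (B₀ ℕ.+ 24 ℕ.+ 31) + pos 13 / 1} (+-mono-≤ {ι A} {ι (B₀ ℕ.+ 24 ℕ.+ 31)} {pos 13 / 1} {pos 13 / 1} (ι-mono A≤) ≤-refl) hV)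
      (c₃ J j₀≤J) (c₄ J j₀≤J) (c₅ J j₀≤J) (c₆ J j₀≤J) hk₀

  bound : ∀ n → 24 ℕ.* j₀ ℕ.≤ n → (C : Code n) → SelfDual C → ∀ d → IsMinEuclideanDistance C d → pos 3 / 1 * ι d ≤ (1ℚ - u) * ι n
  -- The goal compares rationals, so it is decidable; in the negative case membership in the code
  -- may be taken to be decidable.
  bound n n≥ C sd d ((v , Cv , v≢0 , wt≡d) , min) = decide (pos 3 / 1 * ι d ≤? (1ℚ - u) * ι n)
    where
    decide : Dec (pos 3 / 1 * ι d ≤ (1ℚ - u) * ι n) → pos 3 / 1 * ι d ≤ (1ℚ - u) * ι n
    decide (yes p) = p
    decide (no ¬p) = ⊥-elim (¬¬-dec-Vec n C absurd)
      where
      absurd : ¬ (∀ v → Dec (C v))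
      absurd C? = use (SelfDualCode.4∣wtE C sd C? {v} Cv) (window n B₀)
        where
        use : 4 ∣ wtE v → (∃ λ t → ∃ λ j → t ℕ.≤ 24 × n ℕ.+ suc (B₀ ℕ.+ t ℕ.+ 31) ≡ 24 ℕ.* j) → ⊥
        use (divides k₀ eq) (t , j , t≤ , eA) = Reduction.contradiction-Φ C sd C? j A r k₀ r≥0 eA′ lo hi Φ₀
          (Φₖ k₀ (subst ((1ℚ - u) * ι n ≤_) 3d≡ (<⇒≤ (ℚₚ.≰⇒> ¬p))))
          (λ w Cw w≢0 → subst (ℕ._≤ wtE w) (trans d≡ (ℕₚ.*-comm k₀ 4)) (min w Cw w≢0))
          where
          open WithLength n n≥ t j t≤ eA
          d≡ : d ≡ k₀ ℕ.* 4
          d≡ = trans (sym wt≡d) eq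
          3d≡ : pos 3 / 1 * ι d ≡ pos 12 / 1 * ι k₀
          3d≡ = trans (cong (pos 3 / 1 *_) (trans (cong ι d≡) (ι-* k₀ 4))) (ringᵠ₂₃₇ (ι k₀))

Eventually : (ℕ → Set) → Set
Eventually P = ∃ λ K → ∀ n → K ℕ.≤ n → P n

infixr 4 _∧ᵉ_
_∧ᵉ_ : ∀ {P Q : ℕ → Set} → Eventually P → Eventually Q → Eventually (λ n → P n × Q n)
(K , p) ∧ᵉ (K′ , q) = K ℕ.+ K′ , λ n le → p n (ℕₚ.≤-trans (ℕₚ.m≤m+n K K′) le) , q n (ℕₚ.≤-trans (ℕₚ.m≤n+m K′ K) le)

ringᵠ₂₃₈ : ∀ η e → (η + 2ℚ * η) * (pos 1 / 16 * e) ≡ pos 3 / 16 * (e * η)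
ringᵠ₂₃₈ = solveᵠ 2 λ η e → (η :+ con 2ℚ :* η) :* (con (pos 1 / 16) :* e) := con (pos 3 / 16) :* (e :* η)

-- One number E serves twice, as L and as 1/η, because ½^E ≤ 1/E.
choose-η : ∀ {c η₀} → 0ℚ ≤ c → 0ℚ < η₀ → ∃ λ L → ∃ λ η → 0ℚ < η × η ≤ η₀ × (½ ^ L + 2ℚ * η) * c ≤ pos 1 / 4
choose-η {c} {η₀} c≥0 η₀>0 = from (exceed {pos 1 / 16} lit< c ∧ᵉ exceed η₀>0 1ℚ ∧ᵉ (1 , λ _ p → p))
  where
  from : Eventually (λ n → c ≤ pos 1 / 16 * ι n × 1ℚ ≤ η₀ * ι n × 1 ℕ.≤ n) → ∃ λ L → ∃ λ η → 0ℚ < η × η ≤ η₀ × (½ ^ L + 2ℚ * η) * c ≤ pos 1 / 4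
  from (E , h) = E , η , η>0 , η≤η₀ , small
    where
    c≤ : c ≤ pos 1 / 16 * ι E
    c≤ = proj₁ (h E ℕₚ.≤-refl)
    1≤η₀E : 1ℚ ≤ η₀ * ι E
    1≤η₀E = proj₁ (proj₂ (h E ℕₚ.≤-refl))
    E>0 : 0ℚ < ι E
    E>0 = ℚₚ.<-≤-trans {0ℚ} {ι 1} lit< (ι-mono (proj₂ (proj₂ (h E ℕₚ.≤-refl))))
    inv : ∃ λ η → (ι E * η ≡ 1ℚ) × 0ℚ < η
    inv = recip (ι E) E>0
    η : ℚ
    η = proj₁ inv
    Eη : ι E * η ≡ 1ℚ
    Eη = proj₁ (proj₂ inv)
    η>0 : 0ℚ < η
    η>0 = proj₂ (proj₂ inv)
    η≤η₀ : η ≤ η₀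
    η≤η₀ = *-cancelˡ {η} {η₀} {ι E} E>0 (subst₂ _≤_ (sym Eη) (ℚₚ.*-comm η₀ (ι E)) 1≤η₀E)
    ½^≤η : ½ ^ E ≤ η
    ½^≤η = *-cancelˡ {½ ^ E} {η} {ι E} E>0 (subst₂ _≤_ (ℚₚ.*-comm (½ ^ E) (ι E)) (sym Eη) (½^-bound E))
    small : (½ ^ E + 2ℚ * η) * c ≤ pos 1 / 4
    small = ≤-trans {(½ ^ E + 2ℚ * η) * c} {(η + 2ℚ * η) * (pos 1 / 16 * ι E)}
      (*-mono {½ ^ E + 2ℚ * η} {η + 2ℚ * η} {c} {pos 1 / 16 * ι E} (0≤+ (^-nonneg {½} E lit≤) (0≤* {2ℚ} lit≤ (<⇒≤ η>0))) (+-mono-≤ {½ ^ E} {η} {2ℚ * η} {2ℚ * η} ½^≤η ≤-refl) c≥0 c≤)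
      (≤-trans {(η + 2ℚ * η) * (pos 1 / 16 * ι E)} {pos 3 / 16 * 1ℚ} (≤-reflexive (trans (ringᵠ₂₃₈ η (ι E)) (cong (pos 3 / 16 *_) Eη))) lit≤)

Bounded : ℚ → ℕ → Set₁
Bounded u n = (C : Code n) → SelfDual C → ∀ d → IsMinEuclideanDistance C d → pos 3 / 1 * ι d ≤ (1ℚ - u) * ι n

-- The order of choices matters: the grid points and r depend on u alone, `B₀` on them, η and L on
-- the ℓ¹ norms attached to `B₀`, x on η, and only the threshold for j on all of these.
euclidean-bound : ∀ {u} → 0ℚ ≤ u → evalL Pᵤ u < 0ℚ → ∃ λ M → ∀ n → M ℕ.≤ n → Bounded u n
euclidean-bound {u} u≥0 neg-u = from-taus (taus u≥0 neg-u)
  where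
  from-taus : Taus u → ∃ λ M → ∀ n → M ℕ.≤ n → Bounded u n
  from-taus ts = from-multiplier (multiplier τ₁>0 τ₁≤ M⁺>0)
    where
    open Taus ts
    τ₁>0 : 0ℚ < τ₁
    τ₁>0 = subst (0ℚ <_) (sym (trans τ₁≡ (cong (_+ ν) τ₂≡))) (0<+ (0<+ τ₀>0 (<⇒≤ ν>0)) (<⇒≤ ν>0))
    from-multiplier : Multiplier τ₁ → ∃ λ M → ∀ n → M ℕ.≤ n → Bounded u n
    from-multiplier mu = from-δ₁ (exceed δ₁>0 (pos 12 / 1))
      where
      open Multiplier mu
      from-δ₁ : Eventually (λ B → pos 12 / 1 ≤ δ₁ * ι B) → ∃ λ M → ∀ n → M ℕ.≤ n → Bounded u n
      from-δ₁ (K , hK) = from-B₀ B₀ (ℕₚ.m≤m+n (N ℕ.+ N) K) (λ B le → hK B (ℕₚ.≤-trans (ℕₚ.m≤n+m K (N ℕ.+ N)) le))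
        where
        B₀ : ℕ
        B₀ = N ℕ.+ N ℕ.+ K
        from-B₀ : ∀ B₀ → N ℕ.+ N ℕ.≤ B₀ → (∀ B → B₀ ℕ.≤ B → pos 12 / 1 ≤ δ₁ * ι B) → ∃ λ M → ∀ n → M ℕ.≤ n → Bounded u n
        from-B₀ B₀ 2N≤ hδ = from-η (choose-η (sumTo-nonneg F F≥0 24) η₀>0)
          where
          S F : ℕ → ℚ
          S t = Sabs (B₀ ℕ.+ t ℕ.+ 31 ℕ.+ 12) (Ev (pˢ (B₀ ℕ.+ t ℕ.+ 31) r))
          F t = ι (B₀ ℕ.+ t ℕ.+ 31 ℕ.+ 12) * S t
          F≥0 : ∀ t → 0ℚ ≤ F t
          F≥0 t = 0≤* (ι-nonneg (B₀ ℕ.+ t ℕ.+ 31 ℕ.+ 12)) (Sabs-nonneg (B₀ ℕ.+ t ℕ.+ 31 ℕ.+ 12) (Ev (pˢ (B₀ ℕ.+ t ℕ.+ 31) r)))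
          V₀ : ℚ
          V₀ = ι (B₀ ℕ.+ 24 ℕ.+ 31) + pos 13 / 1
          from-η : (∃ λ L → ∃ λ η → 0ℚ < η × η ≤ η₀ × (½ ^ L + 2ℚ * η) * sumTo F 24 ≤ pos 1 / 4) → ∃ λ M → ∀ n → M ℕ.≤ n → Bounded u n
          from-η (L , η , η>0 , η≤η₀ , hη) = from-near (near η>0)
            (exceed {pos 5 / 1 * η} (0<* {pos 5 / 1} lit< η>0) (ι (B₀ ℕ.+ 24 ℕ.+ 31 ℕ.+ 12 ℕ.+ L) + pos 10 / 1)
              ∧ᵉ (B₀ ℕ.+ 24 ℕ.+ 31 ℕ.+ 12 ℕ.+ L , λ _ p → p) ∧ᵉ exceed {½} lit< (pos 1001 / 1 * V₀) ∧ᵉ exceed ν>0 (pos 2000 / 1)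
              ∧ᵉ exceed {τ₀ * τ₀} (0<* τ₀>0 τ₀>0) 1ℚ ∧ᵉ exceed gap (V₀ + 2ℚ))
            where
            hε : ∀ t → t ℕ.≤ 24 → ι (B₀ ℕ.+ t ℕ.+ 31 ℕ.+ 12) * ((½ ^ L + 2ℚ * η) * S t) ≤ pos 1 / 4
            hε t t≤ = ≤-trans {ι (B₀ ℕ.+ t ℕ.+ 31 ℕ.+ 12) * ((½ ^ L + 2ℚ * η) * S t)} {(½ ^ L + 2ℚ * η) * F t} (≤-reflexive (ringᵠ₆₉ (ι (B₀ ℕ.+ t ℕ.+ 31 ℕ.+ 12)) (½ ^ L + 2ℚ * η) (S t)))
              (≤-trans {(½ ^ L + 2ℚ * η) * F t} {(½ ^ L + 2ℚ * η) * sumTo F 24} (*-monoˡ {F t} {sumTo F 24} {½ ^ L + 2ℚ * η} (0≤+ (^-nonneg {½} L lit≤) (0≤* {2ℚ} lit≤ (<⇒≤ η>0))) (≤-sumTo F F≥0 24 t t≤)) hη)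
            from-near : Near η → Eventually (λ j → ι (B₀ ℕ.+ 24 ℕ.+ 31 ℕ.+ 12 ℕ.+ L) + pos 10 / 1 ≤ pos 5 / 1 * η * ι j
              × B₀ ℕ.+ 24 ℕ.+ 31 ℕ.+ 12 ℕ.+ L ℕ.≤ j × pos 1001 / 1 * V₀ ≤ ½ * ι j × pos 2000 / 1 ≤ ν * ι j
              × 1ℚ ≤ τ₀ * τ₀ * ι j × V₀ + 2ℚ ≤ κ-gap u τ₀ * ι j) → ∃ λ M → ∀ n → M ℕ.≤ n → Bounded u n
            from-near (x , x≥ , x≤ , G≥0 , G≤) (K , h) = 24 ℕ.* suc K ,
              Assembly.bound {u} u≥0 (Pᵤ-small u≥0 neg-u) ts mu B₀ L (suc K) x η V₀ 2N≤ hδ (<⇒≤ η>0) x≥ x≤ G≥0 G≤ η≤η₀ hε ≤-refl (s≤s z≤n)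
                (λ j le → proj₁ (h′ j le)) (λ j le → proj₁ (proj₂ (h′ j le))) (λ j le → proj₁ (proj₂ (proj₂ (h′ j le))))
                (λ j le → proj₁ (proj₂ (proj₂ (proj₂ (h′ j le))))) (λ j le → proj₁ (proj₂ (proj₂ (proj₂ (proj₂ (h′ j le))))))
                (λ j le → proj₂ (proj₂ (proj₂ (proj₂ (proj₂ (h′ j le))))))
              where
              h′ : ∀ j → suc K ℕ.≤ j → _
              h′ j le = h j (ℕₚ.≤-trans (ℕₚ.n≤1+n K) le)

ringᵠ₂₃₉ : ∀ u y n → pos 3 / 1 * ((2ℚ - 2ℚ * y) * n) - (1ℚ - u) * n ≡ (u - (- (pos 5 / 1) + pos 6 / 1 * y)) * n
ringᵠ₂₃₉ = solveᵠ 3 λ u y n → con (pos 3 / 1) :* ((con 2ℚ :- con 2ℚ :* y) :* n) :- (con 1ℚ :- u) :* n := (u :- ((:- con (pos 5 / 1)) :+ con (pos 6 / 1) :* y)) :* n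

ringᵠ₂₄₀ : ∀ p → 0ℚ - pos 2821109907456 / 1 * p ≡ pos 2821109907456 / 1 * (- p)
ringᵠ₂₄₀ = solveᵠ 1 λ p → con 0ℚ :- con (pos 2821109907456 / 1) :* p := con (pos 2821109907456 / 1) :* (:- p)

-- With u = 6y - 5 one has 3 (2 - 2y) = 1 - u. A negative u is replaced by 0, where `Pᵤ` is negative
-- and the resulting bound is stronger than the one wanted.
euclidean-bound-poly : ∀ y → poly y < 0ℚ → ∃ λ M → ∀ n → M ℕ.≤ n → (C : Code n) → SelfDual C → ∀ d → IsMinEuclideanDistance C d → ι d ≤ (2ℚ - 2ℚ * y) * ι n
euclidean-bound-poly y neg-y = case (ℚₚ.≤-total 0ℚ (zq -[1+ 4 ] + zq (pos 6) * y))
  where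
  via : ∀ {u} → zq -[1+ 4 ] + zq (pos 6) * y ≤ u → (∃ λ M → ∀ n → M ℕ.≤ n → Bounded u n) →
    ∃ λ M → ∀ n → M ℕ.≤ n → (C : Code n) → SelfDual C → ∀ d → IsMinEuclideanDistance C d → ι d ≤ (2ℚ - 2ℚ * y) * ι n
  via {u} le (M , h) = M , λ n M≤n C sd d dist → *-cancelˡ {ι d} {(2ℚ - 2ℚ * y) * ι n} {pos 3 / 1} lit<
    (≤-trans {pos 3 / 1 * ι d} {(1ℚ - u) * ι n} (h n M≤n C sd d dist) (by≤ (ringᵠ₂₃₉ u y (ι n)) (0≤* (≤⇒0≤- le) (ι-nonneg n))))
  case : 0ℚ ≤ zq -[1+ 4 ] + zq (pos 6) * y ⊎ zq -[1+ 4 ] + zq (pos 6) * y ≤ 0ℚ → _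
  case (inj₁ p) = via ≤-refl (euclidean-bound p (subst (_< 0ℚ) (sym (Pᵤ-poly y)) (by< (ringᵠ₂₄₀ (poly y)) (0<* {pos 2821109907456 / 1} { - poly y} lit< (subst (0ℚ <_) (ℚₚ.+-identityˡ (- poly y)) (<⇒0<- neg-y))))))
  case (inj₂ p) = via p (euclidean-bound {0ℚ} ≤-refl (lit< {evalL Pᵤ 0ℚ} {0ℚ}))

open import Data.Nat using (ℕ; _≥_)
open import Data.Product using (Σ; ∃; _×_)
open import Data.Rational using (ℚ; _≤_; _<_; _-_; _*_; 0ℚ)
open import Data.Integer using (+_)

theorem8 : (n : ℕ → ℕ) (C : (i : ℕ) → Code (n i)) (d : ℕ → ℕ)
    → (∀ i → SelfDual (C i))
    → (∀ i → 0 Data.Nat.< n i → IsMinEuclideanDistance (C i) (d i))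
    → (∀ M → ∃ λ N → ∀ i → i ≥ N → M Data.Nat.≤ n i)
    → ∀ (y : ℚ) → 0ℚ ≤ y → poly y < 0ℚ
    → ∃ λ N → ∀ i → i ≥ N → ℕtoℚ (d i) ≤ (zq (+ 2) - zq (+ 2) * y) * ℕtoℚ (n i)
theorem8 n C d sd dist grows y _ neg-y =
  let M , bound = euclidean-bound-poly y neg-y
      -- `suc M` instead of `M` makes `n i` positive, as `dist` requires.
      N , large = grows (suc M)
  in N , λ i i≥N → bound (n i) (ℕₚ.≤-trans (ℕₚ.n≤1+n M) (large i i≥N)) (C i) (sd i) (d i)
       (dist i (ℕₚ.≤-trans (s≤s z≤n) (large i i≥N)))
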